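{- Let $a,b$ be coprime positive integers and let $X$ be the set ${\mathsf{HNC}}(a,b)$ of homogeneous $a,b$-noncrossing partitions of $[a+b-1]$. Then the triple $(X, C, X(q))$ exhibits the cyclic sieving phenomenon, where $C = \mathbb{Z}_{a+b-1}$ acts on $X$ by rotation and \[ X(q) = {\mathsf{Cat}}_q(a,b) = \frac{1}{[a+b]_q}\begin{bmatrix} a+b \\ a,\, b\end{bmatrix}_q \] is the $q$-rational Catalan number.
   Context: An $a,b$-Dyck path is a lattice path of unit north ($N$) and east ($E$) steps from $(0,0)$ to $(b,a)$ staying above the line $y = \frac{a}{b}x$. Given such a path $D$, label its interior lattice points from southwest to northeast with $1, 2, \dots, a+b-1$ (labels considered to lie slightly below their lattice points), and fire a laser (a line segment of slope $\frac{a}{b}$ going northeast until it hits $D$) from every lattice point of $D$ at the south end of a north step. The set partition $\overline{\pi}(D)$ of $[a+b-1]$ declares $i \sim j$ iff labels $i$ and $j$ are not separated by laser fire; it is noncrossing. The set of homogeneous $a,b$-noncrossing partitions is ${\mathsf{HNC}}(a,b) = \{\overline{\pi}(D) : D \text{ an } a,b\text{ -Dyck path}\}$; it is closed under the rotation $i \mapsto i+1 \pmod{a+b-1}$. Here $[n]_q = 1 + q + \cdots + q^{n-1}$, $[n]_q! = [1]_q[2]_q\cdots[n]_q$, and $\begin{bmatrix} a+b \\ a,\, b\end{bmatrix}_q = \frac{[a+b]_q!}{[a]_q![b]_q!}$. For a finite set $X$ with an action of a cyclic group $C = \langle c\rangle$ and $X(q) \in \mathbb{N}[q]$, the triple $(X,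 C, X(q))$ exhibits the cyclic sieving phenomenon if for every $d \ge 0$, $X(\zeta^d) = |\{x \in X : c^d . x = x\}|$, where $\zeta$ is a root of unity of multiplicative order $|C|$. -}

module Defs where

open import Level using (Level; _⊔_)
open import Data.Bool using (Bool; true; false; _∧_; not; if_then_else_)
open import Data.Bool.Properties using () renaming (_≟_ to _≟ᵇ_)
open import Data.Nat using (ℕ; zero; suc; _+_; _*_; _∸_; _<ᵇ_; _<_; _≡ᵇ_)
open import Data.List.Base using (List; []; _∷_; _++_; map; filter; length; upTo; foldr; replicate; deduplicate)
open import Data.Bool.ListAction using (and)
open import Data.Vec using (Vec; tabulate; lookup)
open import Data.Vec.Properties using (≡-dec)
open import Data.Fin using (Fin; toℕ; fromℕ; inject₁)
open import Data.Product using (_×_)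
open import Data.Sum using (_⊎_)
open import Relation.Nullary using (¬_)
open import Relation.Binary.PropositionalEquality using (_≡_)
open import Algebra.Bundles using (CommutativeRing)

-- Lattice paths: a list of steps, true = N (north), false = E (east).

Path : Set
Path = List Bool

allPaths : ℕ → List Path
allPaths zero    = [] ∷ []
allPaths (suc n) = map (true ∷_) (allPaths n) ++ map (false ∷_) (allPaths n)

countN : Path → ℕ
countN []           = 0
countN (true ∷ p)   = suc (countN p)
countN (false ∷ p)  = countN p

countE : Path → ℕ
countE []           = 0
countE (true ∷ p)   = countE p
countE (false ∷ p)  = suc (countE p)

take : ℕ → Path → Path
take zero    p       = []
take (suc m) []      = []
take (suc m) (s ∷ p) = s ∷ take m p

-- P_m = (xc p m , yc p m) : the lattice point reached after the first m steps
xc : Path → ℕ → ℕ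
xc p m = countE (take m p)

yc : Path → ℕ → ℕ
yc p m = countN (take m p)

-- is step number k (0-indexed, from P_k to P_(k+1)) a north step?
stepN : Path → ℕ → Bool
stepN []      k       = false
stepN (s ∷ p) zero    = s
stepN (s ∷ p) (suc k) = stepN p k

allᵇ : {A : Set} → (A → Bool) → List A → Bool
allᵇ f xs = and (map f xs)

_≤ᵇ_ : ℕ → ℕ → Bool
m ≤ᵇ n = m <ᵇ suc n

-- D is an a,b-Dyck path: a N steps, b E steps (so it ends at (b,a)),
-- and every lattice point (x,y) of D satisfies y ≥ (a/b) x, i.e. a x ≤ b y.
isDyck : ℕ → ℕ → Path → Bool
isDyck a b p =
  (countN p ≡ᵇ a) ∧ (countE p ≡ᵇ b) ∧
  allᵇ (λ m → (a * xc p m) ≤ᵇ (b * yc p m)) (upTo (suc (a + b)))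

DyckPaths : ℕ → ℕ → List Path
DyckPaths a b = filter (λ p → isDyck a b p ≟ᵇ true) (allPaths (a + b))

-- Laser fire.
-- A laser of slope a/b fired from P_k stays on the line  b y - a x = const.
-- Lattice point P_m lies strictly above the laser from P_k iff
--   b y_m - a x_m > b y_k - a x_k,  i.e.  b y_k + a x_m < b y_m + a x_k.
above : ℕ → ℕ → Path → ℕ → ℕ → Bool
above a b p k m = (b * yc p k + a * xc p m) <ᵇ (b * yc p m + a * xc p k)

-- Label i (just below P_i) lies in the region cut off by the laser fired
-- from P_k (between the laser and D) iff k < i and the path stays strictly
-- above the laser at all of P_(k+1), ..., P_i (the laser hits D on the first
-- E step that descends below its line).
inRegion : ℕ → ℕ → Path → ℕ → ℕ → Bool
inRegion a b p k i =
  (k <ᵇ i) ∧ allᵇ (λ t → above a b p k (k + suc t)) (upTo (i ∸ k))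

-- labels i and j are not separated by any laser (lasers are fired from
-- every P_k, 0 ≤ k < a+b, that is the south end of a north step)
sameBlock : ℕ → ℕ → Path → ℕ → ℕ → Bool
sameBlock a b p i j =
  allᵇ (λ k → if stepN p k
             then (inRegion a b p k i ≡ᵇᵇ inRegion a b p k j)
             else true)
      (upTo (a + b))
  where
  _≡ᵇᵇ_ : Bool → Bool → Bool
  true  ≡ᵇᵇ y = y
  false ≡ᵇᵇ y = not y

-- Set partitions of [n], encoded by their (equivalence) relation matrix:
-- entry (i , j) (0-indexed) is true iff labels i+1 and j+1 are in one block.

Partition : ℕ → Set
Partition n = Vec (Vec Bool n) n

_≟ₚ_ : ∀ {n} (π σ : Partition n) → Relation.Nullary.Dec (π ≡ σ)
_≟ₚ_ = ≡-dec (≡-dec _≟ᵇ_)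

laserPartition : (a b : ℕ) → Path → Partition (a + b ∸ 1)
laserPartition a b p =
  tabulate λ i → tabulate λ j → sameBlock a b p (suc (toℕ i)) (suc (toℕ j))

HNC : (a b : ℕ) → List (Partition (a + b ∸ 1))
HNC a b = deduplicate _≟ₚ_ (map (laserPartition a b) (DyckPaths a b))

predMod : ∀ {n} → Fin n → Fin n
predMod {suc m} Fin.zero    = fromℕ m
predMod {suc m} (Fin.suc i) = inject₁ i

-- rotation c . π, where c : i ↦ i + 1 (mod n):  i ~_{c.π} j  iff  c⁻¹ i ~_π c⁻¹ j
rotate : ∀ {n} → Partition n → Partition n
rotate π = tabulate λ i → tabulate λ j → lookup (lookup π (predMod i)) (predMod j)

iterate : ∀ {A : Set} → (A → A) → ℕ → A → A
iterate f zero    x = x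
iterate f (suc d) x = f (iterate f d x)

fixedCount : ℕ → ℕ → ℕ → ℕ
fixedCount a b d = length (filter (λ π → iterate rotate d π ≟ₚ π) (HNC a b))

-- Polynomials in ℕ[q] as coefficient lists (constant term first).

Poly : Set
Poly = List ℕ

_+ₚ_ : Poly → Poly → Poly
[]      +ₚ q       = q
(x ∷ p) +ₚ []      = x ∷ p
(x ∷ p) +ₚ (y ∷ q) = (x + y) ∷ (p +ₚ q)

_*ₚ_ : Poly → Poly → Poly
[]      *ₚ q = []
(x ∷ p) *ₚ q = map (x *_) q +ₚ (0 ∷ (p *ₚ q))

coeff : ℕ → Poly → ℕ
coeff k       []      = 0
coeff zero    (x ∷ p) = x
coeff (suc k) (x ∷ p) = coeff k p

_≈ₚ_ : Poly → Poly → Set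
p ≈ₚ q = ∀ k → coeff k p ≡ coeff k q

qInt : ℕ → Poly
qInt n = replicate n 1

qFact : ℕ → Poly
qFact zero    = 1 ∷ []
qFact (suc n) = qFact n *ₚ qInt (suc n)

module _ {c ℓ : Level} (R : CommutativeRing c ℓ) where
  open CommutativeRing R using (Carrier; 0#; 1#; _≈_) renaming (_+_ to _⊕_; _*_ to _⊗_)

  natR : ℕ → Carrier
  natR zero    = 0#
  natR (suc n) = 1# ⊕ natR n

  powR : Carrier → ℕ → Carrier
  powR x zero    = 1#
  powR x (suc n) = x ⊗ powR x n

  evalPoly : Poly → Carrier → Carrier
  evalPoly p x = foldr (λ k acc → natR k ⊕ (x ⊗ acc)) 0# p

  CharZeroDomain : Set (c ⊔ ℓ)
  CharZeroDomain =
    (¬ (1# ≈ 0#)) ×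
    (∀ x y → (x ⊗ y) ≈ 0# → (x ≈ 0#) ⊎ (y ≈ 0#)) ×
    (∀ m → ¬ (natR (suc m) ≈ 0#))

  HasOrder : Carrier → ℕ → Set ℓ
  HasOrder ζ n = (powR ζ n ≈ 1#) × (∀ k → 0 < k → k < n → ¬ (powR ζ k ≈ 1#))

{-# OPTIONS --safe #-}
-- Write n = a + b - 1 and give the lattice point (x , y) the height b y - a x.  Two labels share a block of the laser
-- partition exactly when the last earlier lattice point that lies strictly below them is the same.  Hence the path is
-- recovered from the minima of the blocks, and rotation corresponds to a promotion of Dyck paths.
--
-- A partition fixed by the rotation through m labels, m a proper divisor of n, is encoded by the word of length m that
-- marks the labels opening a block as seen from the centre of the disc; repeated periodically, this word gives back
-- the partition by the same rule of the last lower point, the points without one forming the central block.  Every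
-- word with a / e or (a - 1) / e north steps, e = n / m, occurs, and the q-Lucas theorem gives the same number for
-- the Gaussian polynomial at a root of unity of order e, where the factor [a + b] takes the value 1.  At q = 1 both
-- sides are counted by the cycle lemma.
--
-- The coefficients of Cat(a , b) are differences of the numbers S k of words with at most k inversions and a number of
-- inversions congruent to k modulo a + b.  They are nonnegative because Gaussian polynomials are unimodal (for which
-- the raising operator of sl₂ on words is shown to be injective below the middle) and because rotating a word
-- equidistributes inversions modulo a + b.
module Submission where

-- There are n = a + b - 1 labels but a + b steps, and the surplus step explains the two kinds of
-- words. Over one period of n labels the symmetric steps end at height a if the surplus step is the
-- final east step, and at height - b if it is an opening north step. In the first case the heights
-- rise from period to period, so every point far enough out has a close source. In the second they
-- do not, and the points that are lowest so far make up the block around the centre.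
--
-- The obstacle is that a rotation moves the starting point of the path, so that sources change far
-- away. A partition is therefore treated as an n-periodic relation on the natural numbers and cut
-- open wherever an argument needs it; closure under rotation supplies a Dyck path for every cut.
-- That e is at least 2 (2m ≤ n) keeps arcs of length up to m within one turn of each other, where
-- noncrossing applies. Looking back from a label requires earlier labels, so most statements hold
-- only away from 0 and are carried back by periodicity.

-- Counting by matchings between duplicate-free lists

module Counting where

  open import Data.Nat using (suc; _≤_; z≤n; s≤s)
  open import Data.Nat.Properties using (≤-antisym; ≤-trans; ≤-reflexive)
  open import Data.List.Base using (List; []; _∷_; length)
  open import Data.List.Membership.Propositional using (_∈_)
  open import Data.List.Relation.Unary.Any using (here; there; _─_)
  open import Data.List.Relation.Unary.All using (lookup)
  open import Data.List.Relation.Unary.AllPairs using ([]; _∷_)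
  open import Data.List.Relation.Unary.Unique.Propositional using (Unique)
  open import Data.Product using (∃; _×_; _,_)
  open import Data.Sum using (_⊎_; inj₁; inj₂)
  open import Data.Empty using (⊥-elim)
  open import Function using (flip)
  open import Relation.Binary.PropositionalEquality using (_≡_; refl; sym; cong)

  ∈-─ : {A : Set} {x y : A} {ys : List A} (p : x ∈ ys) → y ∈ ys → (y ≡ x) ⊎ (y ∈ (ys ─ p))
  ∈-─ (here refl) (here refl) = inj₁ refl
  ∈-─ (here refl) (there q)   = inj₂ q
  ∈-─ (there p)   (here refl) = inj₂ (here refl)
  ∈-─ (there p)   (there q) with ∈-─ p q
  ... | inj₁ e = inj₁ e
  ... | inj₂ r = inj₂ (there r)

  length-─ : {A : Set} {x : A} {ys : List A} (p : x ∈ ys) → length ys ≡ suc (length (ys ─ p))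
  length-─ (here _)              = refl
  length-─ {ys = _ ∷ _} (there p) = cong suc (length-─ p)

  -- Once the partner of the first element is removed from `ys`, the other elements keep their
  -- partners, since injectivity forbids using the removed one twice. With a relation in place of a
  -- map, no explicit inverse has to be built; this matters for `Encodes`, which is only a property
  -- of a word and a partition.
  matching-≤ : {A B : Set} {R : A → B → Set} (xs : List A) (ys : List B) → Unique xs →
    (∀ {x} → x ∈ xs → ∃ λ y → y ∈ ys × R x y) →
    (∀ {x x′ y} → x ∈ xs → x′ ∈ xs → R x y → R x′ y → x ≡ x′) →
    length xs ≤ length ys
  matching-≤ []       ys _          _     _   = z≤n
  matching-≤ {R = R} (x ∷ xs) ys (x∉ ∷ u) total inj with total (here refl)
  ... | y , y∈ , Rxy = ≤-trans (s≤s (matching-≤ {R = R} xs (ys ─ y∈) u total′ inj′)) (≤-reflexive (sym (length-─ y∈)))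
    where
    total′ : ∀ {x′} → x′ ∈ xs → ∃ λ y′ → y′ ∈ (ys ─ y∈) × R x′ y′
    total′ x′∈ with total (there x′∈)
    ... | y′ , y′∈ , Rx′y′ with ∈-─ y∈ y′∈
    ...   | inj₂ q    = y′ , q , Rx′y′
    ...   | inj₁ refl = ⊥-elim (lookup x∉ x′∈ (inj (here refl) (there x′∈) Rxy Rx′y′))
    inj′ : ∀ {x₁ x₂ y} → x₁ ∈ xs → x₂ ∈ xs → R x₁ y → R x₂ y → x₁ ≡ x₂
    inj′ p q = inj (there p) (there q)

  matching-≡ : {A B : Set} (R : A → B → Set) {xs : List A} {ys : List B} → Unique xs → Unique ys →
    (∀ {x} → x ∈ xs → ∃ λ y → y ∈ ys × R x y) →
    (∀ {y} → y ∈ ys → ∃ λ x → x ∈ xs × R x y) →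
    (∀ {x x′ y} → x ∈ xs → x′ ∈ xs → R x y → R x′ y → x ≡ x′) →
    (∀ {x y y′} → y ∈ ys → y′ ∈ ys → R x y → R x y′ → y ≡ y′) →
    length xs ≡ length ys
  matching-≡ R ux uy tx ty ix iy =
    ≤-antisym (matching-≤ {R = R} _ _ ux tx ix) (matching-≤ {R = flip R} _ _ uy ty iy)

-- Last lower points of a height function

module Sources where

  open import Data.Nat using (ℕ; zero; suc; _+_; _≤_; _<_)
  open import Data.Nat.Properties using (≤-refl; ≤-trans; <-trans; ≤-pred; m≤n⇒m≤1+n; m≤n⇒m<n∨m≡n; <⇒≤; ≤-<-trans; <-≤-trans; <-irrefl; +-suc; +-identityʳ; m≤m+n; <-cmp; ≰⇒>; ≤-reflexive; m+[n∸m]≡n)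
  open import Data.Integer using (ℤ) renaming (_<_ to _<ℤ_; _≤_ to _≤ℤ_)
  import Data.Integer.Properties as ℤ
  open import Data.Product using (∃; _×_; _,_)
  open import Data.Sum using (inj₁; inj₂)
  open import Data.Empty using (⊥; ⊥-elim)
  open import Relation.Nullary using (¬_; Dec; yes; no)
  open import Relation.Unary using (Decidable)
  open import Relation.Binary.Definitions using (tri<; tri≈; tri>)
  open import Relation.Binary.PropositionalEquality using (_≡_; refl; sym; trans; cong; subst)

  last-below : {P : ℕ → Set} → Decidable P → ∀ x {c} → c < x → P c →
    ∃ λ k → c ≤ k × k < x × P k × (∀ t → k < t → t < x → ¬ P t)
  last-below {P} P? (suc x) {c} c<x Pc with P? x
  ... | yes Px = x , ≤-pred c<x , ≤-refl , Px , λ t x<t t<1+x → ⊥-elim (<-irrefl refl (<-≤-trans x<t (≤-pred t<1+x)))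
  ... | no ¬Px with m≤n⇒m<n∨m≡n (≤-pred c<x)
  ...   | inj₂ refl = ⊥-elim (¬Px Pc)
  ...   | inj₁ c<x′ with last-below P? x c<x′ Pc
  ...     | k , c≤k , k<x , Pk , above = k , c≤k , m≤n⇒m≤1+n k<x , Pk , above′
    where
    above′ : ∀ t → k < t → t < suc x → ¬ P t
    above′ t k<t t<1+x with m≤n⇒m<n∨m≡n (≤-pred t<1+x)
    ... | inj₁ t<x  = above t k<t t<x
    ... | inj₂ refl = ¬Px

  first-from : {P : ℕ → Set} → Decidable P → ∀ {c x} → c ≤ x → P x →
    ∃ λ k → c ≤ k × k ≤ x × P k × (∀ t → c ≤ t → t < k → ¬ P t)
  first-from {P} P? {c} {x} c≤x Px = go _ c (m+[n∸m]≡n c≤x)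
    where
    go : ∀ d c → c + d ≡ x → ∃ λ k → c ≤ k × k ≤ x × P k × (∀ t → c ≤ t → t < k → ¬ P t)
    go d c eq with P? c
    ... | yes Pc = c , ≤-refl , ≤-trans (m≤m+n c d) (≤-reflexive eq) , Pc , λ t c≤t t<c → ⊥-elim (<-irrefl refl (≤-<-trans c≤t t<c))
    go zero c eq | no ¬Pc = ⊥-elim (¬Pc (subst P (trans (sym eq) (+-identityʳ c)) Px))
    go (suc d) c eq | no ¬Pc with go d (suc c) (trans (sym (+-suc c d)) eq)
    ... | k , c<k , k≤x , Pk , below = k , <⇒≤ c<k , k≤x , Pk , below′
      where
      below′ : ∀ t → c ≤ t → t < k → ¬ P t
      below′ t c≤t t<k with m≤n⇒m<n∨m≡n c≤t
      ... | inj₁ c<t  = below t c<t t<k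
      ... | inj₂ refl = ¬Pc

  bounded-any? : {P : ℕ → Set} → Decidable P → ∀ c x → Dec (∃ λ t → c ≤ t × t < x × P t)
  bounded-any? P? c zero = no λ { (t , _ , () , _) }
  bounded-any? {P} P? c (suc x) with bounded-any? P? c x
  ... | yes (t , c≤t , t<x , Pt) = yes (t , c≤t , m≤n⇒m≤1+n t<x , Pt)
  ... | no none with c Data.Nat.≤? x | P? x
  ...   | yes c≤x | yes Px = yes (x , c≤x , ≤-refl , Px)
  ...   | no c≰x  | _      = no λ { (t , c≤t , t<1+x , _) → c≰x (≤-trans c≤t (≤-pred t<1+x)) }
  ...   | _       | no ¬Px = no λ { (t , c≤t , t<1+x , Pt) → excl t c≤t t<1+x Pt }
    where
    excl : ∀ t → c ≤ t → t < suc x → P t → ⊥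
    excl t c≤t t<1+x Pt with m≤n⇒m<n∨m≡n (≤-pred t<1+x)
    ... | inj₁ t<x  = none (t , c≤t , t<x , Pt)
    ... | inj₂ refl = ¬Px Pt

  -- Choosing the last of the lowest points makes the inequality strict on its right, which
  -- `rising-cut` relies on.
  last-argmin : (f : ℕ → ℤ) → ∀ c L → ∃ λ k → c ≤ k × k ≤ c + L ×
    (∀ t → c ≤ t → t ≤ c + L → f k ≤ℤ f t) × (∀ t → k < t → t ≤ c + L → f k <ℤ f t)
  last-argmin f c zero = c , ≤-refl , m≤m+n c 0
    , (λ t c≤t t≤c → ℤ.≤-reflexive (cong f (eq t c≤t t≤c)))
    , (λ t c<t t≤c → ⊥-elim (<-irrefl (eq t (<⇒≤ c<t) t≤c) c<t))
    where
    eq : ∀ t → c ≤ t → t ≤ c + 0 → c ≡ t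
    eq t c≤t t≤c = Data.Nat.Properties.≤-antisym c≤t (subst (t ≤_) (+-identityʳ c) t≤c)
  last-argmin f c (suc L) rewrite +-suc c L with last-argmin f c L
  ... | k , c≤k , k≤ , min , strict with f (suc (c + L)) ℤ.≤? f k
  ...   | yes le = suc (c + L) , m≤n⇒m≤1+n (m≤m+n c L) , ≤-refl , min′ , λ t lt le′ → ⊥-elim (<-irrefl refl (<-≤-trans lt le′))
    where
    min′ : ∀ t → c ≤ t → t ≤ suc (c + L) → f (suc (c + L)) ≤ℤ f t
    min′ t c≤t t≤ with m≤n⇒m<n∨m≡n t≤
    ... | inj₁ t< = ℤ.≤-trans le (min t c≤t (≤-pred t<))
    ... | inj₂ refl = ℤ.≤-refl
  ...   | no nle = k , c≤k , m≤n⇒m≤1+n k≤ , min′ , strict′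
    where
    gt = ℤ.≰⇒> nle
    min′ : ∀ t → c ≤ t → t ≤ suc (c + L) → f k ≤ℤ f t
    min′ t c≤t t≤ with m≤n⇒m<n∨m≡n t≤
    ... | inj₁ t< = min t c≤t (≤-pred t<)
    ... | inj₂ refl = ℤ.<⇒≤ gt
    strict′ : ∀ t → k < t → t ≤ suc (c + L) → f k <ℤ f t
    strict′ t k<t t≤ with m≤n⇒m<n∨m≡n t≤
    ... | inj₁ t< = strict t k<t (≤-pred t<)
    ... | inj₂ refl = gt

  -- The laser that bounds the region directly around point x starts at the last earlier point
  -- strictly below x; two labels share a block exactly when this source is the same.
  record Source (f : ℕ → ℤ) (x k : ℕ) : Set where
    constructor source
    field
      before  : k < x
      lower   : f k <ℤ f x
      between : ∀ t → k < t → t < x → f x ≤ℤ f t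
  open Source public

  module _ {f : ℕ → ℤ} where

    source-latest : ∀ {x k t} → Source f x k → t < x → f t <ℤ f x → t ≤ k
    source-latest {x} {k} {t} S t<x ft<fx with t Data.Nat.≤? k
    ... | yes t≤k = t≤k
    ... | no t≰k  = ⊥-elim (ℤ.<⇒≱ ft<fx (between S t (≰⇒> t≰k) t<x))

    source-unique : ∀ {x k k′} → Source f x k → Source f x k′ → k ≡ k′
    source-unique S S′ = Data.Nat.Properties.≤-antisym
      (source-latest S′ (before S) (lower S)) (source-latest S (before S′) (lower S′))

    source-exists : ∀ {x c} → c < x → f c <ℤ f x → ∃ λ k → c ≤ k × Source f x k
    source-exists {x} c<x fc<fx with last-below (λ k → f k ℤ.<? f x) x c<x fc<fx
    ... | k , c≤k , k<x , fk<fx , above = k , c≤k , source k<x fk<fx λ t k<t t<x → ℤ.≮⇒≥ (above t k<t t<x)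

    -- Hence the laser fired from the source stays below the path at least as far as `x`.
    source-below-between : ∀ {x k t} → Source f x k → k < t → t ≤ x → f k <ℤ f t
    source-below-between S k<t t≤x with m≤n⇒m<n∨m≡n t≤x
    ... | inj₁ t<x  = ℤ.<-≤-trans (lower S) (between S _ k<t t<x)
    ... | inj₂ refl = lower S

    source-of-ascent : ∀ {x} → f x <ℤ f (suc x) → Source f (suc x) x
    source-of-ascent lt = source ≤-refl lt λ t x<t t<1+x → ⊥-elim (<-irrefl refl (<-≤-trans x<t (≤-pred t<1+x)))

    source-of-descent : ∀ {x k} → f (suc x) <ℤ f x → Source f (suc x) k → k < x
    source-of-descent desc S with m≤n⇒m<n∨m≡n (≤-pred (before S))
    ... | inj₁ k<x  = k<x
    ... | inj₂ refl = ⊥-elim (ℤ.<-asym desc (lower S))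

    -- The witness is the lowest point between the source and the descent.
    descent-sibling : ∀ {x k} → f (suc x) <ℤ f x → Source f (suc x) k →
      ∃ λ j → k < j × j ≤ x × Source f j k
    descent-sibling {x} {k} desc S with last-argmin f (suc k) (x Data.Nat.∸ suc k)
    ... | j , k<j , j≤ , min , _ = j , k<j , j≤x
        , source k<j (source-below-between S k<j (m≤n⇒m≤1+n j≤x)) λ t k<t t<j → min t k<t (≤-trans (<⇒≤ t<j) j≤)
      where
      j≤x : j ≤ x
      j≤x = subst (j ≤_) (m+[n∸m]≡n (source-of-descent desc S)) j≤

    -- Suppose s < t. Then f t < f l ≤ f k because `k` lies between `t` and `l`, while f k ≤ f t
    -- because `t` lies between `s` and `k`. The case t < s is the same contradiction for `j` and
    -- `k`.
    source-noncrossing : ∀ {i j k l s t} → i < j → j < k → k < l →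
      Source f i s → Source f k s → Source f j t → Source f l t → s ≡ t
    source-noncrossing {i} {j} {k} {l} {s} {t} i<j j<k k<l Si Sk Sj Sl with <-cmp s t
    ... | tri≈ _ s≡t _ = s≡t
    ... | tri< s<t _ _ = ⊥-elim (ℤ.<⇒≱ (ℤ.<-≤-trans (lower Sl) (between Sl k (<-trans (before Sj) j<k) k<l))
                                (between Sk t s<t (<-trans (before Sj) j<k)))
    ... | tri> _ _ t<s = ⊥-elim (ℤ.<⇒≱ (ℤ.<-≤-trans (lower Sk) (between Sk j (<-trans (before Si) i<j) j<k))
                                (between Sj s t<s (<-trans (before Si) i<j)))

-- Heights of step sequences

module Heights where

  open import Data.Bool using (Bool; true; false)
  open import Data.Nat as ℕ using (ℕ; zero; suc; _≤_; _<_; _∸_)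
  import Data.Nat.Properties as ℕ
  open import Data.Nat.Divisibility using (_∣_; m∣m*n; ∣⇒≤; ∣m+n∣m⇒∣n)
  open import Data.Nat.Coprimality using (Coprime; coprime-divisor)
  import Data.Nat.Coprimality as Coprime
  open import Data.Integer as ℤ using (ℤ; +_; -_; 0ℤ; 1ℤ; _+_; _*_; _-_) renaming (_<_ to _<ℤ_; _≤_ to _≤ℤ_)
  import Data.Integer.Properties as ℤ
  open import Data.Integer.Tactic.RingSolver using (solve-∀)
  open import Data.Product using (_,_)
  open import Data.Empty using (⊥-elim)
  open import Relation.Binary.PropositionalEquality using (_≡_; _≢_; refl; sym; trans; cong; cong₂; subst; subst₂; module ≡-Reasoning)
  open Sources

  Steps : Set
  Steps = ℕ → Bool

  count : Steps → ℕ → ℕ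
  count s zero    = 0
  count s (suc k) with s k
  ... | true  = suc (count s k)
  ... | false = count s k

  count-cong : ∀ {s s′} L → (∀ t → t < L → s t ≡ s′ t) → count s L ≡ count s′ L
  count-cong zero    _  = refl
  count-cong {s} {s′} (suc L) eq with s L | s′ L | eq L ℕ.≤-refl
  ... | true  | .true  | refl = cong suc (count-cong L λ t t<L → eq t (ℕ.m≤n⇒m≤1+n t<L))
  ... | false | .false | refl = count-cong L λ t t<L → eq t (ℕ.m≤n⇒m≤1+n t<L)

  count-+ : ∀ s c L → count s (c ℕ.+ L) ≡ count s c ℕ.+ count (λ t → s (c ℕ.+ t)) L
  count-+ s c zero    = trans (cong (count s) (ℕ.+-identityʳ c)) (sym (ℕ.+-identityʳ _))
  count-+ s c (suc L) rewrite ℕ.+-suc c L with s (c ℕ.+ L)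
  ... | true  = trans (cong suc (count-+ s c L)) (sym (ℕ.+-suc _ _))
  ... | false = count-+ s c L

  +-cancelʳ-≡ℤ : ∀ {x y} d → x + d ≡ y + d → x ≡ y
  +-cancelʳ-≡ℤ {x} {y} d eq = trans (lemma x d) (trans (cong (_+ - d) eq) (sym (lemma y d)))
    where
    lemma : ∀ x d → x ≡ x + d + - d
    lemma = solve-∀

  +-cancelʳ-<ℤ : ∀ {x y} d → x + d <ℤ y + d → x <ℤ y
  +-cancelʳ-<ℤ {x} {y} d lt = subst₂ _<ℤ_ (lemma x d) (lemma y d) (ℤ.+-monoˡ-< (- d) lt)
    where
    lemma : ∀ x d → x + d + - d ≡ x
    lemma = solve-∀

  +-cancelʳ-≤ℤ : ∀ {x y} d → x + d ≤ℤ y + d → x ≤ℤ y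
  +-cancelʳ-≤ℤ {x} {y} d le = subst₂ _≤ℤ_ (lemma x d) (lemma y d) (ℤ.+-monoˡ-≤ (- d) le)
    where
    lemma : ∀ x d → x + d + - d ≡ x
    lemma = solve-∀

  -- Sources are defined by comparing heights only, so windows that differ by a constant `d` have
  -- corresponding sources. Most transfers between different paths below are made through such a
  -- window.
  Translate : (f g : ℕ → ℤ) (c c′ : ℕ) (d : ℤ) (L : ℕ) → Set
  Translate f g c c′ d L = ∀ t → t ≤ L → f (c ℕ.+ t) ≡ g (c′ ℕ.+ t) + d

  translate-sym : ∀ {f g c c′ d L} → Translate f g c c′ d L → Translate g f c′ c (- d) L
  translate-sym {f} {g} {c} {c′} {d} T t t≤L = trans (lemma (g (c′ ℕ.+ t)) d) (cong (_+ - d) (sym (T t t≤L)))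
    where
    lemma : ∀ x d → x ≡ x + d + - d
    lemma = solve-∀

  module _ {f g : ℕ → ℤ} {c c′ : ℕ} {d : ℤ} {L : ℕ} (T : Translate f g c c′ d L) where

    translate-< : ∀ {t u} → t ≤ L → u ≤ L → g (c′ ℕ.+ t) <ℤ g (c′ ℕ.+ u) → f (c ℕ.+ t) <ℤ f (c ℕ.+ u)
    translate-< t≤L u≤L lt = subst₂ _<ℤ_ (sym (T _ t≤L)) (sym (T _ u≤L)) (ℤ.+-monoˡ-< d lt)

    translate-≤ : ∀ {t u} → t ≤ L → u ≤ L → g (c′ ℕ.+ t) ≤ℤ g (c′ ℕ.+ u) → f (c ℕ.+ t) ≤ℤ f (c ℕ.+ u)
    translate-≤ t≤L u≤L le = subst₂ _≤ℤ_ (sym (T _ t≤L)) (sym (T _ u≤L)) (ℤ.+-monoˡ-≤ d le)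

    translate-source : ∀ {x k} → x ≤ L → Source g (c′ ℕ.+ x) (c′ ℕ.+ k) → Source f (c ℕ.+ x) (c ℕ.+ k)
    translate-source {x} {k} x≤L S = source (ℕ.+-monoʳ-< c k<x) (translate-< k≤L x≤L (lower S)) btw
      where
      k<x = ℕ.+-cancelˡ-< c′ _ _ (before S)
      k≤L = ℕ.≤-trans (ℕ.<⇒≤ k<x) x≤L
      btw : ∀ t → c ℕ.+ k < t → t < c ℕ.+ x → f (c ℕ.+ x) ≤ℤ f t
      btw t lo hi = subst (λ t → f (c ℕ.+ x) ≤ℤ f t) eq
        (translate-≤ x≤L (ℕ.≤-trans (ℕ.<⇒≤ u<x) x≤L)
          (between S (c′ ℕ.+ u) (ℕ.+-monoʳ-< c′ k<u) (ℕ.+-monoʳ-< c′ u<x)))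
        where
        u = t ∸ c
        eq : c ℕ.+ u ≡ t
        eq = ℕ.m+[n∸m]≡n (ℕ.≤-trans (ℕ.m≤m+n c k) (ℕ.<⇒≤ lo))
        k<u = ℕ.+-cancelˡ-< c _ _ (subst (c ℕ.+ k <_) (sym eq) lo)
        u<x = ℕ.+-cancelˡ-< c _ _ (subst (_< c ℕ.+ x) (sym eq) hi)

  module Height (a b : ℕ) where

    step : Bool → ℤ
    step true  = + b
    step false = - + a

    H : Steps → ℕ → ℤ
    H s zero    = 0ℤ
    H s (suc k) = H s k + step (s k)

    -- A north step adds b = (a + b) - a and an east step adds - a: every step costs `a`, and every
    -- north step returns a + b. Modulo a + b the height thus depends on `k` alone.
    H-count : ∀ s k → H s k + + a * + k ≡ (+ a + + b) * + count s k
    H-count s zero = trans (ℤ.+-identityˡ _) (trans (ℤ.*-zeroʳ (+ a)) (sym (ℤ.*-zeroʳ (+ a + + b))))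
    H-count s (suc k) with s k
    ... | true  = trans (lemma (H s k) (+ a) (+ b) (+ k)) (trans (cong (_+ (+ a + + b)) (H-count s k)) (lemma′ (+ a + + b) (+ count s k)))
      where
      lemma : ∀ h a b k → h + b + a * (1ℤ + k) ≡ h + a * k + (a + b)
      lemma = solve-∀
      lemma′ : ∀ n c → n * c + n ≡ n * (1ℤ + c)
      lemma′ = solve-∀
    ... | false = trans (lemma (H s k) (+ a) (+ k)) (H-count s k)
      where
      lemma : ∀ h a k → h + - a + a * (1ℤ + k) ≡ h + a * k
      lemma = solve-∀

    H-≡⇒count : ∀ s k {s′ k′} → H s k ≡ H s′ k′ → (a ℕ.+ b) ℕ.* count s k ℕ.+ a ℕ.* k′ ≡ (a ℕ.+ b) ℕ.* count s′ k′ ℕ.+ a ℕ.* k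
    H-≡⇒count s k {s′} {k′} eq = ℤ.+-injective (trans (embed (count s k) k′) (trans chain (sym (embed (count s′ k′) k))))
      where
      embed : ∀ x y → + ((a ℕ.+ b) ℕ.* x ℕ.+ a ℕ.* y) ≡ (+ a + + b) * + x + + a * + y
      embed x y = cong₂ _+_ (ℤ.pos-* (a ℕ.+ b) x) (ℤ.pos-* a y)
      swap : ∀ h p q → h + p + q ≡ h + q + p
      swap = solve-∀
      chain : (+ a + + b) * + count s k + + a * + k′ ≡ (+ a + + b) * + count s′ k′ + + a * + k
      chain = begin
        (+ a + + b) * + count s k + + a * + k′    ≡⟨ cong (_+ + a * + k′) (sym (H-count s k)) ⟩
        H s k + + a * + k + + a * + k′            ≡⟨ swap (H s k) _ _ ⟩
        H s k + + a * + k′ + + a * + k            ≡⟨ cong (λ h → h + + a * + k′ + + a * + k) eq ⟩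
        H s′ k′ + + a * + k′ + + a * + k          ≡⟨ cong (_+ + a * + k) (H-count s′ k′) ⟩
        (+ a + + b) * + count s′ k′ + + a * + k   ∎
        where open ≡-Reasoning

    -- By `H-count`, equal heights at distance `d` make a + b divide `a * d`, and therefore `d`.
    -- Weak inequalities between the heights of different points in such a window are automatically
    -- strict.
    H-distinct : Coprime a b → ∀ s {i j} → i < j → j < i ℕ.+ (a ℕ.+ b) → H s i ≢ H s j
    H-distinct cop s {i} {j} i<j j<i+n eq = ℕ.<⇒≱ d<n (∣⇒≤ {{ℕ.>-nonZero 0<d}} n∣d)
      where
      d = j ∸ i
      i+d≡j : i ℕ.+ d ≡ j
      i+d≡j = ℕ.m+[n∸m]≡n (ℕ.<⇒≤ i<j)
      0<d : 0 < d
      0<d = ℕ.m<n⇒0<n∸m i<j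
      d<n : d < a ℕ.+ b
      d<n = ℕ.+-cancelˡ-< i _ _ (subst (_< i ℕ.+ (a ℕ.+ b)) (sym i+d≡j) j<i+n)
      rel : (a ℕ.+ b) ℕ.* count s i ℕ.+ a ℕ.* d ≡ (a ℕ.+ b) ℕ.* count s j
      rel = ℕ.+-cancelʳ-≡ (a ℕ.* i) _ _ (begin
        (a ℕ.+ b) ℕ.* count s i ℕ.+ a ℕ.* d ℕ.+ a ℕ.* i ≡⟨ ℕ.+-assoc ((a ℕ.+ b) ℕ.* count s i) _ _ ⟩
        (a ℕ.+ b) ℕ.* count s i ℕ.+ (a ℕ.* d ℕ.+ a ℕ.* i) ≡⟨ cong ((a ℕ.+ b) ℕ.* count s i ℕ.+_) (sym (ℕ.*-distribˡ-+ a d i)) ⟩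
        (a ℕ.+ b) ℕ.* count s i ℕ.+ a ℕ.* (d ℕ.+ i)       ≡⟨ cong (λ x → (a ℕ.+ b) ℕ.* count s i ℕ.+ a ℕ.* x) (trans (ℕ.+-comm d i) i+d≡j) ⟩
        (a ℕ.+ b) ℕ.* count s i ℕ.+ a ℕ.* j               ≡⟨ H-≡⇒count s i eq ⟩
        (a ℕ.+ b) ℕ.* count s j ℕ.+ a ℕ.* i               ∎)
        where open ≡-Reasoning
      n∣ad : (a ℕ.+ b) ∣ a ℕ.* d
      n∣ad = ∣m+n∣m⇒∣n {m = (a ℕ.+ b) ℕ.* count s i} (subst ((a ℕ.+ b) ∣_) (sym rel) (m∣m*n _)) (m∣m*n _)
      n∣d : (a ℕ.+ b) ∣ d
      n∣d = coprime-divisor {a ℕ.+ b} {a} (λ { (p , q) → cop (q , ∣m+n∣m⇒∣n p q) }) n∣ad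

    agree-translate : ∀ {s s′} c c′ L → (∀ t → t < L → s (c ℕ.+ t) ≡ s′ (c′ ℕ.+ t)) →
      Translate (H s) (H s′) c c′ (H s c - H s′ c′) L
    agree-translate {s} {s′} c c′ L eq zero _ rewrite ℕ.+-identityʳ c | ℕ.+-identityʳ c′ = lemma (H s c) (H s′ c′)
      where
      lemma : ∀ x y → x ≡ y + (x - y)
      lemma = solve-∀
    agree-translate {s} {s′} c c′ L eq (suc t) t<L rewrite ℕ.+-suc c t | ℕ.+-suc c′ t | eq t t<L =
      trans (cong (_+ step (s′ (c′ ℕ.+ t))) (agree-translate {s} {s′} c c′ L eq t (ℕ.<⇒≤ t<L))) (lemma (H s′ (c′ ℕ.+ t)) _ _)
      where
      lemma : ∀ x d e → x + d + e ≡ x + e + d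
      lemma = solve-∀

    H-shift : ∀ s c t → H (λ i → s (c ℕ.+ i)) t ≡ H s (c ℕ.+ t) - H s c
    H-shift s c t = trans (agree-translate {λ i → s (c ℕ.+ i)} {s} 0 c t (λ _ _ → refl) t ℕ.≤-refl)
                          (cong (λ z → H s (c ℕ.+ t) + z) (ℤ.+-identityˡ (- H s c)))

    H-cong : ∀ {s s′} L → (∀ t → t < L → s t ≡ s′ t) → ∀ t → t ≤ L → H s t ≡ H s′ t
    H-cong {s} {s′} L eq t t≤L = trans (agree-translate {s} {s′} 0 0 L eq t t≤L) (ℤ.+-identityʳ _)

    H-ascent : 0 < b → ∀ s k → s k ≡ true → H s k <ℤ H s (suc k)
    H-ascent 0<b s k eq rewrite eq = subst (_<ℤ H s k + + b) (ℤ.+-identityʳ _) (ℤ.+-monoʳ-< (H s k) (ℤ.+<+ 0<b))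

    H-descent : 0 < a → ∀ s k → s k ≡ false → H s (suc k) <ℤ H s k
    H-descent 0<a s k eq rewrite eq = subst (H s k + - + a <ℤ_) (ℤ.+-identityʳ _) (ℤ.+-monoʳ-< (H s k) (ℤ.neg-mono-< (ℤ.+<+ 0<a)))

    ascent⇒true : 0 < a → ∀ s k → H s k <ℤ H s (suc k) → s k ≡ true
    ascent⇒true 0<a s k lt = by-cases (s k) refl
      where
      by-cases : ∀ x → s k ≡ x → s k ≡ true
      by-cases true  e = e
      by-cases false e = ⊥-elim (ℤ.<-asym lt (H-descent 0<a s k e))

    descent⇒false : 0 < b → ∀ s k → H s (suc k) <ℤ H s k → s k ≡ false
    descent⇒false 0<b s k lt = by-cases (s k) refl
      where
      by-cases : ∀ x → s k ≡ x → s k ≡ false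
      by-cases false e = e
      by-cases true  e = ⊥-elim (ℤ.<-asym lt (H-ascent 0<b s k e))

-- Laser fire expressed through sources

module LaserFire where

  open import Data.Bool using (Bool; true; false; _∧_; T)
  open import Data.Bool.Properties using () renaming (_≟_ to _≟ᵇ_)
  open import Data.Nat as ℕ using (ℕ; zero; suc; _≤_; _<_; z≤n; s≤s; _∸_; _<ᵇ_; _≡ᵇ_)
  import Data.Nat.Properties as ℕ
  open import Data.Nat.Coprimality using (Coprime)
  open import Data.Integer as ℤ using (ℤ; +_; -_; 0ℤ; _+_; _*_; _-_) renaming (_<_ to _<ℤ_; _≤_ to _≤ℤ_)
  import Data.Integer.Properties as ℤ
  open import Data.Integer.Tactic.RingSolver using (solve-∀)
  open import Data.List.Base using (List; []; _∷_; _++_; map; length; upTo; applyUpTo)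
  open import Data.List.Membership.Propositional using (_∈_)
  open import Data.List.Membership.Propositional.Properties using (∈-upTo⁺; ∈-upTo⁻; ∈-filter⁺; ∈-filter⁻; ∈-map⁺; ∈-map⁻; ∈-++⁺ˡ; ∈-++⁺ʳ; ∈-++⁻)
  open import Data.List.Relation.Unary.Any using (here; there)
  open import Data.Product using (∃; _×_; _,_; proj₁; proj₂)
  open import Data.Sum using (inj₁; inj₂)
  open import Relation.Nullary using (yes; no)
  open import Relation.Binary.PropositionalEquality using (_≡_; _≢_; refl; sym; trans; cong; cong₂; subst; subst₂)
  open import Defs
  open Sources
  open Heights

  ≡true⇒T : ∀ {x} → x ≡ true → T x
  ≡true⇒T refl = _

  T⇒≡true : ∀ {x} → T x → x ≡ true
  T⇒≡true {true} _ = refl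

  <ᵇ-true⁻ : ∀ {m n} → (m <ᵇ n) ≡ true → m < n
  <ᵇ-true⁻ {m} {n} eq = ℕ.<ᵇ⇒< m n (≡true⇒T eq)

  <ᵇ-true⁺ : ∀ {m n} → m < n → (m <ᵇ n) ≡ true
  <ᵇ-true⁺ lt = T⇒≡true (ℕ.<⇒<ᵇ lt)

  ∧-true⁻ : ∀ {x y} → x ∧ y ≡ true → x ≡ true × y ≡ true
  ∧-true⁻ {true} {true} _ = refl , refl

  ∧-true⁺ : ∀ {x y} → x ≡ true → y ≡ true → x ∧ y ≡ true
  ∧-true⁺ refl refl = refl

  bool-ext : ∀ {x y} → (x ≡ true → y ≡ true) → (y ≡ true → x ≡ true) → x ≡ y
  bool-ext {true}  {true}  _ _ = refl
  bool-ext {false} {false} _ _ = refl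
  bool-ext {true}  {false} f _ = sym (f refl)
  bool-ext {false} {true}  _ g = g refl

  allᵇ-true⁻ : {A : Set} (f : A → Bool) {xs : List A} → allᵇ f xs ≡ true → ∀ {x} → x ∈ xs → f x ≡ true
  allᵇ-true⁻ f eq (here refl) = proj₁ (∧-true⁻ eq)
  allᵇ-true⁻ f {x ∷ xs} eq (there p) = allᵇ-true⁻ f (proj₂ (∧-true⁻ {f x} eq)) p

  allᵇ-true⁺ : {A : Set} (f : A → Bool) {xs : List A} → (∀ {x} → x ∈ xs → f x ≡ true) → allᵇ f xs ≡ true
  allᵇ-true⁺ f {[]}     _  = refl
  allᵇ-true⁺ f {x ∷ xs} eq = ∧-true⁺ (eq (here refl)) (allᵇ-true⁺ f λ p → eq (there p))

  allᵇ-false⁻ : {A : Set} (f : A → Bool) {xs : List A} → allᵇ f xs ≡ false → ∃ λ x → x ∈ xs × f x ≡ false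
  allᵇ-false⁻ f {x ∷ xs} eq with f x in e
  ... | false = x , here refl , e
  ... | true with allᵇ-false⁻ f {xs} eq
  ...   | y , y∈ , q = y , there y∈ , q

  ∈-allPaths⁺ : ∀ {p n} → length p ≡ n → p ∈ allPaths n
  ∈-allPaths⁺ {[]}        refl = here refl
  ∈-allPaths⁺ {true ∷ p}  refl = ∈-++⁺ˡ (∈-map⁺ (true ∷_) (∈-allPaths⁺ {p} refl))
  ∈-allPaths⁺ {false ∷ p} refl = ∈-++⁺ʳ _ (∈-map⁺ (false ∷_) (∈-allPaths⁺ {p} refl))

  ∈-allPaths⁻ : ∀ {p} n → p ∈ allPaths n → length p ≡ n
  ∈-allPaths⁻ zero (here refl) = refl
  ∈-allPaths⁻ (suc n) p∈ with ∈-++⁻ (map (true ∷_) (allPaths n)) p∈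
  ... | inj₁ q with ∈-map⁻ (true ∷_) q
  ...   | p , r , refl = cong suc (∈-allPaths⁻ n r)
  ∈-allPaths⁻ (suc n) p∈ | inj₂ q with ∈-map⁻ (false ∷_) q
  ...   | p , r , refl = cong suc (∈-allPaths⁻ n r)

  countN+countE : ∀ p → countN p ℕ.+ countE p ≡ length p
  countN+countE []          = refl
  countN+countE (true ∷ p)  = cong suc (countN+countE p)
  countN+countE (false ∷ p) = trans (ℕ.+-suc _ _) (cong suc (countN+countE p))

  take-length : ∀ p → take (length p) p ≡ p
  take-length []      = refl
  take-length (s ∷ p) = cong (s ∷_) (take-length p)

  take-north : ∀ p k → stepN p k ≡ true → yc p (suc k) ≡ suc (yc p k) × xc p (suc k) ≡ xc p k
  take-north (true ∷ p)  zero    _  = refl , refl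
  take-north (true ∷ p)  (suc k) eq with take-north p k eq
  ... | e₁ , e₂ = cong suc e₁ , e₂
  take-north (false ∷ p) (suc k) eq with take-north p k eq
  ... | e₁ , e₂ = e₁ , cong suc e₂

  take-east : ∀ p k → k < length p → stepN p k ≡ false → yc p (suc k) ≡ yc p k × xc p (suc k) ≡ suc (xc p k)
  take-east (false ∷ p) zero    _         _  = refl , refl
  take-east (true ∷ p)  (suc k) (s≤s k<l) eq with take-east p k k<l eq
  ... | e₁ , e₂ = cong suc e₁ , e₂
  take-east (false ∷ p) (suc k) (s≤s k<l) eq with take-east p k k<l eq
  ... | e₁ , e₂ = e₁ , cong suc e₂

  yc≡count : ∀ p k → k ≤ length p → yc p k ≡ count (stepN p) k
  yc≡count p zero    _   = refl
  yc≡count p (suc k) k<l with stepN p k in eq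
  ... | true  = trans (proj₁ (take-north p k eq)) (cong suc (yc≡count p k (ℕ.<⇒≤ k<l)))
  ... | false = trans (proj₁ (take-east p k k<l eq)) (yc≡count p k (ℕ.<⇒≤ k<l))

  countN≡count : ∀ p → countN p ≡ count (stepN p) (length p)
  countN≡count p = trans (cong countN (sym (take-length p))) (yc≡count p (length p) ℕ.≤-refl)

  stepN-applyUpTo : ∀ (s : Steps) n k → k < n → stepN (applyUpTo s n) k ≡ s k
  stepN-applyUpTo s (suc n) zero    _         = refl
  stepN-applyUpTo s (suc n) (suc k) (s≤s k<n) = stepN-applyUpTo (λ i → s (suc i)) n k k<n

  stepN-injective : ∀ p q → length p ≡ length q → (∀ k → k < length p → stepN p k ≡ stepN q k) → p ≡ q
  stepN-injective []      []      _  _  = refl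
  stepN-injective (x ∷ p) (y ∷ q) le eq = cong₂ _∷_ (eq 0 (s≤s z≤n)) (stepN-injective p q (ℕ.suc-injective le) λ k k<l → eq (suc k) (s≤s k<l))

  SameSource : (ℕ → ℤ) → ℕ → ℕ → Set
  SameSource f x y = ∃ λ k → Source f x k × Source f y k

  module Laser (a b : ℕ) (0<a : 0 < a) (0<b : 0 < b) (cop : Coprime a b) where
    open Height a b public

    -- The number of north steps is encoded in `closed`: by `H-count`, a path that is back at height
    -- 0 after a + b steps has exactly `a` of them.
    record Dyck (s : Steps) : Set where
      constructor dyck
      field
        nonneg : ∀ k → k ≤ a ℕ.+ b → 0ℤ ≤ℤ H s k
        closed : H s (a ℕ.+ b) ≡ 0ℤ
    open Dyck public

    dyck-cong : ∀ {s s′} → (∀ k → k < a ℕ.+ b → s k ≡ s′ k) → Dyck s → Dyck s′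
    dyck-cong eq (dyck nn cl) = dyck
      (λ k k≤ → subst (0ℤ ≤ℤ_) (H-cong (a ℕ.+ b) eq k k≤) (nn k k≤))
      (trans (sym (H-cong (a ℕ.+ b) eq _ ℕ.≤-refl)) cl)

    dyck-positive : ∀ {s} → Dyck s → ∀ {k} → 0 < k → k < a ℕ.+ b → 0ℤ <ℤ H s k
    dyck-positive {s} D 0<k k<n = ℤ.≤∧≢⇒< (nonneg D _ (ℕ.<⇒≤ k<n)) (H-distinct cop s 0<k k<n)

    dyck-source : ∀ {s} → Dyck s → ∀ {k} → 0 < k → k < a ℕ.+ b → ∃ λ j → Source (H s) k j
    dyck-source D 0<k k<n with source-exists 0<k (dyck-positive D 0<k k<n)
    ... | j , _ , S = j , S

    dyck-count : ∀ {s} → H s (a ℕ.+ b) ≡ 0ℤ → count s (a ℕ.+ b) ≡ a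
    dyck-count {s} closed = ℕ.*-cancelˡ-≡ _ _ (a ℕ.+ b) {{ℕ.>-nonZero (ℕ.≤-trans 0<a (ℕ.m≤m+n a b))}}
      (trans (sym (ℕ.+-identityʳ _)) (trans (cong (((a ℕ.+ b) ℕ.* count s (a ℕ.+ b)) ℕ.+_) (sym (ℕ.*-zeroʳ a)))
      (trans (H-≡⇒count s (a ℕ.+ b) {s} {0} closed)
      (trans (cong (ℕ._+ a ℕ.* (a ℕ.+ b)) (ℕ.*-zeroʳ (a ℕ.+ b))) (ℕ.*-comm a (a ℕ.+ b))))))

    H-path : ∀ p k → k ≤ length p → H (stepN p) k + + (a ℕ.* xc p k) ≡ + (b ℕ.* yc p k)
    H-path p zero    _   = trans (ℤ.+-identityˡ _) (cong +_ (trans (ℕ.*-zeroʳ a) (sym (ℕ.*-zeroʳ b))))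
    H-path p (suc k) k<l with stepN p k in eq
    ... | true rewrite proj₁ (take-north p k eq) | proj₂ (take-north p k eq) =
          trans (lemma (H (stepN p) k) (+ b) _) (trans (cong (_+ + b) (H-path p k (ℕ.<⇒≤ k<l)))
          (cong +_ (trans (ℕ.+-comm (b ℕ.* yc p k) b) (sym (ℕ.*-suc b (yc p k))))))
      where
      lemma : ∀ h b x → h + b + x ≡ h + x + b
      lemma = solve-∀
    ... | false rewrite proj₁ (take-east p k k<l eq) | proj₂ (take-east p k k<l eq) =
          trans (cong (λ z → H (stepN p) k + - + a + z) (cong +_ (ℕ.*-suc a (xc p k))))
          (trans (lemma (H (stepN p) k) (+ a) _) (H-path p k (ℕ.<⇒≤ k<l)))
      where
      lemma : ∀ h a x → h + - a + (a + x) ≡ h + x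
      lemma = solve-∀

    private
      -- Adding `a` times both x-coordinates to the two heights clears the subtractions; the sums
      -- obtained are those compared by `above`.
      crossed : ∀ p k m → k ≤ length p → + (b ℕ.* yc p k ℕ.+ a ℕ.* xc p m) ≡ H (stepN p) k + (+ (a ℕ.* xc p k) + + (a ℕ.* xc p m))
      crossed p k m k≤ = trans (cong (_+ + (a ℕ.* xc p m)) (sym (H-path p k k≤))) (ℤ.+-assoc (H (stepN p) k) _ _)

      crossed′ : ∀ p k m → m ≤ length p → + (b ℕ.* yc p m ℕ.+ a ℕ.* xc p k) ≡ H (stepN p) m + (+ (a ℕ.* xc p k) + + (a ℕ.* xc p m))
      crossed′ p k m m≤ = trans (crossed p m k m≤) (cong (λ z → H (stepN p) m + z) (ℤ.+-comm (+ (a ℕ.* xc p m)) (+ (a ℕ.* xc p k))))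

    above⁻ : ∀ p {k m} → k ≤ length p → m ≤ length p → above a b p k m ≡ true → H (stepN p) k <ℤ H (stepN p) m
    above⁻ p {k} {m} k≤ m≤ eq = +-cancelʳ-<ℤ (+ (a ℕ.* xc p k) + + (a ℕ.* xc p m))
      (subst₂ _<ℤ_ (crossed p k m k≤) (crossed′ p k m m≤) (ℤ.+<+ (<ᵇ-true⁻ eq)))

    above⁺ : ∀ p {k m} → k ≤ length p → m ≤ length p → H (stepN p) k <ℤ H (stepN p) m → above a b p k m ≡ true
    above⁺ p {k} {m} k≤ m≤ lt = <ᵇ-true⁺ (ℤ.drop‿+<+
      (subst₂ _<ℤ_ (sym (crossed p k m k≤)) (sym (crossed′ p k m m≤)) (ℤ.+-monoˡ-< (+ (a ℕ.* xc p k) + + (a ℕ.* xc p m)) lt)))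

    ∈-DyckPaths⁻ : ∀ {p} → p ∈ DyckPaths a b → length p ≡ a ℕ.+ b × Dyck (stepN p)
    ∈-DyckPaths⁻ {p} p∈ with ∈-filter⁻ (λ p → isDyck a b p ≟ᵇ true) {xs = allPaths (a ℕ.+ b)} p∈
    ... | p∈all , good with ∧-true⁻ {countN p ≡ᵇ a} good
    ... | isN , rest with ∧-true⁻ {countE p ≡ᵇ b} rest
    ... | isE , stays = len , dyck nn cl
      where
      len : length p ≡ a ℕ.+ b
      len = ∈-allPaths⁻ (a ℕ.+ b) p∈all
      nn : ∀ k → k ≤ a ℕ.+ b → 0ℤ ≤ℤ H (stepN p) k
      nn k k≤ = +-cancelʳ-≤ℤ (+ (a ℕ.* xc p k)) (subst₂ _≤ℤ_ (sym (ℤ.+-identityˡ _)) (sym (H-path p k (subst (k ≤_) (sym len) k≤)))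
        (ℤ.+≤+ (ℕ.≤-pred (<ᵇ-true⁻ (allᵇ-true⁻ _ stays (∈-upTo⁺ (s≤s k≤)))))))
      cl : H (stepN p) (a ℕ.+ b) ≡ 0ℤ
      cl = +-cancelʳ-≡ℤ (+ (a ℕ.* b)) (trans (cong₂ _+_ (cong (H (stepN p)) (sym len)) (cong (λ z → + (a ℕ.* z)) (sym xl)))
        (trans (H-path p (length p) ℕ.≤-refl) (trans (cong (λ z → + (b ℕ.* z)) yl) (trans (cong +_ (ℕ.*-comm b a)) (sym (ℤ.+-identityˡ _))))))
        where
        xl : xc p (length p) ≡ b
        xl = trans (cong countE (take-length p)) (ℕ.≡ᵇ⇒≡ _ _ (≡true⇒T isE))
        yl : yc p (length p) ≡ a
        yl = trans (cong countN (take-length p)) (ℕ.≡ᵇ⇒≡ _ _ (≡true⇒T isN))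

    ∈-DyckPaths⁺ : ∀ {p} → length p ≡ a ℕ.+ b → Dyck (stepN p) → p ∈ DyckPaths a b
    ∈-DyckPaths⁺ {p} len D = ∈-filter⁺ (λ p → isDyck a b p ≟ᵇ true) (∈-allPaths⁺ len)
      (∧-true⁺ (T⇒≡true (ℕ.≡⇒≡ᵇ _ _ isN)) (∧-true⁺ (T⇒≡true (ℕ.≡⇒≡ᵇ _ _ isE)) (allᵇ-true⁺ _ stays)))
      where
      isN : countN p ≡ a
      isN = trans (countN≡count p) (trans (cong (count (stepN p)) len) (dyck-count (closed D)))
      isE : countE p ≡ b
      isE = ℕ.+-cancelˡ-≡ a _ _ (trans (cong (ℕ._+ countE p) (sym isN)) (trans (countN+countE p) len))
      stays : ∀ {k} → k ∈ upTo (suc (a ℕ.+ b)) → ((a ℕ.* xc p k) Defs.≤ᵇ (b ℕ.* yc p k)) ≡ true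
      stays {k} k∈ = <ᵇ-true⁺ (s≤s (ℤ.drop‿+≤+ (subst₂ _≤ℤ_ (ℤ.+-identityˡ _) (H-path p k (subst (k ≤_) (sym len) k≤))
        (ℤ.+-monoˡ-≤ (+ (a ℕ.* xc p k)) (nonneg D k k≤)))))
        where
        k≤ = ℕ.≤-pred (∈-upTo⁻ k∈)

    module _ (p : Path) (len : length p ≡ a ℕ.+ b) (D : Dyck (stepN p)) where
      private
        h : ℕ → ℤ
        h = H (stepN p)

      Region : ℕ → ℕ → Set
      Region k i = k < i × (∀ t → k < t → t ≤ i → h k <ℤ h t)

      inRegion⁻ : ∀ {k i} → i < a ℕ.+ b → inRegion a b p k i ≡ true → Region k i
      inRegion⁻ {k} {i} i<n eq with ∧-true⁻ {k <ᵇ i} eq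
      ... | e₁ , e₂ = k<i , up
        where
        k<i = <ᵇ-true⁻ e₁
        up : ∀ t → k < t → t ≤ i → h k <ℤ h t
        up t k<t t≤i = above⁻ p (subst (k ≤_) (sym len) (ℕ.<⇒≤ (ℕ.<-trans k<i i<n))) (subst (t ≤_) (sym len) (ℕ.≤-trans t≤i (ℕ.<⇒≤ i<n)))
          (subst (λ z → above a b p k z ≡ true) eq′ (allᵇ-true⁻ _ e₂ (∈-upTo⁺ lt)))
          where
          u = t ∸ suc k
          eq′ : k ℕ.+ suc u ≡ t
          eq′ = trans (ℕ.+-suc k u) (ℕ.m+[n∸m]≡n k<t)
          lt : u < i ∸ k
          lt = ℕ.+-cancelˡ-≤ k _ _ (subst₂ _≤_ (sym eq′) (sym (ℕ.m+[n∸m]≡n (ℕ.<⇒≤ k<i))) t≤i)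

      inRegion⁺ : ∀ {k i} → i < a ℕ.+ b → Region k i → inRegion a b p k i ≡ true
      inRegion⁺ {k} {i} i<n (k<i , up) = ∧-true⁺ (<ᵇ-true⁺ k<i) (allᵇ-true⁺ _ λ {u} u∈ →
        let t≤i = subst (k ℕ.+ suc u ≤_) (ℕ.m+[n∸m]≡n (ℕ.<⇒≤ k<i)) (ℕ.+-monoʳ-≤ k (∈-upTo⁻ u∈)) in
        above⁺ p {k} {k ℕ.+ suc u} (subst (k ≤_) (sym len) (ℕ.<⇒≤ (ℕ.<-trans k<i i<n))) (subst (k ℕ.+ suc u ≤_) (sym len) (ℕ.≤-trans t≤i (ℕ.<⇒≤ i<n)))
          (up (k ℕ.+ suc u) (ℕ.m<m+n k (s≤s z≤n)) t≤i))

      sameBlock-regions⁻ : ∀ i j → sameBlock a b p i j ≡ true → ∀ k → k < a ℕ.+ b → stepN p k ≡ true →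
        inRegion a b p k i ≡ inRegion a b p k j
      sameBlock-regions⁻ i j eq k k<n sk with allᵇ-true⁻ _ {upTo (a ℕ.+ b)} eq (∈-upTo⁺ k<n)
      ... | q rewrite sk with inRegion a b p k i | inRegion a b p k j
      ... | true  | true  = refl
      ... | false | false = refl
      ... | true  | false = sym q
      ... | false | true  = q

      sameBlock-regions⁺ : ∀ i j → (∀ k → k < a ℕ.+ b → stepN p k ≡ true → inRegion a b p k i ≡ inRegion a b p k j) →
        sameBlock a b p i j ≡ true
      sameBlock-regions⁺ i j eq with sameBlock a b p i j in e
      ... | true  = refl
      ... | false with allᵇ-false⁻ _ {upTo (a ℕ.+ b)} e
      ... | k , k∈ , q with stepN p k in sk
      ... | true rewrite eq k (∈-upTo⁻ k∈) sk with inRegion a b p k j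
      ...   | true  = sym q
      ...   | false = sym q

      source-region : ∀ {i k} → Source h i k → Region k i
      source-region S = before S , λ t → source-below-between S

      -- A laser that cuts off `i` starts no later than the source `k`, and no higher than it. Up to
      -- `k` it stays below the path because it does so for `i`; after `k` every point up to `j` is
      -- higher than `k`.
      region-transfer : ∀ {i j k} → Source h i k → Source h j k → ∀ {l} → Region l i → Region l j
      region-transfer {i} {j} {k} Si Sj {l} (l<i , up) with source-latest Si l<i (up i l<i ℕ.≤-refl)
      ... | l≤k = ℕ.≤-<-trans l≤k (before Sj) , up′
        where
        up′ : ∀ t → l < t → t ≤ j → h l <ℤ h t
        up′ t l<t t≤j with t ℕ.≤? k
        ... | yes t≤k = up t l<t (ℕ.≤-trans t≤k (ℕ.<⇒≤ (before Si)))
        ... | no t≰k with ℕ.m≤n⇒m<n∨m≡n l≤k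
        ...   | inj₂ refl = source-below-between Sj (ℕ.≰⇒> t≰k) t≤j
        ...   | inj₁ l<k  = ℤ.<-trans (up k l<k (ℕ.<⇒≤ (before Si))) (source-below-between Sj (ℕ.≰⇒> t≰k) t≤j)

      source-north : ∀ {i k} → Source h i k → stepN p k ≡ true
      source-north {k = k} S = ascent⇒true 0<a (stepN p) k (source-below-between S ℕ.≤-refl (before S))

      -- A source is the south end of a north step, so it fires a laser. Its region contains its own
      -- point, hence also the other one, and so neither source can be later than the other.
      sameBlock⁻ : ∀ {i j} → 0 < i → 0 < j → i < a ℕ.+ b → j < a ℕ.+ b → sameBlock a b p i j ≡ true → SameSource h i j
      sameBlock⁻ {i} {j} 0<i 0<j i<n j<n eq with dyck-source D 0<i i<n | dyck-source D 0<j j<n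
      ... | k , Si | l , Sj = k , Si , subst (Source h j) (ℕ.≤-antisym l≤k k≤l) Sj
        where
        move : ∀ {x y m} → x < a ℕ.+ b → y < a ℕ.+ b → (∀ k → k < a ℕ.+ b → stepN p k ≡ true → inRegion a b p k x ≡ inRegion a b p k y) →
          Source h x m → Region m y
        move x<n y<n e S = inRegion⁻ y<n (trans (sym (e _ (ℕ.<-trans (before S) x<n) (source-north S))) (inRegion⁺ x<n (source-region S)))
        E = sameBlock-regions⁻ i j eq
        k≤l : k ≤ l
        k≤l with move i<n j<n E Si
        ... | k<j , up = source-latest Sj k<j (up j k<j ℕ.≤-refl)
        l≤k : l ≤ k
        l≤k with move j<n i<n (λ k k<n sk → sym (E k k<n sk)) Sj
        ... | l<i , up = source-latest Si l<i (up i l<i ℕ.≤-refl)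

      sameBlock⁺ : ∀ {i j} → i < a ℕ.+ b → j < a ℕ.+ b → SameSource h i j → sameBlock a b p i j ≡ true
      sameBlock⁺ {i} {j} i<n j<n (k , Si , Sj) = sameBlock-regions⁺ i j λ l _ _ → bool-ext
        (λ e → inRegion⁺ j<n (region-transfer Si Sj (inRegion⁻ i<n e)))
        (λ e → inRegion⁺ i<n (region-transfer Sj Si (inRegion⁻ j<n e)))

-- Partitions as periodic relations, represented by Dyck paths

module Partitions where

  open import Data.Bool using (Bool; true; false)
  open import Data.Nat as ℕ using (ℕ; zero; suc; _+_; _*_; _∸_; _≤_; _<_; z≤n; s≤s; NonZero; _%_)
  import Data.Nat.Properties as ℕ
  open import Data.Nat.DivMod using (_mod_; m%n<n; m%n%n≡m%n; m<n⇒m%n≡m; [m+kn]%n≡m%n; [m+n]%n≡m%n; %-distribˡ-+; %-congˡ)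
  open import Data.Nat.Coprimality using (Coprime)
  open import Data.Fin as Fin using (Fin; toℕ)
  open import Data.Fin.Properties using (toℕ-injective; toℕ-fromℕ<; toℕ<n; toℕ-fromℕ; toℕ-inject₁)
  open import Data.Vec using (Vec; tabulate; lookup)
  open import Data.Vec.Properties using (tabulate∘lookup; lookup∘tabulate; tabulate-cong)
  open import Data.List.Base using (map; length; applyUpTo)
  open import Data.List.Properties using (length-applyUpTo)
  open import Data.List.Membership.Propositional using (_∈_)
  open import Data.List.Membership.Propositional.Properties using (∈-map⁺; ∈-map⁻; ∈-deduplicate⁺; ∈-deduplicate⁻)
  import Data.Integer as ℤ
  import Data.Integer.Properties as ℤ
  open import Data.Empty using (⊥; ⊥-elim)
  open import Data.Sum using (inj₁; inj₂)
  open import Data.Product using (∃; _×_; _,_)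
  open import Relation.Binary.PropositionalEquality using (_≡_; refl; sym; trans; cong; cong₂; subst; subst₂; module ≡-Reasoning)
  open import Defs
  open Sources
  open Heights
  open LaserFire

  %-+-cong : ∀ n .{{_ : NonZero n}} {x x′ y y′} → x % n ≡ x′ % n → y % n ≡ y′ % n → (x + y) % n ≡ (x′ + y′) % n
  %-+-cong n {x} {x′} {y} {y′} e f = trans (%-distribˡ-+ x y n) (trans (cong₂ (λ u v → (u + v) % n) e f) (sym (%-distribˡ-+ x′ y′ n)))

  private
    total-shift : ∀ n .{{_ : NonZero n}} c i → c + (i + c * (n ∸ 1)) ≡ i + c * n
    total-shift n@(suc m) c i = begin
      c + (i + c * m)  ≡⟨ ℕ.+-comm c _ ⟩
      i + c * m + c    ≡⟨ ℕ.+-assoc i (c * m) c ⟩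
      i + (c * m + c)  ≡⟨ cong (i +_) (ℕ.+-comm (c * m) c) ⟩
      i + (c + c * m)  ≡⟨ cong (i +_) (sym (ℕ.*-suc c m)) ⟩
      i + c * suc m    ∎
      where open ≡-Reasoning

  -- `c * (n ∸ 1)` represents - c modulo `n`, so a shift by `c` is undone without subtracting.
  %-unshift : ∀ n .{{_ : NonZero n}} c i → (c + (i + c * (n ∸ 1))) % n ≡ i % n
  %-unshift n c i = trans (%-congˡ (total-shift n c i)) ([m+kn]%n≡m%n i c n)

  %-cancelˡ-+ : ∀ n .{{_ : NonZero n}} c {x y} → (c + x) % n ≡ (c + y) % n → x % n ≡ y % n
  %-cancelˡ-+ n c {x} {y} e = begin
    x % n              ≡⟨ sym (%-unshift n c x) ⟩
    (c + (x + z)) % n  ≡⟨ %-congˡ {o = n} (sym (ℕ.+-assoc c x z)) ⟩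
    (c + x + z) % n    ≡⟨ %-+-cong n e refl ⟩
    (c + y + z) % n    ≡⟨ %-congˡ {o = n} (ℕ.+-assoc c y z) ⟩
    (c + (y + z)) % n  ≡⟨ %-unshift n c y ⟩
    y % n              ∎
    where
    open ≡-Reasoning
    z = c * (n ∸ 1)

  module Relation {n : ℕ} .{{_ : NonZero n}} where

    -- Reading the matrix with indices modulo `n` gives a relation on all natural numbers, on which
    -- rotation acts as a translation. Index `x` stands for the label x + 1, which sits at the
    -- lattice point after x + 1 steps.
    rel : Partition n → ℕ → ℕ → Bool
    rel π x y = lookup (lookup π (x mod n)) (y mod n)

    toℕ-mod : ∀ x → toℕ (x mod n) ≡ x % n
    toℕ-mod x = toℕ-fromℕ< (m%n<n x n)

    mod-cong : ∀ {x x′} → x % n ≡ x′ % n → x mod n ≡ x′ mod n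
    mod-cong e = toℕ-injective (trans (toℕ-mod _) (trans e (sym (toℕ-mod _))))

    mod-toℕ : ∀ (i : Fin n) → toℕ i mod n ≡ i
    mod-toℕ i = toℕ-injective (trans (toℕ-mod _) (m<n⇒m%n≡m (toℕ<n i)))

    rel-cong : ∀ π {x x′ y y′} → x % n ≡ x′ % n → y % n ≡ y′ % n → rel π x y ≡ rel π x′ y′
    rel-cong π e f = cong₂ (λ i j → lookup (lookup π i) j) (mod-cong e) (mod-cong f)

    vec-ext : ∀ {A : Set} {m} {u v : Vec A m} → (∀ i → lookup u i ≡ lookup v i) → u ≡ v
    vec-ext {u = u} {v} eq = trans (sym (tabulate∘lookup u)) (trans (tabulate-cong eq) (tabulate∘lookup v))

    rel-ext : ∀ {π π′} → (∀ i j → i < n → j < n → rel π i j ≡ rel π′ i j) → π ≡ π′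
    rel-ext {π} {π′} eq = vec-ext λ i → vec-ext λ j →
      trans (cong₂ (λ i j → lookup (lookup π i) j) (sym (mod-toℕ i)) (sym (mod-toℕ j)))
      (trans (eq (toℕ i) (toℕ j) (toℕ<n i) (toℕ<n j))
      (cong₂ (λ i j → lookup (lookup π′ i) j) (mod-toℕ i) (mod-toℕ j)))

    rel-tabulate : ∀ (f : Fin n → Fin n → Bool) x y → rel (tabulate λ i → tabulate λ j → f i j) x y ≡ f (x mod n) (y mod n)
    rel-tabulate f x y = trans (cong (λ v → lookup v (y mod n)) (lookup∘tabulate _ (x mod n))) (lookup∘tabulate _ (y mod n))

    suc-predMod : ∀ {m} .{{_ : NonZero m}} (i : Fin m) → suc (toℕ (predMod i)) % m ≡ toℕ i % m
    suc-predMod {suc m} Fin.zero    rewrite toℕ-fromℕ m = [m+n]%n≡m%n 0 (suc m)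
    suc-predMod {suc m} (Fin.suc i) rewrite toℕ-inject₁ i = refl

    predMod-suc : ∀ x → predMod (suc x mod n) ≡ x mod n
    predMod-suc x = toℕ-injective (begin
      toℕ j          ≡⟨ sym (m<n⇒m%n≡m (toℕ<n j)) ⟩
      toℕ j % n      ≡⟨ %-cancelˡ-+ n 1 {toℕ j} {x} (trans (suc-predMod (suc x mod n)) (trans (cong (_% n) (toℕ-mod (suc x))) (m%n%n≡m%n (suc x) n))) ⟩
      x % n          ≡⟨ sym (toℕ-mod x) ⟩
      toℕ (x mod n)  ∎)
      where
      open ≡-Reasoning
      j = predMod (suc x mod n)

    rel-rotate : ∀ π x y → rel (rotate π) (suc x) (suc y) ≡ rel π x y
    rel-rotate π x y = trans (rel-tabulate _ (suc x) (suc y))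
      (cong₂ (λ i j → lookup (lookup π i) j) (predMod-suc x) (predMod-suc y))

    rel-iterate : ∀ d π x y → rel (iterate rotate d π) (d + x) (d + y) ≡ rel π x y
    rel-iterate zero    π x y = refl
    rel-iterate (suc d) π x y = trans (rel-rotate (iterate rotate d π) (d + x) (d + y)) (rel-iterate d π x y)

    Invariant : ℕ → Partition n → Set
    Invariant d π = ∀ x y → rel π (d + x) (d + y) ≡ rel π x y

    fixed⇒invariant : ∀ d {π} → iterate rotate d π ≡ π → Invariant d π
    fixed⇒invariant d {π} fix x y = trans (cong (λ σ → rel σ (d + x) (d + y)) (sym fix)) (rel-iterate d π x y)

    invariant⇒fixed : ∀ d {π} → Invariant d π → iterate rotate d π ≡ π
    invariant⇒fixed d {π} inv = rel-ext λ i j _ _ → begin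
      rel (iterate rotate d π) i j                  ≡⟨ sym (rel-cong (iterate rotate d π) (%-unshift n d i) (%-unshift n d j)) ⟩
      rel (iterate rotate d π) (d + i′ i) (d + i′ j) ≡⟨ rel-iterate d π (i′ i) (i′ j) ⟩
      rel π (i′ i) (i′ j)                           ≡⟨ sym (inv (i′ i) (i′ j)) ⟩
      rel π (d + i′ i) (d + i′ j)                   ≡⟨ rel-cong π (%-unshift n d i) (%-unshift n d j) ⟩
      rel π i j                                     ∎
      where
      open ≡-Reasoning
      i′ : ℕ → ℕ
      i′ i = i + d * (n ∸ 1)

  module LaserPartitions (a b : ℕ) (0<a : 0 < a) (0<b : 0 < b) (cop : Coprime a b) where
    open Laser a b 0<a 0<b cop public

    n : ℕ
    n = a + b ∸ 1

    suc-n : suc n ≡ a + b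
    suc-n = ℕ.m+[n∸m]≡n (ℕ.≤-trans 0<a (ℕ.m≤m+n a b))

    0<n : 0 < n
    0<n = ℕ.≤-pred (subst (2 ≤_) (sym suc-n) (ℕ.+-mono-≤ 0<a 0<b))

    instance
      n-nonZero : NonZero n
      n-nonZero = ℕ.>-nonZero 0<n

    open Relation {n} public

    <n⇒<a+b : ∀ {i} → i < n → suc i < a + b
    <n⇒<a+b {i} i<n = subst (suc i <_) suc-n (s≤s i<n)

    record Represents (s : Steps) (π : Partition n) : Set where
      constructor represents
      field
        to   : ∀ {i j} → i < n → j < n → rel π i j ≡ true → SameSource (H s) (suc i) (suc j)
        from : ∀ {i j} → i < n → j < n → SameSource (H s) (suc i) (suc j) → rel π i j ≡ true
    open Represents public

    laserPartition-represents : ∀ {p} → length p ≡ a + b → Dyck (stepN p) → Represents (stepN p) (laserPartition a b p)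
    laserPartition-represents {p} len D = represents
      (λ i<n j<n eq → sameBlock⁻ p len D (s≤s z≤n) (s≤s z≤n) (<n⇒<a+b i<n) (<n⇒<a+b j<n) (trans (sym (entry i<n j<n)) eq))
      (λ i<n j<n ss → trans (entry i<n j<n) (sameBlock⁺ p len D (<n⇒<a+b i<n) (<n⇒<a+b j<n) ss))
      where
      toℕ-mod-< : ∀ {i} → i < n → toℕ (i mod n) ≡ i
      toℕ-mod-< {i} i<n = trans (toℕ-mod i) (m<n⇒m%n≡m i<n)
      entry : ∀ {i j} → i < n → j < n → rel (laserPartition a b p) i j ≡ sameBlock a b p (suc i) (suc j)
      entry {i} {j} i<n j<n = trans (rel-tabulate (λ x y → sameBlock a b p (suc (toℕ x)) (suc (toℕ y))) i j)
        (cong₂ (λ x y → sameBlock a b p (suc x) (suc y)) (toℕ-mod-< i<n) (toℕ-mod-< j<n))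

    ∈-HNC⁻ : ∀ {π} → π ∈ HNC a b → ∃ λ s → Dyck s × Represents s π
    ∈-HNC⁻ π∈ with ∈-map⁻ (laserPartition a b) (∈-deduplicate⁻ _≟ₚ_ (map (laserPartition a b) (DyckPaths a b)) π∈)
    ... | p , p∈ , refl with ∈-DyckPaths⁻ p∈
    ... | len , D = stepN p , D , laserPartition-represents len D

    laserPartition∈HNC : ∀ {p} → p ∈ DyckPaths a b → laserPartition a b p ∈ HNC a b
    laserPartition∈HNC p∈ = ∈-deduplicate⁺ _≟ₚ_ (∈-map⁺ (laserPartition a b) p∈)

    ∈-HNC⁺ : ∀ {s} → Dyck s → ∃ λ π → π ∈ HNC a b × Represents s π
    ∈-HNC⁺ {s} D = laserPartition a b p , laserPartition∈HNC (∈-DyckPaths⁺ len D′) , represents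
        (λ i<n j<n e → copy (<n⇒<a+b i<n) (<n⇒<a+b j<n) H≡ (to R i<n j<n e))
        (λ i<n j<n ss → from R i<n j<n (copy (<n⇒<a+b i<n) (<n⇒<a+b j<n) (λ t t≤ → sym (H≡ t t≤)) ss))
      where
      p = applyUpTo s (a + b)
      len = length-applyUpTo s (a + b)
      steps≡ : ∀ k → k < a + b → stepN p k ≡ s k
      steps≡ = stepN-applyUpTo s (a + b)
      D′ : Dyck (stepN p)
      D′ = dyck-cong (λ k k< → sym (steps≡ k k<)) D
      R = laserPartition-represents {p} len D′
      H≡ : ∀ t → t ≤ a + b → H (stepN p) t ≡ H s t
      H≡ = H-cong (a + b) steps≡
      copy : ∀ {f g x y} → x < a + b → y < a + b → (∀ t → t ≤ a + b → f t ≡ g t) → SameSource f x y → SameSource g x y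
      copy {f} {g} x< y< eq (k , S , S′) = k , move x< S , move y< S′
        where
        move : ∀ {x} → x < a + b → Source f x k → Source g x k
        move x< S = source (before S)
          (subst₂ ℤ._<_ (eq _ (ℕ.<⇒≤ (ℕ.<-trans (before S) x<))) (eq _ (ℕ.<⇒≤ x<)) (lower S))
          (λ t k<t t<x → subst₂ ℤ._≤_ (eq _ (ℕ.<⇒≤ x<)) (eq _ (ℕ.<⇒≤ (ℕ.<-trans t<x x<))) (between S t k<t t<x))

    -- Blocks are opened by north steps, so a Dyck path is read off from the minima of the blocks.
    north⁻ : ∀ {s π} → Represents s π → ∀ {i j} → i < n → s i ≡ true → j < i → rel π i j ≡ true → ⊥
    north⁻ {s} R {i} {j} i<n si j<i e with to R i<n (ℕ.<-trans j<i i<n) e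
    ... | k , Si , Sj with source-unique Si (source-of-ascent (H-ascent 0<b s i si))
    ... | refl = ℕ.<-irrefl refl (ℕ.<-≤-trans j<i (ℕ.≤-pred (before Sj)))

    -- An east step makes the point `suc i` lower than its predecessor, so `descent-sibling` finds
    -- an earlier point with the same source: the block is already open.
    east⁻ : ∀ {s π} → Dyck s → Represents s π → ∀ {i} → i < n → s i ≡ false → ∃ λ j → j < i × rel π i j ≡ true
    east⁻ {s} D R {i} i<n si with dyck-source D (s≤s z≤n) (<n⇒<a+b i<n)
    ... | k , S with descent-sibling (H-descent 0<a s i si) S
    ... | suc j , k<j , j≤i , S′ = j , j≤i , from R i<n (ℕ.<-trans j≤i i<n) (k , S , S′)

    last-east : ∀ {s} → Dyck s → s n ≡ false
    last-east {s} D with s n in e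
    ... | false = refl
    ... | true  = ⊥-elim (ℤ.<⇒≱ (H-ascent 0<b s n e)
                   (subst (ℤ._≤ H s n) (sym (trans (cong (H s) suc-n) (closed D))) (nonneg D n (subst (n ≤_) suc-n (ℕ.n≤1+n n)))))

    north-transfer : ∀ {s s′ π} → Dyck s′ → Represents s π → Represents s′ π → ∀ {k} → k < n → s k ≡ true → s′ k ≡ true
    north-transfer {s} {s′} {π} D′ R R′ {k} k<n sk = by-cases (s′ k) refl
      where
      by-cases : ∀ x → s′ k ≡ x → s′ k ≡ true
      by-cases true  e = e
      by-cases false e = ⊥-elim (clash (east⁻ D′ R′ k<n e))
        where
        clash : (∃ λ j → j < k × rel π k j ≡ true) → ⊥
        clash (j , j<k , r) = north⁻ {s} {π} R {k} {j} k<n sk j<k r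

    -- The minima of the blocks account for the first `n` steps. The one remaining step is invisible
    -- to the partition, but it is east in every Dyck path.
    steps-determined : ∀ {s s′ π} → Dyck s → Dyck s′ → Represents s π → Represents s′ π → ∀ k → k < a + b → s k ≡ s′ k
    steps-determined {s} {s′} D D′ R R′ k k<a+b with ℕ.m≤n⇒m<n∨m≡n (ℕ.≤-pred (subst (k <_) (sym suc-n) k<a+b))
    ... | inj₂ k≡n = subst (λ k → s k ≡ s′ k) (sym k≡n) (trans (last-east D) (sym (last-east D′)))
    ... | inj₁ k<n = bool-ext (north-transfer D′ R R′ k<n) (north-transfer D R′ R k<n)

-- Promotion of Dyck paths and closure under rotation

module Promotion where

  open import Data.Bool using (true; false; if_then_else_)
  open import Data.Nat as ℕ using (ℕ; zero; suc; _≤_; _<_; z≤n; s≤s; _∸_; _≡ᵇ_; _<ᵇ_; _%_)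
  import Data.Nat.Properties as ℕ
  open import Data.Nat.DivMod using (m%n<n; m%n%n≡m%n; [m+n]%n≡m%n; %-congˡ)
  open import Data.Nat.Coprimality using (Coprime)
  open import Data.Integer as ℤ using (ℤ; +_; -_; 0ℤ; _+_; _-_) renaming (_<_ to _<ℤ_; _≤_ to _≤ℤ_)
  import Data.Integer.Properties as ℤ
  open import Data.Integer.Tactic.RingSolver using (solve-∀)
  open import Data.List.Membership.Propositional using (_∈_)
  open import Data.Product using (∃; _×_; _,_; proj₁; proj₂)
  open import Data.Sum using (inj₁; inj₂)
  open import Data.Empty using (⊥-elim)
  open import Relation.Nullary using (¬_; yes; no)
  open import Relation.Binary.PropositionalEquality using (_≡_; _≢_; refl; sym; trans; cong; cong₂; subst; subst₂; module ≡-Reasoning)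
  open import Defs
  open Sources
  open Heights
  open LaserFire
  open Partitions

  -- Promotion drops the first (north) step, turns the first later step that ends below height b
  -- from east to north, and appends an east step.
  module Promote (a b : ℕ) (0<a : 0 < a) (0<b : 0 < b) (cop : Coprime a b) where
    open LaserPartitions a b 0<a 0<b cop

    module _ {s : Steps} (D : Dyck s) where

      1<a+b : 1 < a ℕ.+ b
      1<a+b = ℕ.+-mono-≤ 0<a 0<b

      first-north : s 0 ≡ true
      first-north = ascent⇒true 0<a s 0 (dyck-positive D (s≤s z≤n) 1<a+b)

      H1 : H s 1 ≡ + b
      H1 = trans (cong (λ x → 0ℤ + step x) first-north) (ℤ.+-identityˡ _)

      crossing : ∃ λ t → 1 ≤ t × t ≤ a ℕ.+ b × H s t <ℤ H s 1 × (∀ k → 1 ≤ k → k < t → ¬ (H s k <ℤ H s 1))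
      crossing = first-from (λ t → H s t ℤ.<? H s 1) (ℕ.<⇒≤ 1<a+b)
        (subst (_<ℤ H s 1) (sym (closed D)) (dyck-positive D (s≤s z≤n) 1<a+b))

      module _ (v : ℕ) (t≤a+b : suc (suc v) ≤ a ℕ.+ b) (drop : H s (suc (suc v)) <ℤ H s 1)
               (stay : ∀ k → 1 ≤ k → k < suc (suc v) → H s 1 ≤ℤ H s k) where

        t : ℕ
        t = suc (suc v)

        v<n : v < n
        v<n = ℕ.≤-pred (subst (t ≤_) (sym suc-n) t≤a+b)

        east-at-crossing : s (suc v) ≡ false
        east-at-crossing = descent⇒false 0<b s (suc v) (ℤ.<-≤-trans drop (stay (suc v) (s≤s z≤n) ℕ.≤-refl))

        s′ : Steps
        -- The step with index `suc v` in `s` ends at the crossing point `t`; it gets index `v` when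
        -- the first step is dropped.
        s′ i = if i ≡ᵇ v then true else (if i <ᵇ n then s (suc i) else false)

        s′-at : s′ v ≡ true
        s′-at rewrite T⇒≡true (ℕ.≡⇒≡ᵇ v v refl) = refl

        s′-off : ∀ {i} → i ≢ v → i < n → s′ i ≡ s (suc i)
        s′-off {i} i≢v i<n with i ≡ᵇ v in e
        ... | true  = ⊥-elim (i≢v (ℕ.≡ᵇ⇒≡ i v (≡true⇒T e)))
        ... | false rewrite <ᵇ-true⁺ i<n = refl

        s′-last : s′ n ≡ false
        s′-last with n ≡ᵇ v in e
        ... | true  = ⊥-elim (ℕ.<-irrefl (sym (ℕ.≡ᵇ⇒≡ n v (≡true⇒T e))) v<n)
        ... | false with n <ᵇ n in e′
        ...   | true  = ⊥-elim (ℕ.<-irrefl refl (<ᵇ-true⁻ {n} {n} e′))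
        ...   | false = refl

        early : Translate (H s′) (H s) 0 1 (0ℤ - H s 1) v
        early = agree-translate {s′} {s} 0 1 v λ i i<v → s′-off (λ e → ℕ.<-irrefl e i<v) (ℕ.<-trans i<v v<n)

        H′v : H s′ v ≡ H s t + + a + - + b
        H′v = trans (early v ℕ.≤-refl) (trans (cong (λ z → H s (suc v) + (0ℤ - z)) H1)
                (trans (lemma (H s (suc v)) (+ a) (+ b)) (cong (λ z → z + + a + - + b) (sym Ht))))
          where
          Ht : H s t ≡ H s (suc v) + - + a
          Ht = cong (λ x → H s (suc v) + step x) east-at-crossing
          lemma : ∀ h a b → h + (0ℤ - b) ≡ h + - a + a + - b
          lemma = solve-∀

        -- The dropped north step costs `b`, and the step turned from east to north gains a + b, so
        -- after the crossing the heights are larger by `a`.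
        late : Translate (H s′) (H s) (suc v) t (+ a) (n ∸ suc v)
        late i i≤ = trans (agree-translate {s′} {s} (suc v) t (n ∸ suc v) agree i i≤) (cong (λ z → H s (t ℕ.+ i) + z) d≡a)
          where
          agree : ∀ i → i < n ∸ suc v → s′ (suc v ℕ.+ i) ≡ s (t ℕ.+ i)
          agree i i< = s′-off (λ e → ℕ.<-irrefl (sym e) (s≤s (ℕ.m≤m+n v i)))
            (subst (suc v ℕ.+ i <_) (ℕ.m+[n∸m]≡n v<n) (ℕ.+-monoʳ-< (suc v) i<))
          d≡a : H s′ (suc v) - H s t ≡ + a
          d≡a = trans (cong (_- H s t) (trans (cong (λ x → H s′ v + step x) s′-at) (cong (_+ + b) H′v))) (lemma (H s t) (+ a) (+ b))
            where
            lemma : ∀ h a b → h + a + - b + b - h ≡ a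
            lemma = solve-∀

        H′-late : ∀ {x} → v < x → x ≤ n → H s′ x ≡ H s (suc x) + + a
        H′-late {x} v<x x≤n = subst (λ x → H s′ x ≡ H s (suc x) + + a) (ℕ.m+[n∸m]≡n v<x) (late (x ∸ suc v) (ℕ.∸-monoˡ-≤ (suc v) x≤n))

        H′-end : H s′ n ≡ + a
        H′-end = trans (H′-late v<n ℕ.≤-refl) (trans (cong (_+ + a) (trans (cong (H s) suc-n) (closed D))) (ℤ.+-identityˡ _))

        promoted-dyck : Dyck s′
        promoted-dyck = dyck nn cl
          where
          cl : H s′ (a ℕ.+ b) ≡ 0ℤ
          cl = trans (cong (H s′) (sym suc-n)) (trans (cong₂ (λ h x → h + step x) H′-end s′-last) (ℤ.+-inverseʳ (+ a)))
          nn : ∀ k → k ≤ a ℕ.+ b → 0ℤ ≤ℤ H s′ k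
          nn k k≤ with k ℕ.≤? v
          ... | yes k≤v = subst (0ℤ ≤ℤ_) (sym (early k k≤v)) (subst (_≤ℤ H s (suc k) + (0ℤ - H s 1)) (lemma (H s 1))
                            (ℤ.+-monoˡ-≤ (0ℤ - H s 1) (stay (suc k) (s≤s z≤n) (s≤s (s≤s k≤v)))))
            where
            lemma : ∀ h → h + (0ℤ - h) ≡ 0ℤ
            lemma = solve-∀
          ... | no k≰v with ℕ.m≤n⇒m<n∨m≡n k≤
          ...   | inj₂ k≡ = ℤ.≤-reflexive (sym (trans (cong (H s′) k≡) cl))
          ...   | inj₁ k< = subst (0ℤ ≤ℤ_) (sym (H′-late (ℕ.≰⇒> k≰v) (ℕ.≤-pred (subst (k <_) (sym suc-n) k<))))
                              (ℤ.+-mono-≤ (nonneg D (suc k) k<) (ℤ.+≤+ z≤n))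

        -- The effect on sources. The block rooted at the origin is now opened by the new north step
        -- at `v`, and its label 1 has become label `n`; every other source moves one place to the
        -- left.
        φ : ℕ → ℕ
        φ zero    = v
        φ (suc k) = k

        H′v<a : H s′ v <ℤ + a
        H′v<a = subst₂ _<ℤ_ (sym H′v) (lemma (+ a) (+ b)) (ℤ.+-monoˡ-< (- + b) (ℤ.+-monoˡ-< (+ a) (subst (H s t <ℤ_) H1 drop)))
          where
          lemma : ∀ a b → b + a + - b ≡ a
          lemma = solve-∀

        promote-last : Source (H s′) n v
        promote-last = source v<n (subst (H s′ v <ℤ_) (sym H′-end) H′v<a) λ j v<j j<n →
          subst₂ _≤ℤ_ (trans (ℤ.+-identityˡ _) (sym H′-end)) (sym (H′-late v<j (ℕ.<⇒≤ j<n)))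
            (ℤ.+-monoˡ-≤ (+ a) (nonneg D (suc j) (subst (suc j ≤_) suc-n (s≤s (ℕ.<⇒≤ j<n)))))

        -- A point before the crossing lies above height `b`, so the origin is not its source, and
        -- its source is merely relocated. A point after the crossing cannot have its source among
        -- the points 1, ..., v + 1, because these are all higher than the crossing point `t`.
        promote-source : ∀ {x k} → 0 < x → x < n → Source (H s) (suc x) k → Source (H s′) x (φ k)
        promote-source {x} {k} 0<x x<n S with x ℕ.≤? v
        promote-source {x} {zero} 0<x x<n S | yes x≤v =
          ⊥-elim (ℤ.<⇒≱ (ℤ.≤∧≢⇒< (stay (suc x) (s≤s z≤n) (s≤s (s≤s x≤v)))
                           (H-distinct cop s (s≤s 0<x) (s≤s (ℕ.<-trans x<n (ℕ.≤-reflexive suc-n)))))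
                        (between S 1 (s≤s z≤n) (s≤s 0<x)))
        promote-source {x} {suc k} 0<x x<n S | yes x≤v = translate-source early {x} {k} x≤v S
        promote-source {x} {zero} 0<x x<n S | no x≰v = source v<x
            (ℤ.<-trans H′v<a (subst₂ _<ℤ_ (ℤ.+-identityˡ _) (sym (H′-late v<x (ℕ.<⇒≤ x<n))) (ℤ.+-monoˡ-< (+ a) (dyck-positive D (s≤s z≤n) (<n⇒<a+b x<n)))))
            λ j v<j j<x → subst₂ _≤ℤ_ (sym (H′-late v<x (ℕ.<⇒≤ x<n))) (sym (H′-late v<j (ℕ.<⇒≤ (ℕ.<-trans j<x x<n))))
              (ℤ.+-monoˡ-≤ (+ a) (between S (suc j) (s≤s z≤n) (s≤s j<x)))
          where
          v<x = ℕ.≰⇒> x≰v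
        promote-source {x} {suc k} 0<x x<n S | no x≰v = subst₂ (Source (H s′)) x≡ k≡
            (translate-source late {x ∸ suc v} {suc k ∸ t} (ℕ.∸-monoˡ-≤ (suc v) (ℕ.<⇒≤ x<n))
              (subst₂ (Source (H s)) (sym (cong suc x≡)) (sym (cong suc k≡)) S))
          where
          v<x = ℕ.≰⇒> x≰v
          t≤k : t ≤ suc k
          t≤k with t ℕ.≤? suc k
          ... | yes t≤k = t≤k
          ... | no t≰k  = ⊥-elim (ℤ.<⇒≱ (ℤ.<-trans (lower S) (ℤ.≤-<-trans low drop)) (stay (suc k) (s≤s z≤n) (ℕ.≰⇒> t≰k)))
            where
            low : H s (suc x) ≤ℤ H s t
            low with ℕ.m≤n⇒m<n∨m≡n v<x
            ... | inj₂ refl = ℤ.≤-refl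
            ... | inj₁ t≤x  = between S t (ℕ.≰⇒> t≰k) (s≤s t≤x)
          x≡ : suc v ℕ.+ (x ∸ suc v) ≡ x
          x≡ = ℕ.m+[n∸m]≡n v<x
          k≡ : suc v ℕ.+ (suc k ∸ t) ≡ k
          k≡ = ℕ.m+[n∸m]≡n (ℕ.≤-pred t≤k)

        -- The step after point v + 1 is east, so that point is nobody's source and φ stays injective on sources.
        φ-injective : ∀ {x y k l} → Source (H s) x k → Source (H s) y l → φ k ≡ φ l → k ≡ l
        φ-injective {k = zero}  {zero}  _  _  _    = refl
        φ-injective {k = suc k} {suc l} _  _  refl = refl
        φ-injective {k = zero}  {suc l} _  Sl refl = ⊥-elim (ℤ.<-asym (source-below-between Sl ℕ.≤-refl (before Sl)) (H-descent 0<a s (suc v) east-at-crossing))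
        φ-injective {k = suc k} {zero}  Sk _  refl = ⊥-elim (ℤ.<-asym (source-below-between Sk ℕ.≤-refl (before Sk)) (H-descent 0<a s (suc v) east-at-crossing))

        -- The position in the old path of the label now at position `x`; the wrap-around sends `n`
        -- to 1.
        preimage : ℕ → ℕ
        preimage x = if x <ᵇ n then suc x else 1

        preimage-< : ∀ {x} → x < n → preimage x ≡ suc x
        preimage-< x<n rewrite <ᵇ-true⁺ x<n = refl

        preimage-n : preimage n ≡ 1
        preimage-n with n <ᵇ n in e
        ... | true  = ⊥-elim (ℕ.<-irrefl refl (<ᵇ-true⁻ {n} {n} e))
        ... | false = refl

        promoted : ∀ {x} → 0 < x → x ≤ n → ∃ λ k → Source (H s) (preimage x) k × Source (H s′) x (φ k)
        promoted {x} 0<x x≤n with ℕ.m≤n⇒m<n∨m≡n x≤n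
        ... | inj₂ refl = 0 , subst (λ y → Source (H s) y 0) (sym preimage-n) (source-of-ascent (H-ascent 0<b s 0 first-north)) , promote-last
        ... | inj₁ x<n with dyck-source D {suc x} (s≤s z≤n) (<n⇒<a+b x<n)
        ...   | k , S = k , subst (λ y → Source (H s) y k) (sym (preimage-< x<n)) S , promote-source 0<x x<n S

        promoted-same : ∀ {x y} → 0 < x → x ≤ n → 0 < y → y ≤ n → SameSource (H s) (preimage x) (preimage y) → SameSource (H s′) x y
        promoted-same {x} {y} 0<x x≤n 0<y y≤n (k , Sx , Sy) with promoted 0<x x≤n | promoted 0<y y≤n
        ... | k₁ , Sx′ , Tx | k₂ , Sy′ , Ty = φ k , subst (λ z → Source (H s′) x (φ z)) (source-unique Sx′ Sx) Tx
                                                  , subst (λ z → Source (H s′) y (φ z)) (source-unique Sy′ Sy) Ty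

        promoted-same⁻ : ∀ {x y} → 0 < x → x ≤ n → 0 < y → y ≤ n → SameSource (H s′) x y → SameSource (H s) (preimage x) (preimage y)
        promoted-same⁻ {x} {y} 0<x x≤n 0<y y≤n (k , Tx , Ty) with promoted 0<x x≤n | promoted 0<y y≤n
        ... | k₁ , Sx , Tx′ | k₂ , Sy , Ty′ = k₁ , Sx , subst (Source (H s) (preimage y))
              (φ-injective Sy Sx (trans (source-unique Ty′ Ty) (source-unique Tx Tx′))) Sy

      promotion : ∃ λ s′ → Dyck s′ × ∃ λ (pre : ℕ → ℕ) → (∀ {x} → x < n → pre x ≡ suc x) × pre n ≡ 1 ×
        (∀ {x y} → 0 < x → x ≤ n → 0 < y → y ≤ n →
          (SameSource (H s) (pre x) (pre y) → SameSource (H s′) x y) × (SameSource (H s′) x y → SameSource (H s) (pre x) (pre y)))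
      promotion with crossing
      ... | suc zero , _ , _ , lt , _ = ⊥-elim (ℤ.<-irrefl refl lt)
      ... | suc (suc v) , _ , t≤ , drop , stay = s′ v t≤ drop stay′ , promoted-dyck v t≤ drop stay′
          , preimage v t≤ drop stay′ , (λ x<n → preimage-< v t≤ drop stay′ x<n) , preimage-n v t≤ drop stay′
          , λ p q p′ q′ → promoted-same v t≤ drop stay′ p q p′ q′ , promoted-same⁻ v t≤ drop stay′ p q p′ q′
        where
        stay′ : ∀ k → 1 ≤ k → k < suc (suc v) → H s 1 ≤ℤ H s k
        stay′ k 1≤k k<t = ℤ.≮⇒≥ (stay k 1≤k k<t)

    -- The required partition belongs to the promotion of a path that represents `π`. Indices are
    -- first reduced modulo `n`, since a path knows only the labels of one turn.
    HNC-unrotate : ∀ {π} → π ∈ HNC a b → ∃ λ π′ → π′ ∈ HNC a b × (∀ x y → rel π′ x y ≡ rel π (suc x) (suc y))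
    HNC-unrotate {π} π∈ = from-steps (∈-HNC⁻ π∈)
      where
      from-steps : (∃ λ s → Dyck s × Represents s π) → ∃ λ π′ → π′ ∈ HNC a b × (∀ x y → rel π′ x y ≡ rel π (suc x) (suc y))
      from-steps (s , D , R) = from-promotion (promotion D)
        where
        from-promotion : _ → _
        from-promotion (s′ , D′ , pre , pre< , pre-n , same) = from-partition (∈-HNC⁺ D′)
          where
          from-partition : (∃ λ π′ → π′ ∈ HNC a b × Represents s′ π′) → _
          from-partition (π′ , π′∈ , R′) = π′ , π′∈ , λ x y → begin
              rel π′ x y                         ≡⟨ rel-cong π′ (sym (m%n%n≡m%n x n)) (sym (m%n%n≡m%n y n)) ⟩
              rel π′ (x % n) (y % n)             ≡⟨ small (m%n<n x n) (m%n<n y n) ⟩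
              rel π (suc (x % n)) (suc (y % n))  ≡⟨ rel-cong π (%-+-cong n {1} {1} refl (m%n%n≡m%n x n)) (%-+-cong n {1} {1} refl (m%n%n≡m%n y n)) ⟩
              rel π (suc x) (suc y)              ∎
            where
            open ≡-Reasoning
            index : ∀ {i} → i < n → ∃ λ j → j < n × suc j ≡ pre (suc i) × suc i % n ≡ j % n
            index {i} i<n with ℕ.m≤n⇒m<n∨m≡n i<n
            ... | inj₁ 1+i<n = suc i , 1+i<n , sym (pre< 1+i<n) , refl
            ... | inj₂ 1+i≡n = 0 , 0<n , trans (sym pre-n) (cong pre (sym 1+i≡n)) , trans (%-congˡ {o = n} 1+i≡n) ([m+n]%n≡m%n 0 n)
            small : ∀ {i j} → i < n → j < n → rel π′ i j ≡ rel π (suc i) (suc j)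
            small {i} {j} i<n j<n = compare (index i<n) (index j<n)
              where
              compare : (∃ λ k → k < n × suc k ≡ pre (suc i) × suc i % n ≡ k % n) → (∃ λ k → k < n × suc k ≡ pre (suc j) × suc j % n ≡ k % n) →
                rel π′ i j ≡ rel π (suc i) (suc j)
              compare (i′ , i′<n , ei , fi) (j′ , j′<n , ej , fj) = trans (bool-ext
                  (λ e → from R i′<n j′<n (subst₂ (SameSource (H s)) (sym ei) (sym ej) (proj₂ eqv (to R′ i<n j<n e))))
                  (λ e → from R′ i<n j<n (proj₁ eqv (subst₂ (SameSource (H s)) ei ej (to R i′<n j′<n e)))))
                  (rel-cong π (sym fi) (sym fj))
                where
                eqv = same {suc i} {suc j} (s≤s z≤n) i<n (s≤s z≤n) j<n

    HNC-shift : ∀ c {π} → π ∈ HNC a b → ∃ λ π′ → π′ ∈ HNC a b × (∀ x y → rel π′ x y ≡ rel π (c ℕ.+ x) (c ℕ.+ y))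
    HNC-shift zero    {π} π∈ = π , π∈ , λ _ _ → refl
    HNC-shift (suc c) {π} π∈ = once (HNC-shift c π∈)
      where
      once : (∃ λ π′ → π′ ∈ HNC a b × (∀ x y → rel π′ x y ≡ rel π (c ℕ.+ x) (c ℕ.+ y))) →
             ∃ λ π″ → π″ ∈ HNC a b × (∀ x y → rel π″ x y ≡ rel π (suc c ℕ.+ x) (suc c ℕ.+ y))
      once (π′ , π′∈ , eq) = twice (HNC-unrotate π′∈)
        where
        twice : (∃ λ π″ → π″ ∈ HNC a b × (∀ x y → rel π″ x y ≡ rel π′ (suc x) (suc y))) → _
        twice (π″ , π″∈ , eq′) = π″ , π″∈ , λ x y → trans (eq′ x y) (trans (eq (suc x) (suc y))
          (cong₂ (rel π) (ℕ.+-suc c x) (ℕ.+-suc c y)))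

-- Periodic step sequences and their blocks

module PeriodicPaths where

  open import Data.Bool using (true; false)
  open import Data.Nat as ℕ using (ℕ; zero; suc; _≤_; _<_; z≤n; s≤s; _∸_; NonZero; _%_)
  import Data.Nat.Properties as ℕ
  open import Data.Nat.DivMod using (m<n⇒m%n≡m; [m+kn]%n≡m%n; m≡m%n+[m/n]*n; _/_)
  open import Data.Nat.Induction using (<-rec)
  open import Data.Integer as ℤ using (ℤ; +_; -_; 0ℤ; _+_; _-_) renaming (_<_ to _<ℤ_; _≤_ to _≤ℤ_)
  import Data.Integer.Properties as ℤ
  open import Data.Integer.Tactic.RingSolver using (solve-∀)
  import Data.Nat.Tactic.RingSolver as ℕSolver
  open import Data.Product using (∃; _×_; _,_)
  open import Data.Sum using (_⊎_; inj₁; inj₂)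
  open import Data.Empty using (⊥-elim)
  open import Relation.Nullary using (¬_; yes; no)
  open import Relation.Binary.Definitions using (tri<; tri≈; tri>)
  open import Relation.Binary.PropositionalEquality using (_≡_; refl; sym; trans; cong; subst; subst₂)
  open Sources
  open Heights
  open LaserFire
  open Partitions using (%-+-cong; %-cancelˡ-+)

  %-window : ∀ n .{{_ : NonZero n}} {x y} → x % n ≡ y % n → x ≤ y → y < x ℕ.+ n → x ≡ y
  %-window n {x} {y} eq x≤y y<x+n = trans (sym (ℕ.+-identityʳ x)) (trans (cong (x ℕ.+_) (sym d≡0)) x+d≡y)
    where
    d = y ∸ x
    x+d≡y : x ℕ.+ d ≡ y
    x+d≡y = ℕ.m+[n∸m]≡n x≤y
    d<n : d < n
    d<n = ℕ.+-cancelˡ-< x _ _ (subst (_< x ℕ.+ n) (sym x+d≡y) y<x+n)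
    d≡0 : d ≡ 0
    d≡0 = trans (sym (m<n⇒m%n≡m d<n)) (trans (%-cancelˡ-+ n x {d} {0} (trans (cong (_% n) x+d≡y) (trans (sym eq) (cong (_% n) (sym (ℕ.+-identityʳ x))))))
            (m<n⇒m%n≡m (ℕ.≤-trans (s≤s z≤n) d<n)))

  periodic-* : ∀ {A : Set} {f : ℕ → A} {m} → (∀ x → f (m ℕ.+ x) ≡ f x) → ∀ q x → f (q ℕ.* m ℕ.+ x) ≡ f x
  periodic-* per zero    x = refl
  periodic-* {f = f} {m} per (suc q) x = trans (cong f (ℕ.+-assoc m (q ℕ.* m) x)) (trans (per (q ℕ.* m ℕ.+ x)) (periodic-* per q x))

  -- Adding `B` periods moves any argument beyond `B`. This is how statements proved only far from 0
  -- become valid everywhere.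
  periodic-≡ : ∀ {A : Set} {f g : ℕ → A} {m} .{{_ : NonZero m}} → (∀ x → f (m ℕ.+ x) ≡ f x) → (∀ x → g (m ℕ.+ x) ≡ g x) →
    ∀ B → (∀ x → B ≤ x → f x ≡ g x) → ∀ x → f x ≡ g x
  periodic-≡ {m = m} pf pg B eq x = trans (sym (periodic-* pf B x)) (trans (eq (B ℕ.* m ℕ.+ x) (ℕ.≤-trans (ℕ.m≤m*n B m) (ℕ.m≤m+n _ x))) (periodic-* pg B x))

  count-period : ∀ {s m} → (∀ x → s (m ℕ.+ x) ≡ s x) → ∀ e → count s (e ℕ.* m) ≡ e ℕ.* count s m
  count-period per zero = refl
  count-period {s} {m} per (suc e) = trans (count-+ s m (e ℕ.* m)) (cong (count s m ℕ.+_) (trans (count-cong (e ℕ.* m) (λ t _ → per t)) (count-period per e)))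

  count-window : ∀ {s n} → (∀ x → s (n ℕ.+ x) ≡ s x) → ∀ c → count (λ t → s (c ℕ.+ t)) n ≡ count s n
  count-window {s} {n} per c = ℕ.+-cancelˡ-≡ (count s c) _ _ (trans (sym (count-+ s c n)) (trans (cong (count s) (ℕ.+-comm c n))
    (trans (count-+ s n c) (trans (ℕ.+-comm (count s n) _) (cong (ℕ._+ count s n) (count-cong c (λ t _ → per t)))))))

  -- Blocks of the rotation-invariant partition attached to an m-periodic sequence of steps: a point either has a
  -- source within the last m points, or it is central; all central points form one block.
  module PeriodicSteps (a b : ℕ) (0<a : 0 < a) (0<b : 0 < b) (m n : ℕ) .{{_ : NonZero n}} (0<m : 0 < m) (2m≤n : m ℕ.+ m ≤ n) (e : ℕ) (n≡em : n ≡ e ℕ.* m)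
                  (u : Steps) (per : ∀ x → u (m ℕ.+ x) ≡ u x) where
    open Height a b

    h : ℕ → ℤ
    h = H u

    Central : ℕ → Set
    Central x = ∀ k → k < x → x ≤ k ℕ.+ m → h x ≤ℤ h k

    record Near (x k : ℕ) : Set where
      constructor near
      field
        src   : Source h x k
        close : x ≤ k ℕ.+ m
    open Near public

    -- The points lie on the line that covers a circle of `n` labels. Sources need only agree modulo
    -- `n`, because a block may wrap around the circle.
    Linked : ℕ → ℕ → Set
    Linked x y = (Central x × Central y) ⊎ (∃ λ k → ∃ λ l → Near x k × Near y l × k % n ≡ l % n)

    h-period : ∀ x → h (m ℕ.+ x) ≡ h x + h m
    h-period x = trans (agree-translate {u} {u} m 0 x (λ t _ → per t) x ℕ.≤-refl) (lemma (h x) (h m))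
      where
      lemma : ∀ x m → x + (m - 0ℤ) ≡ x + m
      lemma = solve-∀

    shift : ∀ L → Translate h h m 0 (h m) L
    shift L t _ = h-period t

    Near⇒¬Central : ∀ {x k} → Near x k → ¬ Central x
    Near⇒¬Central N C = ℤ.<⇒≱ (lower (src N)) (C _ (before (src N)) (close N))

    near? : ∀ x → (∃ λ k → Near x k) ⊎ Central x
    near? x with bounded-any? (λ k → h k ℤ.<? h x) (x ∸ m) x
    ... | yes (c , x∸m≤c , c<x , lt) with source-exists {h} c<x lt
    ...   | k , c≤k , S = inj₁ (k , near S (ℕ.≤-trans (ℕ.m≤n+m∸n x m) (ℕ.≤-trans (ℕ.+-monoʳ-≤ m (ℕ.≤-trans x∸m≤c c≤k)) (ℕ.≤-reflexive (ℕ.+-comm m k)))))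
    near? x | no none = inj₂ λ k k<x x≤k+m → ℤ.≮⇒≥ λ lt →
      none (k , ℕ.≤-trans (ℕ.∸-monoˡ-≤ m x≤k+m) (ℕ.≤-reflexive (ℕ.m+n∸n≡m k m)) , k<x , lt)

    Near-shift : ∀ {x k} → Near x k → Near (m ℕ.+ x) (m ℕ.+ k)
    Near-shift {x} {k} (near S c) = near (translate-source (shift x) {x} {k} ℕ.≤-refl S) (ℕ.≤-trans (ℕ.+-monoʳ-≤ m c) (ℕ.≤-reflexive (sym (ℕ.+-assoc m k m))))

    Central-shift⁻ : ∀ {x} → Central (m ℕ.+ x) → Central x
    Central-shift⁻ {x} C k k<x x≤ = +-cancelʳ-≤ℤ (h m) (subst₂ _≤ℤ_ (h-period x) (h-period k)
      (C (m ℕ.+ k) (ℕ.+-monoʳ-< m k<x) (ℕ.≤-trans (ℕ.+-monoʳ-≤ m x≤) (ℕ.≤-reflexive (sym (ℕ.+-assoc m k m))))))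

    -- Below `m` there are fewer than `m` earlier points to compare with, so being central says less
    -- there; hence the bound on `x`.
    Central-shift⁺ : ∀ {x} → m ≤ x → Central x → Central (m ℕ.+ x)
    Central-shift⁺ {x} m≤x C k k< ≤k+m with ℕ.≤-trans (ℕ.≤-reflexive (ℕ.+-comm x m)) ≤k+m
    ... | x+m≤k+m = subst₂ _≤ℤ_ (sym (h-period x)) (trans (sym (h-period k′)) (cong h eq)) (ℤ.+-monoˡ-≤ (h m)
          (C k′ (ℕ.+-cancelˡ-< m _ _ (subst (_< m ℕ.+ x) (sym eq) k<)) (ℕ.≤-trans (ℕ.+-cancelʳ-≤ m _ _ x+m≤k+m) (ℕ.≤-reflexive (trans (sym eq) (ℕ.+-comm m k′))))))
      where
      k′ = k ∸ m
      eq : m ℕ.+ k′ ≡ k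
      eq = ℕ.m+[n∸m]≡n (ℕ.≤-trans m≤x (ℕ.+-cancelʳ-≤ m _ _ x+m≤k+m))

    Near-shift-* : ∀ q {x k} → Near x k → Near (q ℕ.* m ℕ.+ x) (q ℕ.* m ℕ.+ k)
    Near-shift-* zero    N = N
    Near-shift-* (suc q) {x} {k} N = subst₂ Near (sym (ℕ.+-assoc m (q ℕ.* m) x)) (sym (ℕ.+-assoc m (q ℕ.* m) k)) (Near-shift (Near-shift-* q N))

    Central-shift-* : ∀ q {x} → m ≤ x → Central x → Central (q ℕ.* m ℕ.+ x)
    Central-shift-* zero    m≤x C = C
    Central-shift-* (suc q) {x} m≤x C = subst Central (sym (ℕ.+-assoc m (q ℕ.* m) x))
      (Central-shift⁺ (ℕ.≤-trans m≤x (ℕ.m≤n+m x (q ℕ.* m))) (Central-shift-* q m≤x C))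

    Linked-sym : ∀ {x y} → Linked x y → Linked y x
    Linked-sym (inj₁ (C , C′)) = inj₁ (C′ , C)
    Linked-sym (inj₂ (k , l , N , N′ , eq)) = inj₂ (l , k , N′ , N , sym eq)

    Linked-shift : ∀ {x y} → m ≤ x → m ≤ y → Linked x y → Linked (m ℕ.+ x) (m ℕ.+ y)
    Linked-shift m≤x m≤y (inj₁ (C , C′)) = inj₁ (Central-shift⁺ m≤x C , Central-shift⁺ m≤y C′)
    Linked-shift m≤x m≤y (inj₂ (k , l , N , N′ , eq)) = inj₂ (m ℕ.+ k , m ℕ.+ l , Near-shift N , Near-shift N′ , %-+-cong n {m} {m} {k} {l} refl eq)

    qem≡qn : ∀ q → q ℕ.* e ℕ.* m ≡ q ℕ.* n
    qem≡qn q = trans (ℕ.*-assoc q e m) (cong (q ℕ.*_) (sym n≡em))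

    Linked-unshift : ∀ {x y} → m ≤ x → m ≤ y → Linked (m ℕ.+ x) (m ℕ.+ y) → Linked x y
    Linked-unshift m≤x m≤y (inj₁ (C , C′)) = inj₁ (Central-shift⁻ C , Central-shift⁻ C′)
    Linked-unshift {x} {y} m≤x m≤y (inj₂ (k , l , N , N′ , eq)) with near? x | near? y
    ... | inj₂ C | _ = ⊥-elim (Near⇒¬Central N (Central-shift⁺ m≤x C))
    ... | _ | inj₂ C = ⊥-elim (Near⇒¬Central N′ (Central-shift⁺ m≤y C))
    ... | inj₁ (k′ , M) | inj₁ (l′ , M′) with source-unique (src N) (src (Near-shift M)) | source-unique (src N′) (src (Near-shift M′))
    ...   | refl | refl = inj₂ (k′ , l′ , M , M′ , %-cancelˡ-+ n m eq)

    Linked-shift-n : ∀ q {x y} → m ≤ x → Linked x y → Linked (q ℕ.* n ℕ.+ x) y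
    Linked-shift-n q {x} m≤x (inj₁ (C , C′)) = inj₁ (subst (λ z → Central (z ℕ.+ x)) (qem≡qn q) (Central-shift-* (q ℕ.* e) m≤x C) , C′)
    Linked-shift-n q {x} m≤x (inj₂ (k , l , N , N′ , eq)) = inj₂ (q ℕ.* n ℕ.+ k , l
      , subst (λ z → Near (z ℕ.+ x) (z ℕ.+ k)) (qem≡qn q) (Near-shift-* (q ℕ.* e) N)
      , N′ , trans (trans (cong (_% n) (ℕ.+-comm (q ℕ.* n) k)) ([m+kn]%n≡m%n k q n)) eq)

    Near-unshift-n : ∀ q {x K} → m ≤ x → Near (q ℕ.* n ℕ.+ x) K → ∃ λ k → Near x k × K ≡ q ℕ.* n ℕ.+ k
    Near-unshift-n q {x} m≤x N with near? x
    ... | inj₁ (k , N′) = k , N′ , source-unique (src N) (src (subst (λ z → Near (z ℕ.+ x) (z ℕ.+ k)) (qem≡qn q) (Near-shift-* (q ℕ.* e) N′)))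
    ... | inj₂ C = ⊥-elim (Near⇒¬Central N (subst (λ z → Central (z ℕ.+ x)) (qem≡qn q) (Central-shift-* (q ℕ.* e) m≤x C)))

    Central-unshift-n : ∀ q {x} → Central (q ℕ.* n ℕ.+ x) → Central x
    Central-unshift-n q {x} C with near? x
    ... | inj₂ C′ = C′
    ... | inj₁ (k , N) = ⊥-elim (Near⇒¬Central (subst (λ z → Near (z ℕ.+ x) (z ℕ.+ k)) (qem≡qn q) (Near-shift-* (q ℕ.* e) N)) C)

    Linked-unshift-n : ∀ q {x y} → m ≤ x → Linked (q ℕ.* n ℕ.+ x) y → Linked x y
    Linked-unshift-n q m≤x (inj₁ (C , C′)) = inj₁ (Central-unshift-n q C , C′)
    Linked-unshift-n q m≤x (inj₂ (K , l , N , N′ , eq)) with Near-unshift-n q m≤x N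
    ... | k , N″ , refl = inj₂ (k , l , N″ , N′ , trans (sym (trans (cong (_% n) (ℕ.+-comm (q ℕ.* n) k)) ([m+kn]%n≡m%n k q n))) eq)

    Linked-cong-% : ∀ {x x′ y} → m ≤ x → m ≤ x′ → x % n ≡ x′ % n → Linked x y → Linked x′ y
    -- Both points are compared with their common residue raised by `n`; the extra `n` keeps this
    -- representative at or above `m`.
    Linked-cong-% {x} {x′} {y} m≤x m≤x′ eq L = Linked-unshift-n 1 m≤x′ (subst (λ z → Linked z y) (expand x′)
        (Linked-shift-n (x′ / n) {n ℕ.+ x′ % n} m≤n+r (subst (λ r → Linked (n ℕ.+ r) y) eq
          (Linked-unshift-n (x / n) {n ℕ.+ x % n} (ℕ.≤-trans m≤n (ℕ.m≤m+n n _)) (subst (λ z → Linked z y) (sym (expand x)) (Linked-shift-n 1 m≤x L))))))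
      where
      m≤n : m ≤ n
      m≤n = ℕ.≤-trans (ℕ.m≤m+n m m) 2m≤n
      m≤n+r : m ≤ n ℕ.+ x′ % n
      m≤n+r = ℕ.≤-trans m≤n (ℕ.m≤m+n n _)
      expand : ∀ x → x / n ℕ.* n ℕ.+ (n ℕ.+ x % n) ≡ 1 ℕ.* n ℕ.+ x
      expand x = trans (rearrange (x / n ℕ.* n) n (x % n)) (trans (cong (n ℕ.+_) (sym (m≡m%n+[m/n]*n x n))) (cong (ℕ._+ x) (sym (ℕ.+-identityʳ n))))
        where
        rearrange : ∀ q n r → q ℕ.+ (n ℕ.+ r) ≡ n ℕ.+ (r ℕ.+ q)
        rearrange = ℕSolver.solve-∀

    north⇒near : ∀ {x} → u x ≡ true → Near (suc x) x
    north⇒near {x} ux = near (source-of-ascent (H-ascent 0<b u x ux)) (ℕ.≤-trans (ℕ.+-monoˡ-≤ x 0<m) (ℕ.≤-reflexive (ℕ.+-comm m x)))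

    -- The point `suc x` has source `x`. The source of `suc j` is earlier than `x` by less than 2m ≤
    -- n, which is too close to be congruent to `x`.
    north-unlinked : ∀ {x j} → u x ≡ true → j < x → x ≤ j ℕ.+ m → ¬ Linked (suc x) (suc j)
    north-unlinked ux _ _ (inj₁ (C , _)) = Near⇒¬Central (north⇒near ux) C
    north-unlinked {x} {j} ux j<x x≤j+m (inj₂ (k , l , N , N′ , eq)) with source-unique (src N) (src (north⇒near ux))
    ... | refl = ℕ.<-irrefl (%-window n (sym eq) (ℕ.<⇒≤ l<x) x<l+n) l<x
      where
      l<x : l < x
      l<x = ℕ.≤-<-trans (ℕ.≤-pred (before (src N′))) j<x
      x<l+n : x < l ℕ.+ n
      x<l+n = ℕ.<-≤-trans (ℕ.≤-<-trans x≤j+m (ℕ.+-monoˡ-< m (close N′)))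
                (ℕ.≤-trans (ℕ.≤-reflexive (ℕ.+-assoc l m m)) (ℕ.+-monoʳ-≤ l 2m≤n))

    -- If `suc x` is central, so is the point one period earlier. Otherwise `descent-sibling` yields
    -- a point with the same source, and as that source is close, so is the point.
    east-linked : ∀ {x} → m ≤ x → u x ≡ false → ∃ λ j → j < x × x ≤ j ℕ.+ m × Linked (suc x) (suc j)
    east-linked {x} m≤x ux with near? (suc x)
    ... | inj₂ C = x ∸ m , subst (x ∸ m <_) (ℕ.m+[n∸m]≡n m≤x) (ℕ.m<n+m (x ∸ m) 0<m) , ℕ.≤-reflexive (sym (ℕ.m∸n+n≡m m≤x)) , inj₁ (C , Central-shift⁻ (subst Central (sym eq) C))
      where
      eq : m ℕ.+ suc (x ∸ m) ≡ suc x
      eq = trans (ℕ.+-suc m _) (cong suc (ℕ.m+[n∸m]≡n m≤x))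
    ... | inj₁ (k , N) with descent-sibling {h} (H-descent 0<a u x ux) (src N)
    ...   | suc j , k<j , j≤x , S = j , j≤x , ℕ.≤-trans (ℕ.n≤1+n x) (ℕ.≤-trans (close N) (ℕ.+-monoˡ-≤ m (ℕ.≤-pred k<j)))
            , inj₂ (k , k , N , near S (ℕ.≤-trans (s≤s (ℕ.<⇒≤ j≤x)) (close N)) , refl)

    -- The last lowest point of one period is a point of last passage: a later point outside the
    -- window is higher than its translate one period back, and induction applies to that translate.
    rising-cut : 0ℤ <ℤ h m → ∀ B → ∃ λ c → B ≤ c × (∀ z → c < z → h c <ℤ h z)
    rising-cut pos B with last-argmin h B m
    ... | c , B≤c , c≤B+m , min , strict = c , B≤c , λ z → <-rec _ go z
      where
      go : ∀ z → (∀ {y} → y < z → c < y → h c <ℤ h y) → c < z → h c <ℤ h z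
      go z rec c<z with z ℕ.≤? B ℕ.+ m
      ... | yes z≤ = strict z c<z z≤
      ... | no z≰  = ℤ.≤-<-trans low (subst₂ _<ℤ_ (ℤ.+-identityʳ _) (sym (trans (cong h (sym eq)) (h-period y))) (ℤ.+-monoʳ-< (h y) pos))
        where
        y = z ∸ m
        m≤z : m ≤ z
        m≤z = ℕ.≤-trans (ℕ.m≤n+m m B) (ℕ.<⇒≤ (ℕ.≰⇒> z≰))
        eq : m ℕ.+ y ≡ z
        eq = ℕ.m+[n∸m]≡n m≤z
        B≤y : B ≤ y
        B≤y = ℕ.+-cancelˡ-≤ m _ _ (ℕ.≤-trans (ℕ.≤-reflexive (ℕ.+-comm m B)) (ℕ.≤-trans (ℕ.<⇒≤ (ℕ.≰⇒> z≰)) (ℕ.≤-reflexive (sym eq))))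
        y<z : y < z
        y<z = subst (y <_) eq (ℕ.m<n+m y 0<m)
        low : h c ≤ℤ h y
        low with ℕ.<-cmp c y
        ... | tri< c<y _ _ = ℤ.<⇒≤ (rec y<z c<y)
        ... | tri≈ _ refl _ = ℤ.≤-refl
        ... | tri> _ _ y<c = min y B≤y (ℕ.≤-trans (ℕ.<⇒≤ y<c) c≤B+m)

    -- A lowest point of a window of length `m` is central: an earlier point outside the window is
    -- at least as high as its translate one period later, which lies inside.
    falling-cut : h m ≤ℤ 0ℤ → ∀ B → ∃ λ c → B ≤ c × Central (suc c)
    falling-cut neg B with last-argmin h (suc B) m
    ... | suc c , s≤s B≤c , c≤ , min , _ = c , B≤c , central
      where
      central : Central (suc c)
      central k k<c c≤k+m with suc B ℕ.≤? k
      ... | yes B≤k = min k B≤k (ℕ.≤-trans (ℕ.<⇒≤ k<c) c≤)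
      ... | no B≰k  = ℤ.≤-trans (min (m ℕ.+ k) (ℕ.≤-trans (s≤s B≤c) (ℕ.≤-trans c≤k+m (ℕ.≤-reflexive (ℕ.+-comm k m))))
                         (ℕ.≤-trans (ℕ.+-monoʳ-≤ m (ℕ.<⇒≤ (ℕ.≰⇒> B≰k))) (ℕ.≤-reflexive (ℕ.+-comm m (suc B)))))
                       (subst₂ _≤ℤ_ (sym (h-period k)) (ℤ.+-identityʳ _) (ℤ.+-monoʳ-≤ (h k) neg))

    -- Moving `k` forward by periods never raises it and eventually brings it within `m` of `x`.
    central-global : h m ≤ℤ 0ℤ → ∀ {x} → Central x → ∀ k → k < x → h x ≤ℤ h k
    central-global neg {x} C k k<x = climb (x ∸ k) k (ℕ.≤-reflexive (sym (ℕ.m+[n∸m]≡n (ℕ.<⇒≤ k<x)))) k<x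
      where
      climb : ∀ d k → x ≤ k ℕ.+ d → k < x → h x ≤ℤ h k
      climb d k x≤k+d k<x with x ℕ.≤? k ℕ.+ m
      ... | yes x≤k+m = C k k<x x≤k+m
      climb zero k x≤k+d k<x | no _ = ⊥-elim (ℕ.<-irrefl refl (ℕ.<-≤-trans k<x (ℕ.≤-trans x≤k+d (ℕ.≤-reflexive (ℕ.+-identityʳ k)))))
      climb (suc d) k x≤k+d k<x | no x≰k+m = ℤ.≤-trans
        (climb d (m ℕ.+ k) (ℕ.≤-trans x≤k+d (ℕ.≤-trans (ℕ.≤-reflexive (ℕ.+-suc k d)) (ℕ.+-monoˡ-≤ d (ℕ.+-monoˡ-≤ k 0<m))))
          (ℕ.<-≤-trans (ℕ.≤-reflexive (cong suc (ℕ.+-comm m k))) (ℕ.≰⇒> x≰k+m)))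
        (subst₂ _≤ℤ_ (sym (h-period k)) (ℤ.+-identityʳ _) (ℤ.+-monoʳ-≤ (h k) neg))

    -- The point one period earlier is lower, so a source is found within that period, and no point
    -- from `m` on is central.
    rising-near : 0ℤ <ℤ h m → ∀ {x} → m ≤ x → ∃ λ k → Near x k
    rising-near pos {x} m≤x with near? x
    ... | inj₁ N = N
    ... | inj₂ C = ⊥-elim (ℤ.<⇒≱ (subst (h (x ∸ m) <ℤ_) (sym (trans (cong h (sym eq)) (h-period (x ∸ m)))) (subst (_<ℤ h (x ∸ m) + h m) (ℤ.+-identityʳ _) (ℤ.+-monoʳ-< (h (x ∸ m)) pos)))
                    (C (x ∸ m) (subst (x ∸ m <_) eq (ℕ.m<n+m _ 0<m)) (ℕ.≤-reflexive (trans (sym eq) (ℕ.+-comm m _)))))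
      where
      eq : m ℕ.+ (x ∸ m) ≡ x
      eq = ℕ.m+[n∸m]≡n m≤x

    h-n-period : ∀ x → h (n ℕ.+ x) ≡ h x + h n
    h-n-period x = trans (agree-translate {u} {u} n 0 x (λ t _ → u-n t) x ℕ.≤-refl) (lemma (h x) (h n))
      where
      lemma : ∀ x m → x + (m - 0ℤ) ≡ x + m
      lemma = solve-∀
      u-n : ∀ x → u (n ℕ.+ x) ≡ u x
      u-n x = trans (cong (λ z → u (z ℕ.+ x)) n≡em) (periodic-* per e x)

    h-falls : h m ≤ℤ 0ℤ → ∀ q → h (q ℕ.* m) ≤ℤ 0ℤ
    h-falls neg zero    = ℤ.≤-refl
    h-falls neg (suc q) = subst (_≤ℤ 0ℤ) (sym (h-period (q ℕ.* m))) (ℤ.+-mono-≤ (h-falls neg q) neg)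

    h-rises : 0ℤ ≤ℤ h m → ∀ q → 0ℤ ≤ℤ h (q ℕ.* m)
    h-rises pos zero    = ℤ.≤-refl
    h-rises pos (suc q) = subst (0ℤ ≤ℤ_) (sym (h-period (q ℕ.* m))) (ℤ.+-mono-≤ (h-rises pos q) pos)

-- Rotation-invariant noncrossing relations and their words

module SymmetricPartitions where

  open import Data.Bool using (Bool; true; false; not)
  open import Data.Nat as ℕ using (ℕ; zero; suc; _≤_; _<_; z≤n; s≤s; _∸_; NonZero; _%_; _/_)
  import Data.Nat.Properties as ℕ
  open import Data.Nat.DivMod using (m≡m%n+[m/n]*n; m%n<n; [m+kn]%n≡m%n)
  open import Data.Nat.Coprimality using (Coprime)
  import Data.Nat.Tactic.RingSolver as ℕSolver
  open import Data.Integer as ℤ using (ℤ; 0ℤ; _+_) renaming (_<_ to _<ℤ_; _≤_ to _≤ℤ_)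
  import Data.Integer.Properties as ℤ
  open import Data.Product using (∃; _×_; _,_; proj₂)
  open import Data.Sum using (_⊎_; inj₁; inj₂)
  open import Data.Empty using (⊥; ⊥-elim)
  open import Relation.Nullary using (¬_; Dec; yes; no; does)
  open import Relation.Binary.Definitions using (tri<; tri≈; tri>)
  open import Relation.Binary.PropositionalEquality using (_≡_; _≢_; refl; sym; trans; cong; cong₂; subst; subst₂)
  open Sources
  open Heights
  open LaserFire
  open PeriodicPaths

  does-≡ : {A B : Set} (a? : Dec A) (b? : Dec B) → (A → B) → (B → A) → does a? ≡ does b?
  does-≡ (yes _) (yes _) _ _ = refl
  does-≡ (no _)  (no _)  _ _ = refl
  does-≡ (yes a) (no ¬b) f _ = ⊥-elim (¬b (f a))
  does-≡ (no ¬a) (yes b) _ g = ⊥-elim (¬a (g b))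

  not-does-true⁻ : {A : Set} (a? : Dec A) → not (does a?) ≡ true → ¬ A
  not-does-true⁻ (no ¬a) _ = ¬a

  not-does-false⁻ : {A : Set} (a? : Dec A) → not (does a?) ≡ false → A
  not-does-false⁻ (yes a) _ = a

  bool-contra : ∀ {x} → x ≡ true → x ≡ false → ⊥
  bool-contra refl ()

  bool-agree : ∀ {x y} → (x ≡ true → y ≡ false → ⊥) → (x ≡ false → y ≡ true → ⊥) → x ≡ y
  bool-agree {true}  {true}  _ _ = refl
  bool-agree {false} {false} _ _ = refl
  bool-agree {true}  {false} f _ = ⊥-elim (f refl refl)
  bool-agree {false} {true}  _ g = ⊥-elim (g refl refl)

  count-first : ∀ {s s′} n → 0 < n → s 0 ≡ false → s′ 0 ≡ true → (∀ t → 0 < t → t < n → s t ≡ s′ t) → suc (count s n) ≡ count s′ n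
  count-first {s} {s′} (suc n) _ s0 s′0 eq =
    trans (cong suc (trans (count-+ s 1 n) (cong (ℕ._+ count (λ t → s (suc t)) n) (one-false {s} s0)))) (sym (trans (count-+ s′ 1 n) (cong₂ ℕ._+_ (one-true {s′} s′0)
      (sym (count-cong n λ t t<n → eq (suc t) (s≤s z≤n) (s≤s t<n))))))
    where
    one-false : ∀ {s} → s 0 ≡ false → count s 1 ≡ 0
    one-false e rewrite e = refl
    one-true : ∀ {s} → s 0 ≡ true → count s 1 ≡ 1
    one-true e rewrite e = refl

  module SymmetricRelation (a b : ℕ) (0<a : 0 < a) (0<b : 0 < b) (cop : Coprime a b)
    (m n : ℕ) .{{_ : NonZero n}} (suc-n : suc n ≡ a ℕ.+ b) (0<m : 0 < m) (2m≤n : m ℕ.+ m ≤ n) (e : ℕ) (n≡em : n ≡ e ℕ.* m)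
    (_~_ : ℕ → ℕ → Set) (_~?_ : ∀ x y → Dec (x ~ y))
    (~-refl : ∀ {x} → x ~ x) (~-sym : ∀ {x y} → x ~ y → y ~ x) (~-trans : ∀ {x y z} → x ~ y → y ~ z → x ~ z)
    (~-n : ∀ x → x ~ (n ℕ.+ x)) (shift⁺ : ∀ {x y} → x ~ y → (m ℕ.+ x) ~ (m ℕ.+ y)) (shift⁻ : ∀ {x y} → (m ℕ.+ x) ~ (m ℕ.+ y) → x ~ y)
    where

    open Laser a b 0<a 0<b cop

    -- The circle cut open before `c`: the labels c, ..., c + n - 1 form the partition of some Dyck
    -- path. The paths of different cuts are not related a priori; `agree` compares each with the
    -- single sequence `u`.
    record View (c : ℕ) : Set where
      field
        s    : Steps
        isDyck : Dyck s
        to   : ∀ {i j} → i < n → j < n → (c ℕ.+ i) ~ (c ℕ.+ j) → SameSource (H s) (suc i) (suc j)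
        from : ∀ {i j} → i < n → j < n → SameSource (H s) (suc i) (suc j) → (c ℕ.+ i) ~ (c ℕ.+ j)

      north : ∀ {i j} → i < n → s i ≡ true → j < i → ¬ ((c ℕ.+ i) ~ (c ℕ.+ j))
      north {i} {j} i<n si j<i i~j with to i<n (ℕ.<-trans j<i i<n) i~j
      ... | k , Si , Sj with source-unique Si (source-of-ascent (H-ascent 0<b s i si))
      ... | refl = ℕ.<-irrefl refl (ℕ.<-≤-trans j<i (ℕ.≤-pred (before Sj)))

      east : ∀ {i} → i < n → s i ≡ false → ∃ λ j → j < i × (c ℕ.+ i) ~ (c ℕ.+ j)
      east {i} i<n si with dyck-source isDyck {suc i} (s≤s z≤n) (subst (suc i <_) suc-n (s≤s i<n))
      ... | k , S with descent-sibling (H-descent 0<a s i si) S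
      ... | suc j , k<j , j≤i , S′ = j , j≤i , from i<n (ℕ.<-trans j≤i i<n) (k , S , S′)

      start : s 0 ≡ false → ⊥
      start s0 = none (east (ℕ.≤-trans 0<m (ℕ.≤-trans (ℕ.m≤m+n m m) 2m≤n)) s0)
        where
        none : ¬ (∃ λ j → j < 0 × (c ℕ.+ 0) ~ (c ℕ.+ j))
        none (_ , () , _)

      count-north : count s n ≡ a
      count-north = trans (helper (s n) refl) (trans (cong (count s) suc-n) (dyck-count (closed isDyck)))
        where
        helper : ∀ x → s n ≡ x → count s n ≡ count s (suc n)
        helper true e = ⊥-elim (ℤ.<⇒≱ (H-ascent 0<b s n e)
          (subst (ℤ._≤ H s n) (sym (trans (cong (H s) suc-n) (closed isDyck))) (nonneg isDyck n (subst (n ≤_) suc-n (ℕ.n≤1+n n)))))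
        helper false e rewrite e = refl

      root : ∀ {k} → Source (H s) 1 k → k ≡ 0
      root S with before S
      ... | s≤s z≤n = refl

    module _ (view : ∀ c → View c) where

      m<n : m < n
      m<n = ℕ.<-≤-trans (ℕ.m<m+n m 0<m) 2m≤n

      noncrossing′ : ∀ c {i j k l} → i < j → j < k → k < l → l < n → (c ℕ.+ i) ~ (c ℕ.+ k) → (c ℕ.+ j) ~ (c ℕ.+ l) → (c ℕ.+ i) ~ (c ℕ.+ j)
      noncrossing′ c {i} {j} {k} {l} i<j j<k k<l l<n ik jl with View.to (view c) (ℕ.<-trans i<j j<n) k<n ik | View.to (view c) j<n l<n jl
        where
        k<n = ℕ.<-trans k<l l<n
        j<n = ℕ.<-trans j<k k<n
      ... | s , Si , Sk | t , Sj , Sl = View.from (view c) (ℕ.<-trans i<j j<n) j<n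
              (s , Si , subst (Source _ _) (sym (source-noncrossing (s≤s i<j) (s≤s j<k) (s≤s k<l) Si Sk Sj Sl)) Sj)
        where
        j<n = ℕ.<-trans j<k (ℕ.<-trans k<l l<n)

      noncrossing : ∀ {i j k l} → i < j → j < k → k < l → l < i ℕ.+ n → i ~ k → j ~ l → i ~ j
      noncrossing {i} {j} {k} {l} i<j j<k k<l l<i+n ik jl =
        subst₂ _~_ (ℕ.+-identityʳ i) ej (noncrossing′ i {0} {j ∸ i} {k ∸ i} {l ∸ i}
          (ℕ.m<n⇒0<n∸m i<j) (ℕ.∸-monoˡ-< j<k (ℕ.<⇒≤ i<j)) (ℕ.∸-monoˡ-< k<l (ℕ.<⇒≤ i<k))
          (ℕ.+-cancelˡ-< i _ _ (subst (_< i ℕ.+ n) (sym el) l<i+n))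
          (subst₂ _~_ (sym (ℕ.+-identityʳ i)) (sym ek) ik) (subst₂ _~_ (sym ej) (sym el) jl))
        where
        i<k = ℕ.<-trans i<j j<k
        i<l = ℕ.<-trans i<k k<l
        ej : i ℕ.+ (j ∸ i) ≡ j
        ej = ℕ.m+[n∸m]≡n (ℕ.<⇒≤ i<j)
        ek : i ℕ.+ (k ∸ i) ≡ k
        ek = ℕ.m+[n∸m]≡n (ℕ.<⇒≤ i<k)
        el : i ℕ.+ (l ∸ i) ≡ l
        el = ℕ.m+[n∸m]≡n (ℕ.<⇒≤ i<l)

      -- Looking back from n + x instead of `x` leaves room for `m` earlier labels even when `x` is
      -- small, which makes `u` periodic from the very start.
      opens? : ∀ x → Dec (∃ λ j → (n ∸ m) ℕ.+ x ≤ j × j < n ℕ.+ x × (n ℕ.+ x) ~ j)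
      opens? x = bounded-any? (λ j → (n ℕ.+ x) ~? j) ((n ∸ m) ℕ.+ x) (n ℕ.+ x)

      -- A label opens its block, seen from the centre, when no equivalent label lies among the m preceding ones.
      u : Steps
      u x = not (does (opens? x))

      n∸m+m : (n ∸ m) ℕ.+ m ≡ n
      n∸m+m = ℕ.m∸n+n≡m (ℕ.<⇒≤ m<n)

      u-true⁻ : ∀ {x j} → u x ≡ true → j < x → x ≤ j ℕ.+ m → ¬ (x ~ j)
      u-true⁻ {x} {j} ux j<x x≤j+m x~j = not-does-true⁻ (opens? x) ux (n ℕ.+ j
        , ℕ.≤-trans (ℕ.+-monoʳ-≤ (n ∸ m) x≤j+m) (ℕ.≤-reflexive (trans (cong ((n ∸ m) ℕ.+_) (ℕ.+-comm j m)) (trans (sym (ℕ.+-assoc (n ∸ m) m j)) (cong (ℕ._+ j) n∸m+m))))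
        , ℕ.+-monoʳ-< n j<x , ~-trans (~-sym (~-n x)) (~-trans x~j (~-n j)))

      u-false⁻ : ∀ {x} → m ≤ x → u x ≡ false → ∃ λ j → j < x × x ≤ j ℕ.+ m × x ~ j
      u-false⁻ {x} m≤x ux with not-does-false⁻ (opens? x) ux
      ... | t , lo , hi , x~t = j , ℕ.+-cancelˡ-< n _ _ (subst (_< n ℕ.+ x) (sym n+j) hi)
          , ℕ.+-cancelˡ-≤ (n ∸ m) _ _ (ℕ.≤-trans lo (ℕ.≤-reflexive (trans (sym n+j) (trans (cong (ℕ._+ j) (sym n∸m+m)) (trans (ℕ.+-assoc (n ∸ m) m j) (cong ((n ∸ m) ℕ.+_) (ℕ.+-comm m j)))))))
          , ~-trans (~-n x) (~-trans x~t (subst (_~ j) n+j (~-sym (~-n j))))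
        where
        j = t ∸ n
        n+j : n ℕ.+ j ≡ t
        n+j = ℕ.m+[n∸m]≡n (ℕ.≤-trans (ℕ.≤-reflexive (sym n∸m+m)) (ℕ.≤-trans (ℕ.+-monoʳ-≤ (n ∸ m) m≤x) lo))

      private
        swap : ∀ x y z → x ℕ.+ (y ℕ.+ z) ≡ y ℕ.+ (x ℕ.+ z)
        swap = ℕSolver.solve-∀

      u-period : ∀ x → u (m ℕ.+ x) ≡ u x
      u-period x = cong not (does-≡ (opens? (m ℕ.+ x)) (opens? x) down up)
        where
        up : (∃ λ j → (n ∸ m) ℕ.+ x ≤ j × j < n ℕ.+ x × (n ℕ.+ x) ~ j) → ∃ λ j → (n ∸ m) ℕ.+ (m ℕ.+ x) ≤ j × j < n ℕ.+ (m ℕ.+ x) × (n ℕ.+ (m ℕ.+ x)) ~ j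
        up (j , lo , hi , r) = m ℕ.+ j , ℕ.≤-trans (ℕ.≤-reflexive (swap (n ∸ m) m x)) (ℕ.+-monoʳ-≤ m lo)
          , ℕ.<-≤-trans (ℕ.+-monoʳ-< m hi) (ℕ.≤-reflexive (swap m n x)) , subst (_~ (m ℕ.+ j)) (swap m n x) (shift⁺ r)
        down : (∃ λ j → (n ∸ m) ℕ.+ (m ℕ.+ x) ≤ j × j < n ℕ.+ (m ℕ.+ x) × (n ℕ.+ (m ℕ.+ x)) ~ j) → ∃ λ j → (n ∸ m) ℕ.+ x ≤ j × j < n ℕ.+ x × (n ℕ.+ x) ~ j
        down (t , lo , hi , r) = j , ℕ.+-cancelˡ-≤ m _ _ (ℕ.≤-trans lo′ (ℕ.≤-reflexive (sym m+j)))
          , ℕ.+-cancelˡ-< m _ _ (subst₂ _<_ (sym m+j) (swap n m x) hi) , shift⁻ (subst₂ _~_ (swap n m x) (sym m+j) r)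
          where
          lo′ : m ℕ.+ ((n ∸ m) ℕ.+ x) ≤ t
          lo′ = ℕ.≤-trans (ℕ.≤-reflexive (swap m (n ∸ m) x)) lo
          j = t ∸ m
          m+j : m ℕ.+ j ≡ t
          m+j = ℕ.m+[n∸m]≡n (ℕ.≤-trans (ℕ.m≤m+n m _) lo′)

      open PeriodicSteps a b 0<a 0<b m n 0<m 2m≤n e n≡em u u-period public

      -- If only `u` is north at `z`, the earlier related label provided by the view lies between
      -- `c` and `z`, hence among the last `m`. If only the view is north, the related label `j`
      -- seen by `u` precedes `c`; noncrossing of j ~ z with c ~ x then relates `z` to `c`, which
      -- the view excludes. For z = x that relation is given.
      agree : ∀ {c x} → m ≤ c → c ~ x → c ≤ x → x ≤ c ℕ.+ m → ∀ t → 0 < t → c ℕ.+ t ≤ x → u (c ℕ.+ t) ≡ View.s (view c) t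
      agree {c} {x} m≤c c~x c≤x x≤c+m t 0<t z≤x = bool-agree
          (λ uz st → let (j , j<t , z~j) = V.east t<n st in
            u-true⁻ uz (ℕ.+-monoʳ-< c j<t) (ℕ.≤-trans z≤c+m (ℕ.+-monoˡ-≤ m (ℕ.m≤m+n c j))) z~j)
          (λ uz st → back st (u-false⁻ (ℕ.≤-trans m≤c (ℕ.m≤m+n c t)) uz))
        where
        module V = View (view c)
        z = c ℕ.+ t
        z≤c+m : z ≤ c ℕ.+ m
        z≤c+m = ℕ.≤-trans z≤x x≤c+m
        t<n : t < n
        t<n = ℕ.≤-<-trans (ℕ.+-cancelˡ-≤ c _ _ z≤c+m) m<n
        back : V.s t ≡ true → (∃ λ j → j < z × z ≤ j ℕ.+ m × z ~ j) → ⊥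
        back st (j , j<z , z≤j+m , z~j) with c ℕ.≤? j
        ... | yes c≤j = V.north {j = j ∸ c} t<n st (ℕ.+-cancelˡ-< c _ _ (subst (_< z) (sym (ℕ.m+[n∸m]≡n c≤j)) j<z))
                          (subst (z ~_) (sym (ℕ.m+[n∸m]≡n c≤j)) z~j)
        ... | no c≰j with ℕ.m≤n⇒m<n∨m≡n z≤x
        ...   | inj₂ z≡x = V.north t<n st 0<t (subst₂ _~_ (sym z≡x) (sym (ℕ.+-identityʳ c)) (~-sym c~x))
        ...   | inj₁ z<x = V.north t<n st 0<t (subst (z ~_) (sym (ℕ.+-identityʳ c)) (~-trans z~j
                  (noncrossing (ℕ.≰⇒> c≰j) (ℕ.m<m+n c 0<t) z<x x<j+n (~-sym z~j) c~x)))
          where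
          x<j+n : x < j ℕ.+ n
          x<j+n = ℕ.<-≤-trans (ℕ.≤-<-trans x≤c+m (ℕ.+-monoˡ-< m (ℕ.<-≤-trans (ℕ.m<m+n c 0<t) z≤j+m)))
                    (ℕ.≤-trans (ℕ.≤-reflexive (ℕ.+-assoc j m m)) (ℕ.+-monoʳ-≤ j 2m≤n))

      -- In its own view `c` is the first point, whose only possible source is the origin, and
      -- related labels share their source.
      root-source : ∀ {c x} → c ~ x → c ≤ x → x ≤ c ℕ.+ m → Source (H (View.s (view c))) (suc (x ∸ c)) 0
      root-source {c} {x} c~x c≤x x≤c+m with V.to {0} {x ∸ c} (ℕ.≤-trans (s≤s z≤n) m<n) (ℕ.≤-<-trans (ℕ.≤-trans (ℕ.∸-monoˡ-≤ c x≤c+m) (ℕ.≤-reflexive (ℕ.m+n∸m≡n c m))) m<n)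
                                               (subst₂ _~_ (sym (ℕ.+-identityʳ c)) (sym (ℕ.m+[n∸m]≡n c≤x)) c~x)
        where module V = View (view c)
      ... | k , S₁ , S = subst (Source _ _) (View.root (view c) S₁) S

      record Opener (x o : ℕ) : Set where
        constructor opener
        field
          o≤x   : o ≤ x
          close : x < o ℕ.+ m
          opens : u o ≡ true
          o~x   : o ~ x
      open Opener using (o≤x; opens; o~x)

      -- In the view cut at `o` the source of `x` is the origin, and `agree` carries the steps from
      -- `o` to `x` over to `u`. Only the first step is not covered by `agree`; it is north on both
      -- sides.
      opener-near : ∀ {x o} → m ≤ o → Opener x o → Near (suc x) o
      opener-near {x} {o} m≤o (opener o≤x x<o+m uo o~x) = near (subst₂ (Source h) (trans (ℕ.+-suc o d) (cong suc o+d)) (ℕ.+-identityʳ o)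
          (translate-source (agree-translate {u} {V.s} o 0 (suc d) same) {suc d} {0} ℕ.≤-refl (root-source o~x o≤x (ℕ.<⇒≤ x<o+m)))) x<o+m
        where
        module V = View (view o)
        d = x ∸ o
        o+d : o ℕ.+ d ≡ x
        o+d = ℕ.m+[n∸m]≡n o≤x
        same : ∀ t → t < suc d → u (o ℕ.+ t) ≡ V.s t
        same zero    _   = bool-agree (λ _ s0 → V.start s0) (λ uo′ _ → bool-contra uo (trans (cong u (sym (ℕ.+-identityʳ o))) uo′))
        same (suc t) t<d = agree m≤o o~x o≤x (ℕ.<⇒≤ x<o+m) (suc t) (s≤s z≤n) (ℕ.≤-trans (ℕ.+-monoʳ-≤ o (ℕ.≤-pred t<d)) (ℕ.≤-reflexive o+d))

      -- In the view cut at `y` the source of `x` is the origin, so no point under the arc is lower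
      -- than that of `x`. By `agree`, `u` makes the same steps there.
      arc-low : ∀ {y x} → m ≤ y → y ~ x → y < x → x ≤ y ℕ.+ m → ∀ t → y < t → t ≤ x → h (suc x) ≤ℤ h t
      arc-low {y} {x} m≤y y~x y<x x≤y+m t y<t t≤x = subst₂ (λ p q → h p ≤ℤ h q) (cong suc y+d) (ℕ.m+[n∸m]≡n y<t)
          (translate-≤ {h} {H V.s} {suc y} {1} (agree-translate {u} {V.s} (suc y) 1 d same) {d} {t ∸ suc y} ℕ.≤-refl (ℕ.≤-trans (ℕ.∸-monoˡ-≤ (suc y) t≤x) (ℕ.∸-monoʳ-≤ x (ℕ.n≤1+n y)))
            (between (root-source y~x (ℕ.<⇒≤ y<x) x≤y+m) (suc (t ∸ suc y)) (s≤s z≤n)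
              (s≤s (ℕ.+-cancelˡ-≤ (suc y) _ _ (subst₂ _≤_ (sym (trans (ℕ.+-suc (suc y) _) (cong suc (ℕ.m+[n∸m]≡n y<t)))) (sym (cong suc y+d)) (s≤s t≤x))))))
        where
        module V = View (view y)
        d = x ∸ y
        y+d : y ℕ.+ d ≡ x
        y+d = ℕ.m+[n∸m]≡n (ℕ.<⇒≤ y<x)
        same : ∀ t → t < d → u (suc y ℕ.+ t) ≡ V.s (suc t)
        same t t<d = trans (cong u (sym (ℕ.+-suc y t))) (agree m≤y y~x (ℕ.<⇒≤ y<x) x≤y+m (suc t) (s≤s z≤n)
          (ℕ.≤-trans (ℕ.+-monoʳ-≤ y t<d) (ℕ.≤-reflexive y+d)))

      Closed : ℕ → Set
      Closed x = ∀ o → ¬ Opener x o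

      opener? : ∀ x → (∃ λ o → Opener x o) ⊎ Closed x
      opener? x with bounded-any? test? (suc x ∸ m) (suc x)
        where
        test? : ∀ o → Dec (u o ≡ true × o ~ x)
        test? o with u o Data.Bool.≟ true | o ~? x
        ... | yes p | yes q = yes (p , q)
        ... | no ¬p | _     = no λ { (p , _) → ¬p p }
        ... | _     | no ¬q = no λ { (_ , q) → ¬q q }
      ... | yes (o , lo , hi , uo , r) = inj₁ (o , opener (ℕ.≤-pred hi) (ℕ.≤-trans (ℕ.m≤n+m∸n (suc x) m) (ℕ.≤-trans (ℕ.+-monoʳ-≤ m lo) (ℕ.≤-reflexive (ℕ.+-comm m o)))) uo r)
      ... | no none = inj₂ λ { o (opener o≤x x<o+m uo r) → none (o , ℕ.≤-trans (ℕ.∸-monoˡ-≤ m x<o+m) (ℕ.≤-reflexive (ℕ.m+n∸n≡m o m)) , s≤s o≤x , uo , r) }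

      closed-predecessor : ∀ {x} → m ℕ.+ m ≤ x → Closed x → ∀ {y} → y ≤ x → x < y ℕ.+ m → y ~ x → ∃ λ j → j < y × y ≤ j ℕ.+ m × y ~ j
      closed-predecessor {x} 2m≤x C {y} y≤x x<y+m y~x = by-cases (u y) refl
        where
        by-cases : ∀ v → u y ≡ v → ∃ λ j → j < y × y ≤ j ℕ.+ m × y ~ j
        by-cases true  uy = ⊥-elim (C y (opener y≤x x<y+m uy y~x))
        by-cases false uy = u-false⁻ (ℕ.+-cancelʳ-≤ m _ _ (ℕ.≤-trans 2m≤x (ℕ.<⇒≤ x<y+m))) uy

      -- The block of `x` is followed backwards. None of its labels met within the last `m` opens
      -- it, so each has a predecessor at distance at most `m`. By `arc-low` the end of each arc is
      -- no higher than the points under it, its starting point included, and chaining the arcs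
      -- compares `suc x` with all of its `m` predecessors. `B` bounds the recursion.
      closed-central : ∀ {x} → m ℕ.+ m ℕ.+ m ≤ x → Closed x → Central (suc x)
      closed-central {x} 3m≤x C k k<1+x x<k+m = chain (suc x) x ℕ.≤-refl ℕ.≤-refl (ℕ.m<m+n x 0<m) ~-refl k x<k+m (ℕ.≤-pred k<1+x)
        where
        chain : ∀ B y → y < B → y ≤ x → x < y ℕ.+ m → y ~ x → ∀ t → x < t ℕ.+ m → t ≤ y → h (suc y) ≤ℤ h t
        chain (suc B) y y<B y≤x x<y+m y~x t x<t+m t≤y with closed-predecessor (ℕ.≤-trans (ℕ.m≤m+n _ m) 3m≤x) C y≤x x<y+m y~x
        ... | j , j<y , y≤j+m , y~j with t ℕ.≤? j
        ...   | no t≰j = arc-low m≤j (~-sym y~j) j<y y≤j+m t (ℕ.≰⇒> t≰j) t≤y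
          where
          m≤j : m ≤ j
          m≤j = ℕ.+-cancelʳ-≤ m _ _ (ℕ.+-cancelʳ-≤ m _ _ (ℕ.≤-trans 3m≤x (ℕ.≤-trans (ℕ.<⇒≤ x<y+m) (ℕ.+-monoˡ-≤ m y≤j+m))))
        ...   | yes t≤j = ℤ.≤-trans (arc-low m≤j (~-sym y~j) j<y y≤j+m (suc j) ℕ.≤-refl j<y)
                            (chain B j (ℕ.<-≤-trans j<y (ℕ.≤-pred y<B)) (ℕ.≤-trans (ℕ.<⇒≤ j<y) y≤x) (ℕ.<-≤-trans x<t+m (ℕ.+-monoˡ-≤ m t≤j)) (~-trans (~-sym y~j) y~x) t x<t+m t≤j)
          where
          m≤j : m ≤ j
          m≤j = ℕ.+-cancelʳ-≤ m _ _ (ℕ.+-cancelʳ-≤ m _ _ (ℕ.≤-trans 3m≤x (ℕ.≤-trans (ℕ.<⇒≤ x<y+m) (ℕ.+-monoˡ-≤ m y≤j+m))))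

      -- The block of m + w is followed backwards until an arc from `j` to `y` reaches `w` or jumps
      -- over it. In the second case y ∸ m ≤ j < w < y, and y ∸ m is related to `w` by periodicity;
      -- noncrossing then puts `j` and `w` in one block.
      closed-shift : ∀ {w} → m ≤ w → Closed (m ℕ.+ w) → (m ℕ.+ w) ~ w
      closed-shift {w} m≤w C = chain (suc x) x ℕ.≤-refl ℕ.≤-refl (ℕ.m<m+n x 0<m) ~-refl
        where
        x = m ℕ.+ w
        chain : ∀ B y → y < B → y ≤ x → x < y ℕ.+ m → y ~ x → x ~ w
        chain (suc B) y y<B y≤x x<y+m y~x with closed-predecessor (ℕ.+-monoʳ-≤ m m≤w) C y≤x x<y+m y~x
        ... | j , j<y , y≤j+m , y~j with ℕ.<-cmp x (j ℕ.+ m)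
        ...   | tri< x<j+m _ _ = chain B j (ℕ.<-≤-trans j<y (ℕ.≤-pred y<B)) (ℕ.≤-trans (ℕ.<⇒≤ j<y) y≤x) x<j+m (~-trans (~-sym y~j) y~x)
        ...   | tri≈ _ x≡j+m _ = ~-trans (~-sym y~x) (subst (y ~_) (ℕ.+-cancelʳ-≡ m _ _ (trans (sym x≡j+m) (ℕ.+-comm m w))) y~j)
        ...   | tri> _ _ j+m<x = ~-trans (~-sym y~x) (~-trans y~j (meet (ℕ.m≤n⇒m<n∨m≡n y′≤j)))
          where
          w<y : w < y
          w<y = ℕ.+-cancelʳ-< m _ _ (subst (_< y ℕ.+ m) (ℕ.+-comm m w) x<y+m)
          y′ = y ∸ m
          m+y′ : m ℕ.+ y′ ≡ y
          m+y′ = ℕ.m+[n∸m]≡n (ℕ.≤-trans m≤w (ℕ.<⇒≤ w<y))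
          y′≤j : y′ ≤ j
          y′≤j = ℕ.+-cancelʳ-≤ m _ _ (subst (_≤ j ℕ.+ m) (trans (sym m+y′) (ℕ.+-comm m y′)) y≤j+m)
          y′~w : y′ ~ w
          y′~w = shift⁻ (subst (_~ x) (sym m+y′) y~x)
          j<w : j < w
          j<w = ℕ.+-cancelʳ-< m _ _ (subst (j ℕ.+ m <_) (ℕ.+-comm m w) j+m<x)
          meet : y′ < j ⊎ y′ ≡ j → j ~ w
          meet (inj₂ y′≡j) = subst (_~ w) y′≡j y′~w
          meet (inj₁ y′<j) = ~-trans (~-sym (noncrossing y′<j j<w w<y
            (subst (_< y′ ℕ.+ n) (trans (ℕ.+-comm y′ m) m+y′) (ℕ.+-monoʳ-< y′ m<n)) y′~w (~-sym y~j))) y′~w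

      -- If o′ + m < o + n, then o - m, o, o′ - m, o′ interlace and noncrossing relates the opener
      -- `o` to o - m. Otherwise `o′` is among the `m` labels before o + n, where an opener of the
      -- same block stands. Either way an opener has a related label that is too close.
      openers-clash : ∀ {o o′} → m ≤ o → o < o′ → o′ < o ℕ.+ n → u o ≡ true → u o′ ≡ true → ¬ (o ~ o′)
      openers-clash {o} {o′} m≤o o<o′ o′<o+n uo uo′ o~o′ = by-cases (ℕ.<-cmp (o′ ℕ.+ m) (o ℕ.+ n))
        where
        i = o ∸ m
        m+i : m ℕ.+ i ≡ o
        m+i = ℕ.m+[n∸m]≡n m≤o
        i<o : i < o
        i<o = subst (i <_) m+i (ℕ.m<n+m i 0<m)
        k = o′ ∸ m
        m+k : m ℕ.+ k ≡ o′
        m+k = ℕ.m+[n∸m]≡n (ℕ.≤-trans m≤o (ℕ.<⇒≤ o<o′))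
        far : o ℕ.+ m < o′
        far = ℕ.≰⇒> λ o′≤o+m → u-true⁻ uo′ o<o′ o′≤o+m (~-sym o~o′)
        i≁o : ¬ (i ~ o)
        i≁o r = u-true⁻ uo i<o (ℕ.≤-reflexive (trans (sym m+i) (ℕ.+-comm m i))) (~-sym r)
        by-cases : _ → ⊥
        by-cases (tri< lt _ _) = i≁o (noncrossing {i} {o} {k} {o′} i<o
          (ℕ.+-cancelˡ-< m _ _ (subst₂ _<_ (ℕ.+-comm o m) (sym m+k) far)) (subst (k <_) m+k (ℕ.m<n+m k 0<m))
          (ℕ.+-cancelʳ-< m _ _ (subst (o′ ℕ.+ m <_) (trans (cong (ℕ._+ n) (sym m+i)) (rearrange m i n)) lt))
          (shift⁻ (subst₂ _~_ (sym m+i) (sym m+k) o~o′)) o~o′)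
          where
          rearrange : ∀ m i n → m ℕ.+ i ℕ.+ n ≡ i ℕ.+ n ℕ.+ m
          rearrange = ℕSolver.solve-∀
        by-cases (tri≈ _ eq _) = i≁o (~-trans (~-n i) (subst (_~ o) (sym n+i) (~-sym o~o′)))
          where
          rearrange : ∀ m i n → m ℕ.+ i ℕ.+ n ≡ n ℕ.+ i ℕ.+ m
          rearrange = ℕSolver.solve-∀
          n+i : n ℕ.+ i ≡ o′
          n+i = ℕ.+-cancelʳ-≡ m _ _ (sym (trans eq (trans (cong (ℕ._+ n) (sym m+i)) (rearrange m i n))))
        by-cases (tri> _ _ gt) = u-true⁻ (trans u-n uo) (subst (o′ <_) (ℕ.+-comm o n) o′<o+n)
            (ℕ.≤-trans (ℕ.≤-reflexive (ℕ.+-comm n o)) (ℕ.<⇒≤ gt)) (~-trans (~-sym (~-n o)) o~o′)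
          where
          u-n : u (n ℕ.+ o) ≡ u o
          u-n = trans (cong (λ z → u (z ℕ.+ o)) n≡em) (periodic-* u-period e o)

      ~-n-* : ∀ q x → x ~ (q ℕ.* n ℕ.+ x)
      ~-n-* zero    x = ~-refl
      ~-n-* (suc q) x = ~-trans (~-n-* q x) (subst ((q ℕ.* n ℕ.+ x) ~_) (sym (ℕ.+-assoc n (q ℕ.* n) x)) (~-n (q ℕ.* n ℕ.+ x)))

      u-n-* : ∀ q x → u (q ℕ.* n ℕ.+ x) ≡ u x
      u-n-* q x = trans (cong (λ z → u (z ℕ.+ x)) (sym (qem≡qn q))) (periodic-* u-period (q ℕ.* e) x)

      openers-congruent-< : ∀ {o o′} → m ≤ o → o < o′ → u o ≡ true → u o′ ≡ true → o ~ o′ → o % n ≡ o′ % n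
      openers-congruent-< {o} {o′} m≤o o<o′ uo uo′ o~o′ = by-cases (ℕ.m≤n⇒m<n∨m≡n o″≤o′)
        where
        d = o′ ∸ o
        q = d / n
        o″ = q ℕ.* n ℕ.+ o
        split : o″ ℕ.+ d % n ≡ o′
        split = trans (rearrange (q ℕ.* n) o (d % n)) (trans (cong (o ℕ.+_) (sym (m≡m%n+[m/n]*n d n))) (ℕ.m+[n∸m]≡n (ℕ.<⇒≤ o<o′)))
          where
          rearrange : ∀ q o r → q ℕ.+ o ℕ.+ r ≡ o ℕ.+ (r ℕ.+ q)
          rearrange = ℕSolver.solve-∀
        o″≤o′ : o″ ≤ o′
        o″≤o′ = subst (o″ ≤_) split (ℕ.m≤m+n o″ _)
        o″%n : o″ % n ≡ o % n
        o″%n = trans (cong (_% n) (ℕ.+-comm (q ℕ.* n) o)) ([m+kn]%n≡m%n o q n)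
        by-cases : o″ < o′ ⊎ o″ ≡ o′ → o % n ≡ o′ % n
        by-cases (inj₂ eq) = trans (sym o″%n) (cong (_% n) eq)
        by-cases (inj₁ lt) = ⊥-elim (openers-clash (ℕ.≤-trans m≤o (ℕ.m≤n+m o _)) lt
          (subst (_< o″ ℕ.+ n) split (ℕ.+-monoʳ-< o″ (m%n<n d n))) (trans (u-n-* q o) uo) uo′ (~-trans (~-sym (~-n-* q o)) o~o′))

      openers-congruent : ∀ {o o′} → m ≤ o → m ≤ o′ → u o ≡ true → u o′ ≡ true → o ~ o′ → o % n ≡ o′ % n
      openers-congruent {o} {o′} m≤o m≤o′ uo uo′ o~o′ with ℕ.<-cmp o o′
      ... | tri< lt _ _   = openers-congruent-< m≤o lt uo uo′ o~o′
      ... | tri≈ _ refl _ = refl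
      ... | tri> _ _ gt   = sym (openers-congruent-< m≤o′ gt uo′ uo (~-sym o~o′))

      congruent⇒~ : ∀ {x y} → x % n ≡ y % n → x ~ y
      congruent⇒~ {x} {y} eq = ~-trans (~-sym (residue x)) (subst (_~ y) (sym eq) (residue y))
        where
        residue : ∀ x → (x % n) ~ x
        residue x = subst ((x % n) ~_) (trans (ℕ.+-comm _ (x % n)) (sym (m≡m%n+[m/n]*n x n))) (~-n-* (x / n) (x % n))

      -- An arc over one of the `m` points before `x` can start almost 2m before `x`, and `agree`
      -- requires the start to be at least `m`.
      3m : ℕ
      3m = m ℕ.+ m ℕ.+ m

      2m≤ : ∀ {x} → 3m ≤ x → m ℕ.+ m ≤ x
      2m≤ 3m≤x = ℕ.≤-trans (ℕ.m≤m+n _ m) 3m≤x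

      closed-shift′ : ∀ {x} → 3m ≤ x → Closed x → ∃ λ w → m ℕ.+ w ≡ x × m ≤ w × x ~ w
      closed-shift′ {x} 3m≤x C = w , m+w , m≤w , subst (_~ w) m+w (closed-shift m≤w (subst Closed (sym m+w) C))
        where
        w = x ∸ m
        m+w : m ℕ.+ w ≡ x
        m+w = ℕ.m+[n∸m]≡n (ℕ.≤-trans (ℕ.m≤m+n m m) (2m≤ 3m≤x))
        m≤w : m ≤ w
        m≤w = ℕ.+-cancelˡ-≤ m _ _ (subst (m ℕ.+ m ≤_) (sym m+w) (2m≤ 3m≤x))

      closed-up : ∀ {x} → 3m ≤ x → Closed x → ∀ q → (q ℕ.* m ℕ.+ x) ~ x
      closed-up {x} 3m≤x C zero = ~-refl
      closed-up {x} 3m≤x C (suc q) = up (closed-shift′ 3m≤x C)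
        where
        up : (∃ λ w → m ℕ.+ w ≡ x × m ≤ w × x ~ w) → (suc q ℕ.* m ℕ.+ x) ~ x
        up (w , m+w , _ , x~w) = ~-trans (subst (_~ (m ℕ.+ x)) (sym (ℕ.+-assoc m (q ℕ.* m) x)) (shift⁺ (closed-up 3m≤x C q)))
          (subst ((m ℕ.+ x) ~_) m+w (shift⁺ x~w))

      -- Moving `x′` by multiples of `m` stays in its block by `closed-up` and ends at `x″` with x″
      -- ≤ x < x″ + m. If x″ < x, the labels x - m, x″, x, x″ + m interlace, so the two blocks
      -- coincide.
      closed-same-≤ : .{{_ : NonZero m}} → ∀ {x x′} → 3m ≤ x → 3m ≤ x′ → x′ ≤ x → Closed x → Closed x′ → x ~ x′
      closed-same-≤ {x} {x′} 3m≤x 3m≤x′ x′≤x C C′ = meet (closed-shift′ 3m≤x C) (ℕ.m≤n⇒m<n∨m≡n x″≤x)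
        where
        d = x ∸ x′
        q = d / m
        x″ = q ℕ.* m ℕ.+ x′
        split : x″ ℕ.+ d % m ≡ x
        split = trans (rearrange (q ℕ.* m) x′ (d % m)) (trans (cong (x′ ℕ.+_) (sym (m≡m%n+[m/n]*n d m))) (ℕ.m+[n∸m]≡n x′≤x))
          where
          rearrange : ∀ q o r → q ℕ.+ o ℕ.+ r ≡ o ℕ.+ (r ℕ.+ q)
          rearrange = ℕSolver.solve-∀
        x″≤x : x″ ≤ x
        x″≤x = subst (x″ ≤_) split (ℕ.m≤m+n x″ _)
        x<x″+m : x < x″ ℕ.+ m
        x<x″+m = subst (_< x″ ℕ.+ m) split (ℕ.+-monoʳ-< x″ (m%n<n d m))
        x″~x′ : x″ ~ x′
        x″~x′ = closed-up 3m≤x′ C′ q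
        x″~x″+m : x″ ~ (x″ ℕ.+ m)
        x″~x″+m = ~-trans x″~x′ (~-sym (subst (_~ x′) (trans (ℕ.+-assoc m (q ℕ.* m) x′) (ℕ.+-comm m x″)) (closed-up 3m≤x′ C′ (suc q))))
        meet : (∃ λ w → m ℕ.+ w ≡ x × m ≤ w × x ~ w) → x″ < x ⊎ x″ ≡ x → x ~ x′
        meet _ (inj₂ eq) = subst (_~ x′) eq x″~x′
        meet (w , m+w , _ , x~w) (inj₁ x″<x) = ~-trans x~w (~-trans (noncrossing {w} {x″} {x} {x″ ℕ.+ m} w<x″ x″<x x<x″+m below (~-sym x~w) x″~x″+m) x″~x′)
          where
          w<x″ : w < x″
          w<x″ = ℕ.+-cancelˡ-< m _ _ (subst₂ _<_ (sym m+w) (ℕ.+-comm x″ m) x<x″+m)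
          below : x″ ℕ.+ m < w ℕ.+ n
          below = ℕ.<-≤-trans (ℕ.+-monoˡ-< m x″<x) (ℕ.≤-trans (ℕ.≤-reflexive (trans (cong (ℕ._+ m) (sym m+w)) (rearrange m w))) (ℕ.+-monoʳ-≤ w 2m≤n))
            where
            rearrange : ∀ m w → m ℕ.+ w ℕ.+ m ≡ w ℕ.+ (m ℕ.+ m)
            rearrange = ℕSolver.solve-∀

      closed-same : ∀ {x x′} → 3m ≤ x → 3m ≤ x′ → Closed x → Closed x′ → x ~ x′
      closed-same {x} {x′} p p′ C C′ with ℕ.≤-total x x′
      ... | inj₁ le = ~-sym (closed-same-≤ {{ℕ.>-nonZero 0<m}} p′ p le C′ C)
      ... | inj₂ ge = closed-same-≤ {{ℕ.>-nonZero 0<m}} p p′ ge C C′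

      opener-≥m : ∀ {x o} → 3m ≤ x → Opener x o → m ≤ o
      opener-≥m 3m≤x O = ℕ.+-cancelʳ-≤ m _ _ (ℕ.≤-trans (2m≤ 3m≤x) (ℕ.<⇒≤ (Opener.close O)))

      -- The block of a closed label is preserved by the shift through `m`. If the opener `o`
      -- belonged to it, `o` would be related to o - m.
      opener-closed-apart : ∀ {x x′ o} → 3m ≤ x → 3m ≤ x′ → Opener x o → Closed x′ → ¬ (x ~ x′)
      opener-closed-apart {x} {x′} {o} 3m≤x 3m≤x′ O C x~x′ = clash (closed-shift′ 3m≤x′ C)
        where
        q = o ∸ m
        m+q : m ℕ.+ q ≡ o
        m+q = ℕ.m+[n∸m]≡n (opener-≥m 3m≤x O)
        o~x′ : o ~ x′
        o~x′ = ~-trans (o~x O) x~x′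
        clash : (∃ λ w → m ℕ.+ w ≡ x′ × m ≤ w × x′ ~ w) → ⊥
        clash (w , m+w , _ , x′~w) = u-true⁻ (opens O) (subst (q <_) m+q (ℕ.m<n+m q 0<m)) (ℕ.≤-reflexive (trans (sym m+q) (ℕ.+-comm m q)))
          (~-trans o~x′ (~-trans x′~w (~-sym (shift⁻ (subst₂ _~_ (sym m+q) (sym m+w) o~x′)))))

      opener-source : ∀ {x o k} → 3m ≤ x → Opener x o → Near (suc x) k → k ≡ o
      opener-source 3m≤x O N = source-unique (src N) (src (opener-near (opener-≥m 3m≤x O) O))

      near⇒opener : ∀ {x k} → 3m ≤ x → Near (suc x) k → Opener x k
      near⇒opener {x} {k} 3m≤x N = by-cases (opener? x)
        where
        by-cases : (∃ λ o → Opener x o) ⊎ Closed x → Opener x k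
        by-cases (inj₁ (o , O)) = subst (Opener x) (sym (opener-source 3m≤x O N)) O
        by-cases (inj₂ C)       = ⊥-elim (Near⇒¬Central N (closed-central 3m≤x C))

      central⇒closed : ∀ {x} → 3m ≤ x → Central (suc x) → Closed x
      central⇒closed 3m≤x C o O = Near⇒¬Central (opener-near (opener-≥m 3m≤x O) O) C

      ~⇒linked : ∀ {x y} → 3m ≤ x → 3m ≤ y → x ~ y → Linked (suc x) (suc y)
      ~⇒linked {x} {y} p q x~y = by-cases (opener? x) (opener? y)
        where
        by-cases : (∃ λ o → Opener x o) ⊎ Closed x → (∃ λ o → Opener y o) ⊎ Closed y → Linked (suc x) (suc y)
        by-cases (inj₁ (o , O)) (inj₁ (o′ , O′)) = inj₂ (o , o′ , opener-near (opener-≥m p O) O , opener-near (opener-≥m q O′) O′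
          , openers-congruent (opener-≥m p O) (opener-≥m q O′) (opens O) (opens O′) (~-trans (o~x O) (~-trans x~y (~-sym (o~x O′)))))
        by-cases (inj₂ C)       (inj₂ C′)        = inj₁ (closed-central p C , closed-central q C′)
        by-cases (inj₁ (o , O)) (inj₂ C′)        = ⊥-elim (opener-closed-apart p q O C′ x~y)
        by-cases (inj₂ C)       (inj₁ (o , O))   = ⊥-elim (opener-closed-apart q p O C (~-sym x~y))

      linked⇒~ : ∀ {x y} → 3m ≤ x → 3m ≤ y → Linked (suc x) (suc y) → x ~ y
      linked⇒~ p q (inj₁ (C , C′)) = closed-same p q (central⇒closed p C) (central⇒closed q C′)
      linked⇒~ p q (inj₂ (k , l , N , N′ , eq)) =
        ~-trans (~-sym (o~x (near⇒opener p N))) (~-trans (congruent⇒~ eq) (o~x (near⇒opener q N′)))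

      -- Cut open at a suitable place, the periodic steps are those of a Dyck path, up to the first one when there is a central block.
      rising-count : 0ℤ <ℤ h m → e ℕ.* count u m ≡ a
      rising-count pos = from-cut (rising-cut pos 3m)
        where
        from-cut : (∃ λ c → 3m ≤ c × (∀ z → c < z → h c <ℤ h z)) → e ℕ.* count u m ≡ a
        from-cut (c , 3m≤c , low) = trans (sym (count-period u-period e)) (trans (cong (count u) (sym n≡em)) (trans (sym (count-window u-n c)) (trans (count-cong n same) V.count-north)))
          where
          module V = View (view c)
          u-n : ∀ x → u (n ℕ.+ x) ≡ u x
          u-n x = trans (cong (λ z → u (z ℕ.+ x)) n≡em) (periodic-* u-period e x)
          -- Every point after `c` is higher than `c`, so none of them has its source before `c`.
          above-c : ∀ {w o} → c ≤ w → Near (suc w) o → c ≤ o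
          above-c c≤w N = source-latest (src N) (s≤s c≤w) (low _ (s≤s c≤w))
          no-central : ∀ {z} → c ≤ z → ¬ Closed z
          no-central {z} c≤z C = Near⇒¬Central (proj₂ (rising-near pos (ℕ.m≤n⇒m≤1+n (ℕ.≤-trans (ℕ.m≤m+n m m) (2m≤ 3m≤z))))) (closed-central 3m≤z C)
            where
            3m≤z = ℕ.≤-trans 3m≤c c≤z
          same : ∀ t → t < n → u (c ℕ.+ t) ≡ V.s t
          same t t<n = bool-agree (λ uz st → fwd uz (V.east t<n st)) (λ uz st → bwd uz st (opener? z))
            where
            z = c ℕ.+ t
            3m≤z : 3m ≤ z
            3m≤z = ℕ.≤-trans 3m≤c (ℕ.m≤m+n c t)
            fwd : u z ≡ true → (∃ λ j → j < t × z ~ (c ℕ.+ j)) → ⊥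
            fwd uz (j , j<t , z~w) = by-cases (opener? w)
              where
              w = c ℕ.+ j
              w<z : w < z
              w<z = ℕ.+-monoʳ-< c j<t
              3m≤w : 3m ≤ w
              3m≤w = ℕ.≤-trans 3m≤c (ℕ.m≤m+n c j)
              Oz : Opener z z
              Oz = opener ℕ.≤-refl (ℕ.m<m+n z 0<m) uz ~-refl
              by-cases : (∃ λ o → Opener w o) ⊎ Closed w → ⊥
              by-cases (inj₂ C) = no-central (ℕ.m≤m+n c j) C
              by-cases (inj₁ (o , O)) = ℕ.<-irrefl (%-window n (openers-congruent (opener-≥m 3m≤w O) (opener-≥m 3m≤z Oz) (opens O) uz (~-trans (o~x O) (~-sym z~w)))
                  (ℕ.<⇒≤ o<z) (ℕ.<-≤-trans (ℕ.+-monoʳ-< c t<n) (ℕ.+-monoˡ-≤ n (above-c (ℕ.m≤m+n c j) (opener-near (opener-≥m 3m≤w O) O))))) o<z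
                where
                o<z : o < z
                o<z = ℕ.≤-<-trans (o≤x O) w<z
            bwd : u z ≡ false → V.s t ≡ true → (∃ λ o → Opener z o) ⊎ Closed z → ⊥
            bwd uz st (inj₂ C) = no-central (ℕ.m≤m+n c t) C
            bwd uz st (inj₁ (o , O)) = V.north {j = o ∸ c} t<n st (ℕ.+-cancelˡ-< c _ _ (subst (_< z) (sym c+) o<z)) (subst (z ~_) (sym c+) (~-sym (o~x O)))
              where
              c+ : c ℕ.+ (o ∸ c) ≡ o
              c+ = ℕ.m+[n∸m]≡n (above-c (ℕ.m≤m+n c t) (opener-near (opener-≥m 3m≤z O) O))
              o<z : o < z
              o<z = ℕ.≤∧≢⇒< (o≤x O) λ o≡z → bool-contra (opens O) (trans (cong u o≡z) uz)

      -- The cut is made at a label `c` of the central block. A Dyck path must begin with a north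
      -- step, whereas `u` has an east step at `c`, because closed labels are not openers. This one
      -- step is the whole difference.
      falling-count : h m ≤ℤ 0ℤ → suc (e ℕ.* count u m) ≡ a
      falling-count neg = from-cut (falling-cut neg 3m)
        where
        from-cut : (∃ λ c → 3m ≤ c × Central (suc c)) → suc (e ℕ.* count u m) ≡ a
        from-cut (c , 3m≤c , cen) = trans (cong suc (trans (sym (count-period u-period e)) (trans (cong (count u) (sym n≡em)) (sym (count-window u-n c))))) (trans (count-first n 0<n′ first-u first-s same) V.count-north)
          where
          module V = View (view c)
          0<n′ : 0 < n
          0<n′ = ℕ.≤-trans (s≤s z≤n) m<n
          u-n : ∀ x → u (n ℕ.+ x) ≡ u x
          u-n x = trans (cong (λ z → u (z ℕ.+ x)) n≡em) (periodic-* u-period e x)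
          Cc : Closed c
          Cc = central⇒closed 3m≤c cen
          first-u : u (c ℕ.+ 0) ≡ false
          first-u = trans (cong u (ℕ.+-identityʳ c)) (helper (u c) refl)
            where
            helper : ∀ v → u c ≡ v → u c ≡ false
            helper false uc = uc
            helper true  uc = ⊥-elim (Cc c (opener ℕ.≤-refl (ℕ.m<m+n c 0<m) uc ~-refl))
          first-s : V.s 0 ≡ true
          first-s = bool-agree (λ _ ()) λ s0 _ → V.start s0
          above-c : ∀ {w o} → c < w → Near (suc w) o → c < o
          above-c {w} {o} c<w N = ℕ.≰⇒> λ o≤c → ℤ.<⇒≱ (lower (src N))
            (ℤ.≤-trans (between (src N) (suc c) (s≤s o≤c) (s≤s c<w)) (cen o (s≤s o≤c) (ℕ.≤-trans (s≤s (ℕ.<⇒≤ c<w)) (close N))))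
          same : ∀ t → 0 < t → t < n → u (c ℕ.+ t) ≡ V.s t
          same t 0<t t<n = bool-agree (λ uz st → fwd uz (V.east t<n st)) (λ uz st → bwd uz st (opener? z))
            where
            z = c ℕ.+ t
            3m≤z : 3m ≤ z
            3m≤z = ℕ.≤-trans 3m≤c (ℕ.m≤m+n c t)
            fwd : u z ≡ true → (∃ λ j → j < t × z ~ (c ℕ.+ j)) → ⊥
            fwd uz (j , j<t , z~w) = by-cases (opener? w)
              where
              w = c ℕ.+ j
              w<z : w < z
              w<z = ℕ.+-monoʳ-< c j<t
              3m≤w : 3m ≤ w
              3m≤w = ℕ.≤-trans 3m≤c (ℕ.m≤m+n c j)
              Oz : Opener z z
              Oz = opener ℕ.≤-refl (ℕ.m<m+n z 0<m) uz ~-refl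
              by-cases : (∃ λ o → Opener w o) ⊎ Closed w → ⊥
              by-cases (inj₂ C) = opener-closed-apart 3m≤z 3m≤w Oz C z~w
              by-cases (inj₁ (o , O)) = ℕ.<-irrefl (%-window n (openers-congruent (opener-≥m 3m≤w O) (opener-≥m 3m≤z Oz) (opens O) uz (~-trans (o~x O) (~-sym z~w)))
                  (ℕ.<⇒≤ o<z) (ℕ.<-trans (ℕ.+-monoʳ-< c t<n) (ℕ.+-monoˡ-< n (above-c c<w (opener-near (opener-≥m 3m≤w O) O))))) o<z
                where
                o<z : o < z
                o<z = ℕ.≤-<-trans (o≤x O) w<z
                c<w : c < w
                c<w = ℕ.≤∧≢⇒< (ℕ.m≤m+n c j) λ c≡w → Cc o (subst (λ v → Opener v o) (sym c≡w) O)
            bwd : u z ≡ false → V.s t ≡ true → (∃ λ o → Opener z o) ⊎ Closed z → ⊥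
            bwd uz st (inj₂ C) = V.north {j = 0} t<n st 0<t (subst (z ~_) (sym (ℕ.+-identityʳ c)) (closed-same 3m≤z 3m≤c C Cc))
            bwd uz st (inj₁ (o , O)) = V.north {j = o ∸ c} t<n st (ℕ.+-cancelˡ-< c _ _ (subst (_< z) (sym c+) o<z)) (subst (z ~_) (sym c+) (~-sym (o~x O)))
              where
              c+ : c ℕ.+ (o ∸ c) ≡ o
              c+ = ℕ.m+[n∸m]≡n (ℕ.<⇒≤ (above-c (ℕ.m<m+n c 0<t) (opener-near (opener-≥m 3m≤z O) O)))
              o<z : o < z
              o<z = ℕ.≤∧≢⇒< (o≤x O) λ o≡z → bool-contra (opens O) (trans (cong u o≡z) uz)

-- Dyck paths realizing periodic words

module Realization where

  open import Data.Bool using (true; false; if_then_else_)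
  open import Data.Nat as ℕ using (ℕ; zero; suc; _≤_; _<_; z≤n; s≤s; _∸_; NonZero; _%_; _<ᵇ_)
  import Data.Nat.Properties as ℕ
  open import Data.Nat.Coprimality using (Coprime)
  open import Data.Integer as ℤ using (ℤ; +_; -_; 0ℤ; 1ℤ; _+_; _*_; _-_) renaming (_<_ to _<ℤ_; _≤_ to _≤ℤ_)
  import Data.Integer.Properties as ℤ
  open import Data.Integer.Tactic.RingSolver using (solve-∀)
  open import Data.Product using (∃; _×_; _,_; proj₂)
  open import Data.Sum using (_⊎_; inj₁; inj₂)
  open import Data.Empty using (⊥-elim)
  open import Relation.Nullary using (¬_; yes; no)
  open import Relation.Binary.PropositionalEquality using (_≡_; refl; sym; trans; cong; cong₂; subst; subst₂)
  open Sources
  open Heights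
  open LaserFire
  open PeriodicPaths

  %-window-≡ : ∀ n .{{_ : NonZero n}} {c x y} → x % n ≡ y % n → c ≤ x → c ≤ y → x < c ℕ.+ n → y < c ℕ.+ n → x ≡ y
  %-window-≡ n {c} {x} {y} eq c≤x c≤y x< y< with ℕ.≤-total x y
  ... | inj₁ x≤y = %-window n eq x≤y (ℕ.<-≤-trans y< (ℕ.+-monoˡ-≤ n c≤x))
  ... | inj₂ y≤x = sym (%-window n (sym eq) y≤x (ℕ.<-≤-trans x< (ℕ.+-monoˡ-≤ n c≤y)))

  module RealizeSteps (a b : ℕ) (0<a : 0 < a) (0<b : 0 < b) (cop : Coprime a b)
    (m n : ℕ) .{{_ : NonZero n}} (suc-n : suc n ≡ a ℕ.+ b) (0<m : 0 < m) (2m≤n : m ℕ.+ m ≤ n) (e : ℕ) (n≡em : n ≡ e ℕ.* m)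
    (u : Steps) (per : ∀ x → u (m ℕ.+ x) ≡ u x) where

    open Laser a b 0<a 0<b cop
    open PeriodicSteps a b 0<a 0<b m n 0<m 2m≤n e n≡em u per public

    -- So h n = (n + 1) c - a n. This equals `a` for c = a, and a - (n + 1) = - b for c = a - 1.
    h-n : ∀ c → count u n ≡ c → h n + + a * + n ≡ (1ℤ + + n) * + c
    h-n c eq = trans (H-count u n) (cong₂ (λ N c → + N * + c) (sym suc-n) eq)

    count-n : count u n ≡ e ℕ.* count u m
    count-n = trans (cong (count u) n≡em) (count-period per e)

    h-n-rising : e ℕ.* count u m ≡ a → h n ≡ + a
    h-n-rising eq = +-cancelʳ-≡ℤ (+ a * + n) (trans (h-n a (trans count-n eq)) (lemma (+ a) (+ n)))
      where
      lemma : ∀ a n → (1ℤ + n) * a ≡ a + a * n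
      lemma = solve-∀

    h-n-falling : suc (e ℕ.* count u m) ≡ a → h n ≡ - + b
    h-n-falling eq = +-cancelʳ-≡ℤ (+ a * + n) (trans (h-n c count-n) (trans (lemma (+ n) (+ c) (+ b) (+ a) size (cong +_ eq)) (ℤ.+-comm (+ a * + n) (- + b))))
      where
      c = e ℕ.* count u m
      size : 1ℤ + + n ≡ + a + + b
      size = cong +_ suc-n
      lemma : ∀ n c b a → 1ℤ + n ≡ a + b → 1ℤ + c ≡ a → (1ℤ + n) * c ≡ a * n + - b
      lemma n c b a p q = trans (ring₁ n c b) (trans (cong (λ z → (1ℤ + c) * n + (z - (1ℤ + n) + - b)) p″) (trans (ring₂ n c b) (cong (λ z → z * n + - b) q)))
        where
        p″ : 1ℤ + c + b ≡ 1ℤ + n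
        p″ = trans (cong (_+ b) q) (sym p)
        ring₁ : ∀ n c b → (1ℤ + n) * c ≡ (1ℤ + c) * n + (1ℤ + c + b - (1ℤ + n) + - b)
        ring₁ = solve-∀
        ring₂ : ∀ n c b → (1ℤ + c) * n + (1ℤ + n - (1ℤ + n) + - b) ≡ (1ℤ + c) * n + - b
        ring₂ = solve-∀

    -- Over `n` steps the height changes by `e` times its change over one period, so the sign can be
    -- read from `h n`.
    rising : e ℕ.* count u m ≡ a → 0ℤ <ℤ h m
    rising eq = ℤ.≰⇒> λ neg → ℤ.<⇒≱ (ℤ.+<+ 0<a) (subst (_≤ℤ 0ℤ) (trans (cong h (sym n≡em)) (h-n-rising eq)) (h-falls neg e))

    falling : suc (e ℕ.* count u m) ≡ a → h m ≤ℤ 0ℤ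
    falling eq = ℤ.≮⇒≥ λ pos → ℤ.<⇒≱ (ℤ.neg-mono-< (ℤ.+<+ 0<b)) (subst (0ℤ ≤ℤ_) (trans (cong h (sym n≡em)) (h-n-falling eq)) (h-rises (ℤ.<⇒≤ pos) e))

    record Realization (c : ℕ) : Set where
      field
        s      : Steps
        isDyck : Dyck s
        to     : ∀ {i j} → i < n → j < n → SameSource (H s) (suc i) (suc j) → Linked (suc (c ℕ.+ i)) (suc (c ℕ.+ j))
        from   : ∀ {i j} → i < n → j < n → Linked (suc (c ℕ.+ i)) (suc (c ℕ.+ j)) → SameSource (H s) (suc i) (suc j)

    -- The `n` steps after the cut rise by `a`, and one appended east step closes the path. Since
    -- everything after `c` is higher, the path stays nonnegative and no source lies before `c`.
    realize-rising : 0ℤ <ℤ h m → h n ≡ + a → ∀ c → m ≤ c → (∀ z → c < z → h c <ℤ h z) → Realization c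
    realize-rising pos hn c m≤c low = record { s = s ; isDyck = D ; to = to ; from = from }
      where
      s : Steps
      s t = if t <ᵇ n then u (c ℕ.+ t) else false
      s-< : ∀ t → t < n → s t ≡ u (c ℕ.+ t)
      s-< t t<n rewrite <ᵇ-true⁺ t<n = refl
      s-n : s n ≡ false
      s-n with n <ᵇ n in eq
      ... | true  = ⊥-elim (ℕ.<-irrefl refl (<ᵇ-true⁻ {n} {n} eq))
      ... | false = refl
      T : Translate (H s) h 0 c (0ℤ - h c) n
      T = agree-translate {s} {u} 0 c n s-<
      T′ : Translate h (H s) c 0 (- (0ℤ - h c)) n
      T′ = translate-sym {H s} {h} {0} {c} T
      D : Dyck s
      D = dyck nn cl
        where
        cl : H s (a ℕ.+ b) ≡ 0ℤ
        cl = trans (cong (H s) (sym suc-n)) (trans (cong₂ (λ x y → x + step y) (T n ℕ.≤-refl) s-n)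
          (trans (cong (λ z → z + (0ℤ - h c) + - + a) (trans (cong h (ℕ.+-comm c n)) (trans (h-n-period c) (cong (λ z → h c + z) hn)))) (lemma (h c) (+ a))))
          where
          lemma : ∀ h a → h + a + (0ℤ - h) + - a ≡ 0ℤ
          lemma = solve-∀
        nn : ∀ k → k ≤ a ℕ.+ b → 0ℤ ≤ℤ H s k
        nn k k≤ with ℕ.m≤n⇒m<n∨m≡n k≤
        ... | inj₂ k≡ = ℤ.≤-reflexive (sym (trans (cong (H s) k≡) cl))
        nn zero    k≤ | inj₁ k< = ℤ.≤-refl
        nn (suc k) k≤ | inj₁ k< = subst₂ _≤ℤ_ (lemma (h c)) (sym (T (suc k) (ℕ.≤-pred (subst (suc k <_) (sym suc-n) k<))))
            (ℤ.+-monoˡ-≤ (0ℤ - h c) (ℤ.<⇒≤ (low (c ℕ.+ suc k) (ℕ.m<m+n c (s≤s z≤n)))))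
          where
          lemma : ∀ h → h + (0ℤ - h) ≡ 0ℤ
          lemma = solve-∀
      to-near : ∀ {i k} → i < n → Source (H s) (suc i) k → Near (suc (c ℕ.+ i)) (c ℕ.+ k)
      to-near {i} {k} i<n S with rising-near pos {suc (c ℕ.+ i)} (ℕ.m≤n⇒m≤1+n (ℕ.≤-trans m≤c (ℕ.m≤m+n c i)))
      ... | l , N = subst (Near (suc (c ℕ.+ i))) (source-unique (src N) (subst (λ z → Source h z (c ℕ.+ k)) (ℕ.+-suc c i) (translate-source T′ {suc i} {k} i<n S))) N
      from-near : ∀ {i k} → i < n → Near (suc (c ℕ.+ i)) (c ℕ.+ k) → Source (H s) (suc i) k
      from-near {i} {k} i<n N = translate-source T {suc i} {k} i<n (subst (λ z → Source h z (c ℕ.+ k)) (sym (ℕ.+-suc c i)) (src N))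
      above-c : ∀ {i k} → Near (suc (c ℕ.+ i)) k → c ≤ k
      above-c {i} N = source-latest (src N) (s≤s (ℕ.m≤m+n c i)) (low _ (s≤s (ℕ.m≤m+n c i)))
      to : ∀ {i j} → i < n → j < n → SameSource (H s) (suc i) (suc j) → Linked (suc (c ℕ.+ i)) (suc (c ℕ.+ j))
      to i<n j<n (k , S , S′) = inj₂ (c ℕ.+ k , c ℕ.+ k , to-near i<n S , to-near j<n S′ , refl)
      from : ∀ {i j} → i < n → j < n → Linked (suc (c ℕ.+ i)) (suc (c ℕ.+ j)) → SameSource (H s) (suc i) (suc j)
      from {i} i<n j<n (inj₁ (C , _)) = ⊥-elim (Near⇒¬Central (proj₂ (rising-near pos (ℕ.m≤n⇒m≤1+n (ℕ.≤-trans m≤c (ℕ.m≤m+n c i))))) C)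
      from {i} {j} i<n j<n (inj₂ (k , l , N , N′ , eq)) = k ∸ c , from-near i<n (subst (Near _) (sym k≡) N)
          , from-near j<n (subst (Near _) (sym (trans k≡ k≡l)) N′)
        where
        below : ∀ {i k} → i < n → Near (suc (c ℕ.+ i)) k → k < c ℕ.+ n
        below i<n N = ℕ.≤-<-trans (ℕ.≤-pred (before (src N))) (ℕ.+-monoʳ-< c i<n)
        k≡l : k ≡ l
        k≡l = %-window-≡ n eq (above-c N) (above-c N′) (below i<n N) (below j<n N′)
        k≡ : c ℕ.+ (k ∸ c) ≡ k
        k≡ = ℕ.m+[n∸m]≡n (above-c N)

    -- The `n` steps after the central point `suc c` fall by `b`, and one prepended north step
    -- compensates. The starting point of that step becomes the common source of all central points.
    -- The bound n ≤ c permits comparing a point with its translate a full turn back.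
    realize-falling : h m ≤ℤ 0ℤ → h n ≡ - + b → ∀ c → n ≤ c → Central (suc c) → Realization c
    realize-falling neg hn c n≤c cen = record { s = s ; isDyck = D ; to = to ; from = from }
      where
      s : Steps
      s zero    = true
      s (suc t) = u (suc c ℕ.+ t)
      low : ∀ k → k ≤ suc c → h (suc c) ≤ℤ h k
      low k k≤ with ℕ.m≤n⇒m<n∨m≡n k≤
      ... | inj₁ k<   = central-global neg cen k k<
      ... | inj₂ refl = ℤ.≤-refl
      T : Translate (H s) h 1 (suc c) (+ b - h (suc c)) n
      T = subst (λ z → Translate (H s) h 1 (suc c) (z - h (suc c)) n) (ℤ.+-identityˡ (+ b)) (agree-translate {s} {u} 1 (suc c) n λ _ _ → refl)
      T′ : Translate h (H s) (suc c) 1 (- (+ b - h (suc c))) n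
      T′ = translate-sym {H s} {h} {1} {suc c} T
      h-end : h (suc c ℕ.+ n) ≡ h (suc c) + - + b
      h-end = trans (cong h (ℕ.+-comm (suc c) n)) (trans (h-n-period (suc c)) (cong (λ z → h (suc c) + z) hn))
      end-low : ∀ k → k ≤ suc c ℕ.+ n → h (suc c) + - + b ≤ℤ h k
      end-low k k≤ with k ℕ.≤? suc c
      ... | yes k≤c = ℤ.≤-trans (subst (h (suc c) + - + b ≤ℤ_) (ℤ.+-identityʳ _) (ℤ.+-monoʳ-≤ (h (suc c)) (ℤ.neg-mono-≤ (ℤ.+≤+ z≤n)))) (low k k≤c)
      ... | no k≰c = subst₂ _≤ℤ_ (cong (λ z → h (suc c) + z) hn) (trans (sym (h-n-period k′)) (cong h n+k′)) (ℤ.+-monoˡ-≤ (h n) (low k′ k′≤))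
        where
        k′ = k ∸ n
        n+k′ : n ℕ.+ k′ ≡ k
        n+k′ = ℕ.m+[n∸m]≡n (ℕ.≤-trans n≤c (ℕ.≤-trans (ℕ.n≤1+n c) (ℕ.<⇒≤ (ℕ.≰⇒> k≰c))))
        k′≤ : k′ ≤ suc c
        k′≤ = ℕ.+-cancelˡ-≤ n _ _ (ℕ.≤-trans (ℕ.≤-reflexive n+k′) (ℕ.≤-trans k≤ (ℕ.≤-reflexive (ℕ.+-comm (suc c) n))))
      D : Dyck s
      D = dyck nn cl
        where
        cl : H s (a ℕ.+ b) ≡ 0ℤ
        cl = trans (cong (H s) (sym suc-n)) (trans (T n ℕ.≤-refl) (trans (cong (_+ (+ b - h (suc c))) h-end) (lemma (h (suc c)) (+ b))))
          where
          lemma : ∀ h b → h + - b + (b - h) ≡ 0ℤ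
          lemma = solve-∀
        nn : ∀ k → k ≤ a ℕ.+ b → 0ℤ ≤ℤ H s k
        nn zero    _  = ℤ.≤-refl
        nn (suc k) k≤ = subst₂ _≤ℤ_ (lemma (h (suc c)) (+ b)) (sym (T k k≤n))
            (ℤ.+-monoˡ-≤ (+ b - h (suc c)) (end-low (suc c ℕ.+ k) (ℕ.+-monoʳ-≤ (suc c) k≤n)))
          where
          k≤n : k ≤ n
          k≤n = ℕ.≤-pred (subst (suc k ≤_) (sym suc-n) k≤)
          lemma : ∀ h b → h + - b + (b - h) ≡ 0ℤ
          lemma = solve-∀
      root⇒central : ∀ {i} → i < n → Source (H s) (suc i) 0 → Central (suc (c ℕ.+ i))
      root⇒central {i} i<n S k k< _ with suc c ℕ.≤? k
      ... | yes c<k = subst (λ k → h (suc c ℕ.+ i) ≤ℤ h k) (ℕ.m+[n∸m]≡n c<k) (lowest (k ∸ suc c) (ℕ.+-cancelˡ-≤ (suc c) _ _ (subst (_≤ suc c ℕ.+ i) (sym (ℕ.m+[n∸m]≡n c<k)) (ℕ.<⇒≤ k<))))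
        where
        lowest : ∀ t → t ≤ i → h (suc c ℕ.+ i) ≤ℤ h (suc c ℕ.+ t)
        lowest t t≤i with ℕ.m≤n⇒m<n∨m≡n t≤i
        ... | inj₂ refl = ℤ.≤-refl
        ... | inj₁ t<i  = translate-≤ {h} {H s} {suc c} {1} T′ {i} {t} (ℕ.<⇒≤ i<n) (ℕ.<⇒≤ (ℕ.<-trans t<i i<n)) (between S (suc t) (s≤s z≤n) (s≤s t<i))
      ... | no c≮k = ℤ.≤-trans (first (ℕ.m≤n⇒m<n∨m≡n (z≤n {i}))) (low k (ℕ.<⇒≤ (ℕ.≰⇒> c≮k)))
        where
        first : 0 < i ⊎ 0 ≡ i → h (suc c ℕ.+ i) ≤ℤ h (suc c)
        first (inj₂ refl) = ℤ.≤-reflexive (cong h (ℕ.+-identityʳ (suc c)))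
        first (inj₁ 0<i)  = subst (λ z → h (suc c ℕ.+ i) ≤ℤ h z) (ℕ.+-identityʳ (suc c))
          (translate-≤ {h} {H s} {suc c} {1} T′ {i} {0} (ℕ.<⇒≤ i<n) z≤n (between S 1 (s≤s z≤n) (s≤s 0<i)))
      central⇒root : ∀ {i} → i < n → Central (suc (c ℕ.+ i)) → Source (H s) (suc i) 0
      central⇒root {i} i<n C = source (s≤s z≤n) (dyck-positive D (s≤s z≤n) (subst (suc i <_) suc-n (s≤s i<n))) btw
        where
        btw : ∀ t → 0 < t → t < suc i → H s (suc i) ≤ℤ H s t
        btw (suc t) _ (s≤s t<i) = translate-≤ {H s} {h} {1} {suc c} T {i} {t} (ℕ.<⇒≤ i<n) (ℕ.<⇒≤ (ℕ.<-trans t<i i<n))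
          (central-global neg C (suc c ℕ.+ t) (ℕ.+-monoʳ-< (suc c) t<i))
      to-near : ∀ {i k} → i < n → Source (H s) (suc i) (suc k) → Near (suc c ℕ.+ i) (suc c ℕ.+ k)
      to-near {i} {k} i<n S = by-cases (near? (suc c ℕ.+ i))
        where
        S′ : Source h (suc c ℕ.+ i) (suc c ℕ.+ k)
        S′ = translate-source T′ {i} {k} (ℕ.<⇒≤ i<n) S
        by-cases : (∃ λ k → Near (suc c ℕ.+ i) k) ⊎ Central (suc c ℕ.+ i) → Near (suc c ℕ.+ i) (suc c ℕ.+ k)
        by-cases (inj₁ (l , N)) = subst (Near _) (source-unique (src N) S′) N
        by-cases (inj₂ C)       = ⊥-elim (ℤ.<⇒≱ (lower S′) (central-global neg C _ (before S′)))
      to : ∀ {i j} → i < n → j < n → SameSource (H s) (suc i) (suc j) → Linked (suc (c ℕ.+ i)) (suc (c ℕ.+ j))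
      to i<n j<n (zero , S , S′)  = inj₁ (root⇒central i<n S , root⇒central j<n S′)
      to i<n j<n (suc k , S , S′) = inj₂ (suc c ℕ.+ k , suc c ℕ.+ k , to-near i<n S , to-near j<n S′ , refl)
      above-c : ∀ {i k} → Near (suc (c ℕ.+ i)) k → suc c ≤ k
      above-c {i} {k} N = ℕ.≰⇒> λ k≤c → ℤ.<⇒≱ (lower (src N)) (ℤ.≤-trans (high k≤c (ℕ.m≤n⇒m<n∨m≡n (z≤n {i}))) (low k (ℕ.m≤n⇒m≤1+n k≤c)))
        where
        high : k ≤ c → 0 < i ⊎ 0 ≡ i → h (suc c ℕ.+ i) ≤ℤ h (suc c)
        high _   (inj₂ refl) = ℤ.≤-reflexive (cong h (ℕ.+-identityʳ (suc c)))
        high k≤c (inj₁ 0<i)  = between (src N) (suc c) (s≤s k≤c) (ℕ.m<m+n (suc c) 0<i)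
      from : ∀ {i j} → i < n → j < n → Linked (suc (c ℕ.+ i)) (suc (c ℕ.+ j)) → SameSource (H s) (suc i) (suc j)
      from i<n j<n (inj₁ (C , C′)) = 0 , central⇒root i<n C , central⇒root j<n C′
      from {i} {j} i<n j<n (inj₂ (k , l , N , N′ , eq)) = suc (k ∸ suc c) , back i<n (subst (Near _) (sym k≡) N) , back j<n (subst (Near _) (sym (trans k≡ k≡l)) N′)
        where
        below : ∀ {i k} → i < n → Near (suc (c ℕ.+ i)) k → k < suc c ℕ.+ n
        below i<n N = ℕ.<-≤-trans (before (src N)) (ℕ.+-monoʳ-≤ (suc c) (ℕ.<⇒≤ i<n))
        k≡l : k ≡ l
        k≡l = %-window-≡ n eq (above-c N) (above-c N′) (below i<n N) (below j<n N′)
        k≡ : suc c ℕ.+ (k ∸ suc c) ≡ k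
        k≡ = ℕ.m+[n∸m]≡n (above-c N)
        back : ∀ {i k} → i < n → Near (suc c ℕ.+ i) (suc c ℕ.+ k) → Source (H s) (suc i) (suc k)
        back {i} {k} i<n N = translate-source T {i} {k} (ℕ.<⇒≤ i<n) (src N)

    realize : (e ℕ.* count u m ≡ a) ⊎ (suc (e ℕ.* count u m) ≡ a) → ∀ B → m ≤ B → n ≤ B → ∃ λ c → B ≤ c × Realization c
    realize (inj₁ eq) B m≤B n≤B with rising-cut (rising eq) B
    ... | c , B≤c , low = c , B≤c , realize-rising (rising eq) (h-n-rising eq) c (ℕ.≤-trans m≤B B≤c) low
    realize (inj₂ eq) B m≤B n≤B with falling-cut (falling eq) B
    ... | c , B≤c , cen = c , B≤c , realize-falling (falling eq) (h-n-falling eq) c (ℕ.≤-trans n≤B B≤c) cen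

-- Partitions fixed by a power of the rotation

module FixedPartitions where

  open import Data.Bool using (Bool; true; false)
  import Data.Bool.Properties as Bool
  open import Data.Nat as ℕ using (ℕ; zero; suc; _+_; _*_; _∸_; _≤_; _<_; z≤n; s≤s; NonZero; _%_; _/_)
  import Data.Nat.Properties as ℕ
  open import Data.Nat.DivMod using (m≡m%n+[m/n]*n; m%n<n; m%n%n≡m%n; m<n⇒m%n≡m; [m+kn]%n≡m%n; [m+n]%n≡m%n; %-congˡ)
  open import Data.Nat.Divisibility using (_∣_; divides)
  open import Data.Nat.GCD using (gcd; gcd-GCD; gcd[m,n]∣m; module Bézout)
  open import Data.Nat.Coprimality using (Coprime)
  open import Data.Integer as ℤ using (0ℤ)
  import Data.Integer.Properties as ℤ
  open import Data.List.Base using (List; []; _∷_; map; filter; length; applyUpTo)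
  open import Data.List.Properties using (length-applyUpTo; ∷-injectiveʳ; filter-all)
  open import Data.List.Membership.Propositional using (_∈_)
  open import Data.List.Membership.Propositional.Properties using (∈-map⁻; ∈-filter⁺; ∈-filter⁻; ∈-deduplicate⁻)
  open import Data.List.Relation.Unary.All using ([]; universal)
  open import Data.List.Relation.Unary.AllPairs using ([]; _∷_)
  open import Data.List.Relation.Unary.Unique.Propositional using (Unique)
  open import Data.List.Relation.Unary.Unique.Propositional.Properties using (map⁺; ++⁺; filter⁺)
  import Data.List.Relation.Unary.Unique.DecPropositional.Properties as DecUnique
  open import Data.Product using (∃; _×_; _,_; proj₁; proj₂)
  open import Data.Sum using (_⊎_; inj₁; inj₂)
  open import Data.Empty using (⊥; ⊥-elim)
  open import Relation.Nullary using (¬_; Dec; yes; no)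
  open import Relation.Nullary.Decidable using (_⊎-dec_)
  open import Relation.Binary.PropositionalEquality using (_≡_; refl; sym; trans; cong; cong₂; subst; subst₂)
  open import Defs
  open Counting
  open Sources
  open Heights
  open LaserFire
  open Partitions
  open Promotion
  open PeriodicPaths
  open SymmetricPartitions
  open Realization

  allPaths-unique : ∀ n → Unique (allPaths n)
  allPaths-unique zero    = [] ∷ []
  allPaths-unique (suc n) = ++⁺ (map⁺ ∷-injectiveʳ (allPaths-unique n)) (map⁺ ∷-injectiveʳ (allPaths-unique n)) disjoint
    where
    disjoint : ∀ {p} → ¬ (p ∈ map (true ∷_) (allPaths n) × p ∈ map (false ∷_) (allPaths n))
    disjoint (q , r) with ∈-map⁻ (true ∷_) q | ∈-map⁻ (false ∷_) r
    ... | _ , _ , refl | _ , _ , ()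

  -- The words that, repeated e times, leave room for one more step in a path with a north steps.
  Fits : (a e : ℕ) → Path → Set
  Fits a e w = (e * countN w ≡ a) ⊎ (suc (e * countN w) ≡ a)

  fits? : ∀ a e w → Dec (Fits a e w)
  fits? a e w = (e * countN w ℕ.≟ a) ⊎-dec (suc (e * countN w) ℕ.≟ a)

  fitting : (a e m : ℕ) → List Path
  fitting a e m = filter (fits? a e) (allPaths m)

  source-cong : ∀ {f g : ℕ → ℤ.ℤ} → (∀ t → f t ≡ g t) → ∀ {x k} → Source f x k → Source g x k
  source-cong eq S = source (before S) (subst₂ ℤ._<_ (eq _) (eq _) (lower S)) λ t p q → subst₂ ℤ._≤_ (eq _) (eq _) (between S t p q)

  module FixedPoints (a b : ℕ) (0<a : 0 < a) (0<b : 0 < b) (cop : Coprime a b) where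
    open LaserPartitions a b 0<a 0<b cop
    open Promote a b 0<a 0<b cop using (HNC-shift)

    HNC-unique : Unique (HNC a b)
    HNC-unique = DecUnique.deduplicate-! _≟ₚ_ (map (laserPartition a b) (DyckPaths a b))

    DyckPaths-unique : Unique (DyckPaths a b)
    DyckPaths-unique = filter⁺ (λ p → isDyck a b p Bool.≟ true) (allPaths-unique (a + b))

    laserPartition-injective : ∀ {p q} → p ∈ DyckPaths a b → q ∈ DyckPaths a b → laserPartition a b p ≡ laserPartition a b q → p ≡ q
    laserPartition-injective {p} {q} p∈ q∈ eq = from-paths (∈-DyckPaths⁻ p∈) (∈-DyckPaths⁻ q∈)
      where
      from-paths : length p ≡ a + b × Dyck (stepN p) → length q ≡ a + b × Dyck (stepN q) → p ≡ q
      from-paths (lp , Dp) (lq , Dq) = stepN-injective p q (trans lp (sym lq)) λ k k< → steps-determined Dp Dq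
        (laserPartition-represents lp Dp) (subst (Represents (stepN q)) (sym eq) (laserPartition-represents lq Dq)) k (subst (k <_) lp k<)

    length-HNC : length (HNC a b) ≡ length (DyckPaths a b)
    length-HNC = matching-≡ (λ π p → π ≡ laserPartition a b p) HNC-unique DyckPaths-unique
      (λ π∈ → ∈-map⁻ (laserPartition a b) (∈-deduplicate⁻ _≟ₚ_ (map (laserPartition a b) (DyckPaths a b)) π∈))
      (λ {p} p∈ → laserPartition a b p , laserPartition∈HNC p∈ , refl)
      (λ _ _ e f → trans e (sym f))
      (λ p∈ q∈ e f → laserPartition-injective p∈ q∈ (trans (sym e) f))

    invariant-* : ∀ {d π} → Invariant d π → ∀ k → Invariant (k * d) π
    invariant-* inv zero x y = refl
    invariant-* {d} {π} inv (suc k) x y = trans (cong₂ (rel π) (ℕ.+-assoc d (k * d) x) (ℕ.+-assoc d (k * d) y))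
      (trans (inv (k * d + x) (k * d + y)) (invariant-* {d} {π} inv k x y))

    invariant-n : ∀ π → Invariant n π
    invariant-n π x y = rel-cong π (trans (%-congˡ {o = n} (ℕ.+-comm n x)) ([m+n]%n≡m%n x n)) (trans (%-congˡ {o = n} (ℕ.+-comm n y)) ([m+n]%n≡m%n y n))

    invariant-difference : ∀ {π g p q} → Invariant p π → Invariant q π → g + p ≡ q → Invariant g π
    invariant-difference {π} {g} {p} {q} Ip Iq eq x y = trans (sym (Ip (g + x) (g + y))) (trans (cong₂ (rel π) (move x) (move y)) (Iq x y))
      where
      move : ∀ x → p + (g + x) ≡ q + x
      move x = trans (sym (ℕ.+-assoc p g x)) (cong (_+ x) (trans (ℕ.+-comm p g) eq))

    -- The shifts that preserve `π` include all multiples of `d` and of `n`, and are closed under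
    -- differences. The Bézout identity writes the gcd as such a difference.
    invariant-gcd : ∀ {d π} → Invariant d π → Invariant (gcd d n) π
    invariant-gcd {d} {π} inv = from-bézout (Bézout.identity (gcd-GCD d n))
      where
      from-bézout : Bézout.Identity (gcd d n) d n → Invariant (gcd d n) π
      from-bézout (Bézout.+- x y eq) = invariant-difference {π} {gcd d n} {y * n} {x * d} (invariant-* {n} {π} (invariant-n π) y) (invariant-* {d} {π} inv x) eq
      from-bézout (Bézout.-+ x y eq) = invariant-difference {π} {gcd d n} {x * d} {y * n} (invariant-* {d} {π} inv x) (invariant-* {n} {π} (invariant-n π) y) eq

    rel-reduce : ∀ π x y → rel π x y ≡ rel π (x % n) (y % n)
    rel-reduce π x y = rel-cong π (sym (m%n%n≡m%n x n)) (sym (m%n%n≡m%n y n))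

    module Equivalence {π} (π∈ : π ∈ HNC a b) where
      private
        S = ∈-HNC⁻ π∈
        s = proj₁ S
        D = proj₁ (proj₂ S)
        R = proj₂ (proj₂ S)
        go : ∀ {x y} → rel π x y ≡ true → SameSource (H s) (suc (x % n)) (suc (y % n))
        go {x} {y} e = to R (m%n<n x n) (m%n<n y n) (trans (sym (rel-reduce π x y)) e)
        back : ∀ {x y} → SameSource (H s) (suc (x % n)) (suc (y % n)) → rel π x y ≡ true
        back {x} {y} ss = trans (rel-reduce π x y) (from R (m%n<n x n) (m%n<n y n) ss)

      rel-refl : ∀ {x} → rel π x x ≡ true
      rel-refl {x} = back {x} {x} (pair (dyck-source D {suc (x % n)} (s≤s z≤n) (<n⇒<a+b (m%n<n x n))))
        where
        pair : ∀ {z} → (∃ λ k → Source (H s) z k) → SameSource (H s) z z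
        pair (k , S) = k , S , S

      rel-sym : ∀ {x y} → rel π x y ≡ true → rel π y x ≡ true
      rel-sym {x} {y} e = back {y} {x} (flip (go {x} {y} e))
        where
        flip : ∀ {p q} → SameSource (H s) p q → SameSource (H s) q p
        flip (k , S , S′) = k , S′ , S

      rel-trans : ∀ {x y z} → rel π x y ≡ true → rel π y z ≡ true → rel π x z ≡ true
      rel-trans {x} {y} {z} e f = back {x} {z} (join (go {x} {y} e) (go {y} {z} f))
        where
        join : ∀ {p q r} → SameSource (H s) p q → SameSource (H s) q r → SameSource (H s) p r
        join (k , S , S′) (l , T , T′) = k , S , subst (Source (H s) _) (source-unique T S′) T′

    module Proper (m e : ℕ) (0<m : 0 < m) (2m≤n : m + m ≤ n) (n≡em : n ≡ e * m) where

      instance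
        m-nonZero : NonZero m
        m-nonZero = ℕ.>-nonZero 0<m

      wordSteps : Path → Steps
      wordSteps w x = stepN w (x % m)

      wordSteps-period : ∀ w x → wordSteps w (m + x) ≡ wordSteps w x
      wordSteps-period w x = cong (stepN w) (trans (%-congˡ {o = m} (ℕ.+-comm m x)) ([m+n]%n≡m%n x m))

      count-wordSteps : ∀ {w} → length w ≡ m → count (wordSteps w) m ≡ countN w
      count-wordSteps {w} len = trans (count-cong m (λ t t<m → cong (stepN w) (m<n⇒m%n≡m t<m))) (trans (cong (count (stepN w)) (sym len)) (sym (countN≡count w)))

      module At (u : Steps) (per : ∀ x → u (m + x) ≡ u x) =
        PeriodicSteps a b 0<a 0<b m n 0<m 2m≤n e n≡em u per

      linked-cong : ∀ {u u′} (per : ∀ x → u (m + x) ≡ u x) (per′ : ∀ x → u′ (m + x) ≡ u′ x) → (∀ x → u x ≡ u′ x) →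
        ∀ {x y} → At.Linked u per x y → At.Linked u′ per′ x y
      linked-cong {u} {u′} per per′ eq = λ { (inj₁ (C , C′)) → inj₁ (central C , central C′)
                                           ; (inj₂ (k , l , N , N′ , e)) → inj₂ (k , l , close N , close N′ , e) }
        where
        H≡ : ∀ t → H u t ≡ H u′ t
        H≡ t = H-cong t (λ i _ → eq i) t ℕ.≤-refl
        central : ∀ {x} → At.Central u per x → At.Central u′ per′ x
        central {x} C k p q = subst₂ ℤ._≤_ (H≡ x) (H≡ k) (C k p q)
        close : ∀ {x k} → At.Near u per x k → At.Near u′ per′ x k
        close (At.near S c) = At.near (source-cong H≡ S) c

      -- 3m is the margin for `SymmetricRelation`, and `n` is the margin that the falling case of
      -- `realize` asks for.
      bound : ℕ
      bound = n + (m + m + m)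

      -- Labels are compared only beyond `bound`, where the word describes the blocks reliably.
      -- Every residue has a representative there, namely its `lift`, so nothing is lost.
      record Encodes (w : Path) (π : Partition n) : Set where
        field
          to   : ∀ {x y} → bound ≤ x → bound ≤ y → rel π x y ≡ true → At.Linked (wordSteps w) (wordSteps-period w) (suc x) (suc y)
          from : ∀ {x y} → bound ≤ x → bound ≤ y → At.Linked (wordSteps w) (wordSteps-period w) (suc x) (suc y) → rel π x y ≡ true

      m≤bound : m ≤ bound
      m≤bound = ℕ.≤-trans (ℕ.m≤n+m m (m + m)) (ℕ.m≤n+m _ n)

      lift : ℕ → ℕ
      lift x = x + bound * n

      lift-≥ : ∀ x → bound ≤ lift x
      lift-≥ x = ℕ.≤-trans (ℕ.m≤m*n bound n) (ℕ.m≤n+m _ x)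

      rel-lift : ∀ π x y → rel π (lift x) (lift y) ≡ rel π x y
      rel-lift π x y = rel-cong π ([m+kn]%n≡m%n x bound n) ([m+kn]%n≡m%n y bound n)

      encodes-unique : ∀ {w π π′} → Encodes w π → Encodes w π′ → π ≡ π′
      encodes-unique {w} {π} {π′} E E′ = rel-ext λ i j _ _ → trans (sym (rel-lift π i j)) (trans (bool-ext
        (λ p → Encodes.from E′ (lift-≥ i) (lift-≥ j) (Encodes.to E (lift-≥ i) (lift-≥ j) p))
        (λ p → Encodes.from E (lift-≥ i) (lift-≥ j) (Encodes.to E′ (lift-≥ i) (lift-≥ j) p))) (rel-lift π′ i j))

      -- An east step of `w′` would link `x` to one of the `m` labels before it, which a north step
      -- of `w` excludes; both words describe the same relation.
      north-transfers : ∀ {w w′ π} → Encodes w π → Encodes w′ π → ∀ x → bound ≤ x → bound + m ≤ x →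
        wordSteps w x ≡ true → wordSteps w′ x ≡ true
      north-transfers {w} {w′} {π} E E′ x B≤x B+m≤x wx = by-cases (wordSteps w′ x) refl
        where
        module A′ = At (wordSteps w′) (wordSteps-period w′)
        module A = At (wordSteps w) (wordSteps-period w)
        by-cases : ∀ v → wordSteps w′ x ≡ v → wordSteps w′ x ≡ true
        by-cases true  e = e
        by-cases false e = ⊥-elim (clash (A′.east-linked (ℕ.≤-trans m≤bound B≤x) e))
          where
          clash : (∃ λ j → j < x × x ≤ j + m × A′.Linked (suc x) (suc j)) → ⊥
          clash (j , j<x , x≤j+m , L) = A.north-unlinked wx j<x x≤j+m (Encodes.to E B≤x B≤j (Encodes.from E′ B≤x B≤j L))
            where
            B≤j : bound ≤ j
            B≤j = ℕ.+-cancelʳ-≤ m _ _ (ℕ.≤-trans B+m≤x x≤j+m)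

      word-unique : ∀ {w w′ π} → length w ≡ m → length w′ ≡ m → Encodes w π → Encodes w′ π → w ≡ w′
      word-unique {w} {w′} len len′ E E′ = stepN-injective w w′ (trans len (sym len′)) λ k k<l →
          subst (λ i → stepN w i ≡ stepN w′ i) (m<n⇒m%n≡m (subst (k <_) len k<l)) (agree k)
        where
        agree : ∀ x → wordSteps w x ≡ wordSteps w′ x
        agree = periodic-≡ (wordSteps-period w) (wordSteps-period w′) (bound + m) λ x B≤x → bool-ext
          (north-transfers E E′ x (ℕ.≤-trans (ℕ.m≤m+n bound m) B≤x) B≤x) (north-transfers E′ E x (ℕ.≤-trans (ℕ.m≤m+n bound m) B≤x) B≤x)

      encodes-invariant : ∀ {w π} → Encodes w π → Invariant m π
      encodes-invariant {w} {π} E x y = sym (trans (sym (rel-lift π x y)) (trans (bool-ext up down) (rel-cong π (lifted x) (lifted y))))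
        where
        module A = At (wordSteps w) (wordSteps-period w)
        lifted : ∀ x → (m + lift x) % n ≡ (m + x) % n
        lifted x = trans (%-congˡ {o = n} (sym (ℕ.+-assoc m x _))) ([m+kn]%n≡m%n (m + x) bound n)
        B≤ : ∀ x → bound ≤ m + lift x
        B≤ x = ℕ.≤-trans (lift-≥ x) (ℕ.m≤n+m _ m)
        shifted : ∀ {x y} → A.Linked (m + suc (lift x)) (m + suc (lift y)) → A.Linked (suc (m + lift x)) (suc (m + lift y))
        shifted {x} {y} = subst₂ A.Linked (ℕ.+-suc m (lift x)) (ℕ.+-suc m (lift y))
        m≤ : ∀ x → m ≤ suc (lift x)
        m≤ x = ℕ.m≤n⇒m≤1+n (ℕ.≤-trans m≤bound (lift-≥ x))
        up : rel π (lift x) (lift y) ≡ true → rel π (m + lift x) (m + lift y) ≡ true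
        up p = Encodes.from E (B≤ x) (B≤ y) (shifted {x} {y} (A.Linked-shift (m≤ x) (m≤ y) (Encodes.to E (lift-≥ x) (lift-≥ y) p)))
        down : rel π (m + lift x) (m + lift y) ≡ true → rel π (lift x) (lift y) ≡ true
        down p = Encodes.from E (lift-≥ x) (lift-≥ y) (unshift (subst₂ A.Linked (sym (ℕ.+-suc m (lift x))) (sym (ℕ.+-suc m (lift y))) (Encodes.to E (B≤ x) (B≤ y) p)))
          where
          unshift : A.Linked (m + suc (lift x)) (m + suc (lift y)) → A.Linked (suc (lift x)) (suc (lift y))
          unshift = A.Linked-unshift (m≤ x) (m≤ y)

      realized : ∀ {w} → length w ≡ m → Fits a e w → ∃ λ π → π ∈ HNC a b × Encodes w π
      realized {w} len fits = from-real (Rz.realize (subst (λ c → (e * c ≡ a) ⊎ (suc (e * c) ≡ a)) (sym (count-wordSteps {w} len)) fits) bound m≤bound (ℕ.m≤m+n n _))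
        where
        module Rz = RealizeSteps a b 0<a 0<b cop m n suc-n 0<m 2m≤n e n≡em (wordSteps w) (wordSteps-period w)
        module A = At (wordSteps w) (wordSteps-period w)
        from-real : (∃ λ c → bound ≤ c × Rz.Realization c) → ∃ λ π → π ∈ HNC a b × Encodes w π
        from-real (c , B≤c , Z) = from-partition (∈-HNC⁺ (Rz.Realization.isDyck Z))
          where
          from-partition : (∃ λ π → π ∈ HNC a b × Represents (Rz.Realization.s Z) π) → ∃ λ π → π ∈ HNC a b × Encodes w π
          from-partition (π₀ , π₀∈ , R) = from-shift (HNC-shift k π₀∈)
            where
            -- This represents - c modulo `n`: the realized path has its first label at `c`, and
            -- rotating by `k` puts it there.
            k = c * (n ∸ 1)
            from-shift : (∃ λ π → π ∈ HNC a b × (∀ x y → rel π x y ≡ rel π₀ (k + x) (k + y))) → ∃ λ π → π ∈ HNC a b × Encodes w π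
            from-shift (π , π∈ , eq) = π , π∈ , record { to = to′ ; from = from′ }
              where
              i : ℕ → ℕ
              i x = (k + x) % n
              rel≡ : ∀ x y → rel π x y ≡ rel π₀ (i x) (i y)
              rel≡ x y = trans (eq x y) (rel-reduce π₀ (k + x) (k + y))
              residue : ∀ x → suc (c + i x) % n ≡ suc x % n
              residue x = %-+-cong n {1} {1} refl (trans (%-+-cong n {c} {c} refl (m%n%n≡m%n (k + x) n)) (trans (%-congˡ {o = n} (cong (c +_) (ℕ.+-comm k x))) (%-unshift n c x)))
              m≤c : ∀ x → m ≤ suc (c + i x)
              m≤c x = ℕ.m≤n⇒m≤1+n (ℕ.≤-trans m≤bound (ℕ.≤-trans B≤c (ℕ.m≤m+n c _)))
              m≤x : ∀ {x} → bound ≤ x → m ≤ suc x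
              m≤x B≤x = ℕ.m≤n⇒m≤1+n (ℕ.≤-trans m≤bound B≤x)
              both : ∀ {p p′ q q′} → m ≤ p → m ≤ p′ → m ≤ q → m ≤ q′ → p % n ≡ p′ % n → q % n ≡ q′ % n → A.Linked p q → A.Linked p′ q′
              both mp mp′ mq mq′ ep eq L = A.Linked-cong-% mp mp′ ep (A.Linked-sym (A.Linked-cong-% mq mq′ eq (A.Linked-sym L)))
              to′ : ∀ {x y} → bound ≤ x → bound ≤ y → rel π x y ≡ true → A.Linked (suc x) (suc y)
              to′ {x} {y} Bx By p = both (m≤c x) (m≤x Bx) (m≤c y) (m≤x By) (residue x) (residue y)
                (Rz.Realization.to Z (m%n<n (k + x) n) (m%n<n (k + y) n) (to R (m%n<n (k + x) n) (m%n<n (k + y) n) (trans (sym (rel≡ x y)) p)))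
              from′ : ∀ {x y} → bound ≤ x → bound ≤ y → A.Linked (suc x) (suc y) → rel π x y ≡ true
              from′ {x} {y} Bx By L = trans (rel≡ x y) (from R (m%n<n (k + x) n) (m%n<n (k + y) n) (Rz.Realization.from Z (m%n<n (k + x) n) (m%n<n (k + y) n)
                (both (m≤x Bx) (m≤c x) (m≤x By) (m≤c y) (sym (residue x)) (sym (residue y)) L)))

      encoded : ∀ {π} → π ∈ HNC a b → Invariant m π → ∃ λ w → length w ≡ m × Fits a e w × Encodes w π
      encoded {π} π∈ inv = w , len , fits , record { to = to′ ; from = from′ }
        where
        open Equivalence π∈
        module Sy = SymmetricRelation a b 0<a 0<b cop m n suc-n 0<m 2m≤n e n≡em
          (λ x y → rel π x y ≡ true) (λ x y → rel π x y Bool.≟ true)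
          (λ {x} → rel-refl {x}) (λ {x} {y} → rel-sym {x} {y}) (λ {x} {y} {z} → rel-trans {x} {y} {z})
          (λ x → trans (rel-cong π {x} {x} {n + x} {x} refl (trans (%-congˡ {o = n} (ℕ.+-comm n x)) ([m+n]%n≡m%n x n))) (rel-refl {x}))
          (λ {x} {y} p → trans (inv x y) p) (λ {x} {y} p → trans (sym (inv x y)) p)
        view : ∀ c → Sy.View c
        view c = from-shift (HNC-shift c π∈)
          where
          from-shift : (∃ λ π′ → π′ ∈ HNC a b × (∀ x y → rel π′ x y ≡ rel π (c + x) (c + y))) → Sy.View c
          from-shift (π′ , π′∈ , eq) = from-steps (∈-HNC⁻ π′∈)
            where
            from-steps : (∃ λ s → Dyck s × Represents s π′) → Sy.View c
            from-steps (s , D , R) = record { s = s ; isDyck = D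
              ; to = λ {i} {j} i<n j<n p → to R i<n j<n (trans (eq i j) p)
              ; from = λ {i} {j} i<n j<n ss → trans (sym (eq i j)) (from R i<n j<n ss) }
        u : Steps
        u = Sy.u view
        w : Path
        w = applyUpTo u m
        len : length w ≡ m
        len = length-applyUpTo u m
        steps≡ : ∀ x → u x ≡ wordSteps w x
        steps≡ = periodic-≡-% u (Sy.u-period view)
          where
          periodic-≡-% : ∀ u → (∀ x → u (m + x) ≡ u x) → ∀ x → u x ≡ stepN (applyUpTo u m) (x % m)
          periodic-≡-% u per x = trans (cong u (trans (m≡m%n+[m/n]*n x m) (ℕ.+-comm (x % m) _)))
            (trans (periodic-* per (x / m) (x % m)) (sym (stepN-applyUpTo u m (x % m) (m%n<n x m))))
        count≡ : count u m ≡ countN w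
        count≡ = trans (count-cong m (λ t _ → steps≡ t)) (count-wordSteps {w} len)
        fits : Fits a e w
        fits = by-sign (0ℤ ℤ.<? H u m)
          where
          by-sign : Dec (0ℤ ℤ.< H u m) → Fits a e w
          by-sign (yes pos) = inj₁ (trans (cong (e *_) (sym count≡)) (Sy.rising-count view pos))
          by-sign (no npos) = inj₂ (trans (cong (λ c → suc (e * c)) (sym count≡)) (Sy.falling-count view (ℤ.≮⇒≥ npos)))
        3m≤ : ∀ {x} → bound ≤ x → m + m + m ≤ x
        3m≤ B≤x = ℕ.≤-trans (ℕ.m≤n+m _ n) B≤x
        to′ : ∀ {x y} → bound ≤ x → bound ≤ y → rel π x y ≡ true → At.Linked (wordSteps w) (wordSteps-period w) (suc x) (suc y)
        to′ Bx By p = linked-cong (Sy.u-period view) (wordSteps-period w) steps≡ (Sy.~⇒linked view (3m≤ Bx) (3m≤ By) p)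
        from′ : ∀ {x y} → bound ≤ x → bound ≤ y → At.Linked (wordSteps w) (wordSteps-period w) (suc x) (suc y) → rel π x y ≡ true
        from′ Bx By L = Sy.linked⇒~ view (3m≤ Bx) (3m≤ By) (linked-cong (wordSteps-period w) (Sy.u-period view) (λ x → sym (steps≡ x)) L)

      -- Invariance under `d` and under gcd d n is the same thing: one direction is Bézout, and the
      -- other holds because `d` is a multiple of the gcd.
      fixedCount≡fitting : ∀ d → m ≡ gcd d n → fixedCount a b d ≡ length (fitting a e m)
      fixedCount≡fitting d m≡ = matching-≡ (λ π w → Encodes w π)
          (filter⁺ fixed? HNC-unique) (filter⁺ (fits? a e) (allPaths-unique m)) forth back
          (λ _ _ E E′ → encodes-unique E E′)
          (λ w∈ w′∈ E E′ → word-unique (word-length w∈) (word-length w′∈) E E′)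
        where
        fixed? : ∀ π → Dec (iterate rotate d π ≡ π)
        fixed? π = iterate rotate d π ≟ₚ π
        word-length : ∀ {w} → w ∈ fitting a e m → length w ≡ m
        word-length w∈ = ∈-allPaths⁻ m (proj₁ (∈-filter⁻ (fits? a e) {xs = allPaths m} w∈))
        forth : ∀ {π} → π ∈ filter fixed? (HNC a b) → ∃ λ w → w ∈ fitting a e m × Encodes w π
        forth {π} π∈ = from-filter (∈-filter⁻ fixed? {xs = HNC a b} π∈)
          where
          from-filter : π ∈ HNC a b × iterate rotate d π ≡ π → ∃ λ w → w ∈ fitting a e m × Encodes w π
          from-filter (π∈′ , fix) = from-encoded (encoded π∈′ (subst (λ g → Invariant g π) (sym m≡) (invariant-gcd {d} {π} (fixed⇒invariant d fix))))
            where
            from-encoded : (∃ λ w → length w ≡ m × Fits a e w × Encodes w π) → ∃ λ w → w ∈ fitting a e m × Encodes w π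
            from-encoded (w , len , fits , E) = w , ∈-filter⁺ (fits? a e) (∈-allPaths⁺ len) fits , E
        back : ∀ {w} → w ∈ fitting a e m → ∃ λ π → π ∈ filter fixed? (HNC a b) × Encodes w π
        back {w} w∈ = from-realized (realized (word-length w∈) (proj₂ (∈-filter⁻ (fits? a e) {xs = allPaths m} w∈)))
          where
          from-realized : (∃ λ π → π ∈ HNC a b × Encodes w π) → ∃ λ π → π ∈ filter fixed? (HNC a b) × Encodes w π
          from-realized (π , π∈ , E) = π , ∈-filter⁺ fixed? π∈ (invariant⇒fixed d (multiple (gcd∣ d))) , E
            where
            gcd∣ : ∀ d → gcd d n ∣ d
            gcd∣ d = gcd[m,n]∣m d n
            multiple : gcd d n ∣ d → Invariant d π
            multiple (divides q eq) = subst (λ k → Invariant k π) (sym (trans eq (cong (q *_) (sym m≡)))) (invariant-* {m} {π} (encodes-invariant E) q)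

    fixedCount-trivial : ∀ d → n ∣ d → fixedCount a b d ≡ length (DyckPaths a b)
    fixedCount-trivial d (divides q eq) = trans (cong length (filter-all fixed? (universal fixes (HNC a b)))) length-HNC
      where
      fixed? : ∀ π → Dec (iterate rotate d π ≡ π)
      fixed? π = iterate rotate d π ≟ₚ π
      fixes : ∀ π → iterate rotate d π ≡ π
      fixes π = invariant⇒fixed d (subst (λ k → Invariant k π) (sym eq) (invariant-* {n} {π} (invariant-n π) q))

-- Gaussian polynomials and polynomial identities by evaluation

module GaussianPolynomials where

  open import Level using (Level)
  open import Data.Nat as ℕ using (ℕ; zero; suc; _<_; _≤_; z≤n; s≤s)
  import Data.Nat.Properties as ℕ
  open import Data.Nat.DivMod using ([m+kn]%n≡m%n; m<n⇒m%n≡m; _%_)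
  open import Data.Integer as ℤ using (ℤ; +_)
  import Data.Integer.Properties as ℤ
  open import Data.List.Base using ([]; _∷_; _++_; map; replicate)
  open import Algebra.Bundles using (CommutativeRing)
  import Algebra.Solver.Ring.NaturalCoefficients.Default
  open import Relation.Binary.PropositionalEquality as ≡ using (_≡_)
  import Relation.Binary.Reasoning.Setoid as SetoidReasoning
  import Algebra.Properties.Ring as RingProperties
  open import Defs

  shiftₚ : ℕ → Poly → Poly
  shiftₚ k p = replicate k 0 ++ p

  -- The Gaussian binomial coefficient, by the q-Pascal rule for the first letter of a word: an
  -- initial north step creates no inversion, and an initial east step creates one with each of the
  -- c + 1 north steps after it.
  gauss : ℕ → ℕ → Poly
  gauss zero    zero    = 1 ∷ []
  gauss zero    (suc c) = []
  gauss (suc L) zero    = gauss L zero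
  gauss (suc L) (suc c) = gauss L c +ₚ shiftₚ (suc c) (gauss L (suc c))

  module RingIdentities {c ℓ : Level} (R : CommutativeRing c ℓ) where
    open CommutativeRing R
    open Algebra.Solver.Ring.NaturalCoefficients.Default commutativeSemiring

    eval-+-ring : ∀ k l x p q → (k + l) + x * (p + q) ≈ (k + x * p) + (l + x * q)
    eval-+-ring = solve 5 (λ k l x p q → (k :+ l) :+ x :* (p :+ q) := (k :+ x :* p) :+ (l :+ x :* q)) refl

    eval-scale-ring : ∀ k l x q → k * l + x * (k * q) ≈ k * (l + x * q)
    eval-scale-ring = solve 4 (λ k l x q → k :* l :+ x :* (k :* q) := k :* (l :+ x :* q)) refl

    eval-*-ring : ∀ k q x p → k * q + x * (p * q) ≈ (k + x * p) * q
    eval-*-ring = solve 4 (λ k q x p → k :* q :+ x :* (p :* q) := (k :+ x :* p) :* q) refl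

    I-+-ring : ∀ o q i p j → o + q * (i + p * j) ≈ (o + q * i) + q * p * j
    I-+-ring = solve 5 (λ o q i p j → o :+ q :* (i :+ p :* j) := (o :+ q :* i) :+ q :* p :* j) refl

    *-swap : ∀ d q i → d * (q * i) ≈ q * (d * i)
    *-swap = solve 3 (λ d q i → d :* (q :* i) := q :* (d :* i)) refl

    G-factorial-ring : ∀ g h p f i f′ j → (g + p * h) * (f * i) * (f′ * j) ≈ (g * f * (f′ * j)) * i + p * j * (h * (f * i) * f′)
    G-factorial-ring = solve 7 (λ g h p f i f′ j → (g :+ p :* h) :* (f :* i) :* (f′ :* j) := (g :* f :* (f′ :* j)) :* i :+ p :* j :* (h :* (f :* i) :* f′)) refl

    G-factorial-ring′ : ∀ f i p j → f * i + p * j * f ≈ f * (i + p * j)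
    G-factorial-ring′ = solve 4 (λ f i p j → f :* i :+ p :* j :* f := f :* (i :+ p :* j)) refl

  module Evaluation {c ℓ : Level} (R : CommutativeRing c ℓ) where
    open CommutativeRing R public
    open SetoidReasoning setoid

    open RingIdentities R
    open RingProperties ring using (-‿distribʳ-*)

    eval : Poly → Carrier → Carrier
    eval = evalPoly R

    infixl 8 _^_
    _^_ : Carrier → ℕ → Carrier
    _^_ = powR R

    nat : ℕ → Carrier
    nat = natR R

    nat-+ : ∀ m n → nat (m ℕ.+ n) ≈ nat m + nat n
    nat-+ zero    n = sym (+-identityˡ _)
    nat-+ (suc m) n = trans (+-congˡ (nat-+ m n)) (sym (+-assoc 1# (nat m) (nat n)))

    nat-* : ∀ m n → nat (m ℕ.* n) ≈ nat m * nat n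
    nat-* zero    n = sym (zeroˡ _)
    nat-* (suc m) n = begin
      nat (n ℕ.+ m ℕ.* n)       ≈⟨ nat-+ n (m ℕ.* n) ⟩
      nat n + nat (m ℕ.* n)     ≈⟨ +-congˡ (nat-* m n) ⟩
      nat n + nat m * nat n     ≈⟨ +-congʳ (sym (*-identityˡ _)) ⟩
      1# * nat n + nat m * nat n ≈⟨ sym (distribʳ _ _ _) ⟩
      (1# + nat m) * nat n      ∎

    nat-1 : nat 1 ≈ 1#
    nat-1 = +-identityʳ 1#

    ^-+ : ∀ x m n → x ^ (m ℕ.+ n) ≈ x ^ m * x ^ n
    ^-+ x zero    n = sym (*-identityˡ _)
    ^-+ x (suc m) n = trans (*-congˡ (^-+ x m n)) (sym (*-assoc _ _ _))

    ^-* : ∀ x m n → x ^ (m ℕ.* n) ≈ (x ^ n) ^ m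
    ^-* x zero    n = refl
    ^-* x (suc m) n = trans (^-+ x n (m ℕ.* n)) (*-congˡ (^-* x m n))

    ^-cong : ∀ {x y} n → x ≈ y → x ^ n ≈ y ^ n
    ^-cong zero    e = refl
    ^-cong (suc n) e = *-cong e (^-cong n e)

    1^ : ∀ n → 1# ^ n ≈ 1#
    1^ zero    = refl
    1^ (suc n) = trans (*-identityˡ _) (1^ n)

    eval-+ₚ : ∀ p q x → eval (p +ₚ q) x ≈ eval p x + eval q x
    eval-+ₚ []      q       x = sym (+-identityˡ _)
    eval-+ₚ (k ∷ p) []      x = sym (+-identityʳ _)
    eval-+ₚ (k ∷ p) (l ∷ q) x = begin
      nat (k ℕ.+ l) + x * eval (p +ₚ q) x                ≈⟨ +-cong (nat-+ k l) (*-congˡ (eval-+ₚ p q x)) ⟩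
      (nat k + nat l) + x * (eval p x + eval q x)        ≈⟨ eval-+-ring (nat k) (nat l) x (eval p x) (eval q x) ⟩
      (nat k + x * eval p x) + (nat l + x * eval q x)    ∎

    eval-scale : ∀ k q x → eval (map (k ℕ.*_) q) x ≈ nat k * eval q x
    eval-scale k []      x = sym (zeroʳ _)
    eval-scale k (l ∷ q) x = begin
      nat (k ℕ.* l) + x * eval (map (k ℕ.*_) q) x   ≈⟨ +-cong (nat-* k l) (*-congˡ (eval-scale k q x)) ⟩
      nat k * nat l + x * (nat k * eval q x)        ≈⟨ eval-scale-ring (nat k) (nat l) x (eval q x) ⟩
      nat k * (nat l + x * eval q x)                ∎

    eval-*ₚ : ∀ p q x → eval (p *ₚ q) x ≈ eval p x * eval q x
    eval-*ₚ []      q x = sym (zeroˡ _)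
    eval-*ₚ (k ∷ p) q x = begin
      eval (map (k ℕ.*_) q +ₚ (0 ∷ (p *ₚ q))) x             ≈⟨ eval-+ₚ (map (k ℕ.*_) q) (0 ∷ (p *ₚ q)) x ⟩
      eval (map (k ℕ.*_) q) x + (0# + x * eval (p *ₚ q) x)  ≈⟨ +-cong (eval-scale k q x) (trans (+-identityˡ _) (*-congˡ (eval-*ₚ p q x))) ⟩
      nat k * eval q x + x * (eval p x * eval q x)   ≈⟨ eval-*-ring (nat k) (eval q x) x (eval p x) ⟩
      (nat k + x * eval p x) * eval q x                     ∎

    eval-≈0 : ∀ p x → (∀ k → coeff k p ≡ 0) → eval p x ≈ 0#
    eval-≈0 []      x e = refl
    eval-≈0 (k ∷ p) x e rewrite e 0 = trans (+-identityˡ _) (trans (*-congˡ (eval-≈0 p x λ k → e (suc k))) (zeroʳ x))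

    eval-cong : ∀ p q x → p ≈ₚ q → eval p x ≈ eval q x
    eval-cong []      q       x e = sym (eval-≈0 q x λ k → ≡.sym (e k))
    eval-cong (k ∷ p) []      x e = eval-≈0 (k ∷ p) x e
    eval-cong (k ∷ p) (l ∷ q) x e rewrite e 0 = +-congˡ (*-congˡ (eval-cong p q x λ k → e (suc k)))

    eval-shift : ∀ k p x → eval (shiftₚ k p) x ≈ x ^ k * eval p x
    eval-shift zero    p x = sym (*-identityˡ _)
    eval-shift (suc k) p x = trans (+-identityˡ _) (trans (*-congˡ (eval-shift k p x)) (sym (*-assoc _ _ _)))

    module At (q : Carrier) where

      I : ℕ → Carrier
      I n = eval (qInt n) q

      fact : ℕ → Carrier
      fact n = eval (qFact n) q

      G : ℕ → ℕ → Carrier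
      G L c = eval (gauss L c) q

      I-+ : ∀ m n → I (m ℕ.+ n) ≈ I m + q ^ m * I n
      I-+ zero    n = trans (sym (*-identityˡ _)) (sym (+-identityˡ _))
      I-+ (suc m) n = begin
        nat 1 + q * I (m ℕ.+ n)              ≈⟨ +-congˡ (*-congˡ (I-+ m n)) ⟩
        nat 1 + q * (I m + q ^ m * I n)      ≈⟨ I-+-ring (nat 1) q (I m) (q ^ m) (I n) ⟩
        (nat 1 + q * I m) + q * q ^ m * I n  ∎

      I-geometric : ∀ n → (1# - q) * I n ≈ 1# - q ^ n
      I-geometric zero    = trans (zeroʳ _) (sym (-‿inverseʳ 1#))
      I-geometric (suc n) = begin
        (1# - q) * (nat 1 + q * I n)          ≈⟨ *-congˡ (+-congʳ nat-1) ⟩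
        (1# - q) * (1# + q * I n)             ≈⟨ distribˡ _ _ _ ⟩
        (1# - q) * 1# + (1# - q) * (q * I n)  ≈⟨ +-cong (*-identityʳ _) (*-swap (1# - q) q (I n)) ⟩
        (1# - q) + q * ((1# - q) * I n)       ≈⟨ +-congˡ (*-congˡ (I-geometric n)) ⟩
        (1# - q) + q * (1# - q ^ n)           ≈⟨ +-congˡ (trans (distribˡ _ _ _) (+-cong (*-identityʳ q) (sym (-‿distribʳ-* q (q ^ n))))) ⟩
        (1# - q) + (q - q * q ^ n)            ≈⟨ +-assoc 1# (- q) _ ⟩
        1# + (- q + (q - q * q ^ n))          ≈⟨ +-congˡ (trans (sym (+-assoc _ _ _)) (trans (+-congʳ (-‿inverseˡ q)) (+-identityˡ _))) ⟩
        1# - q * q ^ n                        ∎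

      fact-suc : ∀ n → fact (suc n) ≈ fact n * I (suc n)
      fact-suc n = eval-*ₚ (qFact n) (qInt (suc n)) q

      G-suc : ∀ L c → G (suc L) (suc c) ≈ G L c + q ^ suc c * G L (suc c)
      G-suc L c = trans (eval-+ₚ (gauss L c) (shiftₚ (suc c) (gauss L (suc c))) q) (+-congˡ (eval-shift (suc c) (gauss L (suc c)) q))

      G-0 : ∀ L → G L 0 ≈ 1#
      G-0 zero    = trans (+-cong nat-1 (zeroʳ q)) (+-identityʳ 1#)
      G-0 (suc L) = G-0 L

      G-> : ∀ L c → L < c → G L c ≈ 0#
      G-> zero    (suc c) _         = refl
      G-> (suc L) (suc c) (s≤s L<c) = begin
        G (suc L) (suc c)                    ≈⟨ G-suc L c ⟩
        G L c + q ^ suc c * G L (suc c)      ≈⟨ +-cong (G-> L c L<c) (*-congˡ (G-> L (suc c) (ℕ.m≤n⇒m≤1+n L<c))) ⟩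
        0# + q ^ suc c * 0#                  ≈⟨ trans (+-identityˡ _) (zeroʳ _) ⟩
        0#                                   ∎

      G-diagonal : ∀ c → G c c ≈ 1#
      G-diagonal zero    = G-0 0
      G-diagonal (suc c) = begin
        G (suc c) (suc c)                ≈⟨ G-suc c c ⟩
        G c c + q ^ suc c * G c (suc c)  ≈⟨ +-cong (G-diagonal c) (*-congˡ (G-> c (suc c) ℕ.≤-refl)) ⟩
        1# + q ^ suc c * 0#              ≈⟨ +-congˡ (zeroʳ _) ⟩
        1# + 0#                          ≈⟨ +-identityʳ 1# ⟩
        1#                               ∎

      -- The q-factorial formula with denominators cleared, so that it remains valid where
      -- q-integers vanish. The inductive step is the q-Pascal rule together with [c + b + 2] =
      -- [c + 1] + q^(c + 1) [b + 1].
      G-factorial : ∀ c b → G (c ℕ.+ b) c * fact c * fact b ≈ fact (c ℕ.+ b)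
      G-factorial zero b = begin
        G b 0 * fact 0 * fact b   ≈⟨ *-congʳ (*-cong (G-0 b) (trans (+-cong nat-1 (zeroʳ q)) (+-identityʳ 1#))) ⟩
        1# * 1# * fact b          ≈⟨ trans (*-congʳ (*-identityˡ 1#)) (*-identityˡ _) ⟩
        fact b                    ∎
      G-factorial (suc c) zero rewrite ℕ.+-identityʳ c = begin
        G (suc c) (suc c) * fact (suc c) * fact 0  ≈⟨ *-cong (*-congʳ (G-diagonal (suc c))) (trans (+-cong nat-1 (zeroʳ q)) (+-identityʳ 1#)) ⟩
        1# * fact (suc c) * 1#                     ≈⟨ trans (*-identityʳ _) (*-identityˡ _) ⟩
        fact (suc c)                               ∎
      G-factorial (suc c) (suc b) = begin
        G (suc (c ℕ.+ suc b)) (suc c) * fact (suc c) * fact (suc b)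
          ≈⟨ *-cong (*-cong (G-suc (c ℕ.+ suc b) c) (fact-suc c)) (fact-suc b) ⟩
        (g₁ + p * g₂) * (fact c * I (suc c)) * (fact b * I (suc b))
          ≈⟨ G-factorial-ring g₁ g₂ p (fact c) (I (suc c)) (fact b) (I (suc b)) ⟩
        (g₁ * fact c * (fact b * I (suc b))) * I (suc c) + p * I (suc b) * (g₂ * (fact c * I (suc c)) * fact b)
          ≈⟨ +-cong (*-congʳ (trans (*-congˡ (sym (fact-suc b))) (G-factorial c (suc b))))
                    (*-congˡ (trans (*-congʳ (*-congˡ (sym (fact-suc c)))) ih₂)) ⟩
        fact (c ℕ.+ suc b) * I (suc c) + p * I (suc b) * fact (c ℕ.+ suc b)
          ≈⟨ G-factorial-ring′ (fact (c ℕ.+ suc b)) (I (suc c)) p (I (suc b)) ⟩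
        fact (c ℕ.+ suc b) * (I (suc c) + p * I (suc b))
          ≈⟨ *-congˡ (sym (I-+ (suc c) (suc b))) ⟩
        fact (c ℕ.+ suc b) * I (suc c ℕ.+ suc b)
          ≈⟨ sym (fact-suc (c ℕ.+ suc b)) ⟩
        fact (suc c ℕ.+ suc b) ∎
        where
        g₁ = G (c ℕ.+ suc b) c
        g₂ = G (c ℕ.+ suc b) (suc c)
        p  = q ^ suc c
        ih₂ : g₂ * fact (suc c) * fact b ≈ fact (c ℕ.+ suc b)
        ih₂ rewrite ℕ.+-suc c b = G-factorial (suc c) b

  ℤ-ring : CommutativeRing _ _
  ℤ-ring = ℤ.+-*-commutativeRing

  evalℕ : Poly → ℕ → ℕ
  evalℕ []      x = 0
  evalℕ (k ∷ p) x = k ℕ.+ x ℕ.* evalℕ p x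

  private
    module ℤE = Evaluation ℤ-ring

  natℤ : ∀ n → natR ℤ-ring n ≡ + n
  natℤ zero    = ≡.refl
  natℤ (suc n) = ≡.cong (ℤ._+_ (+ 1)) (natℤ n)

  evalℤ : ∀ p x → evalPoly ℤ-ring p (+ x) ≡ + evalℕ p x
  evalℤ []      x = ≡.refl
  evalℤ (k ∷ p) x = ≡.trans (≡.cong₂ (λ u v → u ℤ.+ (+ x) ℤ.* v) (natℤ k) (evalℤ p x))
    (≡.cong (ℤ._+_ (+ k)) (≡.sym (ℤ.pos-* x (evalℕ p x))))

  -- Evaluated at an integer larger than both constant terms, the polynomials reveal these as
  -- residues modulo that integer. With equal constant terms removed, the tails again agree at all
  -- positive integers.
  evalℕ-unique : ∀ p q → (∀ x → 0 < x → evalℕ p x ≡ evalℕ q x) → p ≈ₚ q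
  evalℕ-unique p q eq = go p q eq
    where
    digit : ∀ {k l} P Q → (∀ x → 0 < x → k ℕ.+ x ℕ.* P x ≡ l ℕ.+ x ℕ.* Q x) → k ≡ l
    digit {k} {l} P Q eq = ≡.trans (≡.sym (residue k (P x) (s≤s (ℕ.m≤m+n k l)))) (≡.trans (≡.cong (_% x) (eq x (s≤s z≤n))) (residue l (Q x) (s≤s (ℕ.m≤n+m l k))))
      where
      x = suc (k ℕ.+ l)
      residue : ∀ k P → k < x → (k ℕ.+ x ℕ.* P) % x ≡ k
      residue k P k<x = ≡.trans (≡.cong (λ z → (k ℕ.+ z) % x) (ℕ.*-comm x P)) (≡.trans ([m+kn]%n≡m%n k P x) (m<n⇒m%n≡m k<x))
    tail : ∀ {k l} P Q → (∀ x → 0 < x → k ℕ.+ x ℕ.* P x ≡ l ℕ.+ x ℕ.* Q x) → ∀ x → 0 < x → P x ≡ Q x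
    tail {k} P Q eq x@(suc _) 0<x = ℕ.*-cancelˡ-≡ _ _ x (ℕ.+-cancelˡ-≡ k _ _ (≡.trans (eq x 0<x) (≡.cong (ℕ._+ x ℕ.* Q x) (≡.sym (digit P Q eq)))))
    zero-eq : ∀ q → (∀ x → 0 < x → 0 ≡ evalℕ q x) → ∀ x → 0 < x → 0 ℕ.+ x ℕ.* 0 ≡ evalℕ q x
    zero-eq q eq x 0<x = ≡.trans (ℕ.*-zeroʳ x) (eq x 0<x)
    go : ∀ p q → (∀ x → 0 < x → evalℕ p x ≡ evalℕ q x) → p ≈ₚ q
    go []      []      eq k       = ≡.refl
    go []      (l ∷ q) eq zero    = digit (λ _ → 0) (evalℕ q) (zero-eq (l ∷ q) eq)
    go []      (l ∷ q) eq (suc k) = go [] q (tail {0} (λ _ → 0) (evalℕ q) (zero-eq (l ∷ q) eq)) k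
    go (j ∷ p) []      eq zero    = ≡.sym (digit (λ _ → 0) (evalℕ p) (zero-eq (j ∷ p) λ x 0<x → ≡.sym (eq x 0<x)))
    go (j ∷ p) []      eq (suc k) = go p [] (λ x 0<x → ≡.sym (tail {0} (λ _ → 0) (evalℕ p) (zero-eq (j ∷ p) λ x 0<x → ≡.sym (eq x 0<x)) x 0<x)) k
    go (j ∷ p) (l ∷ q) eq zero    = digit (evalℕ p) (evalℕ q) eq
    go (j ∷ p) (l ∷ q) eq (suc k) = go p q (tail (evalℕ p) (evalℕ q) eq) k

  evaluations-determine : ∀ p q → (∀ x → evalPoly ℤ-ring p x ≡ evalPoly ℤ-ring q x) → p ≈ₚ q
  evaluations-determine p q eq = evalℕ-unique p q λ x _ → ℤ.+-injective (≡.trans (≡.sym (evalℤ p x)) (≡.trans (eq (+ x)) (evalℤ q x)))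

  catalan-identity : ∀ a b X → (X *ₚ qInt (a ℕ.+ b)) ≈ₚ gauss (a ℕ.+ b) a →
    (((X *ₚ qInt (a ℕ.+ b)) *ₚ qFact a) *ₚ qFact b) ≈ₚ qFact (a ℕ.+ b)
  catalan-identity a b X eq = evaluations-determine (((X *ₚ qInt (a ℕ.+ b)) *ₚ qFact a) *ₚ qFact b) (qFact (a ℕ.+ b)) λ x → let open ℤE; open ℤE.At x in
    ≡.trans (eval-*ₚ ((X *ₚ qInt (a ℕ.+ b)) *ₚ qFact a) (qFact b) x)
    (≡.trans (*-congʳ (≡.trans (eval-*ₚ (X *ₚ qInt (a ℕ.+ b)) (qFact a) x) (*-congʳ (eval-cong (X *ₚ qInt (a ℕ.+ b)) (gauss (a ℕ.+ b) a) x eq))))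
    (G-factorial a b))

-- q-Vandermonde and q-Lucas at a root of unity

module RootsOfUnity where

  open import Level using (Level)
  open import Data.Bool using (true; false)
  open import Data.Nat as ℕ using (ℕ; zero; suc; _<_; _≤_; z≤n; s≤s; _∸_)
  import Data.Nat.Properties as ℕ
  import Data.Nat.Tactic.RingSolver as ℕSolver
  open import Data.List.Base using (List; []; _∷_; map; filter; length; _++_)
  open import Data.List.Properties using (length-++; filter-++; filter-accept; filter-reject)
  open import Data.Product using (_,_; ∃)
  open import Data.Sum using (_⊎_; inj₁; inj₂)
  open import Data.Empty using (⊥-elim)
  open import Relation.Nullary using (¬_; yes; no)
  open import Relation.Unary using (Decidable)
  open import Algebra.Bundles using (CommutativeRing)
  import Algebra.Properties.Group as GroupProperties
  import Algebra.Solver.Ring.NaturalCoefficients.Default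
  open import Relation.Binary.PropositionalEquality as ≡ using (_≡_; _≢_)
  import Relation.Binary.Reasoning.Setoid as SetoidReasoning
  open import Defs
  open GaussianPolynomials

  module Sums {c ℓ : Level} (R : CommutativeRing c ℓ) where
    open CommutativeRing R
    open SetoidReasoning setoid
    open Algebra.Solver.Ring.NaturalCoefficients.Default commutativeSemiring

    ∑ : ℕ → (ℕ → Carrier) → Carrier
    ∑ zero    t = 0#
    ∑ (suc n) t = ∑ n t + t n

    ∑-cong : ∀ n {t u : ℕ → Carrier} → (∀ j → j < n → t j ≈ u j) → ∑ n t ≈ ∑ n u
    ∑-cong zero    eq = refl
    ∑-cong (suc n) eq = +-cong (∑-cong n λ j j<n → eq j (ℕ.m≤n⇒m≤1+n j<n)) (eq n ℕ.≤-refl)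

    ∑-0 : ∀ n {t : ℕ → Carrier} → (∀ j → j < n → t j ≈ 0#) → ∑ n t ≈ 0#
    ∑-0 zero    eq = refl
    ∑-0 (suc n) eq = trans (+-cong (∑-0 n λ j j<n → eq j (ℕ.m≤n⇒m≤1+n j<n)) (eq n ℕ.≤-refl)) (+-identityˡ 0#)

    ∑-head : ∀ n (t : ℕ → Carrier) → ∑ (suc n) t ≈ t 0 + ∑ n (λ j → t (suc j))
    ∑-head zero    t = trans (+-identityˡ _) (sym (+-identityʳ _))
    ∑-head (suc n) t = trans (+-congʳ (∑-head n t)) (+-assoc _ _ _)

    ∑-+ : ∀ n (t u : ℕ → Carrier) → ∑ n t + ∑ n u ≈ ∑ n (λ j → t j + u j)
    ∑-+ zero    t u = +-identityˡ 0#
    ∑-+ (suc n) t u = trans (solve 4 (λ a b c d → (a :+ b) :+ (c :+ d) := (a :+ c) :+ (b :+ d)) refl (∑ n t) (t n) (∑ n u) (u n)) (+-congʳ (∑-+ n t u))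

    ∑-* : ∀ n x (t : ℕ → Carrier) → x * ∑ n t ≈ ∑ n (λ j → x * t j)
    ∑-* zero    x t = zeroʳ x
    ∑-* (suc n) x t = trans (distribˡ _ _ _) (+-congʳ (∑-* n x t))

    ∑-single : ∀ n i (t : ℕ → Carrier) → i < n → (∀ j → j < n → j ≢ i → t j ≈ 0#) → ∑ n t ≈ t i
    ∑-single (suc n) i t i<n eq with ℕ.m≤n⇒m<n∨m≡n (ℕ.≤-pred i<n)
    ... | inj₁ i<n′ = trans (+-cong (∑-single n i t i<n′ λ j j<n → eq j (ℕ.m≤n⇒m≤1+n j<n)) (eq n ℕ.≤-refl λ n≡i → ℕ.<-irrefl (≡.sym n≡i) i<n′)) (+-identityʳ _)
    ... | inj₂ ≡.refl = trans (+-congʳ (∑-0 n λ j j<n → eq j (ℕ.m≤n⇒m≤1+n j<n) λ j≡n → ℕ.<-irrefl j≡n j<n)) (+-identityˡ _)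

  module Vandermonde {c ℓ : Level} (R : CommutativeRing c ℓ) (q : CommutativeRing.Carrier R) where
    open Evaluation R
    open At q
    open Sums R
    open SetoidReasoning setoid
    open Algebra.Solver.Ring.NaturalCoefficients.Default commutativeSemiring

    term : ℕ → (ℕ → Carrier) → ℕ → ℕ → Carrier
    term K f c j = q ^ ((K ∸ j) ℕ.* (c ∸ j)) * G K j * f (c ∸ j)

    V : ℕ → (ℕ → Carrier) → ℕ → Carrier
    V K f c = ∑ (suc c) (term K f c)

    term-first : ∀ K f c → term (suc K) f c 0 ≈ q ^ c * term K f c 0
    term-first K f c = begin
      q ^ (c ℕ.+ K ℕ.* c) * G K 0 * f c      ≈⟨ *-congʳ (*-congʳ (^-+ q c (K ℕ.* c))) ⟩
      q ^ c * q ^ (K ℕ.* c) * G K 0 * f c    ≈⟨ solve 4 (λ a b c d → a :* b :* c :* d := a :* (b :* c :* d)) refl (q ^ c) (q ^ (K ℕ.* c)) (G K 0) (f c) ⟩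
      q ^ c * (q ^ (K ℕ.* c) * G K 0 * f c)  ∎

    term-next : ∀ K f c j → j ≤ c → term (suc K) f (suc c) (suc j) ≈ term K f c j + q ^ suc c * term K f (suc c) (suc j)
    term-next K f c j j≤c = begin
      q ^ E * G (suc K) (suc j) * F                          ≈⟨ *-congʳ (*-congˡ (G-suc K j)) ⟩
      q ^ E * (G K j + q ^ suc j * G K (suc j)) * F          ≈⟨ solve 5 (λ e g p h f → e :* (g :+ p :* h) :* f := e :* g :* f :+ e :* p :* h :* f) refl (q ^ E) (G K j) (q ^ suc j) (G K (suc j)) F ⟩
      q ^ E * G K j * F + q ^ E * q ^ suc j * G K (suc j) * F ≈⟨ +-congˡ shifted ⟩
      q ^ E * G K j * F + q ^ suc c * (q ^ ((K ∸ suc j) ℕ.* (c ∸ j)) * G K (suc j) * F) ∎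
      where
      E = (K ∸ j) ℕ.* (c ∸ j)
      F = f (c ∸ j)
      shifted : q ^ E * q ^ suc j * G K (suc j) * F ≈ q ^ suc c * (q ^ ((K ∸ suc j) ℕ.* (c ∸ j)) * G K (suc j) * F)
      shifted with suc j ℕ.≤? K
      -- Truncated subtraction breaks the rule for the exponents here, but both sides vanish because
      -- G K (suc j) = 0.
      ... | no j≮K = trans (*-congʳ (trans (*-congˡ z) (zeroʳ _))) (trans (zeroˡ _) (sym (trans (*-congˡ (trans (*-congʳ (trans (*-congˡ z) (zeroʳ _))) (zeroˡ _))) (zeroʳ _))))
        where
        z : G K (suc j) ≈ 0#
        z = G-> K (suc j) (ℕ.≰⇒> j≮K)
      ... | yes j<K = begin
        q ^ E * q ^ suc j * G K (suc j) * F                 ≈⟨ *-congʳ (*-congʳ powers) ⟩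
        q ^ suc c * q ^ E′ * G K (suc j) * F                ≈⟨ solve 4 (λ a b c d → a :* b :* c :* d := a :* (b :* c :* d)) refl (q ^ suc c) (q ^ E′) (G K (suc j)) F ⟩
        q ^ suc c * (q ^ E′ * G K (suc j) * F)              ∎
        where
        E′ = (K ∸ suc j) ℕ.* (c ∸ j)
        exponents : E ℕ.+ suc j ≡ suc c ℕ.+ E′
        exponents = ≡.trans (≡.cong (λ k → k ℕ.* (c ∸ j) ℕ.+ suc j) K∸j)
          (≡.trans (rearrange (c ∸ j) E′ j) (≡.cong (λ z → suc z ℕ.+ E′) (ℕ.m∸n+n≡m j≤c)))
          where
          K∸j : K ∸ j ≡ suc (K ∸ suc j)
          K∸j = ≡.sym (≡.trans (≡.sym (ℕ.+-∸-assoc 1 j<K)) ≡.refl)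
          rearrange : ∀ d e j → d ℕ.+ e ℕ.+ suc j ≡ suc (d ℕ.+ j) ℕ.+ e
          rearrange = ℕSolver.solve-∀
        powers : q ^ E * q ^ suc j ≈ q ^ suc c * q ^ E′
        powers = trans (sym (^-+ q E (suc j))) (trans (reflexive (≡.cong (q ^_) exponents)) (^-+ q (suc c) E′))

    -- For any `f`, the convolution obeys in `K` the same q-Pascal rule as the Gaussian polynomials,
    -- so the Vandermonde identity needs only an induction on `K`.
    V-suc : ∀ K f c → V (suc K) f (suc c) ≈ V K f c + q ^ suc c * V K f (suc c)
    V-suc K f c = begin
      ∑ (suc (suc c)) (term (suc K) f (suc c))
        ≈⟨ ∑-head (suc c) (term (suc K) f (suc c)) ⟩
      term (suc K) f (suc c) 0 + ∑ (suc c) (λ j → term (suc K) f (suc c) (suc j))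
        ≈⟨ +-cong (term-first K f (suc c)) (trans (∑-cong (suc c) λ j j<1+c → term-next K f c j (ℕ.≤-pred j<1+c)) (sym (∑-+ (suc c) _ _))) ⟩
      Q * t₀ + (V K f c + ∑ (suc c) (λ j → Q * term K f (suc c) (suc j)))
        ≈⟨ +-congˡ (+-congˡ (sym (∑-* (suc c) Q _))) ⟩
      Q * t₀ + (V K f c + Q * ∑ (suc c) (λ j → term K f (suc c) (suc j)))
        ≈⟨ solve 4 (λ q t v s → q :* t :+ (v :+ q :* s) := v :+ q :* (t :+ s)) refl Q t₀ (V K f c) _ ⟩
      V K f c + Q * (t₀ + ∑ (suc c) (λ j → term K f (suc c) (suc j)))
        ≈⟨ +-congˡ (*-congˡ (sym (∑-head (suc c) (term K f (suc c))))) ⟩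
      V K f c + Q * V K f (suc c) ∎
      where
      Q = q ^ suc c
      t₀ = term K f (suc c) 0

    G-vandermonde : ∀ K L c → G (K ℕ.+ L) c ≈ V K (G L) c
    G-vandermonde zero L c = sym (begin
      ∑ (suc c) (term 0 (G L) c)  ≈⟨ ∑-single (suc c) 0 _ (s≤s z≤n) (λ { zero _ 0≢0 → ⊥-elim (0≢0 ≡.refl) ; (suc j) _ _ → trans (*-congʳ (zeroʳ _)) (zeroˡ _) }) ⟩
      1# * G 0 0 * G L c          ≈⟨ *-congʳ (trans (*-identityˡ _) (G-0 0)) ⟩
      1# * G L c                  ≈⟨ *-identityˡ _ ⟩
      G L c                       ∎)
    G-vandermonde (suc K) L zero = begin
      G (K ℕ.+ L) 0               ≈⟨ G-vandermonde K L 0 ⟩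
      0# + term K (G L) 0 0       ≈⟨ +-congˡ (sym (trans (term-first K (G L) 0) (*-identityˡ _))) ⟩
      0# + term (suc K) (G L) 0 0 ∎
    G-vandermonde (suc K) L (suc c) = begin
      G (suc (K ℕ.+ L)) (suc c)                        ≈⟨ G-suc (K ℕ.+ L) c ⟩
      G (K ℕ.+ L) c + q ^ suc c * G (K ℕ.+ L) (suc c)  ≈⟨ +-cong (G-vandermonde K L c) (*-congˡ (G-vandermonde K L (suc c))) ⟩
      V K (G L) c + q ^ suc c * V K (G L) (suc c)      ≈⟨ sym (V-suc K (G L) c) ⟩
      V (suc K) (G L) (suc c)                          ∎

  -- For positive `e` this is the binomial coefficient of m over c / e, and 0 when `e` does not
  -- divide `c`. Counting words avoids the division and matches `fitting` directly.
  multiples : (e m c : ℕ) → ℕ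
  multiples e m c = length (filter (λ w → e ℕ.* countN w ℕ.≟ c) (allPaths m))

  filter-map-length : {A B : Set} {P : B → Set} (P? : Decidable P) (f : A → B) (xs : List A) →
    length (filter P? (map f xs)) ≡ length (filter (λ x → P? (f x)) xs)
  filter-map-length P? f [] = ≡.refl
  filter-map-length P? f (x ∷ xs) with P? (f x)
  ... | yes _ = ≡.cong suc (filter-map-length P? f xs)
  ... | no _  = filter-map-length P? f xs

  filter-length-cong : {A : Set} {P Q : A → Set} (P? : Decidable P) (Q? : Decidable Q) (xs : List A) →
    (∀ x → P x → Q x) → (∀ x → Q x → P x) → length (filter P? xs) ≡ length (filter Q? xs)
  filter-length-cong P? Q? [] f g = ≡.refl
  filter-length-cong P? Q? (x ∷ xs) f g with P? x | Q? x
  ... | yes _ | yes _ = ≡.cong suc (filter-length-cong P? Q? xs f g)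
  ... | no _  | no _  = filter-length-cong P? Q? xs f g
  ... | yes p | no ¬q = ⊥-elim (¬q (f x p))
  ... | no ¬p | yes q = ⊥-elim (¬p (g x q))

  filter-length-0 : {A : Set} {P : A → Set} (P? : Decidable P) (xs : List A) → (∀ x → ¬ P x) → length (filter P? xs) ≡ 0
  filter-length-0 P? [] f = ≡.refl
  filter-length-0 P? (x ∷ xs) f with P? x
  ... | yes p = ⊥-elim (f x p)
  ... | no _  = filter-length-0 P? xs f

  filter-witness : {A : Set} {P : A → Set} (P? : Decidable P) (xs : List A) → length (filter P? xs) ≢ 0 → ∃ P
  filter-witness P? []       nz = ⊥-elim (nz ≡.refl)
  filter-witness P? (x ∷ xs) nz with P? x
  ... | yes p = x , p
  ... | no _  = filter-witness P? xs nz

  filter-allPaths-suc : {P : Path → Set} (P? : Decidable P) (m : ℕ) →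
    length (filter P? (allPaths (suc m))) ≡ length (filter (λ w → P? (true ∷ w)) (allPaths m)) ℕ.+ length (filter (λ w → P? (false ∷ w)) (allPaths m))
  filter-allPaths-suc P? m = ≡.trans (≡.cong length (filter-++ P? (map (true ∷_) (allPaths m)) (map (false ∷_) (allPaths m))))
    (≡.trans (length-++ (filter P? (map (true ∷_) (allPaths m))))
    (≡.cong₂ ℕ._+_ (filter-map-length P? (true ∷_) (allPaths m)) (filter-map-length P? (false ∷_) (allPaths m))))

  multiples-0 : ∀ e → multiples e 0 0 ≡ 1
  multiples-0 e = ≡.cong length (filter-accept (λ w → e ℕ.* countN w ℕ.≟ 0) {[]} {[]} (ℕ.*-zeroʳ e))

  multiples-empty : ∀ e c → multiples e 0 (suc c) ≡ 0
  multiples-empty e c = ≡.cong length (filter-reject (λ w → e ℕ.* countN w ℕ.≟ suc c) {[]} {[]} λ eq → ℕ.0≢1+n (≡.trans (≡.sym (ℕ.*-zeroʳ e)) eq))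

  multiples-< : ∀ {e m c} → c < e → multiples e (suc m) c ≡ multiples e m c
  multiples-< {e} {m} {c} c<e = ≡.trans (filter-allPaths-suc _ m) (≡.cong (ℕ._+ multiples e m c)
    (filter-length-0 _ (allPaths m) λ w eq → ℕ.<⇒≱ c<e (≡.subst (e ≤_) eq (ℕ.≤-trans (ℕ.≤-reflexive (≡.sym (ℕ.*-identityʳ e))) (ℕ.*-monoʳ-≤ e (s≤s z≤n))))))

  multiples-≥ : ∀ {e m c} → multiples e (suc m) (e ℕ.+ c) ≡ multiples e m c ℕ.+ multiples e m (e ℕ.+ c)
  multiples-≥ {e} {m} {c} = ≡.trans (filter-allPaths-suc _ m) (≡.cong (ℕ._+ multiples e m (e ℕ.+ c))
    (filter-length-cong _ _ (allPaths m) (λ w eq → ℕ.+-cancelˡ-≡ e _ _ (≡.trans (≡.sym (ℕ.*-suc e (countN w))) eq))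
      (λ w eq → ≡.trans (ℕ.*-suc e (countN w)) (≡.cong (e ℕ.+_) eq))))

  module Root {c ℓ : Level} (R : CommutativeRing c ℓ) (1≉0 : ¬ (CommutativeRing._≈_ R (CommutativeRing.1# R) (CommutativeRing.0# R)))
    (domain : ∀ x y → CommutativeRing._≈_ R (CommutativeRing._*_ R x y) (CommutativeRing.0# R) → CommutativeRing._≈_ R x (CommutativeRing.0# R) ⊎ CommutativeRing._≈_ R y (CommutativeRing.0# R))
    (q : CommutativeRing.Carrier R) (e : ℕ) (1<e : 1 < e)
    (q^e≈1 : CommutativeRing._≈_ R (powR R q e) (CommutativeRing.1# R))
    (minimal : ∀ k → 0 < k → k < e → ¬ (CommutativeRing._≈_ R (powR R q k) (CommutativeRing.1# R))) where
    open Evaluation R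
    open At q
    open Sums R
    open Vandermonde R q
    open SetoidReasoning setoid
    open GroupProperties +-group using () renaming (x∙y⁻¹≈ε⇒x≈y to x-y≈0⇒x≈y)

    1-q≉0 : ¬ (1# - q ≈ 0#)
    1-q≉0 eq = minimal 1 (s≤s z≤n) 1<e (trans (*-identityʳ q) (sym (x-y≈0⇒x≈y 1# q eq)))

    I-periodic : ∀ k → q ^ k ≈ 1# → I k ≈ 0#
    I-periodic k q^k≈1 with domain (1# - q) (I k) (trans (I-geometric k) (trans (+-congˡ (-‿cong q^k≈1)) (-‿inverseʳ 1#)))
    ... | inj₁ z = ⊥-elim (1-q≉0 z)
    ... | inj₂ z = z

    I-nonzero : ∀ k → 0 < k → k < e → ¬ (I k ≈ 0#)
    I-nonzero k 0<k k<e z = minimal k 0<k k<e (sym (x-y≈0⇒x≈y 1# (q ^ k) (trans (sym (I-geometric k)) (trans (*-congˡ z) (zeroʳ _)))))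

    fact-nonzero : ∀ k → k < e → ¬ (fact k ≈ 0#)
    fact-nonzero zero    _     z = 1≉0 (trans (sym (trans (+-cong nat-1 (zeroʳ q)) (+-identityʳ 1#))) z)
    fact-nonzero (suc k) 1+k<e z with domain (fact k) (I (suc k)) (trans (sym (fact-suc k)) z)
    ... | inj₁ z′ = fact-nonzero k (ℕ.<-trans (ℕ.n<1+n k) 1+k<e) z′
    ... | inj₂ z′ = I-nonzero (suc k) (s≤s z≤n) 1+k<e z′

    fact-e : fact e ≈ 0#
    fact-e = helper e 1<e q^e≈1
      where
      helper : ∀ k → 1 < k → q ^ k ≈ 1# → fact k ≈ 0#
      helper (suc k) _ q^≈1 = trans (fact-suc k) (trans (*-congˡ (I-periodic (suc k) q^≈1)) (zeroʳ _))

    -- In the factorial formula [e]! vanishes, whereas [j]! and [e - j]! do not, since all their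
    -- factors have index below the order `e`.
    G-e : ∀ j → 0 < j → j < e → G e j ≈ 0#
    G-e j 0<j j<e with domain (G e j * fact j) (fact (e ∸ j)) product
      where
      product : G e j * fact j * fact (e ∸ j) ≈ 0#
      product = trans (≡.subst (λ k → G k j * fact j * fact (e ∸ j) ≈ fact k) (ℕ.m+[n∸m]≡n (ℕ.<⇒≤ j<e)) (G-factorial j (e ∸ j))) fact-e
    ... | inj₂ z = ⊥-elim (fact-nonzero (e ∸ j) (ℕ.∸-monoʳ-< 0<j (ℕ.<⇒≤ j<e)) z)
    ... | inj₁ z with domain (G e j) (fact j) z
    ...   | inj₁ z′ = z′
    ...   | inj₂ z′ = ⊥-elim (fact-nonzero j j<e z′)

    q^e* : ∀ k → q ^ (e ℕ.* k) ≈ 1#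
    q^e* k = trans (reflexive (≡.cong (q ^_) (ℕ.*-comm e k))) (trans (^-* q k e) (trans (^-cong k q^e≈1) (1^ k)))

    term-0 : ∀ f c → term e f c 0 ≈ f c
    term-0 f c = trans (*-congʳ (trans (*-cong (q^e* c) (G-0 e)) (*-identityˡ 1#))) (*-identityˡ _)

    term-vanishes : ∀ f c j → 0 < j → j ≢ e → term e f c j ≈ 0#
    term-vanishes f c j 0<j j≢e = trans (*-congʳ (trans (*-congˡ vanish) (zeroʳ _))) (zeroˡ _)
      where
      vanish : G e j ≈ 0#
      vanish with j ℕ.<? e
      ... | yes j<e = G-e j 0<j j<e
      ... | no j≮e  = G-> e j (ℕ.≤∧≢⇒< (ℕ.≮⇒≥ j≮e) λ e≡j → j≢e (≡.sym e≡j))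

    lucas-< : ∀ L c → c < e → G (e ℕ.+ L) c ≈ G L c
    lucas-< L c c<e = trans (G-vandermonde e L c) (trans (∑-single (suc c) 0 _ (s≤s z≤n) λ j j<1+c j≢0 →
      term-vanishes (G L) c j (ℕ.n≢0⇒n>0 j≢0) λ j≡e → ℕ.<⇒≱ c<e (ℕ.≤-trans (ℕ.≤-reflexive (≡.sym j≡e)) (ℕ.≤-pred j<1+c))) (term-0 (G L) c))

    -- In the Vandermonde sum with K = e only the terms j = 0 and j = e survive, by `G-e`. Their
    -- powers of `q` are 1, as the exponents are a multiple of `e` and 0.
    lucas-≥ : ∀ L c → G (e ℕ.+ L) (e ℕ.+ c) ≈ G L c + G L (e ℕ.+ c)
    lucas-≥ L c = begin
      G (e ℕ.+ L) (e ℕ.+ c)                                        ≈⟨ G-vandermonde e L (e ℕ.+ c) ⟩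
      ∑ (suc (e ℕ.+ c)) t                                          ≈⟨ ∑-head (e ℕ.+ c) t ⟩
      t 0 + ∑ (e ℕ.+ c) (λ j → t (suc j))                          ≈⟨ +-cong (term-0 (G L) (e ℕ.+ c)) (∑-single (e ℕ.+ c) (ℕ.pred e) _ bound other) ⟩
      G L (e ℕ.+ c) + t (suc (ℕ.pred e))                           ≈⟨ +-congˡ (reflexive (≡.cong t e≡)) ⟩
      G L (e ℕ.+ c) + t e                                          ≈⟨ +-congˡ last ⟩
      G L (e ℕ.+ c) + G L c                                        ≈⟨ +-comm _ _ ⟩
      G L c + G L (e ℕ.+ c)                                        ∎
      where
      t = term e (G L) (e ℕ.+ c)
      e≡ : suc (ℕ.pred e) ≡ e
      e≡ = ℕ.suc-pred e {{ℕ.>-nonZero (ℕ.<-trans (s≤s z≤n) 1<e)}}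
      bound : ℕ.pred e < e ℕ.+ c
      bound = ℕ.≤-trans (ℕ.≤-reflexive e≡) (ℕ.m≤m+n e c)
      other : ∀ j → j < e ℕ.+ c → j ≢ ℕ.pred e → t (suc j) ≈ 0#
      other j _ j≢ = term-vanishes (G L) (e ℕ.+ c) (suc j) (s≤s z≤n) λ 1+j≡e → j≢ (≡.cong ℕ.pred 1+j≡e)
      last : t e ≈ G L c
      last = begin
        q ^ ((e ∸ e) ℕ.* (e ℕ.+ c ∸ e)) * G e e * G L (e ℕ.+ c ∸ e)  ≈⟨ reflexive (≡.cong₂ (λ x y → q ^ (x ℕ.* (e ℕ.+ c ∸ e)) * G e e * G L y) (ℕ.n∸n≡0 e) (ℕ.m+n∸m≡n e c)) ⟩
        1# * G e e * G L c                                           ≈⟨ *-congʳ (trans (*-identityˡ _) (G-diagonal e)) ⟩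
        1# * G L c                                                   ≈⟨ *-identityˡ _ ⟩
        G L c                                                        ∎

    lucas : ∀ m c → G (m ℕ.* e) c ≈ nat (multiples e m c)
    lucas zero zero    = trans (G-0 0) (trans (sym nat-1) (reflexive (≡.cong nat (≡.sym (multiples-0 e)))))
    lucas zero (suc c) = reflexive (≡.cong nat (≡.sym (multiples-empty e c)))
    lucas (suc m) c with c ℕ.<? e
    ... | yes c<e = trans (lucas-< (m ℕ.* e) c c<e) (trans (lucas m c) (reflexive (≡.cong nat (≡.sym (multiples-< {e} {m} c<e)))))
    ... | no c≮e = ≡.subst (λ c → G (suc m ℕ.* e) c ≈ nat (multiples e (suc m) c)) (ℕ.m+[n∸m]≡n (ℕ.≮⇒≥ c≮e)) (begin
      G (e ℕ.+ m ℕ.* e) (e ℕ.+ d)                          ≈⟨ lucas-≥ (m ℕ.* e) d ⟩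
      G (m ℕ.* e) d + G (m ℕ.* e) (e ℕ.+ d)                ≈⟨ +-cong (lucas m d) (lucas m (e ℕ.+ d)) ⟩
      nat (multiples e m d) + nat (multiples e m (e ℕ.+ d)) ≈⟨ sym (nat-+ (multiples e m d) _) ⟩
      nat (multiples e m d ℕ.+ multiples e m (e ℕ.+ d))    ≈⟨ reflexive (≡.cong nat (≡.sym (multiples-≥ {e} {m} {d}))) ⟩
      nat (multiples e (suc m) (e ℕ.+ d))                  ∎)
      where
      d = c ∸ e

    -- Either no word is counted, or a counted word shows that `c` is a multiple of `e`, so that q^c
    -- = 1.
    multiples-power : ∀ m c → q ^ c * nat (multiples e m c) ≈ nat (multiples e m c)
    multiples-power m c with multiples e m c ℕ.≟ 0
    ... | yes z rewrite z = zeroʳ _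
    ... | no nz = trans (*-congʳ (q^c (filter-witness (λ w → e ℕ.* countN w ℕ.≟ c) (allPaths m) nz))) (*-identityˡ _)
      where
      q^c : (∃ λ w → e ℕ.* countN w ≡ c) → q ^ c ≈ 1#
      q^c (w , eq) = trans (reflexive (≡.cong (q ^_) (≡.sym eq))) (q^e* (countN w))

    -- The length a + b exceeds m e by one, and a single q-Pascal step removes the excess. Its two
    -- terms correspond to the two alternatives of `Fits`.
    gauss-at-root : ∀ m c → G (suc (m ℕ.* e)) (suc c) ≈ nat (multiples e m c ℕ.+ multiples e m (suc c))
    gauss-at-root m c = begin
      G (suc (m ℕ.* e)) (suc c)                                   ≈⟨ G-suc (m ℕ.* e) c ⟩
      G (m ℕ.* e) c + q ^ suc c * G (m ℕ.* e) (suc c)             ≈⟨ +-cong (lucas m c) (*-congˡ (lucas m (suc c))) ⟩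
      nat (multiples e m c) + q ^ suc c * nat (multiples e m (suc c)) ≈⟨ +-congˡ (multiples-power m (suc c)) ⟩
      nat (multiples e m c) + nat (multiples e m (suc c))         ≈⟨ sym (nat-+ (multiples e m c) _) ⟩
      nat (multiples e m c ℕ.+ multiples e m (suc c))             ∎

-- Linear dependence over the integers

module LinearDependence where

  open import Data.Nat as ℕ using (ℕ; zero; suc; s≤s)
  import Data.Nat.Properties as ℕ
  open import Data.Fin as Fin using (Fin; zero; suc; punchIn)
  open import Data.Fin.Properties using (any?)
  open import Data.Integer as ℤ using (ℤ; 0ℤ; 1ℤ; _+_; _*_; -_; _-_)
  import Data.Integer.Properties as ℤ
  open import Data.Integer.Tactic.RingSolver using (solve-∀)
  open import Data.Vec.Functional using (insertAt)
  open import Data.Vec.Functional.Properties using (insertAt-lookup; insertAt-punchIn)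
  open import Data.List.Base using (List; _∷_; lookup)
  open import Data.List.Membership.Propositional.Properties using (∈-lookup)
  import Data.List.Relation.Unary.All as All
  open import Data.List.Relation.Unary.AllPairs using (_∷_)
  open import Data.List.Relation.Unary.Unique.Propositional using (Unique)
  open import Data.Product using (∃; _×_; _,_)
  open import Data.Sum using (inj₁; inj₂)
  open import Data.Empty using (⊥-elim)
  open import Relation.Nullary using (¬_; yes; no; ¬?)
  open import Relation.Nullary.Decidable using (decidable-stable)
  open import Relation.Binary.PropositionalEquality using (_≡_; _≢_; refl; sym; trans; cong; cong₂; module ≡-Reasoning)
  open import Algebra.Properties.CommutativeMonoid.Sum ℤ.+-0-commutativeMonoid public using (sum; sum-cong-≗; sum-remove; ∑-distrib-+; sum-replicate-zero)
  open import Algebra.Properties.Semiring.Sum ℤ.+-*-semiring public using (*-distribˡ-sum)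

  sum-0 : ∀ {n} {t : Fin n → ℤ} → (∀ i → t i ≡ 0ℤ) → sum t ≡ 0ℤ
  sum-0 {n} eq = trans (sum-cong-≗ eq) (sum-replicate-zero n)

  *-nonzero : ∀ {x y} → x ≢ 0ℤ → y ≢ 0ℤ → x * y ≢ 0ℤ
  *-nonzero {x} x≢0 y≢0 eq with ℤ.i*j≡0⇒i≡0∨j≡0 x eq
  ... | inj₁ z = x≢0 z
  ... | inj₂ z = y≢0 z

  -- Elimination without fractions. If the first column has a nonzero entry `p` in row `i`, each
  -- other row is multiplied by `p` before its first entry is cleared with row `i`. A dependence c′
  -- of the shorter rows yields the coefficients `p * c′ l`, and the coefficient - s of row `i`
  -- cancels the first column.
  dependent : ∀ m {n} → m ℕ.< n → (M : Fin n → Fin m → ℤ) →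
    ∃ λ (c : Fin n → ℤ) → (∃ λ i → c i ≢ 0ℤ) × (∀ j → sum (λ i → c i * M i j) ≡ 0ℤ)
  dependent zero    {suc n} _ M = (λ _ → 1ℤ) , (zero , λ ()) , λ ()
  dependent (suc m) {suc n} (s≤s m<n) M with any? (λ i → ¬? (M i zero ℤ.≟ 0ℤ))
  ... | no none with dependent m (ℕ.m≤n⇒m≤1+n m<n) (λ i j → M i (suc j))
  ...   | c , nonzero , kills = c , nonzero , λ
          { zero    → sum-0 λ i → trans (cong (c i *_) (decidable-stable (M i zero ℤ.≟ 0ℤ) λ ≢0 → none (i , ≢0))) (ℤ.*-zeroʳ (c i))
          ; (suc j) → kills j }
  dependent (suc m) {suc n} (s≤s m<n) M | yes (i , p≢0)
    with dependent m m<n (λ l j → M i zero * M (punchIn i l) (suc j) - M (punchIn i l) zero * M i (suc j))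
  ... | c′ , (l₀ , c′≢0) , kills = c , (punchIn i l₀ , nonzero) , zeroes
    where
    p = M i zero
    s = sum (λ l → c′ l * M (punchIn i l) zero)
    c : Fin (suc n) → ℤ
    c = insertAt (λ l → p * c′ l) i (- s)
    at-i : c i ≡ - s
    at-i = insertAt-lookup (λ l → p * c′ l) i (- s)
    off-i : ∀ l → c (punchIn i l) ≡ p * c′ l
    off-i = insertAt-punchIn (λ l → p * c′ l) i (- s)
    nonzero : c (punchIn i l₀) ≢ 0ℤ
    nonzero eq = *-nonzero p≢0 c′≢0 (trans (sym (off-i l₀)) eq)
    split : ∀ j → sum (λ k → c k * M k j) ≡ - s * M i j + sum (λ l → p * c′ l * M (punchIn i l) j)
    split j = trans (sum-remove {i = i} (λ k → c k * M k j)) (cong₂ _+_ (cong (_* M i j) at-i) (sum-cong-≗ λ l → cong (_* M (punchIn i l) j) (off-i l)))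
    pull : ∀ p (f : Fin n → ℤ) → sum (λ l → p * f l) ≡ p * sum f
    pull p f = sym (*-distribˡ-sum p f)
    zeroes : ∀ j → sum (λ k → c k * M k j) ≡ 0ℤ
    zeroes zero = trans (split zero) (trans (cong (- s * p +_) (trans (sum-cong-≗ λ l → ℤ.*-assoc p (c′ l) _) (pull p _))) (cancel s p))
      where
      cancel : ∀ s p → - s * p + p * s ≡ 0ℤ
      cancel = solve-∀
    zeroes (suc j) = begin
      sum (λ k → c k * M k (suc j))                                     ≡⟨ split (suc j) ⟩
      - s * q + sum (λ l → p * c′ l * M (punchIn i l) (suc j))          ≡⟨ cong (_+ sum (λ l → p * c′ l * M (punchIn i l) (suc j))) (scaled s q) ⟩
      - q * s + sum (λ l → p * c′ l * M (punchIn i l) (suc j))          ≡⟨ cong (_+ sum (λ l → p * c′ l * M (punchIn i l) (suc j))) (sym (pull (- q) (λ l → c′ l * M (punchIn i l) zero))) ⟩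
      sum (λ l → - q * (c′ l * M (punchIn i l) zero)) + sum (λ l → p * c′ l * M (punchIn i l) (suc j))
                                                                        ≡⟨ sym (∑-distrib-+ (λ l → - q * (c′ l * M (punchIn i l) zero)) (λ l → p * c′ l * M (punchIn i l) (suc j))) ⟩
      sum (λ l → - q * (c′ l * M (punchIn i l) zero) + p * c′ l * M (punchIn i l) (suc j))
                                                                        ≡⟨ sum-cong-≗ (λ l → regroup q (c′ l) (M (punchIn i l) zero) p (M (punchIn i l) (suc j))) ⟩
      sum (λ l → c′ l * (p * M (punchIn i l) (suc j) - M (punchIn i l) zero * q)) ≡⟨ kills j ⟩
      0ℤ ∎
      where
      open ≡-Reasoning
      q = M i (suc j)
      scaled : ∀ s q → - s * q ≡ - q * s
      scaled = solve-∀
      regroup : ∀ q c x p y → - q * (c * x) + p * c * y ≡ c * (p * y - x * q)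
      regroup = solve-∀

  lookup-injective : ∀ {A : Set} {xs : List A} → Unique xs → ∀ {i j} → lookup xs i ≡ lookup xs j → i ≡ j
  lookup-injective {xs = x ∷ xs} (x∉ ∷ u) {zero}  {zero}  eq = refl
  lookup-injective {xs = x ∷ xs} (x∉ ∷ u) {suc i} {suc j} eq = cong suc (lookup-injective u eq)
  lookup-injective {xs = x ∷ xs} (x∉ ∷ u) {zero}  {suc j} eq = ⊥-elim (All.lookup x∉ (∈-lookup j) eq)
  lookup-injective {xs = x ∷ xs} (x∉ ∷ u) {suc i} {zero}  eq = ⊥-elim (All.lookup x∉ (∈-lookup i) (sym eq))

-- Unimodality of Gaussian polynomials by means of sl₂

module Unimodality where

  open import Data.Bool using (Bool; true; false)
  import Data.Bool.Properties as Bool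
  open import Data.Nat as ℕ using (ℕ; zero; suc)
  import Data.Nat.Properties as ℕ
  open import Data.Fin as Fin using (Fin; zero; suc; punchIn)
  open import Data.Fin.Properties using (punchInᵢ≢i)
  open import Data.Integer as ℤ using (ℤ; +_; 0ℤ; 1ℤ; _+_; _*_; -_; _-_)
  import Data.Integer.Properties as ℤ
  open import Data.Integer.Tactic.RingSolver using (solve-∀)
  open import Data.List.Base using (List; []; _∷_; length; lookup; filter)
  open import Data.List.Properties using (≡-dec)
  open import Data.List.Membership.Propositional using (_∈_)
  open import Data.List.Membership.Propositional.Properties using (∈-lookup; ∈-filter⁺; ∈-filter⁻)
  open import Data.List.Relation.Unary.Any using (index)
  open import Data.List.Relation.Unary.Any.Properties using (lookup-index)
  open import Data.List.Relation.Unary.Unique.Propositional using (Unique)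
  open import Data.List.Relation.Unary.Unique.Propositional.Properties using (filter⁺)
  open import Data.Product using (∃; _×_; _,_; proj₁; proj₂)
  open import Data.Sum using (inj₁; inj₂)
  open import Data.Empty using (⊥; ⊥-elim)
  open import Relation.Nullary using (¬_; Dec; yes; no)
  open import Relation.Nullary.Decidable using (_×-dec_)
  open import Relation.Binary.PropositionalEquality using (_≡_; _≢_; refl; sym; trans; cong; cong₂; subst; module ≡-Reasoning)
  open import Defs
  open LaserFire using (∈-allPaths⁺; ∈-allPaths⁻; countN+countE)
  open FixedPartitions using (allPaths-unique)
  open LinearDependence

  inv : Path → ℕ
  inv []          = 0
  inv (true ∷ w)  = inv w
  inv (false ∷ w) = countN w ℕ.+ inv w

  Vector : Set
  Vector = Path → ℤ

  infixl 7 _▹_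
  _▹_ : Vector → Bool → Vector
  (v ▹ x) w = v (x ∷ w)

  -- Operators are described by coordinates: the coordinate at a word beginning E N receives the old
  -- coordinate at the word beginning N E, which has one inversion fewer.
  swapUp : Vector → Bool → Path → ℤ
  swapUp v false (true ∷ w) = v (true ∷ false ∷ w)
  swapUp v _     _          = 0ℤ

  swapDown : Vector → Bool → Path → ℤ
  swapDown v true (false ∷ w) = v (false ∷ true ∷ w)
  swapDown v _    _           = 0ℤ

  -- The raising and lowering operators of the a-th exterior power of the (a+b)-dimensional irreducible sl₂-module,
  -- whose standard basis vectors are indexed by words; the weights ω will be (i + 1)(a + b − 1 − i).
  raise : Vector → Vector
  raise v []      = 0ℤ
  raise v (x ∷ w) = swapUp v x w + raise (v ▹ x) w

  module Operators (ω : ℕ → ℤ) where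

    lower : ℕ → Vector → Vector
    lower i v []      = 0ℤ
    lower i v (x ∷ w) = ω i * swapDown v x w + lower (suc i) (v ▹ x) w

    SameCounts : Path → Path → Set
    SameCounts w w′ = countN w ≡ countN w′ × countE w ≡ countE w′

    same-cons : ∀ x {w w′} → SameCounts w w′ → SameCounts (x ∷ w) (x ∷ w′)
    same-cons true  (p , q) = cong suc p , q
    same-cons false (p , q) = p , cong suc q

    raise-cong : ∀ {v v′} w → (∀ w′ → SameCounts w w′ → v w′ ≡ v′ w′) → raise v w ≡ raise v′ w
    raise-cong []      eq = refl
    raise-cong {v} {v′} (x ∷ w) eq = cong₂ _+_ (swap x w eq) (raise-cong w λ w′ p → eq (x ∷ w′) (same-cons x p))
      where
      swap : ∀ x w → (∀ w′ → SameCounts (x ∷ w) w′ → v w′ ≡ v′ w′) → swapUp v x w ≡ swapUp v′ x w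
      swap true  _           _  = refl
      swap false []          _  = refl
      swap false (false ∷ w) _  = refl
      swap false (true ∷ w)  eq = eq _ (refl , refl)

    lower-cong : ∀ i {v v′} w → (∀ w′ → SameCounts w w′ → v w′ ≡ v′ w′) → lower i v w ≡ lower i v′ w
    lower-cong i []      eq = refl
    lower-cong i {v} {v′} (x ∷ w) eq = cong₂ _+_ (cong (ω i *_) (swap x w eq)) (lower-cong (suc i) w λ w′ p → eq (x ∷ w′) (same-cons x p))
      where
      swap : ∀ x w → (∀ w′ → SameCounts (x ∷ w) w′ → v w′ ≡ v′ w′) → swapDown v x w ≡ swapDown v′ x w
      swap false _           _  = refl
      swap true  []          _  = refl
      swap true  (true ∷ w)  _  = refl
      swap true  (false ∷ w) eq = eq _ (refl , refl)

    raise-0 : ∀ w → raise (λ _ → 0ℤ) w ≡ 0ℤ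
    raise-0 []                 = refl
    raise-0 (true ∷ w)         = trans (ℤ.+-identityˡ _) (raise-0 w)
    raise-0 (false ∷ [])       = refl
    raise-0 (false ∷ false ∷ w) = trans (ℤ.+-identityˡ _) (raise-0 (false ∷ w))
    raise-0 (false ∷ true ∷ w) = trans (ℤ.+-identityˡ _) (raise-0 (true ∷ w))

    lower-0 : ∀ i w → lower i (λ _ → 0ℤ) w ≡ 0ℤ
    lower-0 i []      = refl
    lower-0 i (x ∷ w) = trans (cong₂ _+_ (trans (cong (ω i *_) (swap x w)) (ℤ.*-zeroʳ (ω i))) (lower-0 (suc i) w)) refl
      where
      swap : ∀ x w → swapDown (λ _ → 0ℤ) x w ≡ 0ℤ
      swap false _           = refl
      swap true  []          = refl
      swap true  (true ∷ w)  = refl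
      swap true  (false ∷ w) = refl

    raise-+ : ∀ v v′ w → raise (λ u → v u + v′ u) w ≡ raise v w + raise v′ w
    raise-+ v v′ []      = refl
    raise-+ v v′ (x ∷ w) = trans (cong₂ _+_ (swap x w) (raise-+ (v ▹ x) (v′ ▹ x) w)) (interchange (swapUp v x w) (swapUp v′ x w) _ _)
      where
      swap : ∀ x w → swapUp (λ u → v u + v′ u) x w ≡ swapUp v x w + swapUp v′ x w
      swap true  _           = refl
      swap false []          = refl
      swap false (false ∷ w) = refl
      swap false (true ∷ w)  = refl
      interchange : ∀ p q r s → p + q + (r + s) ≡ p + r + (q + s)
      interchange = solve-∀

    lower-+ : ∀ i v v′ w → lower i (λ u → v u + v′ u) w ≡ lower i v w + lower i v′ w
    lower-+ i v v′ []      = refl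
    lower-+ i v v′ (x ∷ w) = trans (cong₂ _+_ (cong (ω i *_) (swap x w)) (lower-+ (suc i) (v ▹ x) (v′ ▹ x) w)) (interchange (ω i) (swapDown v x w) (swapDown v′ x w) _ _)
      where
      swap : ∀ x w → swapDown (λ u → v u + v′ u) x w ≡ swapDown v x w + swapDown v′ x w
      swap false _           = refl
      swap true  []          = refl
      swap true  (true ∷ w)  = refl
      swap true  (false ∷ w) = refl
      interchange : ∀ o p q r s → o * (p + q) + (r + s) ≡ o * p + r + (o * q + s)
      interchange = solve-∀

    raise-* : ∀ c v w → raise (λ u → c * v u) w ≡ c * raise v w
    raise-* c v []      = sym (ℤ.*-zeroʳ c)
    raise-* c v (x ∷ w) = trans (cong₂ _+_ (swap x w) (raise-* c (v ▹ x) w)) (sym (ℤ.*-distribˡ-+ c _ _))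
      where
      swap : ∀ x w → swapUp (λ u → c * v u) x w ≡ c * swapUp v x w
      swap true  _           = sym (ℤ.*-zeroʳ c)
      swap false []          = sym (ℤ.*-zeroʳ c)
      swap false (false ∷ w) = sym (ℤ.*-zeroʳ c)
      swap false (true ∷ w)  = refl

    lower-* : ∀ i c v w → lower i (λ u → c * v u) w ≡ c * lower i v w
    lower-* i c v []      = sym (ℤ.*-zeroʳ c)
    lower-* i c v (x ∷ w) = trans (cong₂ _+_ (cong (ω i *_) (swap x w)) (lower-* (suc i) c (v ▹ x) w)) (factor (ω i) c (swapDown v x w) _)
      where
      swap : ∀ x w → swapDown (λ u → c * v u) x w ≡ c * swapDown v x w
      swap false _           = sym (ℤ.*-zeroʳ c)
      swap true  []          = sym (ℤ.*-zeroʳ c)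
      swap true  (true ∷ w)  = sym (ℤ.*-zeroʳ c)
      swap true  (false ∷ w) = refl
      factor : ∀ o c p r → o * (c * p) + c * r ≡ c * (o * p + r)
      factor = solve-∀

    raise-sum : ∀ {n} (c : Fin n → ℤ) (f : Fin n → Vector) w → raise (λ u → sum (λ i → c i * f i u)) w ≡ sum (λ i → c i * raise (f i) w)
    raise-sum {zero}  c f w = raise-0 w
    raise-sum {suc n} c f w = trans (raise-+ (λ u → c zero * f zero u) (λ u → sum (λ i → c (suc i) * f (suc i) u)) w)
      (cong₂ _+_ (raise-* (c zero) (f zero) w) (raise-sum (λ i → c (suc i)) (λ i → f (suc i)) w))

    -- What the letters at places `i` and i + 1 contribute to the commutator of raising and
    -- lowering; these contributions add up to the sl₂-weight of the word.
    defect : ℕ → Bool → Path → ℤ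
    defect i false (true ∷ w) = ω i
    defect i true (false ∷ w) = - ω i
    defect i _    _           = 0ℤ

    diagonal : ℕ → Path → ℤ
    diagonal i []      = 0ℤ
    diagonal i (x ∷ w) = defect i x w + diagonal (suc i) w

    private
      swapDown-swapUp : ∀ v z → swapDown (swapUp v false) true z ≡ 0ℤ
      swapDown-swapUp v []          = refl
      swapDown-swapUp v (true ∷ z)  = refl
      swapDown-swapUp v (false ∷ z) = refl

      swapUp-swapDown : ∀ v o z → swapUp (λ u → o * swapDown v true u) false z ≡ 0ℤ
      swapUp-swapDown v o []          = refl
      swapUp-swapDown v o (false ∷ z) = refl
      swapUp-swapDown v o (true ∷ z)  = ℤ.*-zeroʳ o

    -- Moves at overlapping but different places annihilate each other, and moves at distant places commute.
    local-commutator : ∀ i v x w →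
      swapUp (lower i v) x w + raise (λ u → ω i * swapDown v x u) w ≡
      ω i * swapDown (raise v) x w + lower (suc i) (swapUp v x) w + defect i x w * v (x ∷ w)
    local-commutator i v true [] = sym (trans (cong (λ z → z + 0ℤ + 0ℤ) (ℤ.*-zeroʳ (ω i))) refl)
    local-commutator i v false [] = sym (trans (cong (λ z → z + 0ℤ + 0ℤ) (ℤ.*-zeroʳ (ω i))) refl)
    local-commutator i v true (true ∷ z) = begin
      0ℤ + (0ℤ + raise (λ u → ω i * 0ℤ) z)               ≡⟨ cong (λ r → 0ℤ + (0ℤ + r)) (trans (raise-cong z (λ _ _ → ℤ.*-zeroʳ (ω i))) (raise-0 z)) ⟩
      0ℤ                                                 ≡⟨ sym (cong₂ (λ p q → p + q + 0ℤ) (ℤ.*-zeroʳ (ω i)) (trans (cong (_+ lower (suc (suc i)) (λ _ → 0ℤ) z) (trans (cong (ω (suc i) *_) (constant z)) (ℤ.*-zeroʳ (ω (suc i))))) (trans (ℤ.+-identityˡ _) (lower-0 (suc (suc i)) z)))) ⟩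
      ω i * 0ℤ + lower (suc i) (λ _ → 0ℤ) (true ∷ z) + 0ℤ * v (true ∷ true ∷ z) ∎
      where
      open ≡-Reasoning
      constant : ∀ z → swapDown (swapUp v true) true z ≡ 0ℤ
      constant []          = refl
      constant (true ∷ z)  = refl
      constant (false ∷ z) = refl
    local-commutator i v false (false ∷ z) = begin
      0ℤ + raise (λ u → ω i * 0ℤ) (false ∷ z)            ≡⟨ cong (λ r → 0ℤ + r) (trans (raise-cong (false ∷ z) (λ _ _ → ℤ.*-zeroʳ (ω i))) (raise-0 (false ∷ z))) ⟩
      0ℤ                                                 ≡⟨ sym (cong₂ (λ p q → p + q + 0ℤ) (ℤ.*-zeroʳ (ω i)) (trans (cong (_+ lower (suc (suc i)) (λ _ → 0ℤ) z) (ℤ.*-zeroʳ (ω (suc i)))) (trans (ℤ.+-identityˡ _) (lower-0 (suc (suc i)) z)))) ⟩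
      ω i * 0ℤ + lower (suc i) (swapUp v false) (false ∷ z) + 0ℤ * v (false ∷ false ∷ z) ∎
      where open ≡-Reasoning
    local-commutator i v false (true ∷ z) = begin
      (ω i * t + (ω (suc i) * 0ℤ + l)) + raise (λ u → ω i * 0ℤ) (true ∷ z) ≡⟨ cong₂ (λ p q → (ω i * t + (p + l)) + q) (ℤ.*-zeroʳ (ω (suc i))) (trans (raise-cong (true ∷ z) (λ _ _ → ℤ.*-zeroʳ (ω i))) (raise-0 (true ∷ z))) ⟩
      (ω i * t + (0ℤ + l)) + 0ℤ                                          ≡⟨ regroup (ω i * t) l ⟩
      0ℤ + (0ℤ + l) + ω i * t                                            ≡⟨ sym (cong₂ (λ p q → p + (q + l) + ω i * t) (ℤ.*-zeroʳ (ω i)) (trans (cong (ω (suc i) *_) (swapDown-swapUp v z)) (ℤ.*-zeroʳ (ω (suc i))))) ⟩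
      ω i * 0ℤ + (ω (suc i) * swapDown (swapUp v false) true z + l) + ω i * t ∎
      where
      open ≡-Reasoning
      t = v (false ∷ true ∷ z)
      l = lower (suc (suc i)) (λ u → v (true ∷ false ∷ u)) z
      regroup : ∀ p l → (p + (0ℤ + l)) + 0ℤ ≡ 0ℤ + (0ℤ + l) + p
      regroup = solve-∀
    local-commutator i v true (false ∷ z) = begin
      0ℤ + (swapUp (λ u → ω i * swapDown v true u) false z + raise (λ u → ω i * v (false ∷ true ∷ u)) z)
        ≡⟨ cong₂ (λ p q → 0ℤ + (p + q)) (swapUp-swapDown v (ω i) z) (raise-* (ω i) (λ u → v (false ∷ true ∷ u)) z) ⟩
      0ℤ + (0ℤ + ω i * r)
        ≡⟨ regroup (ω i) r t ⟩
      ω i * (t + (0ℤ + r)) + 0ℤ + - ω i * t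
        ≡⟨ sym (cong (λ p → ω i * (t + (0ℤ + r)) + p + - ω i * t) (lower-0 (suc i) (false ∷ z))) ⟩
      ω i * (t + (0ℤ + r)) + lower (suc i) (λ _ → 0ℤ) (false ∷ z) + - ω i * t ∎
      where
      open ≡-Reasoning
      t = v (true ∷ false ∷ z)
      r = raise (λ u → v (false ∷ true ∷ u)) z
      regroup : ∀ o r t → 0ℤ + (0ℤ + o * r) ≡ o * (t + (0ℤ + r)) + 0ℤ + - o * t
      regroup = solve-∀

    -- Each operator splits into the move at the first two letters and the moves further on. The
    -- latter commute up to a diagonal term by induction, and `local-commutator` collects everything
    -- that involves a move at the front.
    commutator : ∀ i v w → raise (lower i v) w ≡ lower i (raise v) w + diagonal i w * v w
    commutator i v []      = refl
    commutator i v (x ∷ w) = begin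
      swapUp (lower i v) x w + raise (λ u → ω i * swapDown v x u + lower (suc i) (v ▹ x) u) w
        ≡⟨ cong (λ r → swapUp (lower i v) x w + r) (raise-+ (λ u → ω i * swapDown v x u) (lower (suc i) (v ▹ x)) w) ⟩
      swapUp (lower i v) x w + (raise (λ u → ω i * swapDown v x u) w + raise (lower (suc i) (v ▹ x)) w)
        ≡⟨ sym (ℤ.+-assoc (swapUp (lower i v) x w) _ _) ⟩
      swapUp (lower i v) x w + raise (λ u → ω i * swapDown v x u) w + raise (lower (suc i) (v ▹ x)) w
        ≡⟨ cong₂ _+_ (local-commutator i v x w) (commutator (suc i) (v ▹ x) w) ⟩
      (ω i * D + L + δ * t) + (M + d * t)
        ≡⟨ regroup (ω i * D) L δ M d t ⟩
      ω i * D + (L + M) + (δ + d) * t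
        ≡⟨ cong (λ z → ω i * D + z + (δ + d) * t) (sym (lower-+ (suc i) (swapUp v x) (raise (v ▹ x)) w)) ⟩
      ω i * D + lower (suc i) (λ u → swapUp v x u + raise (v ▹ x) u) w + (δ + d) * t ∎
      where
      open ≡-Reasoning
      D = swapDown (raise v) x w
      L = lower (suc i) (swapUp v x) w
      δ = defect i x w
      M = lower (suc i) (raise (v ▹ x)) w
      d = diagonal (suc i) w
      t = v (x ∷ w)
      regroup : ∀ o l δ m d t → (o + l + δ * t) + (m + d * t) ≡ o + (l + m) + (δ + d) * t
      regroup = solve-∀

    raise-support : ∀ {v} w → (∀ w′ → SameCounts w w′ → suc (inv w′) ≡ inv w → v w′ ≡ 0ℤ) → raise v w ≡ 0ℤ
    raise-support []      _  = refl
    raise-support {v} (x ∷ w) eq = cong₂ _+_ (swap x w eq) (raise-support w λ w′ p q → eq (x ∷ w′) (same-cons x p) (step x p q))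
      where
      swap : ∀ x w → (∀ w′ → SameCounts (x ∷ w) w′ → suc (inv w′) ≡ inv (x ∷ w) → v w′ ≡ 0ℤ) → swapUp v x w ≡ 0ℤ
      swap true  _           _  = refl
      swap false []          _  = refl
      swap false (false ∷ w) _  = refl
      swap false (true ∷ w)  eq = eq _ (refl , refl) refl
      step : ∀ x {w w′} → SameCounts w w′ → suc (inv w′) ≡ inv w → suc (inv (x ∷ w′)) ≡ inv (x ∷ w)
      step true  _       q = q
      step false (p , _) q = trans (sym (ℕ.+-suc _ _)) (cong₂ ℕ._+_ (sym p) q)

    lower-support : ∀ i {v} w → (∀ w′ → SameCounts w w′ → inv w′ ≡ suc (inv w) → v w′ ≡ 0ℤ) → lower i v w ≡ 0ℤ
    lower-support i []      _  = refl
    lower-support i {v} (x ∷ w) eq = cong₂ _+_ (trans (cong (ω i *_) (swap x w eq)) (ℤ.*-zeroʳ (ω i)))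
        (lower-support (suc i) w λ w′ p q → eq (x ∷ w′) (same-cons x p) (step x p q))
      where
      swap : ∀ x w → (∀ w′ → SameCounts (x ∷ w) w′ → inv w′ ≡ suc (inv (x ∷ w)) → v w′ ≡ 0ℤ) → swapDown v x w ≡ 0ℤ
      swap false _           _  = refl
      swap true  []          _  = refl
      swap true  (true ∷ w)  _  = refl
      swap true  (false ∷ w) eq = eq _ (refl , refl) refl
      step : ∀ x {w w′} → SameCounts w w′ → inv w′ ≡ suc (inv w) → inv (x ∷ w′) ≡ suc (inv (x ∷ w))
      step true  _       q = q
      step false (p , _) q = trans (cong₂ ℕ._+_ (sym p) q) (ℕ.+-suc _ _)

  headN : Path → ℤ
  headN (true ∷ w) = 1ℤ
  headN _          = 0ℤ

  module Injective (a b : ℕ) where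

    L : ℤ
    L = + (a ℕ.+ b)

    ω : ℕ → ℤ
    ω i = (1ℤ + + i) * (L - (1ℤ + + i))

    open Operators ω

    ω-rest : ∀ i w → L ≡ (1ℤ + + i) + (+ countN w + + countE w) → ω i ≡ (1ℤ + + i) * (+ countN w + + countE w)
    ω-rest i w eq = cong ((1ℤ + + i) *_) (trans (cong (_- (1ℤ + + i)) eq) (cancel (1ℤ + + i) _))
      where
      cancel : ∀ i r → i + r - i ≡ r
      cancel = solve-∀

    defect-false : ∀ i w → defect i false w ≡ headN w * ω i
    defect-false i []          = sym (ℤ.*-zeroˡ (ω i))
    defect-false i (true ∷ w)  = sym (ℤ.*-identityˡ (ω i))
    defect-false i (false ∷ w) = sym (ℤ.*-zeroˡ (ω i))

    defect-true : ∀ i w → L ≡ (1ℤ + + i) + (+ countN w + + countE w) → defect i true w ≡ (headN w - 1ℤ) * ω i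
    defect-true i []          eq = sym (trans (cong ((0ℤ - 1ℤ) *_) (trans (ω-rest i [] eq) (ℤ.*-zeroʳ (1ℤ + + i)))) refl)
    defect-true i (true ∷ w)  eq = sym (ℤ.*-zeroˡ (ω i))
    defect-true i (false ∷ w) eq = negate (ω i)
      where
      negate : ∀ o → - o ≡ (0ℤ - 1ℤ) * o
      negate = solve-∀

    -- The induction runs over suffixes starting at place `i`. The additional term on the left is
    -- headN w times ω (i - 1), the part of the defect of the pair across the cut that depends on
    -- the first letter of `w`. It vanishes at i = 0, where the weight is 2 inv w - a b.
    diagonal-formula : ∀ i w → L ≡ + i + (+ countN w + + countE w) →
      diagonal i w + headN w * + i * (+ countN w + + countE w) ≡ + 2 * + inv w - + countN w * + countE w + + i * + countN w
    diagonal-formula i [] eq = sym (trans (ℤ.+-identityˡ _) (ℤ.*-zeroʳ (+ i)))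
    diagonal-formula i (false ∷ w) eq = begin
      defect i false w + d + 0ℤ * + i * (A + (1ℤ + B))   ≡⟨ cong (λ z → z + d + 0ℤ * + i * (A + (1ℤ + B))) (trans (defect-false i w) (cong (headN w *_) (ω-rest i w eq′))) ⟩
      headN w * ((1ℤ + + i) * (A + B)) + d + 0ℤ * + i * (A + (1ℤ + B)) ≡⟨ regroup (headN w) (+ i) A B d ⟩
      d + headN w * (1ℤ + + i) * (A + B)                 ≡⟨ diagonal-formula (suc i) w eq′ ⟩
      + 2 * J - A * B + (1ℤ + + i) * A                   ≡⟨ finish J A B (+ i) ⟩
      + 2 * (A + J) - A * (1ℤ + B) + + i * A             ∎
      where
      open ≡-Reasoning
      A = + countN w
      B = + countE w
      J = + inv w
      d = diagonal (suc i) w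
      eq′ : L ≡ (1ℤ + + i) + (A + B)
      eq′ = trans eq (assoc (+ i) A B)
        where
        assoc : ∀ i a b → i + (a + (1ℤ + b)) ≡ (1ℤ + i) + (a + b)
        assoc = solve-∀
      regroup : ∀ h i a b d → h * ((1ℤ + i) * (a + b)) + d + 0ℤ * i * (a + (1ℤ + b)) ≡ d + h * (1ℤ + i) * (a + b)
      regroup = solve-∀
      finish : ∀ j a b i → + 2 * j - a * b + (1ℤ + i) * a ≡ + 2 * (a + j) - a * (1ℤ + b) + i * a
      finish = solve-∀
    diagonal-formula i (true ∷ w) eq = begin
      defect i true w + d + 1ℤ * + i * ((1ℤ + A) + B)    ≡⟨ cong (λ z → z + d + 1ℤ * + i * ((1ℤ + A) + B)) (trans (defect-true i w eq′) (cong ((headN w - 1ℤ) *_) (ω-rest i w eq′))) ⟩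
      (headN w - 1ℤ) * ((1ℤ + + i) * (A + B)) + d + 1ℤ * + i * ((1ℤ + A) + B) ≡⟨ regroup (headN w) (+ i) A B d ⟩
      (d + headN w * (1ℤ + + i) * (A + B)) + (+ i - A - B)  ≡⟨ cong (_+ (+ i - A - B)) (diagonal-formula (suc i) w eq′) ⟩
      (+ 2 * J - A * B + (1ℤ + + i) * A) + (+ i - A - B)    ≡⟨ finish J A B (+ i) ⟩
      + 2 * J - (1ℤ + A) * B + + i * (1ℤ + A)               ∎
      where
      open ≡-Reasoning
      A = + countN w
      B = + countE w
      J = + inv w
      d = diagonal (suc i) w
      eq′ : L ≡ (1ℤ + + i) + (A + B)
      eq′ = trans eq (assoc (+ i) A B)
        where
        assoc : ∀ i a b → i + ((1ℤ + a) + b) ≡ (1ℤ + i) + (a + b)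
        assoc = solve-∀
      regroup : ∀ h i a b d → (h - 1ℤ) * ((1ℤ + i) * (a + b)) + d + 1ℤ * i * ((1ℤ + a) + b) ≡ (d + h * (1ℤ + i) * (a + b)) + (i - a - b)
      regroup = solve-∀
      finish : ∀ j a b i → (+ 2 * j - a * b + (1ℤ + i) * a) + (i - a - b) ≡ + 2 * j - (1ℤ + a) * b + i * (1ℤ + a)
      finish = solve-∀

    Good : Path → Set
    Good w = countN w ≡ a × countE w ≡ b

    good-same : ∀ {w w′} → Good w → SameCounts w w′ → Good w′
    good-same (p , q) (r , s) = trans (sym r) p , trans (sym s) q

    diagonal-good : ∀ w → Good w → diagonal 0 w ≡ + 2 * + inv w - + a * + b
    diagonal-good w (refl , refl) = trans (clean (diagonal 0 w) (headN w) _) (trans (diagonal-formula 0 w (sym (ℤ.+-identityˡ _))) (drop (+ 2 * + inv w - + a * + b) (+ a)))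
      where
      clean : ∀ d h r → d ≡ d + h * 0ℤ * r
      clean = solve-∀
      drop : ∀ x a → x + 0ℤ * a ≡ x
      drop = solve-∀

    module _ (k : ℕ) (small : 2 ℕ.* k ℕ.< a ℕ.* b) (v : Vector)
             (support : ∀ w → Good w → inv w ≢ k → v w ≡ 0ℤ) (killed : ∀ w → Good w → raise v w ≡ 0ℤ) where

      pow : ℕ → Vector
      pow zero    = v
      pow (suc j) = lower 0 (pow j)

      pow-support : ∀ j w → Good w → inv w ℕ.+ j ≢ k → pow j w ≡ 0ℤ
      pow-support zero    w g ne = support w g λ eq → ne (trans (ℕ.+-identityʳ _) eq)
      pow-support (suc j) w g ne = lower-support 0 w λ w′ s up → pow-support j w′ (good-same {w} {w′} g s)
        λ eq → ne (trans (ℕ.+-suc (inv w) j) (trans (cong (ℕ._+ j) (sym up)) eq))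

      weight : ℕ → ℤ
      weight j = + 2 * (+ k - + j) - + a * + b

      -- The factor by which raising undoes one lowering, as in `raise-pow`: commuting `raise` past
      -- each lowering leaves one weight behind, and `v` itself is killed. Below the middle all
      -- these weights are negative, so the factors cannot cancel to 0.
      coef : ℕ → ℤ
      coef zero    = 0ℤ
      coef (suc j) = coef j + weight j

      diagonal-weight : ∀ j w → Good w → diagonal 0 w * pow j w ≡ weight j * pow j w
      diagonal-weight j w g with inv w ℕ.+ j ℕ.≟ k
      ... | no ne = trans (cong (diagonal 0 w *_) z) (trans (ℤ.*-zeroʳ (diagonal 0 w)) (sym (trans (cong (weight j *_) z) (ℤ.*-zeroʳ (weight j)))))
        where z = pow-support j w g ne
      ... | yes eq = cong (_* pow j w) (trans (diagonal-good w g) (cong (λ z → + 2 * z - + a * + b) (sym k-j)))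
        where
        cancel : ∀ i j → i + j - j ≡ i
        cancel = solve-∀
        k-j : + k - + j ≡ + inv w
        k-j = trans (cong (λ z → + z - + j) (sym eq)) (cancel (+ inv w) (+ j))

      raise-pow : ∀ j w → Good w → raise (pow (suc j)) w ≡ coef (suc j) * pow j w
      lower-raise : ∀ j w → Good w → lower 0 (raise (pow j)) w ≡ coef j * pow j w

      raise-pow j w g = trans (commutator 0 (pow j) w) (trans (cong₂ _+_ (lower-raise j w g) (diagonal-weight j w g)) (sym (ℤ.*-distribʳ-+ (pow j w) (coef j) (weight j))))

      lower-raise zero    w g = trans (lower-cong 0 w λ w′ s → killed w′ (good-same {w} {w′} g s)) (trans (lower-0 0 w) (sym (ℤ.*-zeroˡ (v w))))
      lower-raise (suc j) w g = trans (lower-cong 0 w λ w′ s → raise-pow j w′ (good-same {w} {w′} g s)) (lower-* 0 (coef (suc j)) (pow j) w)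

      weight-negative : ∀ j → weight j ℤ.< 0ℤ
      weight-negative j = ℤ.≤-<-trans bound (subst (ℤ._< 0ℤ) (rewriteℤ (+ k) (+ a * + b)) base)
        where
        rewriteℤ : ∀ k c → + 2 * k + - c ≡ + 2 * k - c
        rewriteℤ = solve-∀
        base : + 2 * + k + - (+ a * + b) ℤ.< 0ℤ
        base = subst (+ 2 * + k + - (+ a * + b) ℤ.<_) (ℤ.+-inverseʳ (+ a * + b)) (ℤ.+-monoˡ-< (- (+ a * + b))
          (subst (ℤ._< + a * + b) (ℤ.pos-* 2 k) (subst (+ (2 ℕ.* k) ℤ.<_) (ℤ.pos-* a b) (ℤ.+<+ small))))
        bound : weight j ℤ.≤ + 2 * + k - + a * + b
        bound = ℤ.+-monoˡ-≤ (- (+ a * + b)) (ℤ.*-monoˡ-≤-nonNeg (+ 2) {+ k - + j} {+ k} (ℤ.i≤j⇒i-k≤j (+ j) ℤ.≤-refl))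

      coef-≤0 : ∀ j → coef j ℤ.≤ 0ℤ
      coef-≤0 zero    = ℤ.≤-refl
      coef-≤0 (suc j) = ℤ.+-mono-≤ (coef-≤0 j) (ℤ.<⇒≤ (weight-negative j))

      coef-≢0 : ∀ j → coef (suc j) ≢ 0ℤ
      coef-≢0 j eq = ℤ.<-irrefl eq (ℤ.+-mono-≤-< (coef-≤0 j) (weight-negative j))

      descend : ∀ j → (∀ w → Good w → pow j w ≡ 0ℤ) → ∀ w → Good w → v w ≡ 0ℤ
      descend zero    z = z
      descend (suc j) z = descend j λ w g → cancel w (trans (sym (raise-pow j w g)) (trans (raise-cong w λ w′ s → z w′ (good-same {w} {w′} g s)) (raise-0 w)))
        where
        cancel : ∀ w → coef (suc j) * pow j w ≡ 0ℤ → pow j w ≡ 0ℤ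
        cancel w eq with ℤ.i*j≡0⇒i≡0∨j≡0 (coef (suc j)) eq
        ... | inj₁ c≡0 = ⊥-elim (coef-≢0 j c≡0)
        ... | inj₂ p≡0 = p≡0

      -- After k + 1 lowerings the inversion number would be negative, so the vector is 0. Raising
      -- it step by step gives back `v` up to nonzero factors.
      raise-injective : ∀ w → Good w → v w ≡ 0ℤ
      raise-injective = descend (suc k) λ w g → pow-support (suc k) w g λ eq → ℕ.<-irrefl (sym eq) (ℕ.m≤n+m (suc k) (inv w))

  level? : ∀ a k w → Dec (countN w ≡ a × inv w ≡ k)
  level? a k w = (countN w ℕ.≟ a) ×-dec (inv w ℕ.≟ k)

  level : (a b k : ℕ) → List Path
  level a b k = filter (level? a k) (allPaths (a ℕ.+ b))

  level-unique : ∀ a b k → Unique (level a b k)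
  level-unique a b k = filter⁺ (level? a k) (allPaths-unique (a ℕ.+ b))

  ∈-level⁻ : ∀ {a b k w} → w ∈ level a b k → countN w ≡ a × countE w ≡ b × inv w ≡ k
  ∈-level⁻ {a} {b} {k} {w} w∈ with ∈-filter⁻ (level? a k) {xs = allPaths (a ℕ.+ b)} w∈
  ... | w∈′ , cN , iv = cN , ℕ.+-cancelˡ-≡ a _ _ (trans (cong (ℕ._+ countE w) (sym cN)) (trans (countN+countE w) (∈-allPaths⁻ (a ℕ.+ b) w∈′))) , iv

  ∈-level⁺ : ∀ {a b k w} → countN w ≡ a → countE w ≡ b → inv w ≡ k → w ∈ level a b k
  ∈-level⁺ {w = w} cN cE iv = ∈-filter⁺ (level? _ _) (∈-allPaths⁺ (trans (sym (countN+countE w)) (cong₂ ℕ._+_ cN cE))) (cN , iv)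

  δ : Path → Vector
  δ x w with ≡-dec Bool._≟_ x w
  ... | yes _ = 1ℤ
  ... | no _  = 0ℤ

  δ-same : ∀ x → δ x x ≡ 1ℤ
  δ-same x with ≡-dec Bool._≟_ x x
  ... | yes _ = refl
  ... | no ≢  = ⊥-elim (≢ refl)

  δ-distinct : ∀ {x w} → x ≢ w → δ x w ≡ 0ℤ
  δ-distinct {x} {w} x≢w with ≡-dec Bool._≟_ x w
  ... | yes eq = ⊥-elim (x≢w eq)
  ... | no _   = refl

  combination : ∀ (xs : List Path) → (Fin (length xs) → ℤ) → Vector
  combination xs c w = sum (λ i → c i * δ (lookup xs i) w)

  combination-at : ∀ {xs} → Unique xs → ∀ c i → combination xs c (lookup xs i) ≡ c i
  combination-at {xs@(_ ∷ _)} u c i = trans (sum-remove {i = i} (λ l → c l * δ (lookup xs l) (lookup xs i)))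
    (trans (cong₂ _+_ (trans (cong (c i *_) (δ-same (lookup xs i))) (ℤ.*-identityʳ (c i)))
      (sum-0 λ l → trans (cong (c (punchIn i l) *_) (δ-distinct λ eq → punchInᵢ≢i i l (lookup-injective u eq))) (ℤ.*-zeroʳ (c (punchIn i l))))) (ℤ.+-identityʳ (c i)))

  combination-outside : ∀ {xs} c {w} → ¬ (w ∈ xs) → combination xs c w ≡ 0ℤ
  combination-outside {xs} c w∉ = sum-0 λ l → trans (cong (c l *_) (δ-distinct λ eq → w∉ (subst (_∈ xs) eq (∈-lookup l)))) (ℤ.*-zeroʳ (c l))

  -- With more words at level `k` than at level k + 1, their images under `raise` would be linearly
  -- dependent. The dependence is a nonzero vector at level `k` killed by `raise`, against
  -- injectivity.
  ascending : ∀ a b k → 2 ℕ.* k ℕ.< a ℕ.* b → length (level a b k) ℕ.≤ length (level a b (suc k))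
  ascending a b k small = ℕ.≮⇒≥ λ more → absurd (dependent (length Bs) more (λ i j → raise (δ (lookup As i)) (lookup Bs j)))
    where
    open Injective a b
    open Operators ω
    As = level a b k
    Bs = level a b (suc k)
    absurd : (∃ λ (c : Fin (length As) → ℤ) → (∃ λ i → c i ≢ 0ℤ) × (∀ j → sum (λ i → c i * raise (δ (lookup As i)) (lookup Bs j)) ≡ 0ℤ)) → ⊥
    absurd (c , (i , ci≢0) , kills) = ci≢0 (trans (sym (combination-at (level-unique a b k) c i)) (raise-injective k small v support killed (lookup As i) good))
      where
      v : Vector
      v = combination As c
      support : ∀ w → Good w → inv w ≢ k → v w ≡ 0ℤ
      support w _ ne = combination-outside c λ w∈ → ne (proj₂ (proj₂ (∈-level⁻ {a} {b} {k} w∈)))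
      killed : ∀ w → Good w → raise v w ≡ 0ℤ
      killed w g with inv w ℕ.≟ suc k
      ... | no ne = raise-support w λ w′ s up → support w′ (good-same {w} {w′} g s) λ eq → ne (trans (sym up) (cong suc eq))
      ... | yes eq = trans (raise-sum c (λ i → δ (lookup As i)) w) (trans (cong (λ w → sum (λ i → c i * raise (δ (lookup As i)) w)) (lookup-index w∈)) (kills (index w∈)))
        where
        w∈ : w ∈ Bs
        w∈ = ∈-level⁺ (proj₁ g) (proj₂ g) eq
      good : Good (lookup As i)
      good with ∈-level⁻ {a} {b} {k} (∈-lookup {xs = As} i)
      ... | cN , cE , _ = cN , cE

-- The q-rational Catalan polynomial and its coefficients

module CatalanPolynomial where

  open import Data.Bool using (Bool; true; false; not)
  import Data.Bool.Properties as Bool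
  open import Data.Nat as ℕ using (ℕ; zero; suc; _+_; _*_; _∸_; _≤_; _<_; s≤s; z≤n; NonZero; _%_)
  import Data.Nat.Properties as ℕ
  open import Data.Nat.DivMod using (m<n⇒m%n≡m; [m+kn]%n≡m%n; [m+n]%n≡m%n; %-congˡ)
  open import Data.Nat.Coprimality using (Coprime; coprime-Bézout)
  open import Data.Nat.GCD using (module Bézout)
  open import Data.Nat.Divisibility using (∣m+n∣m⇒∣n)
  import Data.Nat.Tactic.RingSolver as ℕSolver
  import Data.Integer.Properties as ℤ
  open import Data.List.Base using (List; []; _∷_; _++_; _∷ʳ_; length; filter; map; applyUpTo)
  open import Data.List.Properties using (filter-accept; filter-reject; ∷ʳ-injectiveˡ; ∷ʳ-injectiveʳ; length-++)
  open import Data.List.Membership.Propositional using (_∈_)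
  open import Data.List.Membership.Propositional.Properties using (∈-filter⁺; ∈-filter⁻)
  open import Data.List.Relation.Unary.Any using (here)
  open import Data.List.Relation.Unary.Unique.Propositional.Properties using (filter⁺)
  open import Data.Product using (∃; _×_; _,_; proj₁; proj₂)
  open import Data.Sum using (_⊎_; inj₁; inj₂)
  open import Data.Empty using (⊥; ⊥-elim)
  open import Relation.Nullary using (¬_; yes; no)
  open import Relation.Nullary.Decidable using (_×-dec_)
  open import Relation.Unary using (Decidable)
  open import Relation.Binary.Definitions using (tri<; tri≈; tri>)
  open import Relation.Binary.PropositionalEquality using (_≡_; refl; sym; trans; cong; cong₂; subst; subst₂)
  open import Defs
  open Counting
  open LaserFire using (∈-allPaths⁺; ∈-allPaths⁻; countN+countE)
  open Partitions using (%-cancelˡ-+)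
  open PeriodicPaths using (%-window)
  open FixedPartitions using (allPaths-unique)
  open GaussianPolynomials
  open RootsOfUnity using (filter-allPaths-suc; filter-length-cong; filter-length-0)
  open Unimodality

  coeff-+ₚ : ∀ k p q → coeff k (p +ₚ q) ≡ coeff k p + coeff k q
  coeff-+ₚ k       []      q       = refl
  coeff-+ₚ zero    (x ∷ p) []      = sym (ℕ.+-identityʳ x)
  coeff-+ₚ (suc k) (x ∷ p) []      = sym (ℕ.+-identityʳ _)
  coeff-+ₚ zero    (x ∷ p) (y ∷ q) = refl
  coeff-+ₚ (suc k) (x ∷ p) (y ∷ q) = coeff-+ₚ k p q

  coeff-shift-< : ∀ {m k} p → k < m → coeff k (shiftₚ m p) ≡ 0
  coeff-shift-< {suc m} {zero}  p _         = refl
  coeff-shift-< {suc m} {suc k} p (s≤s k<m) = coeff-shift-< p k<m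

  coeff-shift-≥ : ∀ m k p → coeff (m + k) (shiftₚ m p) ≡ coeff k p
  coeff-shift-≥ zero    k p = refl
  coeff-shift-≥ (suc m) k p = coeff-shift-≥ m k p

  coeff-gauss : ∀ L c k → coeff k (gauss L c) ≡ length (filter (level? c k) (allPaths L))
  coeff-gauss zero zero    zero    = sym (cong length (filter-accept (level? 0 0) {[]} {[]} (refl , refl)))
  coeff-gauss zero zero    (suc k) = sym (cong length (filter-reject (level? 0 (suc k)) {[]} {[]} λ ()))
  coeff-gauss zero (suc c) k       = sym (cong length (filter-reject (level? (suc c) k) {[]} {[]} λ ()))
  coeff-gauss (suc L) zero k = trans (coeff-gauss L zero k) (sym (trans (filter-allPaths-suc (level? 0 k) L)
    (cong₂ _+_ (filter-length-0 _ (allPaths L) λ { w (() , _) })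
      (filter-length-cong _ _ (allPaths L) (λ w (p , q) → p , trans (cong (_+ inv w) (sym p)) q) (λ w (p , q) → p , trans (cong (_+ inv w) p) q)))))
  coeff-gauss (suc L) (suc c) k = trans (coeff-+ₚ k (gauss L c) (shiftₚ (suc c) (gauss L (suc c)))) (sym (trans (filter-allPaths-suc (level? (suc c) k) L)
    (cong₂ _+_ (trans (filter-length-cong _ (level? c k) (allPaths L) (λ w (p , q) → ℕ.suc-injective p , q) (λ w (p , q) → cong suc p , q)) (sym (coeff-gauss L c k))) east)))
    where
    east : length (filter (λ w → level? (suc c) k (false ∷ w)) (allPaths L)) ≡ coeff k (shiftₚ (suc c) (gauss L (suc c)))
    east with suc c ℕ.≤? k
    ... | no c≮k = trans (filter-length-0 _ (allPaths L) λ w (p , q) → c≮k (subst (suc c ≤_) q (subst (_≤ countN w + inv w) p (ℕ.m≤m+n _ _))))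
                     (sym (coeff-shift-< (gauss L (suc c)) (ℕ.≰⇒> c≮k)))
    ... | yes c<k = trans (filter-length-cong _ (level? (suc c) k′) (allPaths L)
                       (λ w (p , q) → p , ℕ.+-cancelˡ-≡ (suc c) _ _ (trans (cong (_+ inv w) (sym p)) (trans q (sym k≡))))
                       (λ w (p , q) → p , trans (cong₂ _+_ p q) k≡))
                     (trans (sym (coeff-gauss L (suc c) k′)) (trans (sym (coeff-shift-≥ (suc c) k′ (gauss L (suc c)))) (cong (λ z → coeff z (shiftₚ (suc c) (gauss L (suc c)))) k≡)))
      where
      k′ = k ∸ suc c
      k≡ : suc c + k′ ≡ k
      k≡ = ℕ.m+[n∸m]≡n c<k

  countN-not : ∀ w → countN (map not w) ≡ countE w
  countN-not []          = refl
  countN-not (true ∷ w)  = countN-not w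
  countN-not (false ∷ w) = cong suc (countN-not w)

  countE-not : ∀ w → countE (map not w) ≡ countN w
  countE-not []          = refl
  countE-not (true ∷ w)  = cong suc (countE-not w)
  countE-not (false ∷ w) = countE-not w

  map-not-involutive : ∀ w → map not (map not w) ≡ w
  map-not-involutive []      = refl
  map-not-involutive (x ∷ w) = cong₂ _∷_ (Bool.not-involutive x) (map-not-involutive w)

  inv-not : ∀ w → inv w + inv (map not w) ≡ countN w * countE w
  inv-not []          = refl
  inv-not (true ∷ w)  = trans (rearrange (inv w) (countN (map not w)) (inv (map not w))) (cong₂ _+_ (countN-not w) (inv-not w))
    where
    rearrange : ∀ i c j → i + (c + j) ≡ c + (i + j)
    rearrange = ℕSolver.solve-∀
  inv-not (false ∷ w) = trans (ℕ.+-assoc (countN w) (inv w) _) (trans (cong (countN w +_) (inv-not w)) (sym (ℕ.*-suc (countN w) (countE w))))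

  no-members : {A : Set} (xs : List A) → (∀ x → ¬ (x ∈ xs)) → length xs ≡ 0
  no-members []       _  = refl
  no-members (x ∷ xs) none = ⊥-elim (none x (here refl))

  p : (a b k : ℕ) → ℕ
  p a b k = length (level a b k)

  -- Exchanging the two letters turns the pairs that are inversions into those that are not, and
  -- there are a b pairs of an east and a north step.
  p-complement : ∀ a b k l → k + l ≡ a * b → p a b k ≡ p b a l
  p-complement a b k l k+l = matching-≡ (λ w w′ → w′ ≡ map not w) (level-unique a b k) (level-unique b a l)
      (λ {w} w∈ → let (cN , cE , iv) = ∈-level⁻ {a} {b} {k} w∈ in map not w , ∈-level⁺ (trans (countN-not w) cE) (trans (countE-not w) cN)
        (ℕ.+-cancelˡ-≡ k _ _ (trans (cong (_+ inv (map not w)) (sym iv)) (trans (inv-not w) (trans (cong₂ _*_ cN cE) (sym k+l))))) , refl)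
      (λ {w} w∈ → let (cN , cE , iv) = ∈-level⁻ {b} {a} {l} w∈ in map not w , ∈-level⁺ (trans (countN-not w) cE) (trans (countE-not w) cN)
        (ℕ.+-cancelˡ-≡ l _ _ (trans (cong (_+ inv (map not w)) (sym iv)) (trans (inv-not w) (trans (cong₂ _*_ cN cE) (trans (ℕ.*-comm b a) (trans (sym k+l) (ℕ.+-comm k l))))))) , sym (map-not-involutive w))
      (λ {x} {x′} _ _ e f → trans (sym (map-not-involutive x)) (trans (cong (map not) (trans (sym e) f)) (map-not-involutive x′)))
      (λ _ _ e f → trans e (sym f))

  p-beyond : ∀ a b k → a * b < k → p a b k ≡ 0
  p-beyond a b k ab<k = no-members (level a b k) λ w w∈ → let (cN , cE , iv) = ∈-level⁻ {a} {b} {k} w∈ in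
    ℕ.<⇒≱ ab<k (subst₂ _≤_ iv (trans (inv-not w) (cong₂ _*_ cN cE)) (ℕ.m≤m+n (inv w) _))

  -- Complementation carries levels k + 1 and `k` to levels `l` and l + 1 with `a` and `b`
  -- exchanged, where l = a b - (k + 1) is below the middle and `ascending` applies. Past a b the
  -- levels are empty.
  descending : ∀ a b k → a * b ≤ suc (2 * k) → p a b (suc k) ≤ p a b k
  descending a b k large with suc k ℕ.≤? a * b
  ... | no k≮ab = subst (_≤ p a b k) (sym (p-beyond a b (suc k) (ℕ.≰⇒> k≮ab))) z≤n
  ... | yes k<ab = subst₂ _≤_ (sym (p-complement a b (suc k) l (ℕ.m+[n∸m]≡n k<ab))) (sym (p-complement a b k (suc l) (trans (ℕ.+-suc k l) (ℕ.m+[n∸m]≡n k<ab))))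
      (ascending b a l (subst (2 * l <_) (ℕ.*-comm a b) 2l<ab))
    where
    l = a * b ∸ suc k
    2l<ab : 2 * l < a * b
    2l<ab = ℕ.+-cancelˡ-< (2 * suc k) _ _ (subst (_< 2 * suc k + a * b) (trans (cong (2 *_) (sym (ℕ.m+[n∸m]≡n k<ab))) (ℕ.*-distribˡ-+ 2 (suc k) l))
      (subst (_< 2 * suc k + a * b) (sym (cong (a * b +_) (ℕ.+-identityʳ (a * b)))) (ℕ.+-monoˡ-< (a * b) (ℕ.≤-<-trans large (ℕ.≤-reflexive (sym (ℕ.*-suc 2 k))))))) 

  filter-length-⊎ : {A : Set} {P Q R : A → Set} (P? : Decidable P) (Q? : Decidable Q) (R? : Decidable R) (xs : List A) →
    (∀ x → P x → Q x ⊎ R x) → (∀ x → Q x → P x) → (∀ x → R x → P x) → (∀ x → Q x → ¬ R x) →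
    length (filter P? xs) ≡ length (filter Q? xs) + length (filter R? xs)
  filter-length-⊎ P? Q? R? [] _ _ _ _ = refl
  filter-length-⊎ P? Q? R? (x ∷ xs) split l r disjoint with P? x | Q? x | R? x | filter-length-⊎ P? Q? R? xs split l r disjoint
  ... | yes _ | yes q | yes s | ih = ⊥-elim (disjoint x q s)
  ... | yes _ | yes _ | no _  | ih = cong suc ih
  ... | yes _ | no _  | yes _ | ih = trans (cong suc ih) (sym (ℕ.+-suc _ _))
  ... | yes p | no ¬q | no ¬r | ih with split x p
  ...   | inj₁ q = ⊥-elim (¬q q)
  ...   | inj₂ s = ⊥-elim (¬r s)
  filter-length-⊎ P? Q? R? (x ∷ xs) split l r disjoint | no ¬p | yes q | _     | ih = ⊥-elim (¬p (l x q))
  filter-length-⊎ P? Q? R? (x ∷ xs) split l r disjoint | no ¬p | no _  | yes s | ih = ⊥-elim (¬p (r x s))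
  filter-length-⊎ P? Q? R? (x ∷ xs) split l r disjoint | no ¬p | no _  | no _  | ih = ih

  inv-∷ʳ-true : ∀ w → inv (w ∷ʳ true) ≡ inv w + countE w
  inv-∷ʳ-true []          = refl
  inv-∷ʳ-true (true ∷ w)  = inv-∷ʳ-true w
  inv-∷ʳ-true (false ∷ w) = trans (cong₂ _+_ (countN-∷ʳ w) (inv-∷ʳ-true w)) (rearrange (countN w) (inv w) (countE w))
    where
    countN-∷ʳ : ∀ w → countN (w ∷ʳ true) ≡ suc (countN w)
    countN-∷ʳ []          = refl
    countN-∷ʳ (true ∷ w)  = cong suc (countN-∷ʳ w)
    countN-∷ʳ (false ∷ w) = countN-∷ʳ w
    rearrange : ∀ c i e → suc c + (i + e) ≡ c + i + suc e
    rearrange = ℕSolver.solve-∀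

  countN-∷ʳ : ∀ w x → countN (w ∷ʳ x) ≡ countN (x ∷ w)
  countN-∷ʳ []          x     = refl
  countN-∷ʳ (true ∷ w)  true  = cong suc (countN-∷ʳ w true)
  countN-∷ʳ (true ∷ w)  false = cong suc (countN-∷ʳ w false)
  countN-∷ʳ (false ∷ w) true  = countN-∷ʳ w true
  countN-∷ʳ (false ∷ w) false = countN-∷ʳ w false

  inv-∷ʳ-false : ∀ w → inv (w ∷ʳ false) ≡ inv w
  inv-∷ʳ-false []          = refl
  inv-∷ʳ-false (true ∷ w)  = inv-∷ʳ-false w
  inv-∷ʳ-false (false ∷ w) = cong₂ _+_ (countN-∷ʳ w false) (inv-∷ʳ-false w)

  length-∷ʳ : ∀ (w : Path) x → length (w ∷ʳ x) ≡ suc (length w)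
  length-∷ʳ w x = trans (length-++ w) (ℕ.+-comm (length w) 1)

  cyclic : Path → Path
  cyclic []      = []
  cyclic (x ∷ w) = w ∷ʳ x

  -- Following the inequality once around the period leads back to the starting value.
  periodic-monotone : ∀ (f : ℕ → ℕ) N → (∀ k → f (suc N + k) ≡ f k) →
    (∀ k → f (suc k) ≤ f k) ⊎ (∀ k → f k ≤ f (suc k)) → ∀ k → f (suc k) ≡ f k
  periodic-monotone f N per (inj₁ dec) k = ℕ.≤-antisym (dec k) (subst (_≤ f (suc k)) (trans (cong f (ℕ.+-suc N k)) (per k)) (many N))
    where
    many : ∀ N → f (N + suc k) ≤ f (suc k)
    many zero    = ℕ.≤-refl
    many (suc N) = ℕ.≤-trans (dec (N + suc k)) (many N)
  periodic-monotone f N per (inj₂ inc) k = ℕ.≤-antisym (subst (f (suc k) ≤_) (trans (cong f (ℕ.+-suc N k)) (per k)) (many N)) (inc k)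
    where
    many : ∀ N → f (suc k) ≤ f (N + suc k)
    many zero    = ℕ.≤-refl
    many (suc N) = ℕ.≤-trans (many N) (inc (N + suc k))

  module Construction (a b : ℕ) (0<a : 0 < a) (cop : Coprime a b) where

    N : ℕ
    N = a + b

    0<N : 0 < N
    0<N = ℕ.≤-trans 0<a (ℕ.m≤m+n a b)

    instance
      N-nonZero : NonZero N
      N-nonZero = ℕ.>-nonZero 0<N

    tally : {Q : ℕ → Set} → Decidable Q → ℕ
    tally Q? = length (filter (λ w → (countN w ℕ.≟ a) ×-dec Q? (inv w)) (allPaths N))

    tally-⊎ : {P Q R : ℕ → Set} (P? : Decidable P) (Q? : Decidable Q) (R? : Decidable R) →
      (∀ i → P i → Q i ⊎ R i) → (∀ i → Q i → P i) → (∀ i → R i → P i) → (∀ i → Q i → ¬ R i) → tally P? ≡ tally Q? + tally R?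
    tally-⊎ {P} {Q} {R} P? Q? R? split l r disjoint = filter-length-⊎ _ _ _ (allPaths N) split′
        (λ w (c , q) → c , l _ q) (λ w (c , q) → c , r _ q) (λ w (_ , q) (_ , s) → disjoint _ q s)
      where
      split′ : ∀ w → countN w ≡ a × P (inv w) → (countN w ≡ a × Q (inv w)) ⊎ (countN w ≡ a × R (inv w))
      split′ w (c , q) with split (inv w) q
      ... | inj₁ x = inj₁ (c , x)
      ... | inj₂ y = inj₂ (c , y)

    tally-cong : {P Q : ℕ → Set} (P? : Decidable P) (Q? : Decidable Q) → (∀ i → P i → Q i) → (∀ i → Q i → P i) → tally P? ≡ tally Q?
    tally-cong P? Q? f g = filter-length-cong _ _ (allPaths N) (λ w (c , q) → c , f _ q) (λ w (c , q) → c , g _ q)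

    up? : ∀ k → Decidable (λ i → i ≤ k × i % N ≡ k % N)
    up? k i = (i ℕ.≤? k) ×-dec (i % N ℕ.≟ k % N)

    over? : ∀ k → Decidable (λ i → k < i × i % N ≡ k % N)
    over? k i = (k ℕ.<? i) ×-dec (i % N ℕ.≟ k % N)

    class? : ∀ k → Decidable (λ i → i % N ≡ k % N)
    class? k i = i % N ℕ.≟ k % N

    -- `S k` is the coefficient of q^k in the power series `gauss N a` / (1 - q^N). As 1 / [N] = (1
    -- - q) / (1 - q^N), the coefficients of the quotient by [N] are the differences of `S`. `U`
    -- collects the rest of the residue class and `M` all of it.
    S U M : ℕ → ℕ
    S k = tally (up? k)
    U k = tally (over? k)
    M k = tally (class? k)

    shift-% : ∀ k → (N + k) % N ≡ k % N
    shift-% k = trans (%-congˡ {o = N} (ℕ.+-comm N k)) ([m+n]%n≡m%n k N)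

    no-between : ∀ {i k} → i % N ≡ k % N → k < i → i < N + k → ⊥
    no-between {i} {k} eq k<i i<N+k = ℕ.<-irrefl (%-window N (sym eq) (ℕ.<⇒≤ k<i) (subst (i <_) (ℕ.+-comm N k) i<N+k)) k<i

    S-shift : ∀ k → S (N + k) ≡ p a b (N + k) + S k
    S-shift k = tally-⊎ (up? (N + k)) (λ i → i ℕ.≟ N + k) (up? k) split
        (λ i eq → ℕ.≤-reflexive eq , cong (_% N) eq) (λ i (le , eq) → ℕ.≤-trans le (ℕ.m≤n+m k N) , trans eq (sym (shift-% k)))
        (λ i eq (le , _) → ℕ.<⇒≱ (ℕ.m<n+m k 0<N) (subst (_≤ k) eq le))
      where
      split : ∀ i → i ≤ N + k × i % N ≡ (N + k) % N → (i ≡ N + k) ⊎ (i ≤ k × i % N ≡ k % N)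
      split i (le , eq) with ℕ.m≤n⇒m<n∨m≡n le
      ... | inj₂ i≡ = inj₁ i≡
      ... | inj₁ i< = inj₂ (ℕ.≮⇒≥ (λ k<i → no-between (trans eq (shift-% k)) k<i i<) , trans eq (shift-% k))

    S-small : ∀ k → k < N → S k ≡ p a b k
    S-small k k<N = tally-cong (up? k) (λ i → i ℕ.≟ k) (λ i (le , eq) → trans (sym (m<n⇒m%n≡m (ℕ.≤-<-trans le k<N))) (trans eq (m<n⇒m%n≡m k<N)))
      (λ i eq → ℕ.≤-reflexive eq , cong (_% N) eq)

    U-shift : ∀ k → U k ≡ p a b (N + k) + U (N + k)
    U-shift k = tally-⊎ (over? k) (λ i → i ℕ.≟ N + k) (over? (N + k)) split
        (λ i eq → subst (k <_) (sym eq) (ℕ.m<n+m k 0<N) , trans (cong (_% N) eq) (shift-% k))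
        (λ i (lt , eq) → ℕ.<-trans (ℕ.m<n+m k 0<N) lt , trans eq (shift-% k))
        (λ i eq (lt , _) → ℕ.<-irrefl (sym eq) lt)
      where
      split : ∀ i → k < i × i % N ≡ k % N → (i ≡ N + k) ⊎ (N + k < i × i % N ≡ (N + k) % N)
      split i (lt , eq) with ℕ.<-cmp i (N + k)
      ... | tri< i< _ _ = ⊥-elim (no-between eq lt i<)
      ... | tri≈ _ i≡ _ = inj₁ i≡
      ... | tri> _ _ >i = inj₂ (>i , trans eq (sym (shift-% k)))

    M-split : ∀ k → M k ≡ S k + U k
    M-split k = tally-⊎ (class? k) (up? k) (over? k) split (λ i → proj₂) (λ i → proj₂) (λ i (le , _) (lt , _) → ℕ.<⇒≱ lt le)
      where
      split : ∀ i → i % N ≡ k % N → (i ≤ k × i % N ≡ k % N) ⊎ (k < i × i % N ≡ k % N)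
      split i eq with i ℕ.≤? k
      ... | yes le = inj₁ (le , eq)
      ... | no ≰   = inj₂ (ℕ.≰⇒> ≰ , eq)

    U-beyond : ∀ k → a * b ≤ k → U k ≡ 0
    U-beyond k ab≤k = no-members (filter _ (allPaths N)) none
      where
      none : ∀ w → ¬ (w ∈ filter (λ w → (countN w ℕ.≟ a) ×-dec over? k (inv w)) (allPaths N))
      none w w∈ with ∈-filter⁻ (λ w → (countN w ℕ.≟ a) ×-dec over? k (inv w)) {xs = allPaths N} w∈
      ... | w∈′ , cN , lt , _ = ℕ.<⇒≱ lt (ℕ.≤-trans (subst (inv w ≤_) (trans (inv-not w) (cong₂ _*_ cN cE)) (ℕ.m≤m+n (inv w) _)) ab≤k)
        where
        cE : countE w ≡ b
        cE = ℕ.+-cancelˡ-≡ a _ _ (trans (cong (_+ countE w) (sym cN)) (trans (countN+countE w) (∈-allPaths⁻ N w∈′)))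

    -- A north step moved to the end gains an inversion with each of the `b` east steps, and a + b
    -- is 0 modulo `N`. An east step moved to the end loses its `a` inversions.
    inv-cyclic : ∀ w → length w ≡ N → countN w ≡ a → (a + inv (cyclic w)) % N ≡ inv w % N
    inv-cyclic [] len cN = ⊥-elim (ℕ.<-irrefl len 0<N)
    inv-cyclic (true ∷ w) len cN = trans (%-congˡ {o = N} (trans (cong (a +_) (inv-∷ʳ-true w)) (trans (rearrange a (inv w) (countE w)) (cong (λ z → inv w + (a + z)) cE)))) ([m+n]%n≡m%n (inv w) N)
      where
      rearrange : ∀ a i e → a + (i + e) ≡ i + (a + e)
      rearrange = ℕSolver.solve-∀
      cE : countE w ≡ b
      cE = ℕ.+-cancelˡ-≡ a _ _ (trans (cong (_+ countE w) (sym cN)) (trans (countN+countE (true ∷ w)) len))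
    inv-cyclic (false ∷ w) len cN = %-congˡ {o = N} (cong₂ _+_ (sym cN) (inv-∷ʳ-false w))

    M-rotate : ∀ k → M (a + k) ≤ M k
    M-rotate k = matching-≤ {R = λ w w′ → w′ ≡ cyclic w} _ _ (filter⁺ (count-class? (a + k)) (allPaths-unique N)) total injective
      where
      count-class? : ∀ k → Decidable (λ w → countN w ≡ a × inv w % N ≡ k % N)
      count-class? k w = (countN w ℕ.≟ a) ×-dec class? k (inv w)
      members : ∀ {k w} → w ∈ filter (count-class? k) (allPaths N) → length w ≡ N × countN w ≡ a × inv w % N ≡ k % N
      members {k} w∈ with ∈-filter⁻ (count-class? k) {xs = allPaths N} w∈
      ... | w∈′ , q = ∈-allPaths⁻ N w∈′ , q
      total : ∀ {w} → w ∈ filter (count-class? (a + k)) (allPaths N) → ∃ λ w′ → w′ ∈ filter (count-class? k) (allPaths N) × w′ ≡ cyclic w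
      total {w} w∈ with members {a + k} w∈
      ... | len , cN , eq = cyclic w , ∈-filter⁺ (count-class? k) (∈-allPaths⁺ (len′ w len)) (cN′ w cN , %-cancelˡ-+ N a (trans (inv-cyclic w len cN) eq)) , refl
        where
        len′ : ∀ w → length w ≡ N → length (cyclic w) ≡ N
        len′ []      len = len
        len′ (x ∷ w) len = trans (length-∷ʳ w x) len
        cN′ : ∀ w → countN w ≡ a → countN (cyclic w) ≡ a
        cN′ []      cN = cN
        cN′ (x ∷ w) cN = trans (countN-∷ʳ w x) cN
      injective : ∀ {w w′ v} → w ∈ filter (count-class? (a + k)) (allPaths N) → w′ ∈ filter (count-class? (a + k)) (allPaths N) → v ≡ cyclic w → v ≡ cyclic w′ → w ≡ w′
      injective {w} {w′} w∈ w′∈ e f = go w w′ (proj₁ (members {a + k} w∈)) (proj₁ (members {a + k} w′∈)) (trans (sym e) f)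
        where
        go : ∀ w w′ → length w ≡ N → length w′ ≡ N → cyclic w ≡ cyclic w′ → w ≡ w′
        go []      _        len _ _ = ⊥-elim (ℕ.<-irrefl len 0<N)
        go (_ ∷ _) []       _ len _ = ⊥-elim (ℕ.<-irrefl len 0<N)
        go (x ∷ w) (y ∷ w′) _ _ eq = cong₂ _∷_ (∷ʳ-injectiveʳ w w′ eq) (∷ʳ-injectiveˡ w w′ eq)

    M-rotate-* : ∀ t k → M (t * a + k) ≤ M k
    M-rotate-* zero    k = ℕ.≤-refl
    M-rotate-* (suc t) k = ℕ.≤-trans (subst (λ z → M z ≤ M (t * a + k)) (sym (ℕ.+-assoc a (t * a) k)) (M-rotate (t * a + k))) (M-rotate-* t k)

    M-cong : ∀ {k l} → k % N ≡ l % N → M k ≡ M l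
    M-cong {k} {l} eq = tally-cong (class? k) (class? l) (λ i e → trans e eq) (λ i e → trans e (sym eq))

    -- Since `a` is invertible modulo `N`, some number of rotations shifts the residue class by one,
    -- upwards or downwards according to the sign in the Bézout identity. This yields an inequality
    -- between neighbouring values, and periodicity turns it into an equality.
    M-constant : ∀ k → M (suc k) ≡ M k
    M-constant = periodic-monotone M (ℕ.pred N) (λ k → trans (cong (λ n → M (n + k)) (ℕ.suc-pred N)) (M-cong (shift-% k))) monotone
      where
      coprime-N : Coprime a N
      coprime-N (d∣a , d∣N) = cop (d∣a , ∣m+n∣m⇒∣n d∣N d∣a)
      monotone : (∀ k → M (suc k) ≤ M k) ⊎ (∀ k → M k ≤ M (suc k))
      monotone with coprime-Bézout coprime-N
      ... | Bézout.+- x y eq = inj₁ λ k → subst (_≤ M k) (M-cong (trans (%-congˡ {o = N} (trans (cong (_+ k) (sym eq)) (rearrange (y * N) k))) ([m+kn]%n≡m%n (suc k) y N))) (M-rotate-* x k)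
        where
        rearrange : ∀ y k → 1 + y + k ≡ suc k + y
        rearrange = ℕSolver.solve-∀
      ... | Bézout.-+ x y eq = inj₂ λ k → subst (_≤ M (suc k)) (M-cong (trans (%-congˡ {o = N} (trans (rearrange (x * a) k) (trans (cong (k +_) eq) refl))) ([m+kn]%n≡m%n k y N))) (M-rotate-* x (suc k))
        where
        rearrange : ∀ x k → x + suc k ≡ k + (1 + x)
        rearrange = ℕSolver.solve-∀

    p≤S : ∀ k → p a b k ≤ S k
    p≤S k with k ℕ.<? N
    ... | yes k<N = ℕ.≤-reflexive (sym (S-small k k<N))
    ... | no k≮N = subst (λ k → p a b k ≤ S k) (ℕ.m+[n∸m]≡n (ℕ.≮⇒≥ k≮N)) (subst (p a b (N + (k ∸ N)) ≤_) (sym (S-shift (k ∸ N))) (ℕ.m≤m+n _ _))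

    -- `S k` adds up the levels k, k - N, k - 2N, ..., all below the middle, so each is no larger
    -- than the level above it, which occurs in `S (suc k)`. `d` bounds the recursion.
    S-rises : ∀ d k → k < d → 2 * k < a * b → S k ≤ S (suc k)
    S-rises (suc d) k (s≤s k≤d) small with k ℕ.<? N
    ... | yes k<N = subst (_≤ S (suc k)) (sym (S-small k k<N)) (ℕ.≤-trans (ascending a b k small) (p≤S (suc k)))
    ... | no k≮N = subst (λ k → S k ≤ S (suc k)) N+j (subst₂ _≤_ (sym (S-shift j)) (trans (sym (S-shift (suc j))) (cong S (ℕ.+-suc N j)))
            (ℕ.+-mono-≤ (subst (λ z → p a b (N + j) ≤ p a b z) (sym (ℕ.+-suc N j)) (ascending a b (N + j) (subst (λ z → 2 * z < a * b) (sym N+j) small)))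
              (S-rises d j (ℕ.<-≤-trans j<k k≤d) (ℕ.≤-<-trans (ℕ.*-monoʳ-≤ 2 (ℕ.<⇒≤ j<k)) small))))
      where
      j = k ∸ N
      N+j : N + j ≡ k
      N+j = ℕ.m+[n∸m]≡n (ℕ.≮⇒≥ k≮N)
      j<k : j < k
      j<k = subst (j <_) N+j (ℕ.m<n+m j 0<N)

    U-falls : ∀ d k → a * b ≤ k + d → a * b ≤ suc (2 * k) → U (suc k) ≤ U k
    U-falls zero k ab≤k _ = subst (_≤ U k) (sym (U-beyond (suc k) (ℕ.m≤n⇒m≤1+n (ℕ.≤-trans ab≤k (ℕ.≤-reflexive (ℕ.+-identityʳ k)))))) z≤n
    U-falls (suc d) k ab≤k+d large = subst₂ _≤_ (sym (trans (U-shift (suc k)) (cong (λ z → p a b z + U z) (ℕ.+-suc N k)))) (sym (U-shift k))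
      (ℕ.+-mono-≤ (descending a b (N + k) large′) (U-falls d (N + k) (ℕ.≤-trans ab≤k+d (ℕ.≤-trans (ℕ.≤-reflexive (ℕ.+-suc k d)) (ℕ.+-monoˡ-≤ d (ℕ.+-monoˡ-≤ k 0<N)))) large′))
      where
      large′ : a * b ≤ suc (2 * (N + k))
      large′ = ℕ.≤-trans large (s≤s (ℕ.*-monoʳ-≤ 2 (ℕ.m≤n+m k N)))

    -- Below the middle the terms of `S` rise one by one. From the middle on, the terms of `U` fall
    -- instead, and S = M - U with `M` constant.
    S-monotone : ∀ k → S k ≤ S (suc k)
    S-monotone k with 2 * k ℕ.<? a * b
    ... | yes small = S-rises (suc k) k ℕ.≤-refl small
    ... | no ≮ = ℕ.+-cancelʳ-≤ (U (suc k)) _ _ (ℕ.≤-trans (ℕ.+-monoʳ-≤ (S k) (U-falls (a * b) k (ℕ.m≤n+m _ k) (ℕ.m≤n⇒m≤1+n (ℕ.≮⇒≥ ≮))))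
                    (ℕ.≤-reflexive (trans (sym (M-split k)) (trans (sym (M-constant k)) (M-split (suc k))))))

    -- This makes the differences vanish beyond a b, so the finite list `X` loses none of them.
    S-stable : ∀ k → a * b ≤ k → S (suc k) ≡ S k
    S-stable k ab≤k = trans (S≡M (suc k) (ℕ.m≤n⇒m≤1+n ab≤k)) (trans (M-constant k) (sym (S≡M k ab≤k)))
      where
      S≡M : ∀ k → a * b ≤ k → S k ≡ M k
      S≡M k ab≤k = sym (trans (M-split k) (trans (cong (S k +_) (U-beyond k ab≤k)) (ℕ.+-identityʳ _)))

    x : ℕ → ℕ
    x zero    = S 0
    x (suc k) = S (suc k) ∸ S k

    x-suc : ∀ k → x (suc k) + S k ≡ S (suc k)
    x-suc k = ℕ.m∸n+n≡m (S-monotone k)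

    X : Poly
    X = applyUpTo x (suc (a * b))

    coeff-applyUpTo-< : ∀ f {n k} → k < n → coeff k (applyUpTo f n) ≡ f k
    coeff-applyUpTo-< f {suc n} {zero}  _         = refl
    coeff-applyUpTo-< f {suc n} {suc k} (s≤s k<n) = coeff-applyUpTo-< (λ i → f (suc i)) k<n

    coeff-applyUpTo-≥ : ∀ f {n k} → n ≤ k → coeff k (applyUpTo f n) ≡ 0
    coeff-applyUpTo-≥ f {zero}  {k}     _         = refl
    coeff-applyUpTo-≥ f {suc n} {suc k} (s≤s n≤k) = coeff-applyUpTo-≥ (λ i → f (suc i)) n≤k

    coeff-X : ∀ k → coeff k X ≡ x k
    coeff-X k with k ℕ.<? suc (a * b)
    ... | yes k< = coeff-applyUpTo-< x k<
    coeff-X zero    | no k≮ = ⊥-elim (k≮ (s≤s z≤n))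
    coeff-X (suc k) | no k≮ = trans (coeff-applyUpTo-≥ x (ℕ.≮⇒≥ k≮)) (sym (trans (cong (_∸ S k) (S-stable k (ℕ.≤-pred (ℕ.≮⇒≥ k≮)))) (ℕ.n∸n≡0 (S k))))

    coeff-scale-1 : ∀ k q → coeff k (map (1 *_) q) ≡ coeff k q
    coeff-scale-1 k       []      = refl
    coeff-scale-1 zero    (y ∷ q) = ℕ.+-identityʳ y
    coeff-scale-1 (suc k) (y ∷ q) = coeff-scale-1 k q

    -- Multiplication by [n] sums `n` consecutive differences, which telescope to S k - S (k - n).
    -- For n = N this is the size of level `k`, by `S-shift`.
    C : ℕ → ℕ → ℕ
    C n k = coeff k (qInt n *ₚ X)

    C-zero : ∀ n → C (suc n) 0 ≡ S 0
    C-zero n = trans (coeff-+ₚ 0 (map (1 *_) X) (0 ∷ (qInt n *ₚ X))) (trans (ℕ.+-identityʳ _) (trans (coeff-scale-1 0 X) (coeff-X 0)))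

    C-suc : ∀ n k → C (suc n) (suc k) ≡ x (suc k) + C n k
    C-suc n k = trans (coeff-+ₚ (suc k) (map (1 *_) X) (0 ∷ (qInt n *ₚ X))) (cong (_+ C n k) (trans (coeff-scale-1 (suc k) X) (coeff-X (suc k))))

    C-< : ∀ n k → k < n → C n k ≡ S k
    C-< (suc n) zero    _         = C-zero n
    C-< (suc n) (suc k) (s≤s k<n) = trans (C-suc n k) (trans (cong (x (suc k) +_) (C-< n k k<n)) (x-suc k))

    C-≥ : ∀ n k → C n (n + k) + S k ≡ S (n + k)
    C-≥ zero    k = refl
    C-≥ (suc n) k = trans (cong (_+ S k) (C-suc n (n + k))) (trans (ℕ.+-assoc (x (suc (n + k))) _ _) (trans (cong (x (suc (n + k)) +_) (C-≥ n k)) (x-suc (n + k))))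

    qInt*X : (qInt N *ₚ X) ≈ₚ gauss N a
    qInt*X k with k ℕ.<? N
    ... | yes k<N = trans (C-< N k k<N) (trans (S-small k k<N) (sym (coeff-gauss N a k)))
    ... | no k≮N = subst (λ k → C N k ≡ coeff k (gauss N a)) (ℕ.m+[n∸m]≡n (ℕ.≮⇒≥ k≮N))
      (trans (ℕ.+-cancelʳ-≡ (S (k ∸ N)) _ _ (trans (C-≥ N (k ∸ N)) (S-shift (k ∸ N)))) (sym (coeff-gauss N a (N + (k ∸ N)))))

    X*qInt : (X *ₚ qInt N) ≈ₚ gauss N a
    X*qInt k = trans (evaluations-determine (X *ₚ qInt N) (qInt N *ₚ X) (λ y → trans (E.eval-*ₚ X (qInt N) y)
        (trans (ℤ.*-comm (E.eval X y) (E.eval (qInt N) y)) (sym (E.eval-*ₚ (qInt N) X y)))) k) (qInt*X k)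
      where
      module E = Evaluation ℤ-ring

-- The cycle lemma

module CyclicWords where

  open import Data.Nat as ℕ using (ℕ; _≤_; _<_; _∸_; NonZero; _%_)
  import Data.Nat.Properties as ℕ
  open import Data.Nat.DivMod using (m%n<n; m<n⇒m%n≡m; m%n%n≡m%n; [m+n]%n≡m%n; %-congˡ)
  open import Data.Nat.Coprimality using (Coprime)
  open import Data.Integer as ℤ using (ℤ; +_; -_; 0ℤ; _+_; _*_; _-_) renaming (_≤_ to _≤ℤ_)
  import Data.Integer.Properties as ℤ
  open import Data.Integer.Tactic.RingSolver using (solve-∀)
  open import Data.List.Base using (List; []; _∷_; _++_; map; filter; length; upTo; applyUpTo; cartesianProduct)
  open import Data.List.Properties using (length-applyUpTo; length-++; length-map; length-upTo)
  open import Data.List.Membership.Propositional using (_∈_)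
  open import Data.List.Membership.Propositional.Properties using (∈-filter⁺; ∈-filter⁻; ∈-upTo⁺; ∈-upTo⁻; ∈-cartesianProduct⁺; ∈-cartesianProduct⁻)
  open import Data.List.Relation.Unary.Unique.Propositional.Properties using (filter⁺; upTo⁺; cartesianProduct⁺)
  open import Data.Product using (∃; _×_; _,_; proj₁; proj₂)
  open import Data.Sum using (inj₁; inj₂)
  open import Data.Empty using (⊥-elim)
  open import Relation.Nullary using (yes; no)
  open import Relation.Binary.PropositionalEquality using (_≡_; _≢_; refl; sym; trans; cong; cong₂; subst)
  open import Defs
  open Counting
  open Sources
  open Heights
  open LaserFire
  open Partitions using (%-+-cong; %-unshift)
  open PeriodicPaths using (count-window)
  open FixedPartitions using (allPaths-unique; module FixedPoints)

  length-cartesianProduct : {A B : Set} (xs : List A) (ys : List B) → length (cartesianProduct xs ys) ≡ length xs ℕ.* length ys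
  length-cartesianProduct []       ys = refl
  length-cartesianProduct (x ∷ xs) ys = trans (length-++ (map (x ,_) ys)) (cong₂ ℕ._+_ (length-map (x ,_) ys) (length-cartesianProduct xs ys))

  module CycleLemma (a b : ℕ) (0<a : 0 < a) (0<b : 0 < b) (cop : Coprime a b) where
    open Laser a b 0<a 0<b cop
    open FixedPoints a b 0<a 0<b cop using (DyckPaths-unique)

    N : ℕ
    N = a ℕ.+ b

    0<N : 0 < N
    0<N = ℕ.≤-trans 0<a (ℕ.m≤m+n a b)

    instance
      N-nonZero : NonZero N
      N-nonZero = ℕ.>-nonZero 0<N

    ext : Path → Steps
    ext p x = stepN p (x % N)

    ext-cong : ∀ p {x y} → x % N ≡ y % N → ext p x ≡ ext p y
    ext-cong p eq = cong (stepN p) eq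

    ext-period : ∀ p x → ext p (N ℕ.+ x) ≡ ext p x
    ext-period p x = ext-cong p (trans (%-congˡ {o = N} (ℕ.+-comm N x)) ([m+n]%n≡m%n x N))

    ext-< : ∀ p x → x < N → ext p x ≡ stepN p x
    ext-< p x x<N = cong (stepN p) (m<n⇒m%n≡m x<N)

    words : List Path
    words = filter (λ w → countN w ℕ.≟ a) (allPaths N)

    RotatesTo : Path × ℕ → Path → Set
    RotatesTo (p , j) w = ∀ k → k < N → stepN w k ≡ ext p (j ℕ.+ k)

    count-ext : ∀ p → length p ≡ N → count (ext p) N ≡ countN p
    count-ext p len = trans (count-cong N (ext-< p)) (trans (cong (count (stepN p)) (sym len)) (sym (countN≡count p)))

    rotate-path : ∀ {p} j → p ∈ DyckPaths a b → ∃ λ w → w ∈ words × RotatesTo (p , j) w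
    rotate-path {p} j p∈ = w , ∈-filter⁺ (λ w → countN w ℕ.≟ a) (∈-allPaths⁺ len) cN , stepN-applyUpTo (λ k → ext p (j ℕ.+ k)) N
      where
      w = applyUpTo (λ k → ext p (j ℕ.+ k)) N
      len : length w ≡ N
      len = length-applyUpTo (λ k → ext p (j ℕ.+ k)) N
      lenp = proj₁ (∈-DyckPaths⁻ p∈)
      cN : countN w ≡ a
      cN = trans (countN≡count w) (trans (cong (count (stepN w)) len) (trans (count-cong N (stepN-applyUpTo (λ k → ext p (j ℕ.+ k)) N))
        (trans (count-window (ext-period p) j) (trans (count-cong N (ext-< p)) (dyck-count (closed (proj₂ (∈-DyckPaths⁻ p∈))))))))

    H-periodic : ∀ {s} → (∀ x → s (N ℕ.+ x) ≡ s x) → H s N ≡ 0ℤ → ∀ x → H s (N ℕ.+ x) ≡ H s x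
    H-periodic {s} per hN x = trans (agree-translate {s} {s} N 0 x (λ t _ → per t) x ℕ.≤-refl) (trans (cong (λ z → H s x + (z - 0ℤ)) hN) (ℤ.+-identityʳ _))

    -- Cut a word at a lowest point of its periodic continuation.
    cut-word : ∀ {w} → w ∈ words → ∃ λ pj → pj ∈ cartesianProduct (DyckPaths a b) (upTo N) × RotatesTo pj w
    cut-word {w} w∈ with ∈-filter⁻ (λ w → countN w ℕ.≟ a) {xs = allPaths N} w∈
    ... | w∈′ , cN with last-argmin (H (ext w)) 1 (N ∸ 1)
    ... | k , 1≤k , k≤N′ , min , _ = (p , j) , ∈-cartesianProduct⁺ (∈-DyckPaths⁺ lenp D) (∈-upTo⁺ (ℕ.∸-monoʳ-< 1≤k k≤N)) , rotates
      where
      s = ext w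
      lenw : length w ≡ N
      lenw = ∈-allPaths⁻ N w∈′
      N≡ : 1 ℕ.+ (N ∸ 1) ≡ N
      N≡ = ℕ.m+[n∸m]≡n 0<N
      k≤N : k ≤ N
      k≤N = subst (k ≤_) N≡ k≤N′
      j = N ∸ k
      s′ : Steps
      s′ t = s (k ℕ.+ t)
      p = applyUpTo s′ N
      lenp : length p ≡ N
      lenp = length-applyUpTo s′ N
      hN : H s N ≡ 0ℤ
      hN = +-cancelʳ-≡ℤ (+ a * + N) (trans (H-count s N) (trans (cong (λ z → (+ a + + b) * + z) (trans (count-ext w lenw) cN)) (comm (+ a) (+ b))))
        where
        comm : ∀ a b → (a + b) * a ≡ 0ℤ + a * (a + b)
        comm = solve-∀
      per = ext-period w
      hp = H-periodic {s} per hN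
      low : ∀ t → t ≤ N → H s k ≤ℤ H s (k ℕ.+ t)
      low t t≤N with k ℕ.+ t ℕ.≤? N
      ... | yes le = min (k ℕ.+ t) (ℕ.≤-trans 1≤k (ℕ.m≤m+n k t)) (subst (k ℕ.+ t ≤_) (sym N≡) le)
      ... | no ≰ = subst (H s k ≤ℤ_) (trans (sym (hp t′)) (cong (H s) eq)) (min t′ 1≤t′ (subst (t′ ≤_) (sym N≡) t′≤N))
        where
        t′ = k ℕ.+ t ∸ N
        eq : N ℕ.+ t′ ≡ k ℕ.+ t
        eq = ℕ.m+[n∸m]≡n (ℕ.<⇒≤ (ℕ.≰⇒> ≰))
        1≤t′ : 1 ≤ t′
        1≤t′ = ℕ.m<n⇒0<n∸m (ℕ.≰⇒> ≰)
        t′≤N : t′ ≤ N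
        t′≤N = ℕ.+-cancelˡ-≤ N _ _ (subst (_≤ N ℕ.+ N) (sym eq) (ℕ.+-mono-≤ k≤N t≤N))
      D′ : Dyck s′
      D′ = dyck (λ t t≤N → subst (0ℤ ≤ℤ_) (sym (H-shift s k t)) (subst (_≤ℤ H s (k ℕ.+ t) - H s k) (ℤ.+-inverseʳ (H s k)) (ℤ.+-monoˡ-≤ (- H s k) (low t t≤N))))
                (trans (H-shift s k N) (trans (cong (_- H s k) (trans (cong (H s) (ℕ.+-comm k N)) (hp k))) (ℤ.+-inverseʳ (H s k))))
      D : Dyck (stepN p)
      D = dyck-cong (λ t t<N → sym (stepN-applyUpTo s′ N t t<N)) D′
      rotates : RotatesTo (p , j) w
      rotates x x<N = sym (trans (stepN-applyUpTo s′ N ((j ℕ.+ x) % N) (m%n<n (j ℕ.+ x) N))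
        (trans (ext-cong w {k ℕ.+ (j ℕ.+ x) % N} {N ℕ.+ x} (trans (%-+-cong N {k} {k} refl (m%n%n≡m%n (j ℕ.+ x) N)) (%-congˡ {o = N} (trans (sym (ℕ.+-assoc k j x)) (cong (ℕ._+ x) (ℕ.m+[n∸m]≡n k≤N))))))
        (trans (ext-period w x) (ext-< w x x<N))))

    -- If `p` is `p′` read from point `i`, then the height of `p` after N - i steps is minus the
    -- height of `p′` at `i`. Both are nonnegative, and a Dyck path with coprime `a` and `b` is
    -- positive strictly between its ends, so i = 0.
    rotations-distinct : ∀ {p p′ j j′ w} → p ∈ DyckPaths a b → p′ ∈ DyckPaths a b → j ≤ j′ → j′ < N →
      RotatesTo (p , j) w → RotatesTo (p′ , j′) w → (p , j) ≡ (p′ , j′)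
    rotations-distinct {p} {p′} {j} {j′} {w} p∈ p′∈ j≤j′ j′<N Rp Rp′ = cong₂ _,_ p≡p′ (trans (sym (ℕ.+-identityʳ j)) (trans (cong (j ℕ.+_) (sym i≡0)) j+i))
      where
      i = j′ ∸ j
      j+i : j ℕ.+ i ≡ j′
      j+i = ℕ.m+[n∸m]≡n j≤j′
      i<N : i < N
      i<N = ℕ.≤-<-trans (ℕ.m∸n≤m j′ j) j′<N
      lenp = proj₁ (∈-DyckPaths⁻ p∈)
      lenp′ = proj₁ (∈-DyckPaths⁻ p′∈)
      D = proj₂ (∈-DyckPaths⁻ p∈)
      D′ = proj₂ (∈-DyckPaths⁻ p′∈)
      aligned : ∀ x → ext p (j ℕ.+ x) ≡ ext p′ (j′ ℕ.+ x)
      aligned x = trans (ext-cong p {j ℕ.+ x} {j ℕ.+ x % N} (%-+-cong N {j} {j} refl (sym (m%n%n≡m%n x N))))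
        (trans (sym (Rp (x % N) (m%n<n x N))) (trans (Rp′ (x % N) (m%n<n x N)) (ext-cong p′ {j′ ℕ.+ x % N} {j′ ℕ.+ x} (%-+-cong N {j′} {j′} refl (m%n%n≡m%n x N)))))
      shifted : ∀ y → ext p y ≡ ext p′ (i ℕ.+ y)
      shifted y = trans (ext-cong p (sym (%-unshift N j y))) (trans (aligned (y ℕ.+ j ℕ.* (N ∸ 1))) (ext-cong p′ back))
        where
        back : (j′ ℕ.+ (y ℕ.+ j ℕ.* (N ∸ 1))) % N ≡ (i ℕ.+ y) % N
        back = trans (%-congˡ {o = N} (trans (cong (ℕ._+ (y ℕ.+ j ℕ.* (N ∸ 1))) (trans (sym j+i) (ℕ.+-comm j i))) (ℕ.+-assoc i j _))) (%-+-cong N {i} {i} refl (%-unshift N j y))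
      H-ext : ∀ {p} t → t ≤ N → H (ext p) t ≡ H (stepN p) t
      H-ext {p} t t≤N = H-cong N (ext-< p) t t≤N
      nonpos : H (stepN p′) i ≤ℤ 0ℤ
      nonpos = subst (_≤ℤ 0ℤ) (neg (H (stepN p′) i)) (ℤ.neg-mono-≤ (subst (0ℤ ≤ℤ_) value (nonneg D (N ∸ i) (ℕ.m∸n≤m N i))))
        where
        neg : ∀ x → - (0ℤ - x) ≡ x
        neg = solve-∀
        value : H (stepN p) (N ∸ i) ≡ 0ℤ - H (stepN p′) i
        value = trans (sym (H-ext {p} (N ∸ i) (ℕ.m∸n≤m N i))) (trans (H-cong (N ∸ i) (λ t _ → shifted t) (N ∸ i) ℕ.≤-refl)
          (trans (H-shift (ext p′) i (N ∸ i)) (cong₂ _-_ (trans (cong (H (ext p′)) (ℕ.m+[n∸m]≡n (ℕ.<⇒≤ i<N))) (trans (H-ext {p′} N ℕ.≤-refl) (closed D′))) (H-ext {p′} i (ℕ.<⇒≤ i<N)))))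
      i≡0 : i ≡ 0
      i≡0 with i ℕ.≟ 0
      ... | yes eq = eq
      ... | no ≢0  = ⊥-elim (ℤ.<⇒≱ (dyck-positive D′ (ℕ.n≢0⇒n>0 ≢0) i<N) nonpos)
      p≡p′ : p ≡ p′
      p≡p′ = stepN-injective p p′ (trans lenp (sym lenp′)) λ k k<l → let k<N = subst (k <_) lenp k<l in
        trans (sym (ext-< p k k<N)) (trans (shifted k) (trans (cong (λ i → ext p′ (i ℕ.+ k)) i≡0) (ext-< p′ k k<N)))

    -- A word with `a` north steps is a rotation of exactly one Dyck path by exactly one offset
    -- below `N`: `cut-word` gives existence and `rotations-distinct` uniqueness.
    cycle-lemma : length (DyckPaths a b) ℕ.* N ≡ length words
    cycle-lemma = trans (sym (trans (length-cartesianProduct (DyckPaths a b) (upTo N)) (cong (length (DyckPaths a b) ℕ.*_) (length-upTo N))))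
      (matching-≡ RotatesTo (cartesianProduct⁺ DyckPaths-unique (upTo⁺ N)) (filter⁺ (λ w → countN w ℕ.≟ a) (allPaths-unique N))
        (λ {pj} pj∈ → rotate-path (proj₂ pj) (proj₁ (∈-cartesianProduct⁻ (DyckPaths a b) (upTo N) pj∈)))
        cut-word (λ {x} {y} {w} → injective {x} {y} {w}) (λ {x} {w} {w′} → unique {x} {w} {w′}))
      where
      injective : ∀ {x y w} → x ∈ cartesianProduct (DyckPaths a b) (upTo N) → y ∈ cartesianProduct (DyckPaths a b) (upTo N) →
        RotatesTo x w → RotatesTo y w → x ≡ y
      injective {p , j} {p′ , j′} {w} x∈ y∈ Rx Ry with ∈-cartesianProduct⁻ (DyckPaths a b) (upTo N) x∈ | ∈-cartesianProduct⁻ (DyckPaths a b) (upTo N) y∈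
      ... | p∈ , j∈ | p′∈ , j′∈ with ℕ.≤-total j j′
      ...   | inj₁ le = rotations-distinct {w = w} p∈ p′∈ le (∈-upTo⁻ j′∈) Rx Ry
      ...   | inj₂ ge = sym (rotations-distinct {w = w} p′∈ p∈ ge (∈-upTo⁻ j∈) Ry Rx)
      unique : ∀ {x w w′} → w ∈ words → w′ ∈ words → RotatesTo x w → RotatesTo x w′ → w ≡ w′
      unique {x} {w} {w′} w∈ w′∈ R R′ = stepN-injective w w′ (trans (len w∈) (sym (len w′∈))) λ k k<l → let k<N = subst (k <_) (len w∈) k<l in
          trans (R k k<N) (sym (R′ k k<N))
        where
        len : ∀ {w} → w ∈ words → length w ≡ N
        len w∈ = ∈-allPaths⁻ N (proj₁ (∈-filter⁻ (λ w → countN w ℕ.≟ a) {xs = allPaths N} w∈))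

-- Comparison of polynomial values with fixed points

module CyclicSieving where

  open import Level using (Level)
  open import Data.Nat as ℕ using (ℕ; zero; suc; _≤_; _<_; z≤n; s≤s; _∸_; NonZero; _%_; _/_)
  import Data.Nat.Properties as ℕ
  open import Data.Nat.DivMod using (m≡m%n+[m/n]*n; m%n<n)
  open import Data.Nat.Divisibility using (_∣_; divides; _∣?_; ∣⇒≤; *-cancelʳ-∣; m%n≡0⇒n∣m; n∣m*n)
  open import Data.Nat.GCD using (gcd; gcd[m,n]∣m; gcd[m,n]∣n; c*gcd[m,n]≡gcd[cm,cn]; gcd-greatest)
  open import Data.Nat.Coprimality using (Coprime)
  open import Data.Integer as ℤ using (+_)
  import Data.Integer.Properties as ℤ
  open import Data.List.Base using (List; []; _∷_; length; filter)
  open import Data.Product using (Σ; _×_; _,_; proj₁; proj₂)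
  open import Data.Sum using (_⊎_; inj₁; inj₂)
  open import Data.Empty using (⊥-elim)
  open import Relation.Nullary using (¬_; yes; no)
  open import Algebra.Bundles using (CommutativeRing)
  open import Relation.Binary.PropositionalEquality as ≡ using (_≡_; _≢_)
  open import Defs
  open FixedPartitions
  open GaussianPolynomials
  open RootsOfUnity
  open CatalanPolynomial
  open CyclicWords

  evalℕ-+ₚ : ∀ p q → evalℕ (p +ₚ q) 1 ≡ evalℕ p 1 ℕ.+ evalℕ q 1
  evalℕ-+ₚ []      q       = ≡.refl
  evalℕ-+ₚ (k ∷ p) []      = ≡.sym (ℕ.+-identityʳ _)
  evalℕ-+ₚ (k ∷ p) (l ∷ q) = ≡.trans (≡.cong (λ z → k ℕ.+ l ℕ.+ (z ℕ.+ 0)) (evalℕ-+ₚ p q)) (rearrange k l (evalℕ p 1) (evalℕ q 1))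
    where
    open import Data.Nat.Tactic.RingSolver using (solve-∀)
    rearrange : ∀ k l p q → k ℕ.+ l ℕ.+ (p ℕ.+ q ℕ.+ 0) ≡ k ℕ.+ (p ℕ.+ 0) ℕ.+ (l ℕ.+ (q ℕ.+ 0))
    rearrange = solve-∀

  evalℕ-shift : ∀ k p → evalℕ (shiftₚ k p) 1 ≡ evalℕ p 1
  evalℕ-shift zero    p = ≡.refl
  evalℕ-shift (suc k) p = ≡.trans (ℕ.+-identityʳ _) (evalℕ-shift k p)

  evalℕ-qInt : ∀ n → evalℕ (qInt n) 1 ≡ n
  evalℕ-qInt zero    = ≡.refl
  evalℕ-qInt (suc n) = ≡.cong suc (≡.trans (ℕ.+-identityʳ _) (evalℕ-qInt n))

  evalℕ-gauss : ∀ L c → evalℕ (gauss L c) 1 ≡ length (filter (λ w → countN w ℕ.≟ c) (allPaths L))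
  evalℕ-gauss zero    zero    = ≡.refl
  evalℕ-gauss zero    (suc c) = ≡.refl
  evalℕ-gauss (suc L) zero    = ≡.trans (evalℕ-gauss L zero) (≡.sym (≡.trans (filter-allPaths-suc (λ w → countN w ℕ.≟ 0) L)
    (≡.cong (ℕ._+ length (filter (λ w → countN w ℕ.≟ 0) (allPaths L))) (filter-length-0 _ (allPaths L) λ w ()))))
  evalℕ-gauss (suc L) (suc c) = ≡.trans (evalℕ-+ₚ (gauss L c) _) (≡.trans (≡.cong₂ ℕ._+_ (evalℕ-gauss L c) (≡.trans (evalℕ-shift (suc c) (gauss L (suc c))) (evalℕ-gauss L (suc c))))
    (≡.sym (≡.trans (filter-allPaths-suc (λ w → countN w ℕ.≟ suc c) L) (≡.cong (ℕ._+ length (filter (λ w → countN w ℕ.≟ suc c) (allPaths L)))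
      (filter-length-cong _ (λ w → countN w ℕ.≟ c) (allPaths L) (λ w → ℕ.suc-injective) (λ w → ≡.cong suc))))))

  evalℕ-*ₚ : ∀ p q x → evalℕ (p *ₚ q) x ≡ evalℕ p x ℕ.* evalℕ q x
  evalℕ-*ₚ p q x = ℤ.+-injective (≡.trans (≡.sym (evalℤ (p *ₚ q) x)) (≡.trans (E.eval-*ₚ p q (+ x)) (≡.trans (≡.cong₂ ℤ._*_ (evalℤ p x) (evalℤ q x)) (≡.sym (ℤ.pos-* (evalℕ p x) (evalℕ q x))))))
    where module E = Evaluation ℤ-ring

  evalℕ-cong : ∀ p q x → p ≈ₚ q → evalℕ p x ≡ evalℕ q x
  evalℕ-cong p q x eq = ℤ.+-injective (≡.trans (≡.sym (evalℤ p x)) (≡.trans (E.eval-cong p q (+ x) eq) (evalℤ q x)))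
    where module E = Evaluation ℤ-ring

  fitting-length : ∀ c e m → length (fitting (suc c) e m) ≡ multiples e m (suc c) ℕ.+ multiples e m c
  fitting-length c e m = filter-length-⊎ (fits? (suc c) e) (λ w → e ℕ.* countN w ℕ.≟ suc c) (λ w → e ℕ.* countN w ℕ.≟ c) (allPaths m)
    split (λ w → inj₁) (λ w eq → inj₂ (≡.cong suc eq)) λ w eq eq′ → ℕ.1+n≢n (≡.trans (≡.sym eq) eq′)
    where
    split : ∀ w → Fits (suc c) e w → (e ℕ.* countN w ≡ suc c) ⊎ (e ℕ.* countN w ≡ c)
    split w (inj₁ eq) = inj₁ eq
    split w (inj₂ eq) = inj₂ (ℕ.suc-injective eq)

  module Sieving {c ℓ : Level} (a b : ℕ) (0<a : 0 < a) (0<b : 0 < b) (cop : Coprime a b) where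
    open Construction a b 0<a cop using (X; X*qInt)
    open CycleLemma a b 0<a 0<b cop using (cycle-lemma)
    open FixedPoints a b 0<a 0<b cop

    n : ℕ
    n = a ℕ.+ b ∸ 1

    suc-n : suc n ≡ a ℕ.+ b
    suc-n = ℕ.m+[n∸m]≡n (ℕ.≤-trans 0<a (ℕ.m≤m+n a b))

    0<n : 0 < n
    0<n = ℕ.≤-pred (≡.subst (2 ≤_) (≡.sym suc-n) (ℕ.+-mono-≤ 0<a 0<b))

    instance
      nonZero-n : NonZero n
      nonZero-n = ℕ.>-nonZero 0<n

    -- Both sides become the number of words with `a` north steps when multiplied by a + b: the left
    -- one by evaluating `X*qInt` at 1, the right one by the cycle lemma.
    X-at-1 : evalℕ X 1 ≡ length (DyckPaths a b)
    X-at-1 = ℕ.*-cancelʳ-≡ _ _ (a ℕ.+ b) {{ℕ.>-nonZero (ℕ.≤-trans 0<a (ℕ.m≤m+n a b))}} (≡.trans (≡.cong (evalℕ X 1 ℕ.*_) (≡.sym (evalℕ-qInt (a ℕ.+ b))))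
      (≡.trans (≡.sym (evalℕ-*ₚ X (qInt (a ℕ.+ b)) 1)) (≡.trans (evalℕ-cong (X *ₚ qInt (a ℕ.+ b)) (gauss (a ℕ.+ b) a) 1 X*qInt)
      (≡.trans (evalℕ-gauss (a ℕ.+ b) a) (≡.sym cycle-lemma)))))

    module _ (R : CommutativeRing c ℓ) (isDomain : CharZeroDomain R) (ζ : CommutativeRing.Carrier R) (order : HasOrder R ζ n) where
      open Evaluation R

      ζ^n* : ∀ k → ζ ^ (k ℕ.* n) ≈ 1#
      ζ^n* k = trans (^-* ζ k n) (trans (^-cong k (proj₁ order)) (1^ k))

      order-divides : ∀ j → ζ ^ j ≈ 1# → n ∣ j
      order-divides j ζ^j≈1 with j % n ℕ.≟ 0
      ... | yes j%n≡0 = m%n≡0⇒n∣m j n j%n≡0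
      ... | no j%n≢0 = ⊥-elim (proj₂ order (j % n) (ℕ.n≢0⇒n>0 j%n≢0) (m%n<n j n)
        (trans (sym (*-identityʳ _)) (trans (*-congˡ (sym (ζ^n* (j / n)))) (trans (sym (^-+ ζ (j % n) (j / n ℕ.* n))) (trans (reflexive (≡.cong (ζ ^_) (≡.sym (m≡m%n+[m/n]*n j n)))) ζ^j≈1)))))

      eval-at-1 : ∀ p {y} → y ≈ 1# → eval p y ≈ nat (evalℕ p 1)
      eval-at-1 []      y≈1 = refl
      eval-at-1 (k ∷ p) y≈1 = trans (+-congˡ (trans (*-cong y≈1 (eval-at-1 p y≈1)) (trans (*-identityˡ _) (reflexive (≡.cong nat (≡.sym (ℕ.+-identityʳ (evalℕ p 1))))))))
        (sym (nat-+ k (evalℕ p 1 ℕ.+ 0)))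

      sieve-trivial : ∀ d → n ∣ d → eval X (ζ ^ d) ≈ nat (fixedCount a b d)
      sieve-trivial d n∣d@(divides q eq) = trans (eval-at-1 X (trans (reflexive (≡.cong (ζ ^_) eq)) (ζ^n* q)))
        (reflexive (≡.cong nat (≡.trans X-at-1 (≡.sym (fixedCount-trivial d n∣d)))))

      module _ (d : ℕ) (n∤d : ¬ (n ∣ d)) where
        m : ℕ
        m = gcd d n

        e : ℕ
        e = _∣_.quotient (gcd[m,n]∣n d n)

        n≡em : n ≡ e ℕ.* m
        n≡em = _∣_.equality (gcd[m,n]∣n d n)

        0<m : 0 < m
        0<m = ℕ.n≢0⇒n>0 λ m≡0 → ℕ.<-irrefl (≡.sym (≡.trans n≡em (≡.trans (≡.cong (e ℕ.*_) m≡0) (ℕ.*-zeroʳ e)))) 0<n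

        instance
          nonZero-m : NonZero m
          nonZero-m = ℕ.>-nonZero 0<m

        1<e : 1 < e
        1<e = by-cases e n≡em
          where
          by-cases : ∀ e → n ≡ e ℕ.* m → 1 < e
          by-cases zero          eq = ⊥-elim (ℕ.<-irrefl (≡.sym eq) 0<n)
          by-cases (suc zero)    eq = ⊥-elim (n∤d (≡.subst (_∣ d) (≡.sym (≡.trans eq (ℕ.+-identityʳ m))) (gcd[m,n]∣m d n)))
          by-cases (suc (suc e)) eq = s≤s (s≤s z≤n)

        2m≤n : m ℕ.+ m ≤ n
        2m≤n = ≡.subst₂ _≤_ (≡.cong (m ℕ.+_) (ℕ.+-identityʳ m)) (≡.sym n≡em) (ℕ.*-monoˡ-≤ m 1<e)

        q : Carrier
        q = ζ ^ d

        q^ : ∀ k → q ^ k ≈ ζ ^ (k ℕ.* d)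
        q^ k = sym (^-* ζ k d)

        q^e≈1 : q ^ e ≈ 1#
        q^e≈1 = trans (q^ e) (trans (reflexive (≡.cong (ζ ^_) exponent)) (ζ^n* d′))
          where
          d′ = _∣_.quotient (gcd[m,n]∣m d n)
          exponent : e ℕ.* d ≡ d′ ℕ.* n
          exponent = ≡.trans (≡.cong (e ℕ.*_) (_∣_.equality (gcd[m,n]∣m d n))) (≡.trans (rearrange e d′ m) (≡.cong (d′ ℕ.*_) (≡.sym n≡em)))
            where
            open import Data.Nat.Tactic.RingSolver using (solve-∀)
            rearrange : ∀ e d m → e ℕ.* (d ℕ.* m) ≡ d ℕ.* (e ℕ.* m)
            rearrange = solve-∀

        -- If q^k = 1, then `n` divides k d, hence also gcd (k d) (k n) = k m. Since n = e m, it
        -- follows that `e` divides `k`.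
        minimal : ∀ k → 0 < k → k < e → ¬ (q ^ k ≈ 1#)
        minimal k 0<k k<e q^k≈1 = ℕ.<⇒≱ k<e (∣⇒≤ {{ℕ.>-nonZero 0<k}} (*-cancelʳ-∣ m (≡.subst₂ _∣_ n≡em (≡.sym (c*gcd[m,n]≡gcd[cm,cn] k d n))
          (gcd-greatest (order-divides (k ℕ.* d) (trans (sym (q^ k)) q^k≈1)) (n∣m*n k)))))

        open Root R (proj₁ isDomain) (proj₁ (proj₂ isDomain)) q e 1<e q^e≈1 minimal
        open At q

        q^n≈1 : q ^ n ≈ 1#
        q^n≈1 = trans (q^ n) (trans (reflexive (≡.cong (ζ ^_) (ℕ.*-comm n d))) (ζ^n* d))

        -- [n + 1] = [n] + q^n, where [n] = 0 and q^n = 1.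
        I-N : I (a ℕ.+ b) ≈ 1#
        I-N = trans (reflexive (≡.cong I (≡.trans (≡.sym suc-n) (ℕ.+-comm 1 n)))) (trans (I-+ n 1)
          (trans (+-cong (I-periodic n q^n≈1) (trans (*-congʳ q^n≈1) (*-identityˡ _))) (trans (+-identityˡ _) (trans (+-cong nat-1 (zeroʳ q)) (+-identityʳ 1#)))))

        X≈G : eval X q ≈ G (a ℕ.+ b) a
        X≈G = trans (sym (*-identityʳ _)) (trans (*-congˡ (sym I-N)) (trans (sym (eval-*ₚ X (qInt (a ℕ.+ b)) q)) (eval-cong (X *ₚ qInt (a ℕ.+ b)) (gauss (a ℕ.+ b) a) q X*qInt)))

        gauss-fits : G (a ℕ.+ b) a ≈ nat (length (fitting a e m))
        gauss-fits = ≡.subst₂ (λ L c → G L c ≈ nat (length (fitting c e m))) (≡.trans (≡.cong suc (≡.trans (ℕ.*-comm m e) (≡.sym n≡em))) suc-n) (ℕ.suc-pred a {{ℕ.>-nonZero 0<a}})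
          (trans (gauss-at-root m (ℕ.pred a)) (reflexive (≡.cong nat (≡.trans (ℕ.+-comm (multiples e m (ℕ.pred a)) _) (≡.sym (fitting-length (ℕ.pred a) e m))))))

        sieve-proper : eval X q ≈ nat (fixedCount a b d)
        sieve-proper = trans X≈G (trans gauss-fits (reflexive (≡.cong nat (≡.sym (Proper.fixedCount≡fitting m e 0<m 2m≤n n≡em d ≡.refl)))))

      sieve : ∀ d → eval X (ζ ^ d) ≈ nat (fixedCount a b d)
      sieve d with n ∣? d
      ... | yes n∣d = sieve-trivial d n∣d
      ... | no n∤d  = sieve-proper d n∤d

open import Defs
open import Level using (Level)
open import Data.Nat using (ℕ; _+_; _∸_; _<_)
open import Data.Nat.Coprimality using (Coprime)
open import Data.List using (List)
open import Data.Product using (Σ; _×_; _,_)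
open import Algebra.Bundles using (CommutativeRing)

theorem5p4 : {c ℓ : Level} (a b : ℕ) → 0 < a → 0 < b → Coprime a b →
    Σ (List ℕ) λ X →
    ((((X *ₚ qInt (a + b)) *ₚ qFact a) *ₚ qFact b) ≈ₚ qFact (a + b)) ×
    ((R : CommutativeRing c ℓ) → CharZeroDomain R →
    (ζ : CommutativeRing.Carrier R) → HasOrder R ζ (a + b ∸ 1) →
    (d : ℕ) →
    CommutativeRing._≈_ R (evalPoly R X (powR R ζ d)) (natR R (fixedCount a b d)))
theorem5p4 a b 0<a 0<b cop = X , catalan-identity a b X X*qInt , sieve
  where
  open GaussianPolynomials using (catalan-identity)
  open CatalanPolynomial.Construction a b 0<a cop using (X; X*qInt)
  open CyclicSieving.Sieving a b 0<a 0<b cop using (sieve)
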